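{- Let $k \ge 2$ and $t \ge 2$ be integers with $(k,t) \neq (2,2)$. Then, as $n \to \infty$ (with $k,t$ fixed), $$ex(n, \{C_{2k+1}, K_{2,t}\text{ -ind}\}) = \sqrt{t-1} \cdot \left(\frac{n}{2}\right)^{3/2} (1+o(1)).$$
   Context: All graphs are finite and simple. $C_{2k+1}$ denotes the cycle of length $2k+1$ and $K_{2,t}$ the complete bipartite graph with parts of sizes $2$ and $t$. For graphs $H$ and $F$, $ex(n, \{H, F\text{ -ind}\})$ denotes the maximum number of edges in an $n$-vertex graph that contains no copy of $H$ as a (not necessarily induced) subgraph and no induced subgraph isomorphic to $F$. -}

module Defs where

open import Data.Nat using (ℕ; zero; suc; _+_; _*_; _∸_; _<ᵇ_; _%_)
open import Data.Bool using (Bool; true; false; if_then_else_; _∧_)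
open import Data.Fin using (Fin; toℕ)
open import Data.List using (List; map; allFin)
open import Data.Nat.ListAction using (sum)
open import Data.Product using (Σ; _×_)
open import Relation.Binary.PropositionalEquality using (_≡_; _≢_)
open import Relation.Nullary using (¬_)
open import Function.Definitions using (Injective)

record Graph (n : ℕ) : Set where
  field
    adj   : Fin n → Fin n → Bool
    sym   : ∀ i j → adj i j ≡ adj j i
    irrefl : ∀ i → adj i i ≡ false
open Graph public

edgeCount : ∀ {n} → Graph n → ℕ
edgeCount {n} G =
  sum (map (λ i → sum (map (λ j → if (toℕ i <ᵇ toℕ j) ∧ adj G i j then 1 else 0)
                           (allFin n)))
           (allFin n))

-- G contains a (not necessarily induced) copy of the cycle C_L, L = suc m:
-- an injective map of Fin L into the vertices sending each cycle edge
-- {i, i+1 mod L} to an edge of G.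
ContainsCycle : ∀ {n} → ℕ → Graph n → Set
ContainsCycle {n} m G =
  Σ (Fin (suc m) → Fin n) λ f →
    Injective _≡_ _≡_ f ×
    (∀ i j → toℕ j ≡ suc (toℕ i) % suc m → adj G (f i) (f j) ≡ true)

K2tAdj : ∀ {t} → Fin (2 + t) → Fin (2 + t) → Bool
K2tAdj i j = (toℕ i <ᵇ 2) xor' (toℕ j <ᵇ 2)
  where
  _xor'_ : Bool → Bool → Bool
  true xor' b = if b then false else true
  false xor' b = b

ContainsInducedK2t : ∀ {n} → ℕ → Graph n → Set
ContainsInducedK2t {n} t G =
  Σ (Fin (2 + t) → Fin n) λ f →
    Injective _≡_ _≡_ f ×
    (∀ i j → i ≢ j → adj G (f i) (f j) ≡ K2tAdj {t} i j)

Admissible : ∀ {n} → ℕ → ℕ → Graph n → Set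
Admissible k t G = ¬ ContainsCycle (2 * k) G × ¬ ContainsInducedK2t t G

{-# OPTIONS --safe #-}
-- Upper bound.  Put Λ = t - 1.  By Ramsey's theorem many common neighbours of two
-- nonadjacent vertices would contain either a clique of size 2k, hence with one of the
-- two vertices a C_{2k+1}, or t independent vertices, hence an induced K_{2,t}; so
-- codegrees of nonadjacent vertices are bounded.  Growing paths greedily shows that
-- there are O(d(x)) triangles at x, that few vertices w have codegree above Λ with
-- u, and that for an edge uv few w are joined by wedges to both u and v.  Every wedge
-- u - x - w is therefore counted at most Λ times by its endpoint, and the endpoint
-- sets of u and v together have about n elements.  So with E = 2e there are at most
-- (Λ/2 + o(1)) n E walks of length 3, while Hölder's inequality gives at least E³/n².
--
-- Lower bound.  Füredi's graph over F_q joins (x, u) and (y, v) if (x + y)^Λ = u v,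
-- where u and v are s-th roots of unity and q - 1 = Λ s.  Its bipartite double has no
-- odd cycles, and two vertices of one side have at most Λ common neighbours.  The
-- field is obtained by Kummer extensions from a prime field, with a degree r that
-- depends only on Λ, so that primes p in every interval (x, (1 + 1/m) x] are needed.
-- If such an interval contained no prime, Selberg's formula would force almost all
-- intervals (x/n, z/n] to have the maximal density 2 of primes; these can be chained
-- into an interval of large ratio with density 2, against Chebyshev's bound.
-- Logarithms are replaced by integer approximations of K log for a large K.
module Submission where

open import Data.Product using (Σ; _×_; _,_; proj₁; proj₂)
open import Data.Sum using (_⊎_; inj₁; inj₂; [_,_]′)
open import Data.Empty using (⊥; ⊥-elim)
open import Relation.Nullary using (¬_; Dec; yes; no; does)
open import Relation.Binary.PropositionalEquality using (_≡_; _≢_; refl; sym; trans; cong; cong₂; subst; subst₂; module ≡-Reasoning)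

-- The graph needs Λ to divide q - 1, and Selberg's formula says nothing about primes in the class 1
-- modulo Λ. Hence q = p^r with one exponent r such that Λ divides p^r - 1 for every prime p > Λ. As
-- r is fixed, a relative error of order 1/(rm) in p costs only a factor 1 - 1/m in the square of
-- the number of edges. In the upper bound the excluded pair k = t = 2 marks the obstacle. A
-- nonadjacent pair u, w with more than Λ common neighbours has two adjacent ones x, y. For k = 2 a
-- third common neighbour z closes the 5-cycle u x y w z, which requires t ≥ 3. For k ≥ 3 the edge
-- xy is used instead: each such w is coloured by its edge, and long paths outside the neighbourhood
-- of u are closed through one or two of these edges, depending on whether the colour changes along
-- the path. The extension fields are recognised as fields through their idempotents: the q-power
-- map acts diagonally on coefficients, so neither irreducibility of a polynomial nor cyclicity of
-- the unit group enters.

module LinearArithmetic where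

  open import Data.Nat as ℕ using (ℕ)
  open import Data.Integer using (ℤ; +_; -_; _+_; _-_; _*_; _≤_; 0ℤ; 1ℤ; nonNegative; +≤+)
  import Data.Integer as ℤ
  open import Data.Integer.Properties

  infixl 5 _⊕_
  infixr 6 _⊗_ _⊛_

  -- Linear arithmetic: a goal a ≤ b follows from a combination l ≤ r of the
  -- hypotheses once the ring solver has checked b - a = r - l.
  lin : ∀ {a b l r : ℤ} → l ≤ r → b - a ≡ r - l → a ≤ b
  lin l≤r eq = 0≤i-j⇒j≤i (subst (0ℤ ≤_) (sym eq) (i≤j⇒0≤j-i l≤r))

  _⊕_ : ∀ {a b c d : ℤ} → a ≤ b → c ≤ d → a + c ≤ b + d
  _⊕_ = +-mono-≤

  _⊗_ : ∀ (k : ℕ) {a b : ℤ} → a ≤ b → + k * a ≤ + k * b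
  k ⊗ h = *-monoˡ-≤-nonNeg (+ k) h

  _⊛_ : ∀ {c a b : ℤ} → 0ℤ ≤ c → a ≤ b → c * a ≤ c * b
  _⊛_ {c} hc h = *-monoˡ-≤-nonNeg c {{nonNegative hc}} h

  *-nonneg : ∀ {a b : ℤ} → 0ℤ ≤ a → 0ℤ ≤ b → 0ℤ ≤ a * b
  *-nonneg {a} {b} ha hb = subst (_≤ a * b) (*-zeroʳ a) (_⊛_ {a} {0ℤ} {b} ha hb)

  +-nonneg : ∀ {a b : ℤ} → 0ℤ ≤ a → 0ℤ ≤ b → 0ℤ ≤ a + b
  +-nonneg = +-mono-≤

  0≤+ : ∀ n → 0ℤ ≤ + n
  0≤+ n = +≤+ ℕ.z≤n

  +≤ : ∀ {m n} → m ℕ.≤ n → + m ≤ + n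
  +≤ = +≤+

  ≤-of : ∀ {a b : ℤ} → a ≡ b → a ≤ b
  ≤-of = ≤-reflexive

  cancel-*≤ : ∀ {c a b : ℤ} → 1ℤ ≤ c → c * a ≤ c * b → a ≤ b
  cancel-*≤ {c} {a} {b} hc h = *-cancelˡ-≤-pos a b c {{ℤ.positive (<-≤-trans (ℤ.+<+ (ℕ.s≤s ℕ.z≤n)) hc)}} h

  mulʳ : ∀ (a b c : ℤ) → 0ℤ ≤ c → a ≤ b → a * c ≤ b * c
  mulʳ a b c hc h = *-monoʳ-≤-nonNeg c {{nonNegative hc}} h

-- Finite sums, floor quotients and divisor sums

module Sums where

  open LinearArithmetic
  open import Data.Nat as ℕ using (ℕ; zero; suc)
  import Data.Nat.Properties as ℕₚ
  import Data.Nat.DivMod as D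
  open import Data.Nat.Divisibility using (_∣_; _∣?_; divides; 0∣⇒≡0)
  open import Data.Integer using (ℤ; +_; -_; _+_; _-_; _*_; _≤_; 0ℤ; 1ℤ)
  open import Data.Integer.Properties
  open import Data.Integer.Tactic.RingSolver using (solve-∀)

  χ : ∀ {a} {P : Set a} → Dec P → ℤ
  χ (yes _) = 1ℤ
  χ (no _)  = 0ℤ

  χ-yes : ∀ {a} {P : Set a} (d : Dec P) → P → χ d ≡ 1ℤ
  χ-yes (yes _) p = refl
  χ-yes (no ¬p) p = ⊥-elim (¬p p)

  χ-no : ∀ {a} {P : Set a} (d : Dec P) → ¬ P → χ d ≡ 0ℤ
  χ-no (yes p) ¬p = ⊥-elim (¬p p)
  χ-no (no _) ¬p = refl

  χ-⇔ : ∀ {a b} {P : Set a} {Q : Set b} (d : Dec P) (d′ : Dec Q) → (P → Q) → (Q → P) → χ d ≡ χ d′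
  χ-⇔ (yes p) d′ f g = sym (χ-yes d′ (f p))
  χ-⇔ (no ¬p) d′ f g = sym (χ-no d′ (λ q → ¬p (g q)))

  0≤χ : ∀ {a} {P : Set a} (d : Dec P) → 0ℤ ≤ χ d
  0≤χ (yes _) = 0≤+ 1
  0≤χ (no _) = 0≤+ 0

  S : ℕ → (ℕ → ℤ) → ℤ
  S zero    f = 0ℤ
  S (suc n) f = S n f + f (suc n)

  S-cong : ∀ n {f g : ℕ → ℤ} → (∀ k → 1 ℕ.≤ k → k ℕ.≤ n → f k ≡ g k) → S n f ≡ S n g
  S-cong zero h = refl
  S-cong (suc n) h = cong₂ _+_ (S-cong n (λ k p q → h k p (ℕₚ.m≤n⇒m≤1+n q))) (h (suc n) (ℕ.s≤s ℕ.z≤n) ℕₚ.≤-refl)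

  S-mono : ∀ n {f g : ℕ → ℤ} → (∀ k → 1 ℕ.≤ k → k ℕ.≤ n → f k ≤ g k) → S n f ≤ S n g
  S-mono zero h = ≤-refl
  S-mono (suc n) h = +-mono-≤ (S-mono n (λ k p q → h k p (ℕₚ.m≤n⇒m≤1+n q))) (h (suc n) (ℕ.s≤s ℕ.z≤n) ℕₚ.≤-refl)

  S-zero : ∀ n {f : ℕ → ℤ} → (∀ k → 1 ℕ.≤ k → k ℕ.≤ n → f k ≡ 0ℤ) → S n f ≡ 0ℤ
  S-zero zero h = refl
  S-zero (suc n) h = cong₂ _+_ (S-zero n (λ k p q → h k p (ℕₚ.m≤n⇒m≤1+n q))) (h (suc n) (ℕ.s≤s ℕ.z≤n) ℕₚ.≤-refl)

  S-nonneg : ∀ n {f : ℕ → ℤ} → (∀ k → 1 ℕ.≤ k → k ℕ.≤ n → 0ℤ ≤ f k) → 0ℤ ≤ S n f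
  S-nonneg n {f} h = subst (_≤ S n f) (S-zero n {λ _ → 0ℤ} (λ _ _ _ → refl)) (S-mono n h)

  interchange : ∀ (a b c d : ℤ) → (a + b) + (c + d) ≡ (a + c) + (b + d)
  interchange = solve-∀

  S-+ : ∀ n (f g : ℕ → ℤ) → S n (λ k → f k + g k) ≡ S n f + S n g
  S-+ zero f g = refl
  S-+ (suc n) f g = trans (cong (_+ (f (suc n) + g (suc n))) (S-+ n f g)) (interchange (S n f) (S n g) (f (suc n)) (g (suc n)))

  S-* : ∀ n (c : ℤ) (f : ℕ → ℤ) → S n (λ k → c * f k) ≡ c * S n f
  S-* zero c f = sym (*-zeroʳ c)
  S-* (suc n) c f = trans (cong (_+ c * f (suc n)) (S-* n c f)) (sym (*-distribˡ-+ c (S n f) (f (suc n))))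

  S-neg : ∀ n (f : ℕ → ℤ) → S n (λ k → - f k) ≡ - S n f
  S-neg zero f = refl
  S-neg (suc n) f = trans (cong (_+ - f (suc n)) (S-neg n f)) (sym (neg-distrib-+ (S n f) (f (suc n))))

  S-minus : ∀ n (f g : ℕ → ℤ) → S n (λ k → f k - g k) ≡ S n f - S n g
  S-minus n f g = trans (S-+ n f (λ k → - g k)) (cong (λ z → S n f + z) (S-neg n g))

  S-swap : ∀ n m (f : ℕ → ℕ → ℤ) → S n (λ i → S m (f i)) ≡ S m (λ j → S n (λ i → f i j))
  S-swap zero m f = sym (S-zero m (λ _ _ _ → refl))
  S-swap (suc n) m f = trans (cong (_+ S m (f (suc n))) (S-swap n m f)) (sym (S-+ m (λ j → S n (λ i → f i j)) (f (suc n))))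

  S-const : ∀ n (c : ℤ) → S n (λ _ → c) ≡ + n * c
  S-const zero c = refl
  S-const (suc n) c = trans (cong (_+ c) (S-const n c)) (alg (+ n) c)
    where
    alg : ∀ a b → a * b + b ≡ (1ℤ + a) * b
    alg = solve-∀

  S-trunc : ∀ n N {f : ℕ → ℤ} → n ℕ.≤ N → (∀ k → n ℕ.< k → k ℕ.≤ N → f k ≡ 0ℤ) → S N f ≡ S n f
  S-trunc n zero ℕ.z≤n h = refl
  S-trunc n (suc N) {f} p h with ℕₚ.m≤n⇒m<n∨m≡n p
  ... | inj₂ refl = refl
  ... | inj₁ (ℕ.s≤s q) = trans (cong₂ _+_ (S-trunc n N q (λ k a b → h k a (ℕₚ.m≤n⇒m≤1+n b))) (h (suc N) (ℕ.s≤s q) ℕₚ.≤-refl)) (+-identityʳ _)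

  S-mono-n : ∀ n N {f : ℕ → ℤ} → n ℕ.≤ N → (∀ k → n ℕ.< k → k ℕ.≤ N → 0ℤ ≤ f k) → S n f ≤ S N f
  S-mono-n n zero ℕ.z≤n h = ≤-refl
  S-mono-n n (suc N) {f} p h with ℕₚ.m≤n⇒m<n∨m≡n p
  ... | inj₂ refl = ≤-refl
  ... | inj₁ (ℕ.s≤s q) = subst (_≤ _) (+-identityʳ _) (+-mono-≤ (S-mono-n n N q (λ k a b → h k a (ℕₚ.m≤n⇒m≤1+n b))) (h (suc N) (ℕ.s≤s q) ℕₚ.≤-refl))

  S-incr-mono : ∀ n N {f g : ℕ → ℤ} → n ℕ.≤ N → (∀ k → n ℕ.< k → k ℕ.≤ N → f k ≤ g k) → S N f - S n f ≤ S N g - S n g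
  S-incr-mono n N {f} {g} p h = lin (S-mono-n n N {λ k → g k - f k} p (λ k a b → i≤j⇒0≤j-i (h k a b)))
    (trans (alg (S n f) (S N f) (S n g) (S N g)) (sym (cong₂ _-_ (S-minus N g f) (S-minus n g f))))
    where
    alg : ∀ a b c d → (d - c) - (b - a) ≡ (d - b) - (c - a)
    alg = solve-∀

  -- The value 0 at the divisor 0 makes floors total, so that summation indices need not carry a
  -- proof of being nonzero.
  quo : ℕ → ℕ → ℕ
  quo x zero = 0
  quo x (suc d) = x D./ suc d

  quo-mul≤ : ∀ x d → quo x d ℕ.* d ℕ.≤ x
  quo-mul≤ x zero = ℕ.z≤n
  quo-mul≤ x (suc d) = D.m/n*n≤m x (suc d)

  <quo : ∀ x d → 1 ℕ.≤ d → x ℕ.< suc (quo x d) ℕ.* d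
  <quo x (suc d) _ = subst (ℕ._< suc (quo x (suc d)) ℕ.* suc d) (sym (D.m≡m%n+[m/n]*n x (suc d)))
    (ℕₚ.+-monoˡ-< (quo x (suc d) ℕ.* suc d) (D.m%n<n x (suc d)))

  quo-unique : ∀ x d q → q ℕ.* d ℕ.≤ x → x ℕ.< suc q ℕ.* d → quo x d ≡ q
  quo-unique x d q l u with 1 ℕ.≤? d
  ... | no ¬d with ℕₚ.n<1⇒n≡0 (ℕₚ.≰⇒> ¬d)
  ...   | refl = ⊥-elim (ℕₚ.n≮0 (subst (x ℕ.<_) (ℕₚ.*-zeroʳ (suc q)) u))
  quo-unique x d@(suc _) q l u | yes 1≤d = ℕₚ.≤-antisym
    (ℕₚ.≤-pred (ℕₚ.*-cancelʳ-< d (quo x d) (suc q) (ℕₚ.≤-<-trans (quo-mul≤ x d) u)))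
    (ℕₚ.≤-pred (ℕₚ.*-cancelʳ-< d q (suc (quo x d)) (ℕₚ.≤-<-trans l (<quo x d 1≤d))))

  ≤quo : ∀ x d q → 1 ℕ.≤ d → q ℕ.* d ℕ.≤ x → q ℕ.≤ quo x d
  ≤quo x d@(suc _) q 1≤d h = ℕₚ.≤-pred (ℕₚ.*-cancelʳ-< d q (suc (quo x d)) (ℕₚ.≤-<-trans h (<quo x d 1≤d)))

  quo≤ : ∀ x d q → x ℕ.< suc q ℕ.* d → quo x d ℕ.≤ q
  quo≤ x zero q h = ℕ.z≤n
  quo≤ x d@(suc _) q h = ℕₚ.≤-pred (ℕₚ.*-cancelʳ-< d (quo x d) (suc q) (ℕₚ.≤-<-trans (quo-mul≤ x d) h))

  quo-small : ∀ x d → x ℕ.< d → quo x d ≡ 0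
  quo-small x d h = quo-unique x d 0 ℕ.z≤n (subst (x ℕ.<_) (sym (ℕₚ.+-identityʳ d)) h)

  quo-1 : ∀ x → quo x 1 ≡ x
  quo-1 x = quo-unique x 1 x (ℕₚ.≤-reflexive (ℕₚ.*-identityʳ x)) (ℕₚ.≤-reflexive (cong suc (sym (ℕₚ.*-identityʳ x))))

  quo-≤ : ∀ x d → quo x d ℕ.≤ x
  quo-≤ x zero = ℕ.z≤n
  quo-≤ x (suc d) = D.m/n≤m x (suc d)

  quo-monoˡ : ∀ {x y} d → x ℕ.≤ y → quo x d ℕ.≤ quo y d
  quo-monoˡ zero h = ℕ.z≤n
  quo-monoˡ {x} {y} d@(suc _) h = ≤quo y d (quo x d) (ℕ.s≤s ℕ.z≤n) (ℕₚ.≤-trans (quo-mul≤ x d) h)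

  quo-antiʳ : ∀ x {d d′} → 1 ℕ.≤ d → d ℕ.≤ d′ → quo x d′ ℕ.≤ quo x d
  quo-antiʳ x {d} {d′} p h = ≤quo x d (quo x d′) p (ℕₚ.≤-trans (ℕₚ.*-monoʳ-≤ (quo x d′) h) (quo-mul≤ x d′))

  1≤quo : ∀ x d → 1 ℕ.≤ d → d ℕ.≤ x → 1 ℕ.≤ quo x d
  1≤quo x d p h = ≤quo x d 1 p (subst (ℕ._≤ x) (sym (ℕₚ.+-identityʳ d)) h)

  quo-mult : ∀ m d → 1 ℕ.≤ d → quo (m ℕ.* d) d ≡ m
  quo-mult m d 1≤d = quo-unique (m ℕ.* d) d m ℕₚ.≤-refl (ℕₚ.m<n+m (m ℕ.* d) 1≤d)

  quo-quo : ∀ x a b → 1 ℕ.≤ a → 1 ℕ.≤ b → quo (quo x a) b ≡ quo x (a ℕ.* b)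
  quo-quo x a@(suc _) b@(suc _) _ _ = sym (quo-unique x (a ℕ.* b) q lo hi)
    where
    q : ℕ
    q = quo (quo x a) b
    re : ∀ c → c ℕ.* (a ℕ.* b) ≡ (c ℕ.* b) ℕ.* a
    re c = trans (cong (c ℕ.*_) (ℕₚ.*-comm a b)) (sym (ℕₚ.*-assoc c b a))
    lo : q ℕ.* (a ℕ.* b) ℕ.≤ x
    lo = subst (ℕ._≤ x) (sym (re q)) (ℕₚ.≤-trans (ℕₚ.*-monoˡ-≤ a (quo-mul≤ (quo x a) b)) (quo-mul≤ x a))
    hi : x ℕ.< suc q ℕ.* (a ℕ.* b)
    hi = subst (x ℕ.<_) (sym (re (suc q))) (ℕₚ.<-≤-trans (<quo x a (ℕ.s≤s ℕ.z≤n)) (ℕₚ.*-monoˡ-≤ a (<quo (quo x a) b (ℕ.s≤s ℕ.z≤n))))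

  quo-step-∣ : ∀ x d → d ∣ suc x → quo (suc x) d ≡ suc (quo x d)
  quo-step-∣ x zero h with 0∣⇒≡0 h
  ... | ()
  quo-step-∣ x d@(suc d₀) (divides zero ())
  quo-step-∣ x d@(suc d₀) (divides (suc c) eq) = trans (quo-unique (suc x) d (suc c) (ℕₚ.≤-reflexive (sym eq)) (subst (ℕ._< suc (suc c) ℕ.* d) (sym eq) (ℕₚ.m<n+m (suc c ℕ.* d) (ℕ.s≤s ℕ.z≤n))))
    (cong suc (sym (quo-unique x d c (ℕₚ.≤-trans (ℕₚ.m≤n+m (c ℕ.* d) d₀) (ℕₚ.≤-reflexive (sym eq′))) (subst (x ℕ.<_) eq ℕₚ.≤-refl))))
    where
    eq′ : x ≡ d₀ ℕ.+ c ℕ.* d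
    eq′ = ℕₚ.suc-injective eq

  quo-step-∤ : ∀ x d → ¬ (d ∣ suc x) → quo (suc x) d ≡ quo x d
  quo-step-∤ x zero h = refl
  quo-step-∤ x d@(suc _) h = quo-unique (suc x) d (quo x d) (ℕₚ.m≤n⇒m≤1+n (quo-mul≤ x d))
    (ℕₚ.≤∧≢⇒< (<quo x d (ℕ.s≤s ℕ.z≤n)) (λ e → h (divides (suc (quo x d)) e)))

  -- The sum of f(d, k/d) over the divisors d of k; a Dirichlet convolution when f is a product.
  T : ℕ → (ℕ → ℕ → ℤ) → ℤ
  T k f = S k (λ d → χ (d ∣? k) * f d (quo k d))

  S-quo-step : ∀ x d (g : ℕ → ℤ) → S (quo (suc x) d) g ≡ S (quo x d) g + χ (d ∣? suc x) * g (quo (suc x) d)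
  S-quo-step x d g with d ∣? suc x
  ... | yes h = trans (cong (λ q → S q g) (quo-step-∣ x d h)) (cong (λ z → S (quo x d) g + z) (trans (cong g (sym (quo-step-∣ x d h))) (sym (*-identityˡ _))))
  ... | no h = trans (cong (λ q → S q g) (quo-step-∤ x d h)) (sym (+-identityʳ _))

  -- Induction on x: from x to x + 1 the floor of x/d grows exactly for the divisors d of x + 1, and
  -- then the new term is the one that `T (suc x) f` has at d.
  hyperbola : ∀ x (f : ℕ → ℕ → ℤ) → S x (λ n → T n f) ≡ S x (λ d → S (quo x d) (f d))
  hyperbola zero f = refl
  hyperbola (suc x) f = begin
    S x (λ n → T n f) + T (suc x) f
      ≡⟨ cong (_+ T (suc x) f) (hyperbola x f) ⟩
    S x (λ d → S (quo x d) (f d)) + T (suc x) f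
      ≡⟨ cong (_+ T (suc x) f) (sym (S-trunc x (suc x) (ℕₚ.n≤1+n x) (λ k a _ → cong (λ q → S q (f k)) (quo-small x k a)))) ⟩
    S (suc x) (λ d → S (quo x d) (f d)) + T (suc x) f
      ≡⟨ sym (S-+ (suc x) (λ d → S (quo x d) (f d)) (λ d → χ (d ∣? suc x) * f d (quo (suc x) d))) ⟩
    S (suc x) (λ d → S (quo x d) (f d) + χ (d ∣? suc x) * f d (quo (suc x) d))
      ≡⟨ S-cong (suc x) (λ d _ _ → sym (S-quo-step x d (f d))) ⟩
    S (suc x) (λ d → S (quo (suc x) d) (f d)) ∎
    where open ≡-Reasoning

  -- Both sides run over the pairs with d m ≤ x. With this condition as an indicator they become
  -- sums over a square, where the order can be exchanged.
  hyperbola-sym : ∀ x (f : ℕ → ℕ → ℤ) → S x (λ d → S (quo x d) (f d)) ≡ S x (λ m → S (quo x m) (λ d → f d m))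
  hyperbola-sym x f = trans (S-cong x inner) (trans (S-swap x x g) (S-cong x (λ m p _ → sym (inner′ m p))))
    where
    g : ℕ → ℕ → ℤ
    g d m = χ (d ℕ.* m ℕ.≤? x) * f d m
    key : ∀ d (h : ℕ → ℤ) → 1 ℕ.≤ d → S (quo x d) h ≡ S x (λ m → χ (d ℕ.* m ℕ.≤? x) * h m)
    key d h p = sym (trans (S-trunc (quo x d) x (quo-≤ x d) (λ m a _ → cong (_* h m) (χ-no (d ℕ.* m ℕ.≤? x) (λ q → ℕₚ.<⇒≱ a (≤quo x d m p (subst (ℕ._≤ x) (ℕₚ.*-comm d m) q))))))
      (S-cong (quo x d) (λ m _ b → trans (cong (_* h m) (χ-yes (d ℕ.* m ℕ.≤? x) (ℕₚ.≤-trans (ℕₚ.*-monoʳ-≤ d b) (subst (ℕ._≤ x) (ℕₚ.*-comm (quo x d) d) (quo-mul≤ x d))))) (*-identityˡ (h m)))))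
    inner : ∀ d → 1 ℕ.≤ d → d ℕ.≤ x → S (quo x d) (f d) ≡ S x (g d)
    inner d p _ = key d (f d) p
    inner′ : ∀ m → 1 ℕ.≤ m → S (quo x m) (λ d → f d m) ≡ S x (λ d → g d m)
    inner′ m p = trans (key m (λ d → f d m) p) (S-cong x (λ d _ _ → cong (λ c → χ (c ℕ.≤? x) * f d m) (ℕₚ.*-comm m d)))

  S-tail : ∀ (f : ℕ → ℤ) n N → n ℕ.≤ N → S N (λ k → χ (suc n ℕ.≤? k) * f k) ≡ S N f - S n f
  S-tail f n N h = sym (trans (cong (λ z → S N f - z) head) (trans (sym (S-minus N f _)) (S-cong N term)))
    where
    g : ℕ → ℤ
    g k = χ (k ℕ.≤? n) * f k
    head : S n f ≡ S N g
    head = sym (trans (S-trunc n N h (λ k p _ → cong (_* f k) (χ-no (k ℕ.≤? n) (ℕₚ.<⇒≱ p)))) (S-cong n (λ k _ q → trans (cong (_* f k) (χ-yes (k ℕ.≤? n) q)) (*-identityˡ (f k)))))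
    term : ∀ k → 1 ℕ.≤ k → k ℕ.≤ N → f k - g k ≡ χ (suc n ℕ.≤? k) * f k
    term k _ _ with k ℕ.≤? n | suc n ℕ.≤? k
    ... | yes p | yes q = ⊥-elim (ℕₚ.<⇒≱ q p)
    ... | yes p | no _ = trans (cong (λ z → f k - z) (*-identityˡ (f k))) (+-inverseʳ (f k))
    ... | no _ | yes _ = trans (+-identityʳ (f k)) (sym (*-identityˡ (f k)))
    ... | no p | no q = ⊥-elim (q (ℕₚ.≰⇒> p))

-- Factorization by least primes; the functions of Möbius and von Mangoldt

module ArithmeticFunctions where

  open LinearArithmetic
  open Sums
  open import Data.Nat as ℕ using (ℕ; zero; suc)
  import Data.Nat.Properties as ℕₚ
  open import Data.Nat.Divisibility
  open import Data.Nat.Primality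
  open import Data.Nat.Coprimality using (Coprime; coprime-divisor)
  open import Data.Integer using (ℤ; +_; -_; _+_; _-_; _*_; _≤_; 0ℤ; 1ℤ)
  import Data.Integer as ℤ
  open import Data.Integer.Properties
  open import Data.Integer.Tactic.RingSolver using (solve-∀)
  open import Relation.Nullary.Decidable using (¬?)

  -- For n = 1 this holds with every p, which lets a factorization end at 1.
  Least : ℕ → ℕ → Set
  Least p n = ∀ r → Prime r → r ∣ n → p ℕ.≤ r

  Least-∣ : ∀ {p m d} → Least p m → d ∣ m → Least p d
  Least-∣ h q r pr r∣d = h r pr (∣-trans r∣d q)

  prime≥2 : ∀ {p} → Prime p → 2 ℕ.≤ p
  prime≥2 {p} pr = ℕ.nonTrivial⇒n>1 p {{prime⇒nonTrivial pr}}

  prime≥1 : ∀ {p} → Prime p → 1 ℕ.≤ p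
  prime≥1 pr = ℕₚ.<⇒≤ (prime≥2 pr)

  prime-∣-prime : ∀ {p r} → Prime p → Prime r → p ∣ r → p ≡ r
  prime-∣-prime {p} pp pr h with prime⇒irreducible pr h
  ... | inj₂ e = e
  ... | inj₁ refl = ⊥-elim (¬prime[1] pp)

  findPrime : ∀ fuel k n → 2 ℕ.≤ n → 2 ℕ.≤ k → k Rough n → n ℕ.≤ fuel ℕ.+ k →
              Σ ℕ λ p → Prime p × p ∣ n × Least p n
  findPrime fuel k n 2≤n 2≤k rough bound with k ∣? n
  ... | yes k∣n = k , rough∧∣⇒prime {{ℕ.n>1⇒nonTrivial 2≤k}} rough k∣n , k∣n , least
    where
    least : Least k n
    least r pr r∣n with k ℕ.≤? r
    ... | yes q = q
    ... | no q = ⊥-elim (rough (hasNonTrivialDivisor {{prime⇒nonTrivial pr}} (ℕₚ.≰⇒> q) r∣n))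
  findPrime zero k n 2≤n 2≤k rough bound | no k∤n =
    ⊥-elim (k∤n (subst (k ∣_) (ℕₚ.≤-antisym (rough⇒≤ {{ℕ.n>1⇒nonTrivial 2≤n}} rough) bound) ∣-refl))
  findPrime (suc fuel) k n 2≤n 2≤k rough bound | no k∤n =
    findPrime fuel (suc k) n 2≤n (ℕₚ.m≤n⇒m≤1+n 2≤k) (∤⇒rough-suc k∤n rough) (subst (n ℕ.≤_) (sym (ℕₚ.+-suc fuel k)) bound)

  leastPrime : ∀ n → 2 ℕ.≤ n → Σ ℕ λ p → Prime p × p ∣ n × Least p n
  leastPrime n h = findPrime n 2 n h ℕₚ.≤-refl 2-rough (ℕₚ.m≤m+n n 2)

  lpf : ℕ → ℕ
  lpf n with 2 ℕ.≤? n
  ... | yes h = proj₁ (leastPrime n h)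
  ... | no _ = 1

  lpf-unique : ∀ {p} n → Prime p → p ∣ n → 1 ℕ.≤ n → Least p n → lpf n ≡ p
  lpf-unique {p} n pp p∣n 1≤n least with 2 ℕ.≤? n
  ... | yes h = let (r , pr , r∣n , lr) = leastPrime n h in ℕₚ.≤-antisym (lr p pp p∣n) (least r pr r∣n)
  ... | no h = ⊥-elim (h (ℕₚ.≤-trans (prime≥2 pp) (∣⇒≤ {{ℕ.>-nonZero 1≤n}} p∣n)))

  1≤* : ∀ {m n} → 1 ℕ.≤ m → 1 ℕ.≤ n → 1 ℕ.≤ m ℕ.* n
  1≤* = ℕₚ.*-mono-≤

  1≤*⇒1≤ˡ : ∀ m {n} → 1 ℕ.≤ m ℕ.* n → 1 ℕ.≤ m
  1≤*⇒1≤ˡ (suc _) _ = ℕ.s≤s ℕ.z≤n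

  Least-* : ∀ {p m} → Prime p → Least p m → Least p (p ℕ.* m)
  Least-* {p} {m} pp h r pr r∣ with euclidsLemma p m pr r∣
  ... | inj₁ q = ℕₚ.≤-reflexive (sym (prime-∣-prime pr pp q))
  ... | inj₂ q = h r pr q

  lpf-* : ∀ {p m} → Prime p → 1 ℕ.≤ m → Least p m → lpf (p ℕ.* m) ≡ p
  lpf-* {p} {m} pp 1≤m h = lpf-unique (p ℕ.* m) pp (m∣m*n m) (1≤* (prime≥1 pp) 1≤m) (Least-* pp h)

  quo-*ˡ : ∀ p m → 1 ℕ.≤ p → quo (p ℕ.* m) p ≡ m
  quo-*ˡ p m h = trans (cong (λ z → quo z p) (ℕₚ.*-comm p m)) (quo-mult m p h)

  -- Every n > 1 is p m with p its least prime factor. The condition `Least p m` makes this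
  -- decomposition canonical, so arithmetic functions can be defined along it as well.
  factor-ind : ∀ {a} (P : ℕ → Set a) → P 1 → (∀ p m → Prime p → 1 ℕ.≤ m → Least p m → P m → P (p ℕ.* m)) →
               ∀ n → 1 ℕ.≤ n → P n
  factor-ind P base step n = go n n ℕₚ.≤-refl
    where
    go : ∀ fuel n → n ℕ.≤ fuel → 1 ℕ.≤ n → P n
    go zero n h 1≤n = ⊥-elim (ℕₚ.<⇒≱ 1≤n h)
    go (suc fuel) n h 1≤n with ℕₚ.m≤n⇒m<n∨m≡n 1≤n
    ... | inj₂ refl = base
    ... | inj₁ 2≤n with leastPrime n 2≤n
    ...   | p , pp , divides m refl , least = subst P (ℕₚ.*-comm p m) (step p m pp 1≤m (Least-∣ least (m∣m*n p)) (go fuel m m≤fuel 1≤m))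
      where
      1≤m : 1 ℕ.≤ m
      1≤m = 1≤*⇒1≤ˡ m 1≤n
      m≤fuel : m ℕ.≤ fuel
      m≤fuel = ℕₚ.≤-pred (ℕₚ.<-≤-trans (ℕₚ.m<m*n m p {{ℕ.>-nonZero 1≤m}} (prime≥2 pp)) h)

  module _ {A : Set} (base : A) (step : ℕ → ℕ → A → A) where
    -- Recursion along `factor-ind`. The first argument is fuel, and n itself is always enough
    -- because m < p m.
    recF : ℕ → ℕ → A
    recF zero n = base
    recF (suc f) n with 2 ℕ.≤? n
    ... | yes _ = step (lpf n) (quo n (lpf n)) (recF f (quo n (lpf n)))
    ... | no _ = base

    rec : ℕ → A
    rec n = recF n n

    recF-* : ∀ f {p m} → Prime p → 1 ℕ.≤ m → Least p m → recF (suc f) (p ℕ.* m) ≡ step p m (recF f m)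
    recF-* f {p} {m} pp 1≤m h with 2 ℕ.≤? p ℕ.* m
    ... | yes _ = cong₂ (λ a b → step a b (recF f b)) l (trans (cong (quo (p ℕ.* m)) l) (quo-*ˡ p m (prime≥1 pp)))
      where
      l : lpf (p ℕ.* m) ≡ p
      l = lpf-* pp 1≤m h
    ... | no q = ⊥-elim (q (ℕₚ.*-mono-≤ (prime≥2 pp) 1≤m))

    recF-1 : ∀ f → recF f 1 ≡ base
    recF-1 zero = refl
    recF-1 (suc f) = refl

    private
      m<pm : ∀ {p m} → Prime p → 1 ℕ.≤ m → m ℕ.< p ℕ.* m
      m<pm {p} {m} pp 1≤m = subst (m ℕ.<_) (ℕₚ.*-comm m p) (ℕₚ.m<m*n m p {{ℕ.>-nonZero 1≤m}} (prime≥2 pp))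

    recF-fuel : ∀ n → 1 ℕ.≤ n → ∀ f → n ℕ.≤ f → recF f n ≡ rec n
    recF-fuel = factor-ind _ (λ f _ → recF-1 f) go
      where
      go : ∀ p m → Prime p → 1 ℕ.≤ m → Least p m → (∀ f → m ℕ.≤ f → recF f m ≡ rec m) →
           ∀ f → p ℕ.* m ℕ.≤ f → recF f (p ℕ.* m) ≡ rec (p ℕ.* m)
      go p m pp 1≤m least ih f h with p ℕ.* m in eq | m<pm pp 1≤m
      ... | suc n | m<n with f | h
      ...   | suc f′ | ℕ.s≤s h′ = subst (λ z → recF (suc f′) z ≡ recF (suc n) z) eq
              (trans (recF-* f′ pp 1≤m least) (trans (cong (step p m) (trans (ih f′ (ℕₚ.≤-trans (ℕₚ.≤-pred m<n) h′)) (sym (ih n (ℕₚ.≤-pred m<n))))) (sym (recF-* n pp 1≤m least))))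

    rec-* : ∀ p m → Prime p → 1 ℕ.≤ m → Least p m → rec (p ℕ.* m) ≡ step p m (rec m)
    rec-* p m pp 1≤m least = trans (sym (recF-fuel (p ℕ.* m) (1≤* (prime≥1 pp) 1≤m) (suc (p ℕ.* m)) (ℕₚ.n≤1+n _)))
      (trans (recF-* (p ℕ.* m) pp 1≤m least) (cong (step p m) (recF-fuel m 1≤m (p ℕ.* m) (ℕₚ.<⇒≤ (m<pm pp 1≤m)))))

  T-cong : ∀ k {f g : ℕ → ℕ → ℤ} → (∀ d → 1 ℕ.≤ d → d ∣ k → f d (quo k d) ≡ g d (quo k d)) → T k f ≡ T k g
  T-cong k {f} {g} h = S-cong k go
    where
    go : ∀ d → 1 ℕ.≤ d → d ℕ.≤ k → χ (d ∣? k) * f d (quo k d) ≡ χ (d ∣? k) * g d (quo k d)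
    go d p _ with d ∣? k
    ... | yes q = cong (1ℤ *_) (h d p q)
    ... | no _ = refl

  T₁ : ℕ → (ℕ → ℤ) → ℤ
  T₁ k f = T k (λ d _ → f d)

  T₁-zero : ∀ k {f : ℕ → ℤ} → (∀ d → 1 ℕ.≤ d → d ∣ k → f d ≡ 0ℤ) → T₁ k f ≡ 0ℤ
  T₁-zero k {f} h = trans (T-cong k h) (S-zero k (λ d _ _ → *-zeroʳ (χ (d ∣? k))))

  T₁-* : ∀ k c (f : ℕ → ℤ) → T₁ k (λ d → c * f d) ≡ c * T₁ k f
  T₁-* k c f = trans (S-cong k (λ d _ _ → alg (χ (d ∣? k)) c (f d))) (S-* k c _)
    where
    alg : ∀ a b c → a * (b * c) ≡ b * (a * c)
    alg = solve-∀

  T₁-+ : ∀ k (f g : ℕ → ℤ) → T₁ k (λ d → f d + g d) ≡ T₁ k f + T₁ k g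
  T₁-+ k f g = trans (S-cong k (λ d _ _ → *-distribˡ-+ (χ (d ∣? k)) (f d) (g d))) (S-+ k _ _)

  S-multiples : ∀ p m (h : ℕ → ℤ) → 1 ℕ.≤ p → S (p ℕ.* m) (λ d → χ (p ∣? d) * h d) ≡ S m (λ d → h (p ℕ.* d))
  S-multiples p zero h 1≤p = cong (λ z → S z (λ d → χ (p ∣? d) * h d)) (ℕₚ.*-zeroʳ p)
  S-multiples p@(suc p₀) (suc m) h 1≤p = begin
    S (p ℕ.* suc m) f ≡⟨ cong (λ z → S z f) e ⟩
    S (p₀ ℕ.+ p ℕ.* m) f + f (suc (p₀ ℕ.+ p ℕ.* m))
      ≡⟨ cong₂ _+_ (S-trunc (p ℕ.* m) _ (ℕₚ.m≤n+m _ p₀) gap) (trans (cong f (sym e)) (trans (cong (_* h (p ℕ.* suc m)) (χ-yes (p ∣? p ℕ.* suc m) (m∣m*n (suc m)))) (*-identityˡ _))) ⟩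
    S (p ℕ.* m) f + h (p ℕ.* suc m) ≡⟨ cong (_+ h (p ℕ.* suc m)) (S-multiples p m h 1≤p) ⟩
    S m (λ d → h (p ℕ.* d)) + h (p ℕ.* suc m) ∎
    where
    open ≡-Reasoning
    f : ℕ → ℤ
    f d = χ (p ∣? d) * h d
    e : p ℕ.* suc m ≡ suc (p₀ ℕ.+ p ℕ.* m)
    e = ℕₚ.*-suc p m
    gap : ∀ k → p ℕ.* m ℕ.< k → k ℕ.≤ p₀ ℕ.+ p ℕ.* m → f k ≡ 0ℤ
    gap k lo hi = cong (_* h k) (χ-no (p ∣? k) no-div)
      where
      no-div : ¬ p ∣ k
      no-div (divides c refl) = ℕₚ.<⇒≱ (ℕₚ.*-cancelˡ-< p m c (subst (p ℕ.* m ℕ.<_) (ℕₚ.*-comm c p) lo))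
        (ℕₚ.≤-pred (ℕₚ.*-cancelˡ-< p c (suc m) (subst (λ z → p ℕ.* c ℕ.< z) (sym e) (ℕ.s≤s (subst (ℕ._≤ p₀ ℕ.+ p ℕ.* m) (ℕₚ.*-comm c p) hi)))))

  ν : ℕ → ℕ → ℤ
  ν p d = χ (¬? (p ∣? d))

  ν-yes : ∀ p d → ¬ p ∣ d → ν p d ≡ 1ℤ
  ν-yes p d = χ-yes (¬? (p ∣? d))

  ν-no : ∀ p d → p ∣ d → ν p d ≡ 0ℤ
  ν-no p d h = χ-no (¬? (p ∣? d)) (λ q → q h)

  ν+χ : ∀ p d (c : ℤ) → ν p d * c + χ (p ∣? d) * c ≡ c
  ν+χ p d c with p ∣? d
  ... | yes _ = trans (+-identityˡ (1ℤ * c)) (*-identityˡ c)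
  ... | no _ = trans (+-identityʳ (1ℤ * c)) (*-identityˡ c)

  coprime-∣ : ∀ {p d m} → Prime p → ¬ p ∣ d → d ∣ p ℕ.* m → d ∣ m
  coprime-∣ {p} {d} {m} pp p∤d h = coprime-divisor cop h
    where
    cop : Coprime d p
    cop {c} (c∣d , c∣p) with prime⇒irreducible pp c∣p
    ... | inj₁ e = e
    ... | inj₂ refl = ⊥-elim (p∤d c∣d)

  -- The divisors of p m are those not divisible by p, which already divide m, and the products p d
  -- with d a divisor of m.
  divisors-p* : ∀ p m (f : ℕ → ℤ) → Prime p → 1 ℕ.≤ m → T₁ (p ℕ.* m) f ≡ T₁ m (λ d → ν p d * f d + f (p ℕ.* d))
  divisors-p* p m f pp 1≤m = begin
    S n (λ d → χ (d ∣? n) * f d)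
      ≡⟨ S-cong n (λ d _ _ → sym (ν+χ p d (χ (d ∣? n) * f d))) ⟩
    S n (λ d → ν p d * (χ (d ∣? n) * f d) + χ (p ∣? d) * (χ (d ∣? n) * f d))
      ≡⟨ S-+ n _ _ ⟩
    S n (λ d → ν p d * (χ (d ∣? n) * f d)) + S n (λ d → χ (p ∣? d) * (χ (d ∣? n) * f d))
      ≡⟨ cong₂ _+_ (trans (S-trunc m n m≤n vanish) (S-cong m (λ d _ _ → same d))) (trans (S-multiples p m _ 1≤p) (S-cong m (λ d a _ → cong (_* f (p ℕ.* d)) (χ-⇔ (p ℕ.* d ∣? n) (d ∣? m) (*-cancelˡ-∣ p {{ℕ.>-nonZero 1≤p}}) (*-monoʳ-∣ p))))) ⟩
    T₁ m (λ d → ν p d * f d) + T₁ m (λ d → f (p ℕ.* d))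
      ≡⟨ sym (T₁-+ m (λ d → ν p d * f d) (λ d → f (p ℕ.* d))) ⟩
    T₁ m (λ d → ν p d * f d + f (p ℕ.* d)) ∎
    where
    open ≡-Reasoning
    n : ℕ
    n = p ℕ.* m
    1≤p : 1 ℕ.≤ p
    1≤p = prime≥1 pp
    m≤n : m ℕ.≤ n
    m≤n = ℕₚ.m≤n*m m p {{ℕ.>-nonZero 1≤p}}
    same : ∀ d → ν p d * (χ (d ∣? n) * f d) ≡ χ (d ∣? m) * (ν p d * f d)
    same d with p ∣? d
    ... | yes _ = sym (*-zeroʳ (χ (d ∣? m)))
    ... | no p∤d = trans (*-identityˡ (χ (d ∣? n) * f d)) (cong₂ _*_ (χ-⇔ (d ∣? n) (d ∣? m) (coprime-∣ pp p∤d) (∣n⇒∣m*n p)) (sym (*-identityˡ (f d))))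
    vanish : ∀ d → m ℕ.< d → d ℕ.≤ n → ν p d * (χ (d ∣? n) * f d) ≡ 0ℤ
    vanish d lo _ = trans (same d) (cong (_* (ν p d * f d)) (χ-no (d ∣? m) (λ q → ℕₚ.<⇒≱ lo (∣⇒≤ {{ℕ.>-nonZero 1≤m}} q))))

  T₁-one : ∀ m (c : ℤ) → 1 ℕ.≤ m → T₁ m (λ d → χ (d ℕ.≟ 1) * c) ≡ c
  T₁-one m c 1≤m = trans (S-trunc 1 m 1≤m (λ d a _ → trans (cong (λ z → χ (d ∣? m) * (z * c)) (χ-no (d ℕ.≟ 1) (ℕₚ.>⇒≢ a))) (*-zeroʳ (χ (d ∣? m)))))
    (trans (+-identityˡ _) (trans (cong (_* (1ℤ * c)) (χ-yes (1 ∣? m) (1∣ m))) (trans (*-identityˡ (1ℤ * c)) (*-identityˡ c))))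

  -- A new prime changes the sign, a repeated prime gives 0.
  μ : ℕ → ℤ
  μ = rec 1ℤ (λ p m r → - (ν p m * r))

  μ-* : ∀ p m → Prime p → 1 ℕ.≤ m → Least p m → μ (p ℕ.* m) ≡ - (ν p m * μ m)
  μ-* = rec-* 1ℤ (λ p m r → - (ν p m * r))

  -1≤1 : - 1ℤ ≤ 1ℤ
  -1≤1 = ℤ.-≤+

  μ-bounds : ∀ n → 1 ℕ.≤ n → (- 1ℤ ≤ μ n) × (μ n ≤ 1ℤ)
  μ-bounds = factor-ind _ (-1≤1 , ≤-refl) go
    where
    go : ∀ p m → Prime p → 1 ℕ.≤ m → Least p m → (- 1ℤ ≤ μ m) × (μ m ≤ 1ℤ) → (- 1ℤ ≤ μ (p ℕ.* m)) × (μ (p ℕ.* m) ≤ 1ℤ)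
    go p m pp 1≤m least (lo , hi) with p ∣? m | μ-* p m pp 1≤m least
    ... | yes _ | e = subst (λ z → (- 1ℤ ≤ z) × (z ≤ 1ℤ)) (sym e) (ℤ.-≤+ , 0≤+ 1)
    ... | no _ | e = subst (λ z → (- 1ℤ ≤ z) × (z ≤ 1ℤ)) (sym (trans e (cong -_ (*-identityˡ (μ m))))) (neg-mono-≤ hi , neg-mono-≤ lo)

  -- For n = p m the contributions of d and p d cancel for every divisor d of m, so that only n = 1
  -- leaves anything.
  T-μ : ∀ n → 1 ℕ.≤ n → T₁ n μ ≡ χ (n ℕ.≟ 1)
  T-μ = factor-ind _ refl go
    where
    go : ∀ p m → Prime p → 1 ℕ.≤ m → Least p m → T₁ m μ ≡ χ (m ℕ.≟ 1) → T₁ (p ℕ.* m) μ ≡ χ (p ℕ.* m ℕ.≟ 1)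
    go p m pp 1≤m least _ = trans (divisors-p* p m μ pp 1≤m) (trans (T₁-zero m term) (sym (χ-no (p ℕ.* m ℕ.≟ 1) (ℕₚ.>⇒≢ (ℕₚ.*-mono-≤ (prime≥2 pp) 1≤m)))))
      where
      term : ∀ d → 1 ℕ.≤ d → d ∣ m → ν p d * μ d + μ (p ℕ.* d) ≡ 0ℤ
      term d 1≤d d∣m = trans (cong (λ z → ν p d * μ d + z) (μ-* p d pp 1≤d (Least-∣ least d∣m))) (+-inverseʳ (ν p d * μ d))

  module Mangoldt (l : ℕ → ℤ) where
    -- The completely additive function with values `l p` at primes. The weights are arbitrary since
    -- the identities below hold for all of them; in the application they are integers close to a
    -- multiple of log p.
    L : ℕ → ℤ
    L = rec 0ℤ (λ p m r → l p + r)

    L-*least : ∀ p m → Prime p → 1 ℕ.≤ m → Least p m → L (p ℕ.* m) ≡ l p + L m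
    L-*least = rec-* 0ℤ (λ p m r → l p + r)

    -- The value is `l p` at powers of p and 0 elsewhere: p m is a power of p if m = 1, or if p
    -- divides m and m is such a power itself.
    Λ : ℕ → ℤ
    Λ = rec 0ℤ (λ p m r → χ (m ℕ.≟ 1) * l p + χ (p ∣? m) * r)

    Λ-* : ∀ p m → Prime p → 1 ℕ.≤ m → Least p m → Λ (p ℕ.* m) ≡ χ (m ℕ.≟ 1) * l p + χ (p ∣? m) * Λ m
    Λ-* = rec-* 0ℤ (λ p m r → χ (m ℕ.≟ 1) * l p + χ (p ∣? m) * r)

    Least-1 : ∀ p → Least p 1
    Least-1 p r pr r∣1 = ⊥-elim (¬prime[1] (subst Prime (∣1⇒≡1 r∣1) pr))

    -- The recursion covers only a prime p below all primes of n. Otherwise the least prime r of n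
    -- is split off first and p is moved to the remaining factor.
    L-*prime : ∀ n → 1 ℕ.≤ n → ∀ p → Prime p → L (p ℕ.* n) ≡ l p + L n
    L-*prime = factor-ind _ base go
      where
      base : ∀ p → Prime p → L (p ℕ.* 1) ≡ l p + L 1
      base p pp = L-*least p 1 pp ℕₚ.≤-refl (Least-1 p)
      go : ∀ r m → Prime r → 1 ℕ.≤ m → Least r m → (∀ p → Prime p → L (p ℕ.* m) ≡ l p + L m) →
           ∀ p → Prime p → L (p ℕ.* (r ℕ.* m)) ≡ l p + L (r ℕ.* m)
      go r m pr 1≤m least ih p pp with p ℕ.≤? r
      ... | yes p≤r = L-*least p (r ℕ.* m) pp (1≤* (prime≥1 pr) 1≤m) (λ s ps s∣ → ℕₚ.≤-trans p≤r (Least-* pr least s ps s∣))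
      ... | no p≰r = begin
        L (p ℕ.* (r ℕ.* m)) ≡⟨ cong L (trans (sym (ℕₚ.*-assoc p r m)) (trans (cong (ℕ._* m) (ℕₚ.*-comm p r)) (ℕₚ.*-assoc r p m))) ⟩
        L (r ℕ.* (p ℕ.* m)) ≡⟨ L-*least r (p ℕ.* m) pr (1≤* (prime≥1 pp) 1≤m) least′ ⟩
        l r + L (p ℕ.* m) ≡⟨ cong (λ z → l r + z) (ih p pp) ⟩
        l r + (l p + L m) ≡⟨ alg (l r) (l p) (L m) ⟩
        l p + (l r + L m) ≡⟨ cong (λ z → l p + z) (sym (L-*least r m pr 1≤m least)) ⟩
        l p + L (r ℕ.* m) ∎
        where
        open ≡-Reasoning
        alg : ∀ a b c → a + (b + c) ≡ b + (a + c)
        alg = solve-∀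
        least′ : Least r (p ℕ.* m)
        least′ s ps s∣ with euclidsLemma p m ps s∣
        ... | inj₁ q = subst (r ℕ.≤_) (sym (prime-∣-prime ps pp q)) (ℕₚ.<⇒≤ (ℕₚ.≰⇒> p≰r))
        ... | inj₂ q = least s ps q

    L-* : ∀ a → 1 ℕ.≤ a → ∀ b → 1 ℕ.≤ b → L (a ℕ.* b) ≡ L a + L b
    L-* = factor-ind _ (λ b _ → trans (cong L (ℕₚ.+-identityʳ b)) (sym (+-identityˡ (L b)))) go
      where
      go : ∀ p m → Prime p → 1 ℕ.≤ m → Least p m → (∀ b → 1 ℕ.≤ b → L (m ℕ.* b) ≡ L m + L b) →
           ∀ b → 1 ℕ.≤ b → L (p ℕ.* m ℕ.* b) ≡ L (p ℕ.* m) + L b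
      go p m pp 1≤m least ih b 1≤b = trans (cong L (ℕₚ.*-assoc p m b)) (trans (L-*prime (m ℕ.* b) (1≤* 1≤m 1≤b) p pp)
        (trans (cong (λ z → l p + z) (ih b 1≤b)) (trans (sym (+-assoc (l p) (L m) (L b))) (cong (_+ L b) (sym (L-*prime m 1≤m p pp))))))

    Λ-support : ∀ n → 1 ℕ.≤ n → Λ n ≢ 0ℤ → Σ ℕ λ p → Σ ℕ λ a → Prime p × (n ≡ p ℕ.^ suc a) × (Λ n ≡ l p)
    Λ-support = factor-ind _ (λ h → ⊥-elim (h refl)) go
      where
      prime-∣-^ : ∀ {p r} a → Prime p → Prime r → p ∣ r ℕ.^ a → p ≡ r
      prime-∣-^ zero pp pr h = ⊥-elim (¬prime[1] (subst Prime (∣1⇒≡1 h) pp))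
      prime-∣-^ {p} {r} (suc a) pp pr h with euclidsLemma r (r ℕ.^ a) pp h
      ... | inj₁ q = prime-∣-prime pp pr q
      ... | inj₂ q = prime-∣-^ a pp pr q
      go : ∀ p m → Prime p → 1 ℕ.≤ m → Least p m → (Λ m ≢ 0ℤ → Σ ℕ λ r → Σ ℕ λ a → Prime r × (m ≡ r ℕ.^ suc a) × (Λ m ≡ l r)) →
           Λ (p ℕ.* m) ≢ 0ℤ → Σ ℕ λ r → Σ ℕ λ a → Prime r × (p ℕ.* m ≡ r ℕ.^ suc a) × (Λ (p ℕ.* m) ≡ l r)
      go p m pp 1≤m least ih ne with m ℕ.≟ 1 | p ∣? m | Λ-* p m pp 1≤m least
      ... | yes refl | yes q | _ = ⊥-elim (¬prime[1] (subst Prime (∣1⇒≡1 q) pp))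
      ... | yes refl | no _ | e = p , 0 , pp , refl , trans e (trans (+-identityʳ (1ℤ * l p)) (*-identityˡ (l p)))
      ... | no _ | no _ | e = ⊥-elim (ne e)
      ... | no _ | yes q | e = let e′ = trans e (trans (+-identityˡ (1ℤ * Λ m)) (*-identityˡ (Λ m)))
                                   (r , a , pr , m≡ , Λ≡) = ih (λ z → ne (trans e′ z))
                                   p≡r = prime-∣-^ (suc a) pp pr (subst (p ∣_) m≡ q)
                               in r , suc a , pr , cong₂ ℕ._*_ p≡r m≡ , trans e′ Λ≡

    T-Λ : ∀ n → 1 ℕ.≤ n → T₁ n Λ ≡ L n
    T-Λ = factor-ind _ refl go
      where
      go : ∀ p m → Prime p → 1 ℕ.≤ m → Least p m → T₁ m Λ ≡ L m → T₁ (p ℕ.* m) Λ ≡ L (p ℕ.* m)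
      go p m pp 1≤m least ih = begin
        T₁ (p ℕ.* m) Λ ≡⟨ divisors-p* p m Λ pp 1≤m ⟩
        T₁ m (λ d → ν p d * Λ d + Λ (p ℕ.* d)) ≡⟨ T-cong m term ⟩
        T₁ m (λ d → χ (d ℕ.≟ 1) * l p + Λ d) ≡⟨ T₁-+ m (λ d → χ (d ℕ.≟ 1) * l p) Λ ⟩
        T₁ m (λ d → χ (d ℕ.≟ 1) * l p) + T₁ m Λ ≡⟨ cong₂ _+_ (T₁-one m (l p) 1≤m) ih ⟩
        l p + L m ≡⟨ sym (L-*least p m pp 1≤m least) ⟩
        L (p ℕ.* m) ∎
        where
        open ≡-Reasoning
        alg : ∀ a b c → a + (b + c) ≡ b + (a + c)
        alg = solve-∀
        term : ∀ d → 1 ℕ.≤ d → d ∣ m → ν p d * Λ d + Λ (p ℕ.* d) ≡ χ (d ℕ.≟ 1) * l p + Λ d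
        term d 1≤d d∣m = trans (cong (λ z → ν p d * Λ d + z) (Λ-* p d pp 1≤d (Least-∣ least d∣m)))
          (trans (alg (ν p d * Λ d) (χ (d ℕ.≟ 1) * l p) (χ (p ∣? d) * Λ d)) (cong (λ z → χ (d ℕ.≟ 1) * l p + z) (ν+χ p d (Λ d))))

    -- The sum of μ over the divisors of m prime to p is 1 if m is a power of p and 0 otherwise. If
    -- p does not divide m > 1, this is `T-μ`; if it does, minimality forces the least prime of m to
    -- be p, and removing it does not change the sum.
    Λ-via-μ : ∀ p → Prime p → ∀ m → 1 ℕ.≤ m → Least p m → Λ (p ℕ.* m) ≡ l p * T₁ m (λ d → ν p d * μ d)
    Λ-via-μ p pp = factor-ind _ base go
      where
      base : Least p 1 → Λ (p ℕ.* 1) ≡ l p * T₁ 1 (λ d → ν p d * μ d)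
      base h = trans (Λ-* p 1 pp ℕₚ.≤-refl h) (trans (cong (λ z → 1ℤ * l p + z) (*-zeroʳ (χ (p ∣? 1)))) (trans (alg (l p)) (cong (λ z → l p * (0ℤ + 1ℤ * (z * 1ℤ))) (sym (ν-yes p 1 (λ q → ¬prime[1] (subst Prime (∣1⇒≡1 q) pp)))))))
        where
        alg : ∀ a → 1ℤ * a + 0ℤ ≡ a * (0ℤ + 1ℤ * (1ℤ * 1ℤ))
        alg = solve-∀
      go : ∀ r m → Prime r → 1 ℕ.≤ m → Least r m → (Least p m → Λ (p ℕ.* m) ≡ l p * T₁ m (λ d → ν p d * μ d)) →
           Least p (r ℕ.* m) → Λ (p ℕ.* (r ℕ.* m)) ≡ l p * T₁ (r ℕ.* m) (λ d → ν p d * μ d)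
      go r m pr 1≤m least ih h with p ∣? (r ℕ.* m) | Λ-* p (r ℕ.* m) pp (1≤* (prime≥1 pr) 1≤m) h | χ-no (r ℕ.* m ℕ.≟ 1) (ℕₚ.>⇒≢ (ℕₚ.*-mono-≤ (prime≥2 pr) 1≤m))
      ... | no p∤ | e | z = trans e (trans (cong₂ _+_ (cong (_* l p) z) refl) (sym (trans (cong (l p *_) none) (*-zeroʳ (l p)))))
        where
        none : T₁ (r ℕ.* m) (λ d → ν p d * μ d) ≡ 0ℤ
        none = trans (T-cong (r ℕ.* m) (λ d _ d∣ → trans (cong (_* μ d) (ν-yes p d (λ q → p∤ (∣-trans q d∣)))) (*-identityˡ (μ d))))
          (trans (T-μ (r ℕ.* m) (1≤* (prime≥1 pr) 1≤m)) z)
      ... | yes p∣ | e | z with ℕₚ.≤-antisym (h r pr (m∣m*n m)) (Least-* pr least p pp p∣)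
      ...   | refl = trans e (trans (cong₂ _+_ (cong (_* l p) z) (*-identityˡ (Λ (p ℕ.* m)))) (trans (+-identityˡ (Λ (p ℕ.* m))) (trans (ih least) (cong (l p *_) (sym reduce)))))
        where
        reduce : T₁ (p ℕ.* m) (λ d → ν p d * μ d) ≡ T₁ m (λ d → ν p d * μ d)
        reduce = trans (divisors-p* p m (λ d → ν p d * μ d) pp 1≤m) (T-cong m term)
          where
          term : ∀ d → 1 ℕ.≤ d → d ∣ m → ν p d * (ν p d * μ d) + ν p (p ℕ.* d) * μ (p ℕ.* d) ≡ ν p d * μ d
          term d _ _ = trans (cong (λ z → ν p d * (ν p d * μ d) + z * μ (p ℕ.* d)) (ν-no p (p ℕ.* d) (m∣m*n d))) (trans (+-identityʳ _) idem)
            where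
            idem : ν p d * (ν p d * μ d) ≡ ν p d * μ d
            idem with p ∣? d
            ... | yes _ = refl
            ... | no _ = *-identityˡ (1ℤ * μ d)

    -- As in `T-μ`, the divisors d and p d are paired. Since L (p d) exceeds L d by `l p`, what
    -- remains is - `l p` times the sum in `Λ-via-μ`.
    T-μL : ∀ n → 1 ℕ.≤ n → T₁ n (λ d → μ d * L d) ≡ - Λ n
    T-μL = factor-ind _ refl go
      where
      go : ∀ p m → Prime p → 1 ℕ.≤ m → Least p m → T₁ m (λ d → μ d * L d) ≡ - Λ m → T₁ (p ℕ.* m) (λ d → μ d * L d) ≡ - Λ (p ℕ.* m)
      go p m pp 1≤m least _ = begin
        T₁ (p ℕ.* m) (λ d → μ d * L d) ≡⟨ divisors-p* p m (λ d → μ d * L d) pp 1≤m ⟩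
        T₁ m (λ d → ν p d * (μ d * L d) + μ (p ℕ.* d) * L (p ℕ.* d)) ≡⟨ T-cong m term ⟩
        T₁ m (λ d → (- l p) * (ν p d * μ d)) ≡⟨ T₁-* m (- l p) (λ d → ν p d * μ d) ⟩
        - l p * T₁ m (λ d → ν p d * μ d) ≡⟨ sym (neg-distribˡ-* (l p) (T₁ m (λ d → ν p d * μ d))) ⟩
        - (l p * T₁ m (λ d → ν p d * μ d)) ≡⟨ cong -_ (sym (Λ-via-μ p pp m 1≤m least)) ⟩
        - Λ (p ℕ.* m) ∎
        where
        open ≡-Reasoning
        alg : ∀ a b c d → a * (b * c) + (- (a * b)) * (d + c) ≡ (- d) * (a * b)
        alg = solve-∀
        term : ∀ d → 1 ℕ.≤ d → d ∣ m → ν p d * (μ d * L d) + μ (p ℕ.* d) * L (p ℕ.* d) ≡ (- l p) * (ν p d * μ d)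
        term d 1≤d d∣m = trans (cong (λ z → ν p d * (μ d * L d) + z) (cong₂ _*_ (μ-* p d pp 1≤d (Least-∣ least d∣m)) (L-*least p d pp 1≤d (Least-∣ least d∣m))))
          (alg (ν p d) (μ d) (L d) (l p))

    module _ (l≥0 : ∀ p → Prime p → 0ℤ ≤ l p) where
      Λ≥0 : ∀ n → 1 ℕ.≤ n → 0ℤ ≤ Λ n
      Λ≥0 = factor-ind _ ≤-refl (λ p m pp 1≤m least ih → subst (0ℤ ≤_) (sym (Λ-* p m pp 1≤m least))
        (+-nonneg (*-nonneg (0≤χ (m ℕ.≟ 1)) (l≥0 p pp)) (*-nonneg (0≤χ (p ∣? m)) ih)))

      L≥0 : ∀ n → 1 ℕ.≤ n → 0ℤ ≤ L n
      L≥0 = factor-ind _ ≤-refl (λ p m pp 1≤m least ih → subst (0ℤ ≤_) (sym (L-*least p m pp 1≤m least)) (+-nonneg (l≥0 p pp) ih))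

-- Integer approximations to a multiple of the logarithm

module Logarithm where

  open LinearArithmetic
  open Sums
  open ArithmeticFunctions
  open import Data.Nat as ℕ using (ℕ; zero; suc; _!)
  import Data.Nat.Properties as ℕₚ
  open import Data.Nat.Divisibility
  open import Data.Nat.Primality
  open import Data.Integer using (ℤ; +_; -_; _+_; _-_; _*_; _≤_; 0ℤ; 1ℤ)
  open import Data.Integer.Properties
  open import Data.Integer.Tactic.RingSolver using (solve; solve-∀)
  open import Data.List using ([]; _∷_)

  -- A completely additive integer-valued approximation L of K log on [1, X],
  -- with K / k exact for k ≤ X; e is the error of a single increment.
  record Scale (X : ℕ) : Set where
    field
      K     : ℤ
      1≤K   : 1ℤ ≤ K
      inv   : ℕ → ℤ
      inv≥0 : ∀ k → 0ℤ ≤ inv k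
      k*inv : ∀ k → 1 ℕ.≤ k → k ℕ.≤ X → + k * inv k ≡ K
      l     : ℕ → ℤ
      l≥0   : ∀ p → Prime p → 0ℤ ≤ l p
      e     : ℤ
      e≥0   : 0ℤ ≤ e
      -- So even X increments together err by at most K / X, the smallest reciprocal in the range.
      X²e≤K : + X * (+ X * e) ≤ K
    open Mangoldt l public
    field
      L-up   : ∀ j → 1 ℕ.≤ j → j ℕ.< X → L (suc j) ≤ L j + inv j + e
      L-down : ∀ j → 1 ℕ.≤ j → j ℕ.< X → L j + inv (suc j) ≤ L (suc j) + e

  module HarmonicLog (X : ℕ) (1≤X : 1 ℕ.≤ X) where
    -- With R = X³ and ε = K / R the accumulated error X ε satisfies X² (X ε) = K, as `Scale`
    -- demands. Every k ≤ B = R X divides B!, so all reciprocals that occur are exact.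
    R B : ℕ
    R = X ℕ.* (X ℕ.* X)
    B = R ℕ.* X

    1≤R : 1 ℕ.≤ R
    1≤R = 1≤* 1≤X (1≤* 1≤X 1≤X)

    invN : ℕ → ℕ
    invN k = quo (B !) k

    inv : ℕ → ℤ
    inv k = + invN k

    abstract
      K₀ : ℕ
      K₀ = B !

      k∣k! : ∀ k → 1 ℕ.≤ k → k ∣ k !
      k∣k! (suc k) _ = m∣m*n (k !)

      k*invN : ∀ k → 1 ℕ.≤ k → k ℕ.≤ B → k ℕ.* invN k ≡ K₀
      k*invN k 1≤k k≤B with ∣-trans (k∣k! k 1≤k) (m≤n⇒m!∣n! k≤B)
      ... | divides q eq = trans (cong (k ℕ.*_) (trans (cong (λ z → quo z k) eq) (quo-mult q k 1≤k))) (trans (ℕₚ.*-comm k q) (sym eq))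

      1≤K₀ : 1 ℕ.≤ K₀
      1≤K₀ = ℕₚ.1≤n! B

      invN-anti : ∀ {j k} → 1 ℕ.≤ j → j ℕ.≤ k → invN k ℕ.≤ invN j
      invN-anti = quo-antiʳ (B !)

    a*inv : ∀ a j → 1 ℕ.≤ a → 1 ℕ.≤ j → a ℕ.* j ℕ.≤ B → + a * inv (a ℕ.* j) ≡ inv j
    a*inv a j@(suc _) 1≤a 1≤j h = trans (sym (pos-* a _)) (cong +_ (ℕₚ.*-cancelˡ-≡ _ _ j
      (trans (trans (sym (ℕₚ.*-assoc j a _)) (trans (cong (ℕ._* invN (a ℕ.* j)) (ℕₚ.*-comm j a)) (k*invN (a ℕ.* j) (1≤* 1≤a 1≤j) h)))
        (sym (k*invN j 1≤j (ℕₚ.≤-trans (ℕₚ.m≤n*m j a {{ℕ.>-nonZero 1≤a}}) h))))))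

    H : ℕ → ℤ
    H n = S n inv

    -- There are a terms between a j and a (j + 1), each lying between K / (a (j + 1)) and K / (a
    -- j).
    block : ∀ a j → 1 ℕ.≤ a → 1 ℕ.≤ j → a ℕ.* suc j ℕ.≤ B →
            (inv (suc j) ≤ H (a ℕ.* suc j) - H (a ℕ.* j)) × (H (a ℕ.* suc j) - H (a ℕ.* j) ≤ inv j)
    block a j 1≤a 1≤j h =
        subst (_≤ H N - H n) (const (suc j) (s≤s₀) h) (S-incr-mono n N n≤N (λ k lo hi → +≤ (invN-anti (ℕₚ.≤-<-trans ℕ.z≤n lo) hi)))
      , subst (H N - H n ≤_) (const j 1≤j (ℕₚ.≤-trans n≤N h)) (S-incr-mono n N n≤N (λ k lo hi → +≤ (invN-anti (1≤* 1≤a 1≤j) (ℕₚ.<⇒≤ lo))))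
      where
      s≤s₀ : 1 ℕ.≤ suc j
      s≤s₀ = ℕ.s≤s ℕ.z≤n
      n N : ℕ
      n = a ℕ.* j
      N = a ℕ.* suc j
      n≤N : n ℕ.≤ N
      n≤N = ℕₚ.*-monoʳ-≤ a (ℕₚ.n≤1+n j)
      alg : ∀ x y c → (x + y) * c - y * c ≡ x * c
      alg = solve-∀
      const : ∀ i → 1 ℕ.≤ i → a ℕ.* i ℕ.≤ B → S N (λ _ → inv (a ℕ.* i)) - S n (λ _ → inv (a ℕ.* i)) ≡ inv i
      const i 1≤i hi = trans (cong₂ _-_ (trans (S-const N c) (cong (λ z → + z * c) (ℕₚ.*-suc a j))) (S-const n c)) (trans (alg (+ a) (+ n) c) (a*inv a i 1≤a 1≤i hi))
        where
        c : ℤ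
        c = inv (a ℕ.* i)

    Dil : ℕ → ℕ → ℕ → ℤ
    Dil a M N = (H (a ℕ.* N) - H (a ℕ.* M)) - (H N - H M)

    -- By `block` each step adds between `inv (suc j)` and `inv j` to the dilated sum and exactly
    -- `inv (suc j)` to the other one, so the discrepancy telescopes.
    dilation : ∀ a M n → 1 ℕ.≤ a → 1 ℕ.≤ M → a ℕ.* (n ℕ.+ M) ℕ.≤ B →
               (0ℤ ≤ Dil a M (n ℕ.+ M)) × (Dil a M (n ℕ.+ M) ≤ inv M - inv (n ℕ.+ M))
    dilation a M zero 1≤a 1≤M h = ≤-of (alg (H (a ℕ.* M)) (H M)) , ≤-of (alg′ (H (a ℕ.* M)) (H M) (inv M))
      where
      alg : ∀ x y → 0ℤ ≡ (x - x) - (y - y)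
      alg = solve-∀
      alg′ : ∀ x y z → (x - x) - (y - y) ≡ z - z
      alg′ = solve-∀
    dilation a M (suc n) 1≤a 1≤M h = core (H (a ℕ.* N)) (H (a ℕ.* M)) (H N) (H M) (inv N) (inv (suc N)) (inv M) (H (a ℕ.* suc N)) (proj₁ ih) (proj₂ ih) (proj₁ b) (proj₂ b)
      where
      N : ℕ
      N = n ℕ.+ M
      ih : (0ℤ ≤ Dil a M N) × (Dil a M N ≤ inv M - inv N)
      ih = dilation a M n 1≤a 1≤M (ℕₚ.≤-trans (ℕₚ.*-monoʳ-≤ a (ℕₚ.n≤1+n N)) h)
      b : (inv (suc N) ≤ H (a ℕ.* suc N) - H (a ℕ.* N)) × (H (a ℕ.* suc N) - H (a ℕ.* N) ≤ inv N)
      b = block a N 1≤a (ℕₚ.≤-trans 1≤M (ℕₚ.m≤n+m M n)) h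
      core : ∀ haN haM hN hM iN iN′ iM haN′ → 0ℤ ≤ (haN - haM) - (hN - hM) → (haN - haM) - (hN - hM) ≤ iM - iN →
             iN′ ≤ haN′ - haN → haN′ - haN ≤ iN →
             (0ℤ ≤ (haN′ - haM) - (hN + iN′ - hM)) × ((haN′ - haM) - (hN + iN′ - hM) ≤ iM - iN′)
      core a b c d f g i j p q r s = lin (p ⊕ r) (solve (a ∷ b ∷ c ∷ d ∷ g ∷ j ∷ [])) , lin (q ⊕ s) (solve (a ∷ b ∷ c ∷ d ∷ f ∷ g ∷ i ∷ j ∷ []))

    -- The sum of K / k over R < k ≤ R n, close to K log n. Starting at R makes it additive up to K
    -- / R.
    A : ℕ → ℤ
    A n = H (R ℕ.* n) - H R

    ε : ℤ
    ε = inv R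

    A-1 : A 1 ≡ 0ℤ
    A-1 = trans (cong (λ z → H z - H R) (ℕₚ.*-identityʳ R)) (+-inverseʳ (H R))

    A-* : ∀ a b → 1 ℕ.≤ a → 1 ℕ.≤ b → a ℕ.* b ℕ.≤ X → (A a + A b ≤ A (a ℕ.* b)) × (A (a ℕ.* b) ≤ A a + A b + ε)
    A-* a b 1≤a 1≤b h = core (H (R ℕ.* (a ℕ.* b))) (H (R ℕ.* a)) (H (R ℕ.* b)) (H R) ε (inv (R ℕ.* b)) (0≤+ _)
        (subst (λ z → 0ℤ ≤ z) eq (subst (λ z → 0ℤ ≤ Dil a R z) n+R (proj₁ d)))
        (subst (λ z → z ≤ ε - inv (R ℕ.* b)) eq (subst (λ z → Dil a R z ≤ ε - inv z) n+R (proj₂ d)))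
      where
      R≤Rb : R ℕ.≤ R ℕ.* b
      R≤Rb = ℕₚ.m≤m*n R b {{ℕ.>-nonZero 1≤b}}
      n : ℕ
      n = R ℕ.* b ℕ.∸ R
      n+R : n ℕ.+ R ≡ R ℕ.* b
      n+R = ℕₚ.m∸n+n≡m R≤Rb
      aRb : a ℕ.* (R ℕ.* b) ≡ R ℕ.* (a ℕ.* b)
      aRb = trans (sym (ℕₚ.*-assoc a R b)) (trans (cong (ℕ._* b) (ℕₚ.*-comm a R)) (ℕₚ.*-assoc R a b))
      d = dilation a R n 1≤a 1≤R (subst (ℕ._≤ B) (trans (sym aRb) (cong (a ℕ.*_) (sym n+R))) (ℕₚ.*-monoʳ-≤ R h))
      eq : Dil a R (R ℕ.* b) ≡ (H (R ℕ.* (a ℕ.* b)) - H (R ℕ.* a)) - (H (R ℕ.* b) - H R)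
      eq = cong₂ (λ z w → (H z - H w) - (H (R ℕ.* b) - H R)) aRb (ℕₚ.*-comm a R)
      core : ∀ x y z w ε i → 0ℤ ≤ i → 0ℤ ≤ (x - y) - (z - w) → (x - y) - (z - w) ≤ ε - i →
             ((y - w) + (z - w) ≤ x - w) × (x - w ≤ (y - w) + (z - w) + ε)
      core x y z w ε i hi p q = lin p (solve (x ∷ y ∷ z ∷ w ∷ [])) , lin (q ⊕ hi) (solve (x ∷ y ∷ z ∷ w ∷ ε ∷ i ∷ []))

    A-step : ∀ j → 1 ℕ.≤ j → j ℕ.< X → (inv (suc j) ≤ A (suc j) - A j) × (A (suc j) - A j ≤ inv j)
    A-step j 1≤j j<X = subst₂ _≤_ refl eq (proj₁ b) , subst (_≤ inv j) eq (proj₂ b)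
      where
      b = block R j 1≤R 1≤j (ℕₚ.*-monoʳ-≤ R j<X)
      alg : ∀ x y z → x - y ≡ (x - z) - (y - z)
      alg = solve-∀
      eq : H (R ℕ.* suc j) - H (R ℕ.* j) ≡ A (suc j) - A j
      eq = alg (H (R ℕ.* suc j)) (H (R ℕ.* j)) (H R)

    open Mangoldt A

    -- Splitting off a prime costs at most ε by `A-*`, and the bound n ε has room for it because (m
    -- + 1) ε ≤ p m ε.
    L≈A : ∀ n → 1 ℕ.≤ n → n ℕ.≤ X → (L n ≤ A n) × (A n ≤ L n + + n * ε)
    L≈A = factor-ind _ (λ _ → ≤-of (sym A-1) , ≤-trans (≤-of A-1) (+-nonneg {0ℤ} {1ℤ * ε} ≤-refl (*-nonneg {1ℤ} {ε} (0≤+ 1) (0≤+ _)))) go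
      where
      go : ∀ p m → Prime p → 1 ℕ.≤ m → Least p m → (m ℕ.≤ X → (L m ≤ A m) × (A m ≤ L m + + m * ε)) →
           p ℕ.* m ℕ.≤ X → (L (p ℕ.* m) ≤ A (p ℕ.* m)) × (A (p ℕ.* m) ≤ L (p ℕ.* m) + + (p ℕ.* m) * ε)
      go p m pp 1≤m least ih h = subst (λ z → (z ≤ A (p ℕ.* m)) × (A (p ℕ.* m) ≤ z + + (p ℕ.* m) * ε)) (sym (L-*least p m pp 1≤m least))
        (core (A p) (A m) (L m) (A (p ℕ.* m)) ε (+ m * ε) (+ (p ℕ.* m) * ε) (proj₁ (A-* p m (prime≥1 pp) 1≤m h)) (proj₂ (A-* p m (prime≥1 pp) 1≤m h)) (proj₁ i) (proj₂ i) big)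
        where
        i = ih (ℕₚ.≤-trans (ℕₚ.m≤n*m m p {{ℕ.>-nonZero (prime≥1 pp)}}) h)
        big : ε + + m * ε ≤ + (p ℕ.* m) * ε
        big = subst (_≤ + (p ℕ.* m) * ε) (suc-* (+ m) ε) (*-monoʳ-≤-nonNeg ε (+≤ (ℕₚ.<-≤-trans (ℕₚ.m<m*n m 2 {{ℕ.>-nonZero 1≤m}} ℕₚ.≤-refl) (subst (ℕ._≤ p ℕ.* m) (ℕₚ.*-comm 2 m) (ℕₚ.*-monoˡ-≤ m (prime≥2 pp))))))
        core : ∀ ap am lm apm ε me pme → ap + am ≤ apm → apm ≤ ap + am + ε → lm ≤ am → am ≤ lm + me → ε + me ≤ pme →
               (ap + lm ≤ apm) × (apm ≤ ap + lm + pme)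
        core a b c d f g h p q r s t = lin (p ⊕ r) (solve (a ∷ b ∷ c ∷ d ∷ [])) , lin (q ⊕ s ⊕ t) (solve (a ∷ b ∷ c ∷ d ∷ f ∷ g ∷ h ∷ []))

    scale : Scale X
    scale = record
      { K = + K₀ ; 1≤K = +≤ 1≤K₀ ; inv = inv ; inv≥0 = λ _ → 0≤+ _
      ; k*inv = λ k 1≤k k≤X → trans (sym (pos-* k (invN k))) (cong +_ (k*invN k 1≤k (ℕₚ.≤-trans k≤X (ℕₚ.m≤n*m X R {{ℕ.>-nonZero 1≤R}}))))
      ; l = A ; l≥0 = λ p pp → i≤j⇒0≤j-i (S-mono-n R (R ℕ.* p) (ℕₚ.m≤m*n R p {{ℕ.>-nonZero (prime≥1 pp)}}) (λ _ _ _ → 0≤+ _))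
      ; e = + X * ε ; e≥0 = *-nonneg {+ X} {ε} (0≤+ X) (0≤+ _)
      ; X²e≤K = ≤-of (trans (alg (+ X) ε) (trans (cong (_* ε) (trans (cong (λ z → + X * z) (sym (pos-* X X))) (sym (pos-* X (X ℕ.* X))))) (trans (sym (pos-* R (invN R))) (cong +_ (k*invN R 1≤R (ℕₚ.m≤m*n R X {{ℕ.>-nonZero 1≤X}}))))))
      ; L-up = λ j 1≤j j<X → up (A (suc j)) (A j) (L (suc j)) (L j) (inv j) (+ X * ε) (+ j * ε)
          (proj₁ (L≈A (suc j) (ℕ.s≤s ℕ.z≤n) j<X)) (proj₂ (A-step j 1≤j j<X)) (proj₂ (L≈A j 1≤j (ℕₚ.<⇒≤ j<X))) (*-monoʳ-≤-nonNeg ε (+≤ (ℕₚ.<⇒≤ j<X)))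
      ; L-down = λ j 1≤j j<X → down (A (suc j)) (A j) (L (suc j)) (L j) (inv (suc j)) (+ X * ε) (+ suc j * ε)
          (proj₁ (L≈A j 1≤j (ℕₚ.<⇒≤ j<X))) (proj₁ (A-step j 1≤j j<X)) (proj₂ (L≈A (suc j) (ℕ.s≤s ℕ.z≤n) j<X)) (*-monoʳ-≤-nonNeg ε (+≤ j<X))
      }
      where
      alg : ∀ x ε → x * (x * (x * ε)) ≡ (x * (x * x)) * ε
      alg = solve-∀
      up : ∀ a′ a l′ l i e f → l′ ≤ a′ → a′ - a ≤ i → a ≤ l + f → f ≤ e → l′ ≤ l + i + e
      up a b c d f g h p q r s = lin (p ⊕ q ⊕ r ⊕ s) (solve (a ∷ b ∷ c ∷ d ∷ f ∷ g ∷ h ∷ []))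
      down : ∀ a′ a l′ l i e f → l ≤ a → i ≤ a′ - a → a′ ≤ l′ + f → f ≤ e → l + i ≤ l′ + e
      down a b c d f g h p q r s = lin (p ⊕ q ⊕ r ⊕ s) (solve (a ∷ b ∷ c ∷ d ∷ f ∷ g ∷ h ∷ []))

-- Binary length and its mean square over the quotients x / n

module Halving where

  open LinearArithmetic
  open Sums
  open import Data.Nat as ℕ using (ℕ; zero; suc)
  import Data.Nat.Properties as ℕₚ
  import Data.Integer as ℤ
  open import Data.Integer using (ℤ; +_; -_; _+_; _-_; _*_; _≤_; 0ℤ; 1ℤ)
  open import Data.Integer.Properties
  open import Data.Integer.Tactic.RingSolver using (solve; solve-∀)
  import Data.Nat.Tactic.RingSolver as ℕSolver
  open import Data.List using ([]; _∷_)

  half : ℕ → ℕ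
  half n = quo n 2

  2*half≤ : ∀ n → 2 ℕ.* half n ℕ.≤ n
  2*half≤ n = subst (ℕ._≤ n) (ℕₚ.*-comm (half n) 2) (quo-mul≤ n 2)

  <2*half+2 : ∀ n → n ℕ.< 2 ℕ.* suc (half n)
  <2*half+2 n = subst (n ℕ.<_) (ℕₚ.*-comm (suc (half n)) 2) (<quo n 2 (ℕ.s≤s ℕ.z≤n))

  half-cases : ∀ n → (n ≡ 2 ℕ.* half n) ⊎ (n ≡ suc (2 ℕ.* half n))
  half-cases n with ℕₚ.m≤n⇒m<n∨m≡n (2*half≤ n)
  ... | inj₂ e = inj₁ (sym e)
  ... | inj₁ lt = inj₂ (ℕₚ.≤-antisym (ℕₚ.≤-pred (subst (n ℕ.<_) (ℕₚ.*-suc 2 (half n)) (<2*half+2 n))) lt)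

  half< : ∀ n → 1 ℕ.≤ n → half n ℕ.< n
  half< n 1≤n = ℕₚ.*-cancelˡ-< 2 (half n) n (ℕₚ.≤-<-trans (2*half≤ n) (subst (n ℕ.<_) (ℕₚ.*-comm n 2) (ℕₚ.m<m*n n 2 {{ℕ.>-nonZero 1≤n}} ℕₚ.≤-refl)))

  half-ind : (P : ℕ → Set) → P 0 → (∀ n → 1 ℕ.≤ n → P (half n) → P n) → ∀ n → P n
  half-ind P base step n = go n n ℕₚ.≤-refl
    where
    go : ∀ f n → n ℕ.≤ f → P n
    go zero .0 ℕ.z≤n = base
    go (suc f) zero h = base
    go (suc f) n@(suc _) h = step n (ℕ.s≤s ℕ.z≤n) (go f (half n) (ℕₚ.≤-pred (ℕₚ.<-≤-trans (half< n (ℕ.s≤s ℕ.z≤n)) h)))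

  blF : ℕ → ℕ → ℕ
  blF zero n = 0
  blF (suc f) zero = 0
  blF (suc f) n@(suc _) = suc (blF f (half n))

  -- The number of binary digits, used in place of a logarithm in all error terms.
  bl : ℕ → ℕ
  bl n = blF n n

  blF-fuel : ∀ n f → n ℕ.≤ f → blF f n ≡ bl n
  blF-fuel = half-ind _ base step
    where
    base : ∀ f → 0 ℕ.≤ f → blF f 0 ≡ bl 0
    base zero _ = refl
    base (suc f) _ = refl
    step : ∀ n → 1 ℕ.≤ n → (∀ f → half n ℕ.≤ f → blF f (half n) ≡ bl (half n)) → ∀ f → n ℕ.≤ f → blF f n ≡ bl n
    step n@(suc n₀) 1≤n ih (suc f) h = cong suc (trans (ih f (ℕₚ.≤-pred (ℕₚ.<-≤-trans (half< n 1≤n) h))) (sym (ih n₀ (ℕₚ.≤-pred (half< n 1≤n)))))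

  bl-half : ∀ n → 1 ℕ.≤ n → bl n ≡ suc (bl (half n))
  bl-half n@(suc n₀) 1≤n = cong suc (blF-fuel (half n) n₀ (ℕₚ.≤-pred (half< n 1≤n)))

  1≤bl : ∀ n → 1 ℕ.≤ n → 1 ℕ.≤ bl n
  1≤bl n h = subst (1 ℕ.≤_) (sym (bl-half n h)) (ℕ.s≤s ℕ.z≤n)

  <2^bl : ∀ n → n ℕ.< 2 ℕ.^ bl n
  <2^bl = half-ind _ (ℕ.s≤s ℕ.z≤n) (λ n 1≤n ih → subst (λ z → n ℕ.< 2 ℕ.^ z) (sym (bl-half n 1≤n)) (ℕₚ.<-≤-trans (<2*half+2 n) (ℕₚ.*-monoʳ-≤ 2 ih)))

  2^bl≤ : ∀ n → 1 ℕ.≤ n → 2 ℕ.^ bl n ℕ.≤ 2 ℕ.* n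
  2^bl≤ = half-ind _ (λ ()) step
    where
    step : ∀ n → 1 ℕ.≤ n → (1 ℕ.≤ half n → 2 ℕ.^ bl (half n) ℕ.≤ 2 ℕ.* half n) → 1 ℕ.≤ n → 2 ℕ.^ bl n ℕ.≤ 2 ℕ.* n
    step n 1≤n ih _ = subst (λ z → 2 ℕ.^ z ℕ.≤ 2 ℕ.* n) (sym (bl-half n 1≤n)) (ℕₚ.*-monoʳ-≤ 2 inner)
      where
      inner : 2 ℕ.^ bl (half n) ℕ.≤ n
      inner with 1 ℕ.≤? half n
      ... | yes h = ℕₚ.≤-trans (ih h) (2*half≤ n)
      ... | no h = subst (λ z → 2 ℕ.^ bl z ℕ.≤ n) (sym (ℕₚ.n<1⇒n≡0 (ℕₚ.≰⇒> h))) 1≤n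

  bl-mono : ∀ {m n} → m ℕ.≤ n → bl m ℕ.≤ bl n
  bl-mono {m} {n} h with bl m ℕ.≤? bl n
  ... | yes p = p
  ... | no p with 1 ℕ.≤? m
  ...   | no q = ⊥-elim (p (subst (λ z → bl z ℕ.≤ bl n) (sym (ℕₚ.n<1⇒n≡0 (ℕₚ.≰⇒> q))) ℕ.z≤n))
  ...   | yes q = ⊥-elim (ℕₚ.<-irrefl refl (ℕₚ.<-≤-trans (ℕₚ.*-monoʳ-< 2 (ℕₚ.≤-<-trans h (<2^bl n))) (ℕₚ.≤-trans (ℕₚ.^-monoʳ-≤ 2 (ℕₚ.≰⇒> p)) (2^bl≤ m q))))

  0≤sq : ∀ i → 0ℤ ≤ i * i
  0≤sq (+ n) = subst (0ℤ ≤_) (pos-* n n) (0≤+ _)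
  0≤sq ℤ.-[1+ n ] = 0≤+ _

  half-quo : ∀ x n → 1 ℕ.≤ n → half (quo x n) ≡ quo (half x) n
  half-quo x n 1≤n = trans (quo-quo x n 2 1≤n (ℕ.s≤s ℕ.z≤n)) (trans (cong (quo x) (ℕₚ.*-comm n 2)) (sym (quo-quo x 2 n (ℕ.s≤s ℕ.z≤n) 1≤n)))

  sq : ℕ → ℤ
  sq n = + n * + n

  -- From (b - 2)² ≥ 0 comes 2 (1 + b)² ≤ 6 + 3 b². With b the length of the halved quotient, the
  -- sum Q satisfies 2 Q(x) ≤ 6 x + 3 Q(x/2), and the constant 12 reproduces itself since 6 + 3 · 6
  -- = 2 · 12.
  Σbl² : ∀ x → S x (λ n → sq (bl (quo x n))) ≤ + 12 * + x
  Σbl² = half-ind _ ≤-refl step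
    where
    step : ∀ x → 1 ℕ.≤ x → S (half x) (λ n → sq (bl (quo (half x) n))) ≤ + 12 * + half x → S x (λ n → sq (bl (quo x n))) ≤ + 12 * + x
    step x 1≤x ih = core (S x (λ n → sq (bl (quo x n)))) (S (half x) g) (+ x) (+ half x) double ih (subst (_≤ + x) (pos-* 2 (half x)) (+≤ (2*half≤ x)))
      where
      g : ℕ → ℤ
      g n = sq (bl (quo (half x) n))
      pointwise : ∀ b → + 2 * ((1ℤ + b) * (1ℤ + b)) ≤ + 6 * 1ℤ + + 3 * (b * b)
      pointwise b = lin (0≤sq (b - + 2)) (solve (b ∷ []))
      term : ∀ n → 1 ℕ.≤ n → n ℕ.≤ x → + 2 * sq (bl (quo x n)) ≤ + 6 * 1ℤ + + 3 * g n
      term n 1≤n n≤x = subst (λ z → + 2 * sq z ≤ + 6 * 1ℤ + + 3 * g n) (sym (trans (bl-half (quo x n) (1≤quo x n 1≤n n≤x)) (cong (λ z → suc (bl z)) (half-quo x n 1≤n)))) (pointwise (+ bl (quo (half x) n)))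
      double : + 2 * S x (λ n → sq (bl (quo x n))) ≤ + 6 * + x + + 3 * S (half x) g
      double = subst₂ _≤_ (S-* x (+ 2) _) (trans (S-+ x (λ _ → + 6 * 1ℤ) (λ n → + 3 * g n)) (cong₂ _+_ (trans (S-const x (+ 6 * 1ℤ)) (alg (+ x))) (trans (S-* x (+ 3) g) (cong (+ 3 *_) (S-trunc (half x) x (ℕₚ.<⇒≤ (half< x 1≤x)) (λ k lo _ → cong (λ z → sq (bl z)) (quo-small (half x) k lo)))))))
        (S-mono x term)
        where
        alg : ∀ x → x * (+ 6 * 1ℤ) ≡ + 6 * x
        alg = solve-∀
      core : ∀ q r x h → + 2 * q ≤ + 6 * x + + 3 * r → r ≤ + 12 * h → + 2 * h ≤ x → q ≤ + 12 * x
      core q r x h p s t = cancel-*≤ {+ 2} {q} {+ 12 * x} (+≤ (ℕ.s≤s ℕ.z≤n)) (lin (p ⊕ 3 ⊗ s ⊕ 18 ⊗ t) (solve (q ∷ r ∷ x ∷ h ∷ [])))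

  bl²≤ : ∀ x → sq (bl x) ≤ + 12 * + x
  bl²≤ zero = ≤-refl
  bl²≤ x@(suc _) = ≤-trans (subst (λ z → sq (bl x) ≤ sq (bl z)) (sym (quo-1 x)) ≤-refl)
    (≤-trans (subst (_≤ S x f) (+-identityˡ (f 1)) (S-mono-n 1 x {f} (ℕ.s≤s ℕ.z≤n) (λ k _ _ → 0≤sq (+ bl (quo x k))))) (Σbl² x))
    where
    f : ℕ → ℤ
    f n = sq (bl (quo x n))

  bl≤bl² : ∀ n → + bl n ≤ sq (bl n)
  bl≤bl² n = subst (+ bl n ≤_) (pos-* (bl n) (bl n)) (+≤ (go (bl n)))
    where
    go : ∀ b → b ℕ.≤ b ℕ.* b
    go zero = ℕ.z≤n
    go (suc b) = ℕₚ.m≤m*n (suc b) (suc b)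

  -- 2 (a b - x y) = (a - x)(b + y) + (a + x)(b - y), and similarly for the other sign.
  bound-* : ∀ {a b x y} → - a ≤ x → x ≤ a → - b ≤ y → y ≤ b → (- (a * b) ≤ x * y) × (x * y ≤ a * b)
  bound-* {a} {b} {x} {y} la ua lb ub =
      cancel-*≤ {+ 2} { - (a * b)} {x * y} 1≤2 (lin (*-nonneg {a - x} {b - y} (i≤j⇒0≤j-i ua) (i≤j⇒0≤j-i ub) ⊕ *-nonneg {x - - a} {y - - b} (i≤j⇒0≤j-i la) (i≤j⇒0≤j-i lb)) (solve (a ∷ b ∷ x ∷ y ∷ [])))
    , cancel-*≤ {+ 2} {x * y} {a * b} 1≤2 (lin (*-nonneg {a - x} {y - - b} (i≤j⇒0≤j-i ua) (i≤j⇒0≤j-i lb) ⊕ *-nonneg {x - - a} {b - y} (i≤j⇒0≤j-i la) (i≤j⇒0≤j-i ub)) (solve (a ∷ b ∷ x ∷ y ∷ [])))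
    where
    1≤2 : 1ℤ ≤ + 2
    1≤2 = +≤ (ℕ.s≤s ℕ.z≤n)

  12sq≤2^ : ∀ j → 12 ℕ.* ((12 ℕ.+ j) ℕ.* (12 ℕ.+ j)) ℕ.+ 20 ℕ.≤ 2 ℕ.^ (11 ℕ.+ j)
  12sq≤2^ zero = ℕₚ.m≤m+n 1748 300
  12sq≤2^ (suc j) = ℕₚ.≤-trans (subst (12 ℕ.* ((13 ℕ.+ j) ℕ.* (13 ℕ.+ j)) ℕ.+ 20 ℕ.≤_) (alg j) (ℕₚ.m≤m+n _ (1448 ℕ.+ 264 ℕ.* j ℕ.+ 12 ℕ.* (j ℕ.* j)))) (ℕₚ.*-monoʳ-≤ 2 (12sq≤2^ j))
    where
    alg : ∀ j → 12 ℕ.* ((13 ℕ.+ j) ℕ.* (13 ℕ.+ j)) ℕ.+ 20 ℕ.+ (1448 ℕ.+ 264 ℕ.* j ℕ.+ 12 ℕ.* (j ℕ.* j)) ≡ 2 ℕ.* (12 ℕ.* ((12 ℕ.+ j) ℕ.* (12 ℕ.+ j)) ℕ.+ 20)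
    alg = ℕSolver.solve-∀

  12bl²≤ : ∀ n → 2 ℕ.^ 12 ℕ.≤ n → + 12 * sq (bl n) + + 20 ≤ + n
  12bl²≤ n h = subst (_≤ + n) (trans (pos-+ (12 ℕ.* (b ℕ.* b)) 20) (cong (_+ + 20) (trans (pos-* 12 (b ℕ.* b)) (cong (+ 12 *_) (pos-* b b))))) (+≤ (ℕₚ.≤-trans (subst (λ t → 12 ℕ.* (t ℕ.* t) ℕ.+ 20 ℕ.≤ 2 ℕ.^ ℕ.pred t) b≡ (12sq≤2^ (b ℕ.∸ 12))) n≥))
    where
    b : ℕ
    b = bl n
    b≡ : 12 ℕ.+ (b ℕ.∸ 12) ≡ b
    b≡ = ℕₚ.m+[n∸m]≡n {12} {b} (ℕₚ.≮⇒≥ (λ b<12 → ℕₚ.<⇒≱ (<2^bl n) (ℕₚ.≤-trans (ℕₚ.^-monoʳ-≤ 2 (ℕₚ.<⇒≤ b<12)) h)))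
    n≥ : 2 ℕ.^ ℕ.pred b ℕ.≤ n
    n≥ = ℕₚ.*-cancelˡ-≤ 2 (subst (ℕ._≤ 2 ℕ.* n) (cong (2 ℕ.^_) (trans (sym b≡) (cong (λ t → suc (ℕ.pred t)) b≡))) (2^bl≤ n (ℕₚ.≤-trans (ℕₚ.m^n>0 2 12) h)))

  bl≤ : ∀ n → bl n ℕ.≤ n
  bl≤ = half-ind _ ℕ.z≤n (λ n 1≤n ih → subst (ℕ._≤ n) (sym (bl-half n 1≤n)) (ℕₚ.≤-<-trans ih (half< n 1≤n)))

-- Inequalities behind the chain of dense intervals

module IntegerInequalities where

  open LinearArithmetic
  open import Data.Nat as ℕ using (ℕ)
  open import Data.Integer using (ℤ; +_; -_; _+_; _-_; _*_; _≤_; 0ℤ; 1ℤ)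
  open import Data.Integer.Properties
  open import Data.Integer.Tactic.RingSolver using (solve; solve-∀)
  open import Data.List using ([]; _∷_)

  cancel-ℤ : ∀ (c a b : ℤ) → 1ℤ ≤ c → c * a ≤ c * b → a ≤ b
  cancel-ℤ c a b = cancel-*≤ {c} {a} {b}

  mul : ∀ (c a b : ℤ) → 0ℤ ≤ c → a ≤ b → c * a ≤ c * b
  mul c a b = _⊛_ {c} {a} {b}

  from1 : ∀ {m : ℤ} → 1ℤ ≤ m → 0ℤ ≤ m
  from1 = ≤-trans (0≤+ 1)

  m²≥m : ∀ (m : ℤ) → 1ℤ ≤ m → 0ℤ ≤ m * (m - 1ℤ)
  m²≥m m h = *-nonneg {m} {m - 1ℤ} (from1 h) (i≤j⇒0≤j-i h)

  -- Arithmetic of one step of the chain, with floors replaced by their defining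
  -- inequalities: y = x/n, v = z/n, q = y/s, s = 16m.
  stretch : ∀ m y v n x z → 1ℤ ≤ m → 1ℤ ≤ n → y * n ≤ x → 1ℤ + z ≤ (1ℤ + v) * n → 1ℤ + (1ℤ + m) * x ≤ m * z + m → (1ℤ + m) * y ≤ m * (1ℤ + v)
  stretch m y v n x z 1≤m 1≤n p q r = cancel-ℤ n ((1ℤ + m) * y) (m * (1ℤ + v)) 1≤n
    (lin (mul (1ℤ + m) (y * n) x (+-nonneg {1ℤ} {m} (0≤+ 1) (from1 1≤m)) p ⊕ mul m (1ℤ + z) ((1ℤ + v) * n) (from1 1≤m) q ⊕ r ⊕ 0≤+ 1) (solve (m ∷ y ∷ v ∷ n ∷ x ∷ z ∷ [])))

  -- v is at least about (1 + 1/m) y, so a piece of length q ≤ y / (16 m) fits, with room for the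
  -- rounding.
  inside : ∀ m y v q → 1ℤ ≤ m → (1ℤ + m) * y ≤ m * (1ℤ + v) → q * (+ 16 * m) ≤ y → 1ℤ + + 2 * (+ 16 * m) ≤ y → y + q ≤ v
  inside m y v q 1≤m p r t = cancel-ℤ m (y + q) v 1≤m (cancel-ℤ (+ 16) (m * (y + q)) (m * v) (+≤ (ℕ.s≤s ℕ.z≤n)) (lin (16 ⊗ p ⊕ r ⊕ 15 ⊗ t ⊕ 464 ⊗ from1 1≤m ⊕ 0≤+ 15) (solve (m ∷ y ∷ v ∷ q ∷ []))))

  -- (y, v] has density 2 up to an error and its upper part (u, v] density at most 2, so the lower
  -- part (y, u] with u = y + q must carry mass. After scaling by 256 m its share is about 32 K y,
  -- the two errors K v together cost about 4 K y, and more than 2 K u is left, which is what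
  -- `find-good` asks for.
  dense₁ : ∀ m K y v q pv pu py → 1ℤ ≤ m → 1ℤ ≤ K → + 256 * m * (+ 2 * (K * (v - y)) - (pv - py)) ≤ K * v →
           + 256 * m * (pv - pu) ≤ + 2 * (+ 256 * m * (K * (v - (y + q)))) + K * v → 1ℤ + y ≤ (1ℤ + q) * (+ 16 * m) → v ≤ 1ℤ + + 2 * y → q ≤ y → 1ℤ + + 2 * (+ 16 * m) ≤ y →
           + 2 * (K * (y + q)) + 1ℤ ≤ + 256 * m * (pu - py)
  dense₁ m K y v q pv pu py 1≤m 1≤K a b c d e f = lin (a ⊕ b ⊕ 32 ⊗ K· (1ℤ + y) ((1ℤ + q) * (+ 16 * m)) c ⊕ 2 ⊗ K· v (1ℤ + + 2 * y) d ⊕ 2 ⊗ K· q y e ⊕ 24 ⊗ K· (1ℤ + + 2 * (+ 16 * m)) y f ⊕ 256 ⊗ *-nonneg {K} {m} (from1 1≤K) (from1 1≤m) ⊕ 53 ⊗ from1 1≤K ⊕ 1≤K)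
      (solve (m ∷ K ∷ y ∷ v ∷ q ∷ pv ∷ pu ∷ py ∷ []))
    where
    K· : ∀ a b → a ≤ b → K * a ≤ K * b
    K· a b = mul K a b (from1 1≤K)

  -- k is at most (1 + 1/(16 m)) x / n, so z / k is at least n (1 + 1/m) / (1 + 1/(16 m)) up to
  -- rounding.
  reflect : ∀ m n y x k q z v → 1ℤ ≤ m → 1ℤ ≤ n → 1ℤ ≤ k → y * n ≤ x → k ≤ y + q → q * (+ 16 * m) ≤ y → 1ℤ + (1ℤ + m) * x ≤ m * z + m → 1ℤ + z ≤ (1ℤ + v) * k →
            + 16 * (1ℤ + m) * n ≤ (+ 16 * m + 1ℤ) * (1ℤ + v)
  reflect m n y x k q z v 1≤m 1≤n 1≤k a b c d e = cancel-ℤ k (+ 16 * (1ℤ + m) * n) ((+ 16 * m + 1ℤ) * (1ℤ + v)) 1≤k (cancel-ℤ m (k * (+ 16 * (1ℤ + m) * n)) (k * ((+ 16 * m + 1ℤ) * (1ℤ + v))) 1≤m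
    (lin (mul ((1ℤ + m) * n) (+ 16 * m * k) ((+ 16 * m + 1ℤ) * y) 0≤mn (lin (mul (+ 16 * m) k (y + q) 0≤16m b ⊕ c) (solve (m ∷ k ∷ y ∷ q ∷ []))) ⊕ mul (+ 16 * m + 1ℤ) ((1ℤ + m) * (y * n)) (m * ((1ℤ + v) * k)) 0≤s+1 (lin (mul (1ℤ + m) (y * n) x 0≤1+m a ⊕ d ⊕ mul m (1ℤ + z) ((1ℤ + v) * k) (from1 1≤m) e ⊕ 0≤+ 1) (core m y n x z v k)))
      (solve (m ∷ n ∷ y ∷ k ∷ v ∷ []))))
    where
    0≤1+m : 0ℤ ≤ 1ℤ + m
    0≤1+m = +-nonneg {1ℤ} {m} (0≤+ 1) (from1 1≤m)
    0≤mn : 0ℤ ≤ (1ℤ + m) * n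
    0≤mn = *-nonneg {1ℤ + m} {n} 0≤1+m (from1 1≤n)
    0≤16m : 0ℤ ≤ + 16 * m
    0≤16m = *-nonneg {+ 16} {m} (0≤+ 16) (from1 1≤m)
    0≤s+1 : 0ℤ ≤ + 16 * m + 1ℤ
    0≤s+1 = +-nonneg {+ 16 * m} {1ℤ} 0≤16m (0≤+ 1)
    core : ∀ m y n x z v k → m * ((1ℤ + v) * k) - (1ℤ + m) * (y * n) ≡ (1ℤ + m) * x + (m * z + m) + m * ((1ℤ + v) * k) + 1ℤ - ((1ℤ + m) * (y * n) + (1ℤ + (1ℤ + m) * x) + m * (1ℤ + z) + 0ℤ)
    core = solve-∀

  -- The factor supplied by `reflect` still exceeds 1 + 1/(2 m) after the top piece of relative
  -- length 1/(16 m) is cut off.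
  growth : ∀ m n v q → 1ℤ ≤ m → + 16 * (1ℤ + m) * n ≤ (+ 16 * m + 1ℤ) * (1ℤ + v) → q * (+ 16 * m) ≤ v → 1ℤ + + 2 * (+ 16 * m) ≤ n → (+ 2 * m + 1ℤ) * n ≤ + 2 * m * (v - q)
  growth m n v q 1≤m a b c = cancel-ℤ (+ 16 * m + 1ℤ) ((+ 2 * m + 1ℤ) * n) (+ 2 * m * (v - q)) (lin (16 ⊗ from1 1≤m) (solve (m ∷ []))) (cancel-ℤ (+ 8) ((+ 16 * m + 1ℤ) * ((+ 2 * m + 1ℤ) * n)) ((+ 16 * m + 1ℤ) * (+ 2 * m * (v - q))) (+≤ (ℕ.s≤s ℕ.z≤n))
    (lin (mul (+ 16 * m + 1ℤ) (q * (+ 16 * m)) v (lin (from1 1≤m ⊕ 15 ⊗ from1 1≤m ⊕ 0≤+ 1) (solve (m ∷ []))) b ⊕ mul (+ 16 * m - 1ℤ) (+ 16 * (1ℤ + m) * n) ((+ 16 * m + 1ℤ) * (1ℤ + v)) (lin (16 ⊗ 1≤m ⊕ 0≤+ 15) (solve (m ∷ []))) a ⊕ *-nonneg {+ 96 * m - + 24} {n - (1ℤ + + 2 * (+ 16 * m))} (lin (96 ⊗ 1≤m ⊕ 0≤+ 72) (solve (m ∷ []))) (i≤j⇒0≤j-i c) ⊕ 2816 ⊗ m²≥m m 1≤m ⊕ 2144 ⊗ 1≤m ⊕ 0≤+ 2121)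
      (solve (m ∷ n ∷ v ∷ q ∷ []))))

  -- The subtraction of `dense₁` at the other end: the lower part has density at most 2, so the top
  -- piece (v - q, v] carries mass.
  dense₂ : ∀ m K y v q pv pu py → 1ℤ ≤ m → 1ℤ ≤ K → 0ℤ ≤ q → + 256 * m * (+ 2 * (K * (v - y)) - (pv - py)) ≤ K * v →
           + 256 * m * (pu - py) ≤ + 2 * (+ 256 * m * (K * (v - q - y))) + K * (v - q) → 1ℤ + v ≤ (1ℤ + q) * (+ 16 * m) → 1ℤ + + 2 * (+ 16 * m) ≤ v →
           + 2 * (K * v) + 1ℤ ≤ + 256 * m * (pv - pu)
  dense₂ m K y v q pv pu py 1≤m 1≤K 0≤q a b c d = lin (a ⊕ b ⊕ 32 ⊗ K· (1ℤ + v) ((1ℤ + q) * (+ 16 * m)) c ⊕ 28 ⊗ K· (1ℤ + + 2 * (+ 16 * m)) v d ⊕ 384 ⊗ *-nonneg {K} {m} (from1 1≤K) (from1 1≤m) ⊕ *-nonneg {K} {q} (from1 1≤K) 0≤q ⊕ 59 ⊗ from1 1≤K ⊕ 1≤K)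
      (solve (m ∷ K ∷ y ∷ v ∷ q ∷ pv ∷ pu ∷ py ∷ []))
    where
    K· : ∀ a b → a ≤ b → K * a ≤ K * b
    K· a b = mul K a b (from1 1≤K)

  -- (n, n′] keeps what the dense interval (y, v] has after (y, n] and (n′, v], of density at most
  -- 2, are removed. The errors K v + K v + K n are at most 5 K n′ because v ≤ 2 n.
  advance : ∀ g K n n′ v y pv py pn pn′ → 0ℤ ≤ K → g * (+ 2 * (K * (v - y)) - (pv - py)) ≤ K * v → g * (pv - pn′) ≤ + 2 * (g * (K * (v - n′))) + K * v → g * (pn - py) ≤ + 2 * (g * (K * (n - y))) + K * n →
            v ≤ + 2 * n → n ≤ n′ → + 2 * (g * (K * (n′ - n))) ≤ g * (pn′ - pn) + + 5 * (K * n′)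
  advance g K n n′ v y pv py pn pn′ 0≤K a b c d e = lin (a ⊕ b ⊕ c ⊕ 2 ⊗ mul K v (+ 2 * n) 0≤K d ⊕ 5 ⊗ mul K n n′ 0≤K e) (solve (g ∷ K ∷ n ∷ n′ ∷ v ∷ y ∷ pv ∷ py ∷ pn ∷ pn′ ∷ []))

  -- The error 5 K n′ is charged to the length of the step: growth gives n′ ≤ (2 m + 1)(n′ - n), so
  -- the errors telescope along with the masses.
  chain-step : ∀ g K m n₀ n n′ p₀ p p′ → 0ℤ ≤ K → + 2 * (g * (K * (n - n₀))) ≤ g * (p - p₀) + + 5 * (K * ((+ 2 * m + 1ℤ) * (n - n₀))) → + 2 * (g * (K * (n′ - n))) ≤ g * (p′ - p) + + 5 * (K * n′) → (+ 2 * m + 1ℤ) * n ≤ + 2 * m * n′ →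
               + 2 * (g * (K * (n′ - n₀))) ≤ g * (p′ - p₀) + + 5 * (K * ((+ 2 * m + 1ℤ) * (n′ - n₀)))
  chain-step g K m n₀ n n′ p₀ p p′ 0≤K a b c = lin (a ⊕ b ⊕ 5 ⊗ mul K ((+ 2 * m + 1ℤ) * n) (+ 2 * m * n′) 0≤K c) (solve (g ∷ K ∷ m ∷ n₀ ∷ n ∷ n′ ∷ p₀ ∷ p ∷ p′ ∷ []))

  -- Density 2 over a range of ratio 100 contradicts Chebyshev's bound 5/3.
  contradiction-end : ∀ m K n₀ n p₀ p b → 1ℤ ≤ m → 1ℤ ≤ K → 0ℤ ≤ p₀ → 0ℤ ≤ n₀ → + 2 * (+ 256 * m * (K * (n - n₀))) ≤ + 256 * m * (p - p₀) + + 5 * (K * ((+ 2 * m + 1ℤ) * (n - n₀))) →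
                      + 100 * n₀ ≤ n → + 3 * p ≤ + 5 * (K * n) + + 15 * K + + 9 * (K * b) → + 12 * b + + 20 ≤ n → n₀ ≤ 0ℤ
  contradiction-end m K n₀ n p₀ p b 1≤m 1≤K 0≤p₀ 0≤n₀ a c d e = final
    where
    0≤K : 0ℤ ≤ K
    0≤K = from1 1≤K
    0≤t : 0ℤ ≤ n - n₀
    0≤t = lin (c ⊕ 99 ⊗ 0≤n₀) (solve (n ∷ n₀ ∷ []))
    -- Density 2 amounts to 512 m, of which the errors take 5 (2 m + 1) ≤ 15 m.
    step₁ : + 497 * (K * (n - n₀)) ≤ + 256 * p
    step₁ = cancel-ℤ m (+ 497 * (K * (n - n₀))) (+ 256 * p) 1≤m (lin (a ⊕ 5 ⊗ mul (K * (n - n₀)) 1ℤ m (*-nonneg {K} {n - n₀} 0≤K 0≤t) 1≤m ⊕ 256 ⊗ *-nonneg {m} {p₀} (from1 1≤m) 0≤p₀) (solve (m ∷ K ∷ n₀ ∷ n ∷ p₀ ∷ p ∷ [])))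
    -- 5/3 and a quarter for the terms of lower order make 23/12, which is below the 497/256 of
    -- `step₁`.
    step₂ : + 12 * p ≤ + 23 * (K * n)
    step₂ = lin (4 ⊗ d ⊕ 3 ⊗ mul K (+ 12 * b + + 20) n 0≤K e) (solve (K ∷ n ∷ p ∷ b ∷ []))
    final : n₀ ≤ 0ℤ
    final = cancel-ℤ K n₀ 0ℤ 1≤K (cancel-ℤ (+ 409) (K * n₀) (K * 0ℤ) (+≤ (ℕ.s≤s ℕ.z≤n))
      (lin (3 ⊗ step₁ ⊕ 64 ⊗ step₂ ⊕ 19 ⊗ mul K (+ 100 * n₀) n 0≤K c) (solve (K ∷ n₀ ∷ n ∷ p ∷ []))))

  -- At the ratio 200 Chebyshev's lower bound for ψ(200 a), less its logarithmic term, exceeds the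
  -- crude upper bound 43 K a for ψ(a) by a multiple of K a.
  start-dense : ∀ m K a b pu pa → 1ℤ ≤ m → 1ℤ ≤ K → 1ℤ ≤ a → + 7 * (K * (+ 100 * a)) ≤ + 6 * pu + + 30 * K + + 6 * (K * b) → b ≤ + 3 + + 25 * a → pa ≤ + 43 * (K * a) →
                + 2 * (K * (+ 200 * a)) + 1ℤ ≤ + 256 * m * (pu - pa)
  start-dense m K a b pu pa 1≤m 1≤K 1≤a p q r = lin (256 ⊗ Δ ⊕ 256 ⊗ mul (pu - pa) 1ℤ m (≤-trans (*-nonneg {+ 2} {K * a} (0≤+ 2) 0≤Ka) Δ) 1≤m ⊕ 111 ⊗ 0≤Ka ⊕ mul K 1ℤ a (from1 1≤K) 1≤a ⊕ 1≤K) (solve (m ∷ K ∷ a ∷ pu ∷ pa ∷ []))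
    where
    0≤Ka : 0ℤ ≤ K * a
    0≤Ka = *-nonneg {K} {a} (from1 1≤K) (from1 1≤a)
    Δ : + 2 * (K * a) ≤ pu - pa
    Δ = cancel-ℤ (+ 6) (+ 2 * (K * a)) (pu - pa) (+≤ (ℕ.s≤s ℕ.z≤n)) (lin (p ⊕ 6 ⊗ mul K b (+ 3 + + 25 * a) (from1 1≤K) q ⊕ 6 ⊗ r ⊕ 48 ⊗ mul K 1ℤ a (from1 1≤K) 1≤a ⊕ 232 ⊗ 0≤Ka) (solve (K ∷ a ∷ b ∷ pu ∷ pa ∷ [])))

  ΣΛD-alg : ∀ a k z x p q → a * (+ 2 * (k * (z - x)) - (p - q)) ≡ + 2 * k * (z * a - x * a) - (a * p - a * q)
  ΣΛD-alg = solve-∀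

  ΣΛD-core : ∀ fz fx cz cx pz px lz lx K z x → (pz - px) * lz ≤ K * (K * x) → - (+ 310 * (K * (K * z))) ≤ pz * lz + cz - + 2 * (K * fz) → px * lx + cx - + 2 * (K * fx) ≤ + 310 * (K * (K * x)) →
         px * lz ≤ px * (lx + + 6 * K) → K * px ≤ K * (+ 43 * (K * x)) → K * (K * z) ≤ K * (K * (+ 2 * x)) → 0ℤ ≤ K * (K * x) →
         + 2 * K * (fz - fx) - (cz - cx) ≤ + 1200 * (K * (K * x))
  ΣΛD-core fz fx cz cx pz px lz lx K z x a b c d f g h = lin (a ⊕ b ⊕ c ⊕ d ⊕ 6 ⊗ f ⊕ 310 ⊗ g ⊕ 11 ⊗ h) (solve (fz ∷ fx ∷ cz ∷ cx ∷ pz ∷ px ∷ lz ∷ lx ∷ K ∷ z ∷ x ∷ []))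

  0≤P-core : ∀ g K pz px z x → g * pz ≤ g * (+ 43 * (K * z)) → 0ℤ ≤ g * (K * (z - x)) → 0ℤ ≤ g * px → 0ℤ ≤ K * z → 0ℤ ≤ g * (+ 2 * (K * (z - x)) - (pz - px)) + K * z + + 43 * (g * (K * z)) * 1ℤ
  0≤P-core g K pz px z x a b c d = lin (a ⊕ 2 ⊗ b ⊕ c ⊕ d) (solve (g ∷ K ∷ pz ∷ px ∷ z ∷ x ∷ []))

  0≤P-core₂ : ∀ g K pz px z x → g * (pz - px) ≤ + 2 * (g * (K * (z - x))) + K * z → 0ℤ ≤ g * (+ 2 * (K * (z - x)) - (pz - px)) + K * z + + 43 * (g * (K * z)) * 0ℤ
  0≤P-core₂ g K pz px z x a = lin a (solve (g ∷ K ∷ pz ∷ px ∷ z ∷ x ∷ []))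

  V-bound-core : ∀ z x h b → z * h ≤ z * b → z * b ≤ + 2 * x * b → + 43 * z * h ≤ + 86 * (x * b)
  V-bound-core z x h b p q = lin (43 ⊗ (p ⊕ q)) (solve (z ∷ x ∷ h ∷ b ∷ []))

  V-bound-scaled : ∀ K j i q z → j * i ≡ K → 0ℤ ≤ i → q * j ≤ z → + 43 * (K * q) ≤ + 43 * z * i
  V-bound-scaled .(j * i) j i q z refl hi p = lin (43 ⊗ (_⊛_ {i} {q * j} {z} hi p)) (solve (j ∷ i ∷ q ∷ z ∷ []))

  Lf-bound-each : ∀ a b e k n → a ≤ b + e → b ≤ + 3 * (k * n) → e ≤ k → k ≤ k * n → a ≤ + 4 * (k * n)
  Lf-bound-each a b e k n p q r s = lin (p ⊕ q ⊕ r ⊕ s) (solve (a ∷ b ∷ e ∷ k ∷ n ∷ []))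

  Lf-bound-core : ∀ z x k n → z * (k * n) ≤ + 2 * x * (k * n) → z * (+ 4 * (k * n)) ≤ + 8 * (k * (n * x))
  Lf-bound-core z x k n p = lin (4 ⊗ p) (solve (z ∷ x ∷ k ∷ n ∷ []))

  ΣΛP-alg : ∀ l g d k q t → l * (g * d + k * q + + 43 * (g * (k * q)) * t) ≡ (g * (l * d) + k * (q * l)) + + 43 * (g * k) * (t * (q * l))
  ΣΛP-alg = solve-∀

  ΣΛP-core : ∀ g K N x b d f v → g * d ≤ g * (+ 1200 * (K * (K * x))) → K * f ≤ K * (+ 8 * (K * (N * x))) → g * K * v ≤ g * K * (+ 86 * (x * (K * b))) → K * (K * x) * (+ 1200 * g + + 3698 * (g * b)) ≤ K * (K * x) * N →
         (g * d + K * f) + + 43 * (g * K) * v ≤ + 9 * (K * (K * (N * x)))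
  ΣΛP-core g K N x b d f v p q r s = ≤-trans (collect (g * d) (K * f) (g * K * v) (g * (+ 1200 * T)) (+ 86 * (T * (g * b))) (T * N) (g * K) v refl p (≤-trans q (≤-of (alg₁ K N x))) (≤-trans r (≤-of (alg₂ g K x b))) (≤-trans (≤-of (expand (+ 1200) (+ 43) (+ 86) g T b)) s)) (≤-of (regroup K N x))
    where
    T : ℤ
    T = K * (K * x)
    alg₁ : ∀ K N x → K * (+ 8 * (K * (N * x))) ≡ + 8 * (K * (K * x) * N)
    alg₁ = solve-∀
    alg₂ : ∀ g K x b → g * K * (+ 86 * (x * (K * b))) ≡ + 86 * (K * (K * x) * (g * b))
    alg₂ = solve-∀
    expand : ∀ p q r g T b → g * (p * T) + q * (r * (T * (g * b))) ≡ T * (p * g + q * r * (g * b))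
    expand = solve-∀
    regroup : ∀ K N x → + 9 * (K * (K * x) * N) ≡ + 9 * (K * (K * (N * x)))
    regroup = solve-∀
    collect : ∀ A F V A′ V′ N′ h v → h * v ≡ V → A ≤ A′ → F ≤ + 8 * N′ → V ≤ V′ → A′ + + 43 * V′ ≤ N′ → (A + F) + + 43 * h * v ≤ + 9 * N′
    collect A F .(h * v) A′ V′ N′ h v refl a b c e = lin (a ⊕ b ⊕ 43 ⊗ c ⊕ e) (solve (A ∷ F ∷ A′ ∷ V′ ∷ N′ ∷ h ∷ v ∷ []))

  bad-weight-swap : ∀ a b c → a * (b * c) ≡ b * a * c
  bad-weight-swap = solve-∀

  bad-weight-comm : ∀ a k → + 9 * (k * a) ≡ k * (+ 9 * a)
  bad-weight-comm = solve-∀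

  bad-weight-core : ∀ g1 g2 d l k q g t → g ≡ g1 * g2 → l * (g2 * (k * q)) ≤ l * (g2 * (g1 * d)) → 0ℤ ≤ l * (k * q) → 0ℤ ≤ l * (g * (k * q) * t) →
         g2 * k * (1ℤ * (q * l)) ≤ l * (g * d + k * q + + 43 * (g * (k * q)) * t)
  bad-weight-core g1 g2 d l k q .(g1 * g2) t refl a b c = lin (a ⊕ b ⊕ 43 ⊗ c) (solve (g1 ∷ g2 ∷ d ∷ l ∷ k ∷ q ∷ t ∷ []))

  window-lin₃ : ∀ b1 bz b2 b3 b4 b5 b6 → b1 ≤ bz → 0ℤ ≤ b2 → 0ℤ ≤ b3 → 0ℤ ≤ b4 → b5 ≤ bz → b6 ≤ bz → b1 - b2 - b3 - (b4 - b5 - b6) ≤ + 3 * bz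
  window-lin₃ b1 bz b2 b3 b4 b5 b6 p q r t u v = lin (p ⊕ q ⊕ r ⊕ t ⊕ u ⊕ v) (solve (b1 ∷ bz ∷ b2 ∷ b3 ∷ b4 ∷ b5 ∷ b6 ∷ []))

  window-core : ∀ g1 g2 I K x N p bz → g2 * (I * (K * x + 1ℤ)) ≤ g2 * (g1 * p) → g2 * (g1 * p) ≤ g2 * (g1 * (+ 3 * bz)) →
         g1 * (g2 * bz) ≤ g1 * (+ 9 * (K * (N * x))) → K * x * (+ 27 * (g1 * N)) ≤ K * x * (g2 * I) → g2 * I ≤ 0ℤ
  window-core g1 g2 I K x N p bz a b c d = lin (a ⊕ b ⊕ 3 ⊗ c ⊕ d) (solve (g1 ∷ g2 ∷ I ∷ K ∷ x ∷ N ∷ p ∷ bz ∷ []))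

  window-part₁ : ∀ b2 b1 h0 h1 h2 → h2 ≤ h0 → b2 - b1 ≤ b2 - h1 - h2 - (b1 - h0 - h1)
  window-part₁ b2 b1 h0 h1 h2 p = lin p (solve (b2 ∷ b1 ∷ h0 ∷ h1 ∷ h2 ∷ []))

  window-part₂ : ∀ b2 b1 h0 h1 h2 c → b1 ≤ b2 → c ≤ h0 → c - h2 ≤ b2 - h1 - h2 - (b1 - h0 - h1)
  window-part₂ b2 b1 h0 h1 h2 c p q = lin (p ⊕ q) (solve (b2 ∷ b1 ∷ h0 ∷ h1 ∷ h2 ∷ c ∷ []))

  find-good-alg : ∀ a b c → a * b - a * c ≡ a * (b - c)
  find-good-alg = solve-∀

  find-good-core : ∀ q p b K x z u g → q * (+ 2 * (K * u) + 1ℤ) ≤ q * (g * p) → g * (q * p) ≤ g * b → g * b ≤ K * x → K * x ≤ K * z → K * z ≤ K * ((1ℤ + q) * u) → K * (1ℤ * u) ≤ K * (q * u) → q ≤ 0ℤ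
  find-good-core q p b K x z u g a c d e f h = lin (a ⊕ c ⊕ d ⊕ e ⊕ f ⊕ h) (solve (q ∷ p ∷ b ∷ K ∷ x ∷ z ∷ u ∷ g ∷ []))

  next-alg : ∀ m → + 2 * m - 1ℤ ≡ m + m - (1ℤ + 0ℤ)
  next-alg = solve-∀

  next-alg′ : ∀ m n u → + 2 * m * u - + 2 * m * n ≡ + 2 * m * u + n - ((+ 2 * m + 1ℤ) * n + 0ℤ)
  next-alg′ = solve-∀

  chain-alg : ∀ m K n p → + 2 * (+ 256 * m * (K * (n - n))) ≡ + 256 * m * (p - p) + + 5 * (K * ((+ 2 * m + 1ℤ) * (n - n)))
  chain-alg = solve-∀

  chain-gr : ∀ m j n₀ n n′ → (+ 2 * m + j) * n₀ ≤ + 2 * m * n → n₀ ≤ n → (+ 2 * m + 1ℤ) * n ≤ + 2 * m * n′ → (+ 2 * m + (1ℤ + j)) * n₀ ≤ + 2 * m * n′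
  chain-gr m j n₀ n n′ p q r = lin (p ⊕ q ⊕ r) (solve (m ∷ j ∷ n₀ ∷ n ∷ n′ ∷ []))

  no-window-alg : ∀ m → + 2 * m - 1ℤ ≡ m + m - (1ℤ + 0ℤ)
  no-window-alg = solve-∀

  no-window-alg′ : ∀ m n → + 2 * m * (+ 100 * n) ≡ (+ 2 * m + + 198 * m) * n
  no-window-alg′ = solve-∀

-- Chebyshev's bounds, Selberg's formula and intervals of density two

module SelbergFormula where

  open LinearArithmetic
  open Sums
  open ArithmeticFunctions
  open Logarithm
  open Halving
  open IntegerInequalities

  open import Data.Nat as ℕ using (ℕ; zero; suc)
  import Data.Nat.Properties as ℕₚ
  open import Data.Nat.Divisibility
  open import Data.Nat.Primality
  import Data.Integer as ℤ
  open import Data.Integer using (ℤ; +_; -_; _+_; _-_; _*_; _≤_; 0ℤ; 1ℤ)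
  open import Data.Integer.Properties
  open import Data.Integer.Tactic.RingSolver using (solve; solve-∀)
  open import Data.List using ([]; _∷_)
  open import Function using (_∘_)
  open import Relation.Nullary.Decidable using (¬?)

  S-single : ∀ n a (c : ℤ) → 1 ℕ.≤ a → a ℕ.≤ n → S n (λ p → χ (a ℕ.≟ p) * c) ≡ c
  S-single zero a c 1≤a a≤0 = ⊥-elim (ℕₚ.<⇒≱ 1≤a a≤0)
  S-single (suc n) a c 1≤a a≤n with ℕₚ.m≤n⇒m<n∨m≡n a≤n
  ... | inj₁ lt = trans (cong₂ _+_ (S-single n a c 1≤a (ℕₚ.≤-pred lt)) (cong (_* c) (χ-no (a ℕ.≟ suc n) (ℕₚ.<⇒≢ lt)))) (+-identityʳ c)
  ... | inj₂ refl = trans (cong₂ _+_ (S-zero n (λ k _ q → cong (_* c) (χ-no (suc n ℕ.≟ k) (ℕₚ.>⇒≢ (ℕ.s≤s q))))) (trans (cong (_* c) (χ-yes (suc n ℕ.≟ suc n) refl)) (*-identityˡ c))) (+-identityˡ c)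

  S-atmost1 : ∀ n {f : ℕ → ℤ} {M : ℤ} → 0ℤ ≤ M → (∀ k → 1 ℕ.≤ k → k ℕ.≤ n → f k ≤ M) →
              (∀ j k → 1 ℕ.≤ j → j ℕ.< k → k ℕ.≤ n → (f j ≡ 0ℤ) ⊎ (f k ≡ 0ℤ)) → S n f ≤ M
  S-atmost1 zero 0≤M _ _ = 0≤M
  S-atmost1 (suc n) {f} {M} 0≤M bound one with f (suc n) ℤ.≟ 0ℤ
  ... | yes e = subst (_≤ M) (sym (trans (cong (λ z → S n f + z) e) (+-identityʳ (S n f)))) (S-atmost1 n 0≤M (λ k p q → bound k p (ℕₚ.m≤n⇒m≤1+n q)) (λ j k p q r → one j k p q (ℕₚ.m≤n⇒m≤1+n r)))
  ... | no ne = subst (_≤ M) (sym (trans (cong (_+ f (suc n)) (S-zero n rest)) (+-identityˡ (f (suc n))))) (bound (suc n) (ℕ.s≤s ℕ.z≤n) ℕₚ.≤-refl)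
    where
    rest : ∀ k → 1 ℕ.≤ k → k ℕ.≤ n → f k ≡ 0ℤ
    rest k p q with one k (suc n) p (ℕ.s≤s q) ℕₚ.≤-refl
    ... | inj₁ e = e
    ... | inj₂ e = ⊥-elim (ne e)

  lpf-^ : ∀ p a → Prime p → lpf (p ℕ.^ suc a) ≡ p
  lpf-^ p a pp = lpf-* pp (ℕₚ.m^n>0 p {{prime⇒nonZero pp}} a) (least a)
    where
    least : ∀ a → Least p (p ℕ.^ a)
    least zero r pr r∣1 = ⊥-elim (¬prime[1] (subst Prime (∣1⇒≡1 r∣1) pr))
    least (suc a) = Least-* pp (least a)

  find-in : ∀ {P : ℕ → Set} → (∀ k → Dec (P k)) → ∀ y n → (Σ ℕ λ k → (y ℕ.< k) × (k ℕ.≤ n ℕ.+ y) × P k) ⊎ (∀ k → y ℕ.< k → k ℕ.≤ n ℕ.+ y → ¬ P k)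
  find-in P? y zero = inj₂ (λ k lo hi _ → ℕₚ.<⇒≱ lo hi)
  find-in {P} P? y (suc n) with P? (suc (n ℕ.+ y)) | find-in P? y n
  ... | yes p | _ = inj₁ (suc (n ℕ.+ y) , ℕ.s≤s (ℕₚ.m≤n+m y n) , ℕₚ.≤-refl , p)
  ... | no _ | inj₁ (k , lo , hi , p) = inj₁ (k , lo , ℕₚ.m≤n⇒m≤1+n hi , p)
  ... | no ¬p | inj₂ none = inj₂ go
    where
    go : ∀ k → y ℕ.< k → k ℕ.≤ suc (n ℕ.+ y) → ¬ P k
    go k lo hi with ℕₚ.m≤n⇒m<n∨m≡n hi
    ... | inj₁ lt = none k lo (ℕₚ.≤-pred lt)
    ... | inj₂ refl = ¬p

  pigeonhole : ∀ (Φ : ℕ → ℤ) (d b : ℤ) I n → (Σ ℕ λ i → (I ℕ.≤ i) × (i ℕ.< n ℕ.+ I) × (d * (Φ (suc i) - Φ i) ≤ b)) ⊎ (+ n * (b + 1ℤ) ≤ d * (Φ (n ℕ.+ I) - Φ I))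
  pigeonhole Φ d b I zero = inj₂ (≤-of (alg b d (Φ I)))
    where
    alg : ∀ b d p → 0ℤ * (b + 1ℤ) ≡ d * (p - p)
    alg = solve-∀
  pigeonhole Φ d b I (suc n) with d * (Φ (suc (n ℕ.+ I)) - Φ (n ℕ.+ I)) ℤ.≤? b | pigeonhole Φ d b I n
  ... | yes h | _ = inj₁ (n ℕ.+ I , ℕₚ.m≤n+m I n , ℕₚ.≤-refl , h)
  ... | no _ | inj₁ (i , p , q , h) = inj₁ (i , p , ℕₚ.m≤n⇒m≤1+n q , h)
  ... | no ¬h | inj₂ h = inj₂ (core (+ n) b d (Φ (suc (n ℕ.+ I))) (Φ (n ℕ.+ I)) (Φ I) h (i<j⇒suc[i]≤j (≰⇒> ¬h)))
    where
    core : ∀ n b d p q r → n * (b + 1ℤ) ≤ d * (q - r) → ℤ.suc b ≤ d * (p - q) → (1ℤ + n) * (b + 1ℤ) ≤ d * (p - r)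
    core n b d p q r h k = lin (h ⊕ k) (alg n b d p q r)
      where
      alg : ∀ n b d p q r → d * (p - r) - (1ℤ + n) * (b + 1ℤ) ≡ d * (q - r) + d * (p - q) - (n * (b + 1ℤ) + (1ℤ + b))
      alg = solve-∀

  quo-lo : ∀ x d → + quo x d * + d ≤ + x
  quo-lo x d = subst (_≤ + x) (pos-* (quo x d) d) (+≤ (quo-mul≤ x d))

  quo-hi : ∀ x d → 1 ℕ.≤ d → 1ℤ + + x ≤ (1ℤ + + quo x d) * + d
  quo-hi x d h = subst (1ℤ + + x ≤_) (pos-* (suc (quo x d)) d) (+≤ (<quo x d h))

  double-double : ∀ y → 2 ℕ.* (y ℕ.+ y) ≡ 4 ℕ.* y
  double-double y = trans (cong (λ t → 2 ℕ.* (y ℕ.+ t)) (sym (ℕₚ.+-identityʳ y))) (sym (ℕₚ.*-assoc 2 2 y))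

  module Bounds (X : ℕ) (sc : Scale X) (24≤X : 24 ℕ.≤ X) where
    open Scale sc

    4≤X : 4 ℕ.≤ X
    4≤X = ℕₚ.≤-trans (ℕₚ.m≤m+n 4 20) 24≤X

    0≤K : 0ℤ ≤ K
    0≤K = ≤-trans (0≤+ 1) 1≤K

    1≤X : 1 ℕ.≤ X
    1≤X = ℕₚ.≤-trans (ℕ.s≤s ℕ.z≤n) 4≤X

    cancel-+ : ∀ j {a b : ℤ} → 1 ℕ.≤ j → + j * a ≤ + j * b → a ≤ b
    cancel-+ j {a} {b} h = cancel-*≤ {+ j} {a} {b} (+≤ h)

    inv-mul : ∀ n m → 1 ℕ.≤ n → 1 ℕ.≤ m → n ℕ.* m ℕ.≤ X → + n * inv (n ℕ.* m) ≡ inv m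
    inv-mul n m 1≤n 1≤m h = ≤-antisym (cancel-+ m 1≤m (≤-of eq)) (cancel-+ m 1≤m (≤-of (sym eq)))
      where
      alg : ∀ a b c → a * (b * c) ≡ (b * a) * c
      alg = solve-∀
      eq : + m * (+ n * inv (n ℕ.* m)) ≡ + m * inv m
      eq = trans (alg (+ m) (+ n) (inv (n ℕ.* m))) (trans (cong (_* inv (n ℕ.* m)) (sym (pos-* n m)))
        (trans (k*inv (n ℕ.* m) (1≤* 1≤n 1≤m) h) (sym (k*inv m 1≤m (ℕₚ.≤-trans (ℕₚ.m≤n*m m n {{ℕ.>-nonZero 1≤n}}) h)))))

    inv-anti : ∀ j k → 1 ℕ.≤ j → j ℕ.≤ k → k ℕ.≤ X → inv k ≤ inv j
    inv-anti j k 1≤j j≤k k≤X = cancel-+ j 1≤j (≤-trans (*-monoʳ-≤-nonNeg (inv k) {{ℤ.nonNegative (inv≥0 k)}} (+≤ j≤k))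
      (≤-of (trans (k*inv k (ℕₚ.≤-trans 1≤j j≤k) k≤X) (sym (k*inv j 1≤j (ℕₚ.≤-trans j≤k k≤X))))))

    inv-1 : inv 1 ≡ K
    inv-1 = trans (sym (*-identityˡ (inv 1))) (k*inv 1 ℕₚ.≤-refl 1≤X)

    inv≤K : ∀ j → 1 ℕ.≤ j → j ℕ.≤ X → inv j ≤ K
    inv≤K j 1≤j h = subst (inv j ≤_) inv-1 (inv-anti 1 j ℕₚ.≤-refl 1≤j h)

    Xe : ℤ
    Xe = + X * e

    Xe≤inv : ∀ j → 1 ℕ.≤ j → j ℕ.≤ X → Xe ≤ inv j
    Xe≤inv j 1≤j h = ≤-trans (cancel-+ X 1≤X (≤-trans X²e≤K (≤-of (sym (k*inv X 1≤X ℕₚ.≤-refl))))) (inv-anti j X 1≤j h ℕₚ.≤-refl)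

    Xe≤K : Xe ≤ K
    Xe≤K = ≤-trans (Xe≤inv 1 ℕₚ.≤-refl 1≤X) (≤-of inv-1)

    ne≤Xe : ∀ n → n ℕ.≤ X → + n * e ≤ Xe
    ne≤Xe n h = *-monoʳ-≤-nonNeg e {{ℤ.nonNegative e≥0}} (+≤ h)

    H : ℕ → ℤ
    H n = S n inv

    0≤H : ∀ n → 0ℤ ≤ H n
    0≤H n = S-nonneg n (λ k _ _ → inv≥0 k)

    H-mono : ∀ {m n} → m ℕ.≤ n → H m ≤ H n
    H-mono {m} {n} h = S-mono-n m n h (λ k _ _ → inv≥0 k)

    -- H − L is nearly decreasing and H − L − inv nearly increasing.
    drift : ∀ n j → 1 ℕ.≤ j → n ℕ.+ j ℕ.≤ X →
            (H (n ℕ.+ j) - L (n ℕ.+ j) ≤ H j - L j + + n * e) × (H j - L j - inv j ≤ H (n ℕ.+ j) - L (n ℕ.+ j) - inv (n ℕ.+ j) + + n * e)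
    drift zero j _ _ = ≤-of (alg (H j - L j) e) , ≤-of (alg (H j - L j - inv j) e)
      where
      alg : ∀ x e → x ≡ x + 0ℤ * e
      alg = solve-∀
    drift (suc n) j 1≤j h = core (H (n ℕ.+ j)) (L (n ℕ.+ j)) (inv (n ℕ.+ j)) (inv (suc n ℕ.+ j)) (L (suc n ℕ.+ j)) (H j) (L j) (inv j) (+ n) e
        (proj₁ ih) (proj₂ ih) (L-up (n ℕ.+ j) 1≤nj h) (L-down (n ℕ.+ j) 1≤nj h)
      where
      1≤nj : 1 ℕ.≤ n ℕ.+ j
      1≤nj = ℕₚ.≤-trans 1≤j (ℕₚ.m≤n+m j n)
      ih = drift n j 1≤j (ℕₚ.<⇒≤ h)
      core : ∀ hn ln i i′ l′ hj lj ij n e → hn - ln ≤ hj - lj + n * e → hj - lj - ij ≤ hn - ln - i + n * e → l′ ≤ ln + i + e → ln + i′ ≤ l′ + e →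
             (hn + i′ - l′ ≤ hj - lj + (1ℤ + n) * e) × (hj - lj - ij ≤ hn + i′ - l′ - i′ + (1ℤ + n) * e)
      core a b c d f g h i n e p q r s = lin (p ⊕ s) (solve (a ∷ b ∷ d ∷ f ∷ g ∷ h ∷ n ∷ e ∷ [])) , lin (q ⊕ r) (solve (a ∷ b ∷ c ∷ d ∷ f ∷ g ∷ h ∷ i ∷ n ∷ e ∷ []))

    -- Close to `K` times Euler's constant, read off at the end of the range.
    a₀ : ℤ
    a₀ = H X - L X

    L≈H : ∀ j → 1 ℕ.≤ j → j ℕ.≤ X → (a₀ ≤ H j - L j + inv j) × (H j - L j ≤ a₀ + inv j)
    L≈H j 1≤j j≤X = core (H X - L X) (H j - L j) (+ n * e) Xe (inv j) (inv X) (proj₁ d) (proj₂ d) (ne≤Xe n (ℕₚ.m∸n≤m X j)) (Xe≤inv j 1≤j j≤X) (Xe≤inv X 1≤X ℕₚ.≤-refl)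
      where
      n : ℕ
      n = X ℕ.∸ j
      n+j : n ℕ.+ j ≡ X
      n+j = ℕₚ.m∸n+n≡m j≤X
      d : (H X - L X ≤ H j - L j + + n * e) × (H j - L j - inv j ≤ H X - L X - inv X + + n * e)
      d = subst (λ z → (H z - L z ≤ H j - L j + + n * e) × (H j - L j - inv j ≤ H z - L z - inv z + + n * e)) n+j (drift n j 1≤j (ℕₚ.≤-reflexive n+j))
      core : ∀ a b ne xe i iX → a ≤ b + ne → b - i ≤ a - iX + ne → ne ≤ xe → xe ≤ i → xe ≤ iX → (a ≤ b + i) × (b ≤ a + i)
      core a b ne xe i iX p q r s t = lin (p ⊕ r ⊕ s) (solve (a ∷ b ∷ ne ∷ xe ∷ i ∷ [])) , lin (q ⊕ r ⊕ t) (solve (a ∷ b ∷ ne ∷ xe ∷ i ∷ iX ∷ []))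

    L-nearly-mono : ∀ n j → 1 ℕ.≤ j → n ℕ.+ j ℕ.≤ X → L j ≤ L (n ℕ.+ j) + + n * e
    L-nearly-mono zero j _ _ = ≤-of (sym (+-identityʳ (L j)))
    L-nearly-mono (suc n) j 1≤j h = core (L j) (L (n ℕ.+ j)) (L (suc n ℕ.+ j)) (inv (suc n ℕ.+ j)) (+ n) e
        (L-nearly-mono n j 1≤j (ℕₚ.<⇒≤ h)) (L-down (n ℕ.+ j) (ℕₚ.≤-trans 1≤j (ℕₚ.m≤n+m j n)) h) (inv≥0 (suc n ℕ.+ j))
      where
      core : ∀ a b c i n e → a ≤ b + n * e → b + i ≤ c + e → 0ℤ ≤ i → a ≤ c + (1ℤ + n) * e
      core a b c i n e p q r = lin (p ⊕ q ⊕ r) (solve (a ∷ b ∷ c ∷ i ∷ n ∷ e ∷ []))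

    L-mono : ∀ j k → 1 ℕ.≤ j → j ℕ.≤ k → k ℕ.≤ X → L j ≤ L k + Xe
    L-mono j k 1≤j j≤k k≤X = ≤-trans (subst (λ z → L j ≤ L z + + (k ℕ.∸ j) * e) n+j (L-nearly-mono (k ℕ.∸ j) j 1≤j (subst (ℕ._≤ X) (sym n+j) k≤X)))
      (+-monoʳ-≤ (L k) (ne≤Xe (k ℕ.∸ j) (ℕₚ.≤-trans (ℕₚ.m∸n≤m k j) k≤X)))
      where
      n+j : k ℕ.∸ j ℕ.+ j ≡ k
      n+j = ℕₚ.m∸n+n≡m j≤k

    -- Close to K (1 + γ), the coefficient of the linear term when log M! is expanded around M H(M),
    -- see `Lf≈`.
    c₀ : ℤ
    c₀ = K + a₀

    c₀-bounds : (K ≤ c₀) × (c₀ ≤ + 3 * K)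
    c₀-bounds = core a₀ K (subst₂ (λ u v → u ≤ v) refl eq₁ (proj₁ h)) (subst₂ _≤_ eq₂ (cong (a₀ +′_) inv-1) (proj₂ h))
      where
      _+′_ : ℤ → ℤ → ℤ
      x +′ y = x + y
      h = L≈H 1 ℕₚ.≤-refl 1≤X
      alg : ∀ k → 0ℤ + k - 0ℤ ≡ k
      alg = solve-∀
      eq₂ : H 1 - L 1 ≡ K
      eq₂ = trans (alg (inv 1)) inv-1
      eq₁ : H 1 - L 1 + inv 1 ≡ K + K
      eq₁ = cong₂ _+_ eq₂ inv-1
      core : ∀ a k → a ≤ k + k → k ≤ a + k → (k ≤ k + a) × (k + a ≤ + 3 * k)
      core a k p q = lin q (solve (a ∷ k ∷ [])) , lin p (solve (a ∷ k ∷ []))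

    ΣH : ∀ M → M ℕ.≤ X → S M H ≡ (1ℤ + + M) * H M - + M * K
    ΣH zero _ = refl
    ΣH (suc M) h = trans (cong (_+ H (suc M)) (ΣH M (ℕₚ.<⇒≤ h))) (trans (cong (λ z → (1ℤ + + M) * H M - + M * z + (H M + inv (suc M))) (sym ki)) (trans (alg (+ M) (H M) (inv (suc M))) (cong (λ z → (1ℤ + + suc M) * H (suc M) - + suc M * z) ki)))
      where
      ki : + suc M * inv (suc M) ≡ K
      ki = k*inv (suc M) (ℕ.s≤s ℕ.z≤n) h
      alg : ∀ m h i → (1ℤ + m) * h - m * ((1ℤ + m) * i) + (h + i) ≡ (1ℤ + (1ℤ + m)) * (h + i) - (1ℤ + m) * ((1ℤ + m) * i)
      alg = solve-∀

    Lf : ℕ → ℤ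
    Lf n = S n L

    Lf≈ : ∀ M → M ℕ.≤ X → (+ M * H M - c₀ * + M ≤ Lf M) × (Lf M ≤ + M * H M - c₀ * + M + + 2 * H M)
    Lf≈ M h = core (Lf M) (S M H) (H M) (+ M) a₀ K (ΣH M h) lo hi
      where
      lo : S M H - + M * a₀ - H M ≤ Lf M
      lo = subst (_≤ Lf M) (trans (S-minus M (λ j → H j - a₀) inv) (cong (_- H M) (trans (S-minus M H (λ _ → a₀)) (cong (λ z → S M H - z) (S-const M a₀)))))
        (S-mono M (λ j p q → let (_ , u) = L≈H j p (ℕₚ.≤-trans q h) in lo′ (H j) (L j) a₀ (inv j) u))
        where
        lo′ : ∀ h l a i → h - l ≤ a + i → h - a - i ≤ l
        lo′ h l a i p = lin p (solve (h ∷ l ∷ a ∷ i ∷ []))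
      hi : Lf M ≤ S M H - + M * a₀ + H M
      hi = subst (Lf M ≤_) (trans (S-+ M (λ j → H j - a₀) inv) (cong (_+ H M) (trans (S-minus M H (λ _ → a₀)) (cong (λ z → S M H - z) (S-const M a₀)))))
        (S-mono M (λ j p q → let (u , _) = L≈H j p (ℕₚ.≤-trans q h) in hi′ (H j) (L j) a₀ (inv j) u))
        where
        hi′ : ∀ h l a i → a ≤ h - l + i → l ≤ h - a + i
        hi′ h l a i p = lin p (solve (h ∷ l ∷ a ∷ i ∷ []))
      core : ∀ f s h m a k → s ≡ (1ℤ + m) * h - m * k → s - m * a - h ≤ f → f ≤ s - m * a + h → (m * h - (k + a) * m ≤ f) × (f ≤ m * h - (k + a) * m + + 2 * h)
      core f .((1ℤ + m) * h - m * k) h m a k refl p q = lin p (solve (f ∷ h ∷ m ∷ a ∷ k ∷ [])) , lin q (solve (f ∷ h ∷ m ∷ a ∷ k ∷ []))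

    ψ : ℕ → ℤ
    ψ n = S n Λ

    Λ≥0′ : ∀ n → 1 ℕ.≤ n → 0ℤ ≤ Λ n
    Λ≥0′ = Λ≥0 l≥0

    0≤ψ : ∀ n → 0ℤ ≤ ψ n
    0≤ψ n = S-nonneg n (λ k p _ → Λ≥0′ k p)

    ψ-mono : ∀ {m n} → m ℕ.≤ n → ψ m ≤ ψ n
    ψ-mono {m} {n} h = S-mono-n m n h (λ k p _ → Λ≥0′ k (ℕₚ.≤-trans (ℕ.s≤s ℕ.z≤n) p))

    Lf-hyp : ∀ M → Lf M ≡ S M (λ d → S (quo M d) (λ _ → Λ d))
    Lf-hyp M = trans (S-cong M (λ n p _ → sym (T-Λ n p))) (hyperbola M (λ d _ → Λ d))

    Lf-Λ : ∀ M → Lf M ≡ S M (λ d → + quo M d * Λ d)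
    Lf-Λ M = trans (Lf-hyp M) (S-cong M (λ d _ _ → S-const (quo M d) (Λ d)))

    Lf-ψ : ∀ M → Lf M ≡ S M (λ m → ψ (quo M m))
    Lf-ψ M = trans (Lf-hyp M) (hyperbola-sym M (λ d _ → Λ d))

    -- A scaled form of ψ(y) - y + 1 + γ at y = x / k. The constant cancels the linear term of log
    -- M!, so that the sums over multiples in `ΣF-bounds` are only of the size of `H`.
    F : ℕ → ℕ → ℤ
    F x k = ψ (quo x k) - + x * inv k + c₀

    ΣF-bounds : ∀ x n → 1 ℕ.≤ n → n ℕ.≤ x → x ℕ.≤ X →
                (- (+ 2 * H (quo x n)) ≤ S (quo x n) (λ m → F x (n ℕ.* m))) × (S (quo x n) (λ m → F x (n ℕ.* m)) ≤ + 2 * H (quo x n))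
    ΣF-bounds x n 1≤n n≤x x≤X = subst (λ z → (- (+ 2 * H M) ≤ z) × (z ≤ + 2 * H M)) (sym ΣF)
        (core (Lf M) (S M (λ m → + x * inv (n ℕ.* m))) (+ M) (H M) c₀ (proj₁ (Lf≈ M M≤X)) (proj₂ (Lf≈ M M≤X)) lo hi (0≤H M))
      where
      M : ℕ
      M = quo x n
      M≤X : M ℕ.≤ X
      M≤X = ℕₚ.≤-trans (quo-≤ x n) x≤X
      ΣF : S M (λ m → F x (n ℕ.* m)) ≡ Lf M - S M (λ m → + x * inv (n ℕ.* m)) + + M * c₀
      ΣF = trans (S-+ M (λ m → ψ (quo x (n ℕ.* m)) - + x * inv (n ℕ.* m)) (λ _ → c₀)) (cong₂ _+_
        (trans (S-minus M (λ m → ψ (quo x (n ℕ.* m))) (λ m → + x * inv (n ℕ.* m))) (cong (_- S M (λ m → + x * inv (n ℕ.* m)))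
          (trans (S-cong M (λ m p _ → cong ψ (sym (quo-quo x n m 1≤n p)))) (sym (Lf-ψ M))))) (S-const M c₀))
      nm≤X : ∀ m → m ℕ.≤ M → n ℕ.* m ℕ.≤ X
      nm≤X m m≤M = ℕₚ.≤-trans (ℕₚ.*-monoʳ-≤ n m≤M) (ℕₚ.≤-trans (subst (ℕ._≤ x) (ℕₚ.*-comm M n) (quo-mul≤ x n)) x≤X)
      scaled : ∀ c m → 1 ℕ.≤ m → m ℕ.≤ M → + (c ℕ.* n) * inv (n ℕ.* m) ≡ + c * inv m
      scaled c m p q = trans (cong (_* inv (n ℕ.* m)) (pos-* c n)) (trans (*-assoc (+ c) (+ n) (inv (n ℕ.* m))) (cong (+ c *_) (inv-mul n m 1≤n p (nm≤X m q))))
      lo : + M * H M ≤ S M (λ m → + x * inv (n ℕ.* m))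
      lo = subst (_≤ S M (λ m → + x * inv (n ℕ.* m))) (S-* M (+ M) inv) (S-mono M (λ m p q → subst (_≤ + x * inv (n ℕ.* m)) (scaled M m p q)
        (*-monoʳ-≤-nonNeg (inv (n ℕ.* m)) {{ℤ.nonNegative (inv≥0 _)}} (+≤ (quo-mul≤ x n)))))
      hi : S M (λ m → + x * inv (n ℕ.* m)) ≤ + suc M * H M
      hi = subst (S M (λ m → + x * inv (n ℕ.* m)) ≤_) (S-* M (+ suc M) inv) (S-mono M (λ m p q → subst (+ x * inv (n ℕ.* m) ≤_) (scaled (suc M) m p q)
        (*-monoʳ-≤-nonNeg (inv (n ℕ.* m)) {{ℤ.nonNegative (inv≥0 _)}} (+≤ (ℕₚ.<⇒≤ (<quo x n 1≤n))))))
      core : ∀ f s m h c → m * h - c * m ≤ f → f ≤ m * h - c * m + + 2 * h → m * h ≤ s → s ≤ (1ℤ + m) * h → 0ℤ ≤ h →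
             (- (+ 2 * h) ≤ f - s + m * c) × (f - s + m * c ≤ + 2 * h)
      core f s m h c p q r t u = lin (p ⊕ t ⊕ u) (solve (f ∷ s ∷ m ∷ h ∷ c ∷ [])) , lin (q ⊕ r) (solve (f ∷ s ∷ m ∷ h ∷ c ∷ []))

    T-μlog : ∀ x k → 1 ℕ.≤ k → T₁ k (λ n → μ n * (L x - L n)) ≡ L x * χ (k ℕ.≟ 1) + Λ k
    T-μlog x k 1≤k = begin
      T₁ k (λ n → μ n * (L x - L n)) ≡⟨ T-cong k (λ n _ _ → alg (μ n) (L x) (L n)) ⟩
      T₁ k (λ n → L x * μ n + - 1ℤ * (μ n * L n)) ≡⟨ T₁-+ k (λ n → L x * μ n) (λ n → - 1ℤ * (μ n * L n)) ⟩
      T₁ k (λ n → L x * μ n) + T₁ k (λ n → - 1ℤ * (μ n * L n)) ≡⟨ cong₂ _+_ (T₁-* k (L x) μ) (T₁-* k (- 1ℤ) (λ n → μ n * L n)) ⟩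
      L x * T₁ k μ + - 1ℤ * T₁ k (λ n → μ n * L n) ≡⟨ cong₂ (λ u v → L x * u + - 1ℤ * v) (T-μ k 1≤k) (T-μL k 1≤k) ⟩
      L x * χ (k ℕ.≟ 1) + - 1ℤ * - Λ k ≡⟨ cong (λ z → L x * χ (k ℕ.≟ 1) + z) (alg′ (Λ k)) ⟩
      L x * χ (k ℕ.≟ 1) + Λ k ∎
      where
      open ≡-Reasoning
      alg : ∀ a b c → a * (b - c) ≡ b * a + - 1ℤ * (a * c)
      alg = solve-∀
      alg′ : ∀ a → - 1ℤ * - a ≡ a
      alg′ = solve-∀

    -- Collecting the pairs (n, m) by their product k gives F x k the coefficient that `T-μlog`
    -- evaluates: the sum over the divisors n of k of μ(n) log(x/n).
    tatuzawa-iseki : ∀ x → 1 ℕ.≤ x → S x (λ n → (μ n * (L x - L n)) * S (quo x n) (λ m → F x (n ℕ.* m))) ≡ F x 1 * L x + S x (λ k → Λ k * F x k)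
    tatuzawa-iseki x 1≤x = begin
      S x (λ n → g n * S (quo x n) (λ m → F x (n ℕ.* m))) ≡⟨ S-cong x (λ n _ _ → sym (S-* (quo x n) (g n) (λ m → F x (n ℕ.* m)))) ⟩
      S x (λ n → S (quo x n) (λ m → g n * F x (n ℕ.* m))) ≡⟨ sym (hyperbola x (λ n m → g n * F x (n ℕ.* m))) ⟩
      S x (λ k → T k (λ n m → g n * F x (n ℕ.* m))) ≡⟨ S-cong x inner ⟩
      S x (λ k → χ (k ℕ.≟ 1) * (F x k * L x) + Λ k * F x k) ≡⟨ S-+ x (λ k → χ (k ℕ.≟ 1) * (F x k * L x)) (λ k → Λ k * F x k) ⟩
      S x (λ k → χ (k ℕ.≟ 1) * (F x k * L x)) + S x (λ k → Λ k * F x k) ≡⟨ cong (_+ S x (λ k → Λ k * F x k)) (trans (S-trunc 1 x 1≤x (λ k p _ → cong (_* (F x k * L x)) (χ-no (k ℕ.≟ 1) (ℕₚ.>⇒≢ p)))) (trans (+-identityˡ (1ℤ * (F x 1 * L x))) (*-identityˡ (F x 1 * L x)))) ⟩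
      F x 1 * L x + S x (λ k → Λ k * F x k) ∎
      where
      open ≡-Reasoning
      g : ℕ → ℤ
      g n = μ n * (L x - L n)
      alg : ∀ a b c d → d * (a * b + c) ≡ b * (d * a) + c * d
      alg = solve-∀
      inner : ∀ k → 1 ℕ.≤ k → k ℕ.≤ x → T k (λ n m → g n * F x (n ℕ.* m)) ≡ χ (k ℕ.≟ 1) * (F x k * L x) + Λ k * F x k
      inner k 1≤k _ = trans (T-cong k {λ n m → g n * F x (n ℕ.* m)} {λ n _ → F x k * g n} (λ n p n∣k → trans (cong (λ z → g n * F x z) (n*quo n∣k p)) (*-comm (g n) (F x k)))) (trans (T₁-* k (F x k) g)
        (trans (cong (F x k *_) (T-μlog x k 1≤k)) (alg (L x) (χ (k ℕ.≟ 1)) (Λ k) (F x k))))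
        where
        n*quo : ∀ {n} → n ∣ k → 1 ℕ.≤ n → n ℕ.* quo k n ≡ k
        n*quo {n} (divides q refl) p = trans (cong (n ℕ.*_) (quo-mult q n p)) (ℕₚ.*-comm n q)

    Kb : ℕ → ℤ
    Kb n = K * + bl n

    0≤Kb : ∀ n → 0ℤ ≤ Kb n
    0≤Kb n = *-nonneg {K} {+ bl n} 0≤K (0≤+ _)

    K≤Kb : ∀ n → 1 ℕ.≤ n → K ≤ Kb n
    K≤Kb n h = subst (_≤ Kb n) (*-identityʳ K) (_⊛_ {K} {1ℤ} {+ bl n} 0≤K (+≤ (1≤bl n h)))

    -- The terms at 2j and 2j + 1 together are at most the term at j, so only the first term `K` is
    -- left over.
    H-half : ∀ h → (2 ℕ.* h ℕ.≤ X → H (2 ℕ.* h) ≤ K + H h) × (suc (2 ℕ.* h) ℕ.≤ X → H (suc (2 ℕ.* h)) ≤ K + H h)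
    H-half zero = (λ _ → subst (0ℤ ≤_) (sym (+-identityʳ K)) 0≤K) , (λ _ → ≤-of (trans (+-identityˡ (inv 1)) (trans inv-1 (sym (+-identityʳ K)))))
    H-half (suc h) = subst (λ z → (z ℕ.≤ X → H z ≤ K + H (suc h)) × (suc z ℕ.≤ X → H (suc z) ≤ K + H (suc h))) (sym (ℕₚ.*-suc 2 h))
        ( (λ q → even (H (suc h₂)) (inv (2 ℕ.+ h₂)) (H h) (inv (suc h)) K (odd′ (ℕₚ.<⇒≤ q)) (anti q))
        , (λ q → odd (H (suc h₂)) (inv (2 ℕ.+ h₂)) (inv (3 ℕ.+ h₂)) (H h) (inv (suc h)) K (odd′ (ℕₚ.<⇒≤ (ℕₚ.<⇒≤ q)))
            (inv-anti (2 ℕ.+ h₂) (3 ℕ.+ h₂) (ℕ.s≤s ℕ.z≤n) (ℕₚ.n≤1+n _) q) (double (ℕₚ.<⇒≤ q))))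
      where
      h₂ : ℕ
      h₂ = 2 ℕ.* h
      odd′ : suc h₂ ℕ.≤ X → H (suc h₂) ≤ K + H h
      odd′ = proj₂ (H-half h)
      anti : 2 ℕ.+ h₂ ℕ.≤ X → inv (2 ℕ.+ h₂) ≤ inv (suc h)
      anti = inv-anti (suc h) (2 ℕ.+ h₂) (ℕ.s≤s ℕ.z≤n) (ℕ.s≤s (ℕₚ.m≤n⇒m≤1+n (ℕₚ.m≤m+n h _)))
      double : 2 ℕ.+ h₂ ℕ.≤ X → + 2 * inv (2 ℕ.+ h₂) ≡ inv (suc h)
      double q = trans (cong (λ z → + 2 * inv z) (sym (ℕₚ.*-suc 2 h))) (inv-mul 2 (suc h) (ℕ.s≤s ℕ.z≤n) (ℕ.s≤s ℕ.z≤n) (subst (ℕ._≤ X) (sym (ℕₚ.*-suc 2 h)) q))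
      even : ∀ a b c d k → a ≤ k + c → b ≤ d → a + b ≤ k + (c + d)
      even a b c d k p q = lin (p ⊕ q) (solve (a ∷ b ∷ c ∷ d ∷ k ∷ []))
      odd : ∀ a b b′ c d k → a ≤ k + c → b′ ≤ b → + 2 * b ≡ d → a + b + b′ ≤ k + (c + d)
      odd a b b′ c .(+ 2 * b) k p q refl = lin (p ⊕ q) (solve (a ∷ b ∷ b′ ∷ c ∷ k ∷ []))

    H≤Kb : ∀ n → n ℕ.≤ X → H n ≤ Kb n
    H≤Kb = half-ind _ (λ _ → 0≤Kb 0) step
      where
      step : ∀ n → 1 ℕ.≤ n → (half n ℕ.≤ X → H (half n) ≤ Kb (half n)) → n ℕ.≤ X → H n ≤ Kb n
      step n 1≤n ih n≤X = ≤-trans bound (≤-trans (+-monoʳ-≤ K (ih (ℕₚ.≤-trans (ℕₚ.<⇒≤ (half< n 1≤n)) n≤X)))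
          (≤-of (trans (alg K (+ bl (half n))) (cong (λ z → K * + z) (sym (bl-half n 1≤n))))))
        where
        alg : ∀ k b → k + k * b ≡ k * (1ℤ + b)
        alg = solve-∀
        bound : H n ≤ K + H (half n)
        bound with half-cases n
        ... | inj₁ e = subst (λ z → H z ≤ K + H (half n)) (sym e) (proj₁ (H-half (half n)) (subst (ℕ._≤ X) e n≤X))
        ... | inj₂ e = subst (λ z → H z ≤ K + H (half n)) (sym e) (proj₂ (H-half (half n)) (subst (ℕ._≤ X) e n≤X))

    -- The terms from n j to n (j + 1) are n in number and at most K / (n j), hence sum to at most K
    -- / j.
    H-gap : ∀ n M y → 1 ℕ.≤ n → y ℕ.≤ n ℕ.* suc M → y ℕ.≤ X → H y - H n ≤ H M
    H-gap n zero y 1≤n y≤ y≤X = lin (H-mono {y} {n} (subst (y ℕ.≤_) (ℕₚ.*-identityʳ n) y≤)) (alg (H y) (H n))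
      where
      alg : ∀ a b → 0ℤ - (a - b) ≡ b - a
      alg = solve-∀
    H-gap n (suc M) y 1≤n y≤ y≤X with y ℕ.≤? n ℕ.* suc M
    ... | yes p = ≤-trans (H-gap n M y 1≤n p y≤X) (H-mono (ℕₚ.n≤1+n M))
    ... | no p = core (H y) (H N) (H n) (H M) (inv N) (inv (suc M)) (+ y) (+ N) (+ n) (inv≥0 N)
          (H-gap n M N 1≤n ℕₚ.≤-refl N≤X) block (subst (λ z → + y ≤ + z) (ℕₚ.*-suc n (suc M)) (+≤ y≤)) (inv-mul n (suc M) 1≤n (ℕ.s≤s ℕ.z≤n) N≤X)
      where
      N : ℕ
      N = n ℕ.* suc M
      N≤y : N ℕ.≤ y
      N≤y = ℕₚ.<⇒≤ (ℕₚ.≰⇒> p)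
      N≤X : N ℕ.≤ X
      N≤X = ℕₚ.≤-trans N≤y y≤X
      block : H y - H N ≤ + y * inv N - + N * inv N
      block = subst (H y - H N ≤_) (cong₂ _-_ (S-const y (inv N)) (S-const N (inv N))) (S-incr-mono N y N≤y (λ k lo hi → inv-anti N k (1≤* 1≤n (ℕ.s≤s ℕ.z≤n)) (ℕₚ.<⇒≤ lo) (ℕₚ.≤-trans hi y≤X)))
      core : ∀ hy hN hn hM i i′ y N n → 0ℤ ≤ i → hN - hn ≤ hM → hy - hN ≤ y * i - N * i → y ≤ n + N → n * i ≡ i′ → hy - hn ≤ hM + i′
      core hy hN hn hM i .(n * i) y N n hi p q r refl = lin (p ⊕ q ⊕ (_⊛_ {i} {y} {n + N} hi r)) (solve (hy ∷ hN ∷ hn ∷ hM ∷ i ∷ y ∷ N ∷ n ∷ []))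

    log-gap : ∀ x n → 1 ℕ.≤ n → n ℕ.≤ x → x ℕ.≤ X → (- (+ 3 * Kb (quo x n)) ≤ L x - L n) × (L x - L n ≤ + 3 * Kb (quo x n))
    log-gap x n 1≤n n≤x x≤X = core (L x) (L n) (H x) (H n) (H M) a₀ (inv x) (inv n) K (Kb M) Xe
        (L-mono n x 1≤n n≤x x≤X) Xe≤K (K≤Kb M (1≤quo x n 1≤n n≤x)) (0≤Kb M)
        (proj₁ (L≈H x 1≤x x≤X)) (proj₂ (L≈H n 1≤n n≤X)) (inv≤K x 1≤x x≤X) (inv≤K n 1≤n n≤X)
        (H-gap n M x 1≤n (ℕₚ.<⇒≤ (subst (x ℕ.<_) (ℕₚ.*-comm (suc M) n) (<quo x n 1≤n))) x≤X) (H≤Kb M (ℕₚ.≤-trans (quo-≤ x n) x≤X))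
      where
      M : ℕ
      M = quo x n
      1≤x : 1 ℕ.≤ x
      1≤x = ℕₚ.≤-trans 1≤n n≤x
      n≤X : n ℕ.≤ X
      n≤X = ℕₚ.≤-trans n≤x x≤X
      core : ∀ lx ln hx hn hM a ix iN k kb xe → ln ≤ lx + xe → xe ≤ k → k ≤ kb → 0ℤ ≤ kb → a ≤ hx - lx + ix → hn - ln ≤ a + iN → ix ≤ k → iN ≤ k → hx - hn ≤ hM → hM ≤ kb →
             (- (+ 3 * kb) ≤ lx - ln) × (lx - ln ≤ + 3 * kb)
      core lx ln hx hn hM a ix iN k kb xe p q r s t u v w y z = lin (p ⊕ q ⊕ r ⊕ 2 ⊗ s) (solve (lx ∷ ln ∷ xe ∷ k ∷ kb ∷ []))
        , lin (2 ⊗ r ⊕ t ⊕ u ⊕ v ⊕ w ⊕ y ⊕ z) (solve (lx ∷ ln ∷ hx ∷ hn ∷ hM ∷ a ∷ ix ∷ iN ∷ k ∷ kb ∷ []))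

    L≤3Kb : ∀ x → 1 ℕ.≤ x → x ℕ.≤ X → L x ≤ + 3 * Kb x
    L≤3Kb x 1≤x x≤X = subst₂ _≤_ (+-identityʳ (L x)) (cong (λ z → + 3 * Kb z) (quo-1 x)) (proj₂ (log-gap x 1 ℕₚ.≤-refl 1≤x x≤X))

    -- E(y) approximates log of the central binomial coefficient.
    E : ℕ → ℤ
    E y = Lf (2 ℕ.* y) - + 2 * Lf y

    -- The difference of the floor of 2y/d and twice the floor of y/d is 0 or 1, and it is 1 for y <
    -- d ≤ 2y.
    ψ-binomial : ∀ y → (ψ (2 ℕ.* y) - ψ y ≤ E y) × (E y ≤ ψ (2 ℕ.* y))
    ψ-binomial y = subst₂ _≤_ e₁ (sym eE) (S-mono N lo) , subst (_≤ ψ N) (sym eE) (S-mono N hi)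
      where
      N : ℕ
      N = 2 ℕ.* y
      y≤N : y ℕ.≤ N
      y≤N = ℕₚ.m≤m+n y _
      w : ℕ → ℤ
      w d = (+ quo N d - + 2 * + quo y d) * Λ d
      eE : E y ≡ S N w
      eE = trans (cong₂ (λ u v → u - + 2 * v) (Lf-Λ N) (trans (Lf-Λ y) (sym (S-trunc y N y≤N (λ k p _ → cong (λ z → + z * Λ k) (quo-small y k p))))))
        (trans (cong (λ z → S N (λ d → + quo N d * Λ d) - z) (sym (S-* N (+ 2) (λ d → + quo y d * Λ d)))) (trans (sym (S-minus N _ _)) (S-cong N (λ d _ _ → alg (+ quo N d) (+ quo y d) (Λ d)))))
        where
        alg : ∀ a b c → a * c - + 2 * (b * c) ≡ (a - + 2 * b) * c
        alg = solve-∀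
      two : ∀ d → 1 ℕ.≤ d → (2 ℕ.* quo y d ℕ.≤ quo N d) × (quo N d ℕ.≤ suc (2 ℕ.* quo y d))
      two d 1≤d = ≤quo N d _ 1≤d (subst (ℕ._≤ N) (sym (ℕₚ.*-assoc 2 (quo y d) d)) (ℕₚ.*-monoʳ-≤ 2 (quo-mul≤ y d)))
        , quo≤ N d _ (subst (N ℕ.<_) (trans (sym (ℕₚ.*-assoc 2 (suc (quo y d)) d)) (cong (ℕ._* d) (ℕₚ.*-suc 2 (quo y d)))) (ℕₚ.*-monoʳ-< 2 (<quo y d 1≤d)))
      c : ℕ → ℤ
      c d = χ (suc y ℕ.≤? d) * Λ d
      lower : ∀ q r (λd : ℤ) → r ≤ q → 0ℤ ≤ λd → 0ℤ ≤ (q - r) * λd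
      lower q r λd p h = *-nonneg {q - r} {λd} (i≤j⇒0≤j-i p) h
      lo : ∀ d → 1 ℕ.≤ d → d ℕ.≤ N → c d ≤ w d
      lo d 1≤d d≤N with suc y ℕ.≤? d
      ... | no _ = lower (+ quo N d) (+ 2 * + quo y d) (Λ d) (subst (_≤ + quo N d) (pos-* 2 (quo y d)) (+≤ (proj₁ (two d 1≤d)))) (Λ≥0′ d 1≤d)
      ... | yes y<d = subst (λ z → 1ℤ * Λ d ≤ (+ quo N d - + 2 * + z) * Λ d) (sym (quo-small y d y<d))
            (mulʳ 1ℤ (+ quo N d - + 2 * + 0) (Λ d) (Λ≥0′ d 1≤d) (lin (+≤ (1≤quo N d 1≤d d≤N)) (alg (+ quo N d))))
        where
        alg : ∀ a → a - + 2 * + 0 - 1ℤ ≡ a - 1ℤ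
        alg = solve-∀
      hi : ∀ d → 1 ℕ.≤ d → d ℕ.≤ N → w d ≤ Λ d
      hi d 1≤d _ = subst (w d ≤_) (*-identityˡ (Λ d)) (mulʳ (+ quo N d - + 2 * + quo y d) 1ℤ (Λ d) (Λ≥0′ d 1≤d)
        (lin (subst (+ quo N d ≤_) (cong (λ z → 1ℤ + z) (pos-* 2 (quo y d))) (+≤ (proj₂ (two d 1≤d)))) (alg (+ quo N d) (+ quo y d))))
        where
        alg : ∀ a b → 1ℤ - (a - + 2 * b) ≡ 1ℤ + + 2 * b - a
        alg = solve-∀
      e₁ : S N c ≡ ψ N - ψ y
      e₁ = S-tail Λ y N y≤N

    l₂ : ℤ
    l₂ = L 2

    l₂≥0 : 0ℤ ≤ l₂
    l₂≥0 = L≥0 l≥0 2 (ℕ.s≤s ℕ.z≤n)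

    -- Since L (2y + 2) = L 2 + L (y + 1), passing to y + 1 adds 2 `l₂` minus the increment L (2y +
    -- 2) - L (2y + 1). These increments are nearly nonnegative and sum to at most H (2y) up to the
    -- errors.
    E-bounds : ∀ y → 2 ℕ.* y ℕ.≤ X → (E y ≤ + y * (+ 2 * l₂ + e)) × (+ y * (+ 2 * l₂) - H (2 ℕ.* y) - + y * e ≤ E y)
    E-bounds zero _ = ≤-refl , ≤-refl
    E-bounds (suc y) h = subst (λ z → (Lf z - + 2 * Lf (suc y) ≤ + suc y * (+ 2 * l₂ + e)) × (+ suc y * (+ 2 * l₂) - H z - + suc y * e ≤ Lf z - + 2 * Lf (suc y))) (sym (ℕₚ.*-suc 2 y))
        (core (Lf y₂) (L (suc y₂)) (L (2 ℕ.+ y₂)) (Lf y) (L (suc y)) (H y₂) (inv (suc y₂)) (inv (2 ℕ.+ y₂)) l₂ e (+ y)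
          (proj₁ ih) (proj₂ ih) L2 (L-up (suc y₂) (ℕ.s≤s ℕ.z≤n) y₂<X) (L-down (suc y₂) (ℕ.s≤s ℕ.z≤n) y₂<X) (inv≥0 (2 ℕ.+ y₂)))
      where
      y₂ : ℕ
      y₂ = 2 ℕ.* y
      y₂<X : suc y₂ ℕ.< X
      y₂<X = subst (ℕ._≤ X) (ℕₚ.*-suc 2 y) h
      ih = E-bounds y (ℕₚ.<⇒≤ (ℕₚ.<⇒≤ y₂<X))
      L2 : L (2 ℕ.+ y₂) ≡ l₂ + L (suc y)
      L2 = trans (cong L (sym (ℕₚ.*-suc 2 y))) (L-* 2 (ℕ.s≤s ℕ.z≤n) (suc y) (ℕ.s≤s ℕ.z≤n))
      core : ∀ f l1 l2′ g ls h i1 i2 l2 e y → f - + 2 * g ≤ y * (+ 2 * l2 + e) → y * (+ 2 * l2) - h - y * e ≤ f - + 2 * g → l2′ ≡ l2 + ls →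
             l2′ ≤ l1 + i1 + e → l1 + i2 ≤ l2′ + e → 0ℤ ≤ i2 →
             (f + l1 + l2′ - + 2 * (g + ls) ≤ (1ℤ + y) * (+ 2 * l2 + e)) × ((1ℤ + y) * (+ 2 * l2) - (h + i1 + i2) - (1ℤ + y) * e ≤ f + l1 + l2′ - + 2 * (g + ls))
      core f l1 .(l2 + ls) g ls h i1 i2 l2 e y p q refl r s t = lin (p ⊕ s ⊕ t) (solve (f ∷ l1 ∷ g ∷ ls ∷ i2 ∷ l2 ∷ e ∷ y ∷ []))
        , lin (q ⊕ r ⊕ t) (solve (f ∷ l1 ∷ g ∷ ls ∷ h ∷ i1 ∷ i2 ∷ l2 ∷ e ∷ y ∷ []))

    Λ≤L : ∀ n → 1 ℕ.≤ n → Λ n ≤ L n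
    Λ≤L n@(suc n₀) 1≤n = subst (Λ n ≤_) (T-Λ n 1≤n) (subst (_≤ T₁ n Λ) (trans (+-identityˡ (χ (n ∣? n) * Λ n)) (trans (cong (_* Λ n) (χ-yes (n ∣? n) ∣-refl)) (*-identityˡ (Λ n))))
      (+-monoˡ-≤ (χ (n ∣? n) * Λ n) (S-nonneg n₀ {λ d → χ (d ∣? n) * Λ d} (λ d p _ → *-nonneg {χ (d ∣? n)} {Λ d} (0≤χ (d ∣? n)) (Λ≥0′ d p)))))

    -- Each halving adds at most `E` at x/2, and Λ x ≤ 3 K bl x if x is odd. There are bl x
    -- halvings.
    ψ-upper : ∀ x → x ℕ.≤ X → ψ x ≤ (+ 2 * l₂ + e) * + x + + 3 * (K * sq (bl x))
    ψ-upper = half-ind _ (λ _ → ≤-of (alg (+ 2 * l₂ + e) K)) step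
      where
      alg : ∀ d k → 0ℤ ≡ d * 0ℤ + + 3 * (k * (0ℤ * 0ℤ))
      alg = solve-∀
      step : ∀ x → 1 ℕ.≤ x → (half x ℕ.≤ X → ψ (half x) ≤ (+ 2 * l₂ + e) * + half x + + 3 * (K * sq (bl (half x)))) →
             x ℕ.≤ X → ψ x ≤ (+ 2 * l₂ + e) * + x + + 3 * (K * sq (bl x))
      step x 1≤x ih x≤X = subst (λ z → ψ x ≤ (+ 2 * l₂ + e) * + x + + 3 * (K * sq z)) (sym (bl-half x 1≤x))
          (core (ψ x) (ψ h) (E h) l₂ e (+ h) (+ x) K (+ bl h) l₂≥0 e≥0 0≤K (0≤+ (bl h)) (ih h≤X) (proj₁ (E-bounds h 2h≤X)) (subst (_≤ + x) (pos-* 2 h) (+≤ (2*half≤ x)))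
            (subst (λ z → ψ x ≤ ψ h + E h + + 3 * (K * + z)) (bl-half x 1≤x) bound))
        where
        h : ℕ
        h = half x
        h≤X : h ℕ.≤ X
        h≤X = ℕₚ.≤-trans (ℕₚ.<⇒≤ (half< x 1≤x)) x≤X
        2h≤X : 2 ℕ.* h ℕ.≤ X
        2h≤X = ℕₚ.≤-trans (2*half≤ x) x≤X
        aux₁ : ∀ a b c d → a - b ≤ c → 0ℤ ≤ d → a ≤ b + c + + 3 * d
        aux₁ a b c d p q = lin (p ⊕ 3 ⊗ q) (solve (a ∷ b ∷ c ∷ d ∷ []))
        aux₂ : ∀ a b c d f → a - b ≤ c → f ≤ + 3 * d → a + f ≤ b + c + + 3 * d
        aux₂ a b c d f p q = lin (p ⊕ q) (solve (a ∷ b ∷ c ∷ d ∷ f ∷ []))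
        bound : ψ x ≤ ψ h + E h + + 3 * Kb x
        bound with half-cases x
        ... | inj₁ eq = subst (λ z → ψ z ≤ ψ h + E h + + 3 * Kb x) (sym eq) (aux₁ (ψ (2 ℕ.* h)) (ψ h) (E h) (Kb x) (proj₁ (ψ-binomial h)) (0≤Kb x))
        ... | inj₂ eq = subst (λ z → ψ z ≤ ψ h + E h + + 3 * Kb x) (sym eq) (aux₂ (ψ (2 ℕ.* h)) (ψ h) (E h) (Kb x) (Λ (suc (2 ℕ.* h))) (proj₁ (ψ-binomial h))
               (subst (λ z → Λ z ≤ + 3 * Kb x) eq (≤-trans (Λ≤L x 1≤x) (L≤3Kb x 1≤x x≤X))))
        core : ∀ px ph eh l e h x k b → 0ℤ ≤ l → 0ℤ ≤ e → 0ℤ ≤ k → 0ℤ ≤ b → ph ≤ (+ 2 * l + e) * h + + 3 * (k * (b * b)) → eh ≤ h * (+ 2 * l + e) → + 2 * h ≤ x →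
               px ≤ ph + eh + + 3 * (k * (1ℤ + b)) → px ≤ (+ 2 * l + e) * x + + 3 * (k * ((1ℤ + b) * (1ℤ + b)))
        core px ph eh l e h x k b hl he hk hb p q r s = lin (p ⊕ q ⊕ (_⊛_ {+ 2 * l + e} {+ 2 * h} {x} (+-nonneg {+ 2 * l} {e} (*-nonneg {+ 2} {l} (0≤+ 2) hl) he) r) ⊕ s ⊕ 3 ⊗ *-nonneg {k} {b} hk hb)
          (solve (px ∷ ph ∷ eh ∷ l ∷ e ∷ h ∷ x ∷ k ∷ b ∷ []))

    -- log 2 = log 4 - log 2 lies between 1/3 + 1/4 = 7/12 and 1/2 + 1/3 = 5/6; doubling the latter
    -- gives Chebyshev's constant 5/3.
    l₂-bounds : (+ 6 * l₂ ≤ + 5 * K + + 12 * e) × (+ 7 * K ≤ + 12 * l₂ + + 24 * e)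
    l₂-bounds = core l₂ (L 3) (L 4) (inv 2) (inv 3) (inv 4) e K (L-* 2 (ℕ.s≤s ℕ.z≤n) 2 (ℕ.s≤s ℕ.z≤n))
        (L-up 2 (ℕ.s≤s ℕ.z≤n) 3≤X) (L-up 3 (ℕ.s≤s ℕ.z≤n) 4≤X) (L-down 2 (ℕ.s≤s ℕ.z≤n) 3≤X) (L-down 3 (ℕ.s≤s ℕ.z≤n) 4≤X)
        (k*inv 2 (ℕ.s≤s ℕ.z≤n) (ℕₚ.<⇒≤ 3≤X)) (k*inv 3 (ℕ.s≤s ℕ.z≤n) 3≤X) (k*inv 4 (ℕ.s≤s ℕ.z≤n) 4≤X)
      where
      3≤X : 3 ℕ.≤ X
      3≤X = ℕₚ.<⇒≤ 4≤X
      core : ∀ l l3 l4 i2 i3 i4 e k → l4 ≡ l + l → l3 ≤ l + i2 + e → l4 ≤ l3 + i3 + e → l + i3 ≤ l3 + e → l3 + i4 ≤ l4 + e →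
             + 2 * i2 ≡ k → + 3 * i3 ≡ k → + 4 * i4 ≡ k → (+ 6 * l ≤ + 5 * k + + 12 * e) × (+ 7 * k ≤ + 12 * l + + 24 * e)
      core l l3 .(l + l) i2 i3 i4 e k refl p q r s a b c =
          lin (6 ⊗ (p ⊕ q) ⊕ 3 ⊗ ≤-of a ⊕ 2 ⊗ ≤-of b) (solve (l ∷ l3 ∷ i2 ∷ i3 ∷ e ∷ k ∷ []))
        , lin (12 ⊗ (r ⊕ s) ⊕ 4 ⊗ ≤-of (sym b) ⊕ 3 ⊗ ≤-of (sym c)) (solve (l ∷ l3 ∷ i3 ∷ i4 ∷ e ∷ k ∷ []))

    xe≤K : ∀ x → x ℕ.≤ X → + x * e ≤ K
    xe≤K x h = ≤-trans (ne≤Xe x h) Xe≤K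

    ψ-sharp : ∀ x → x ℕ.≤ X → + 3 * ψ x ≤ + 5 * (K * + x) + + 15 * K + + 9 * (K * sq (bl x))
    ψ-sharp x h = core (ψ x) l₂ e (+ x) K (K * sq (bl x)) (ψ-upper x h) (mulʳ (+ 6 * l₂) (+ 5 * K + + 12 * e) (+ x) (0≤+ x) (proj₁ l₂-bounds)) (xe≤K x h)
      where
      core : ∀ p l e x k s → p ≤ (+ 2 * l + e) * x + + 3 * s → + 6 * l * x ≤ (+ 5 * k + + 12 * e) * x → x * e ≤ k → + 3 * p ≤ + 5 * (k * x) + + 15 * k + + 9 * s
      core p l e x k s a b c = lin (3 ⊗ a ⊕ b ⊕ 15 ⊗ c) (solve (p ∷ l ∷ e ∷ x ∷ k ∷ s ∷ []))

    Kx-mono : ∀ {a b : ℤ} → a ≤ b → K * a ≤ K * b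
    Kx-mono {a} {b} h = _⊛_ {K} {a} {b} 0≤K h

    -- 3 · 43 covers the 5 + 15 + 9 · 12 that `ψ-sharp` and `bl²≤` leave.
    ψ≤ : ∀ x → x ℕ.≤ X → ψ x ≤ + 43 * (K * + x)
    ψ≤ zero h = ≤-of (alg K)
      where
      alg : ∀ k → 0ℤ ≡ + 43 * (k * 0ℤ)
      alg = solve-∀
    ψ≤ x@(suc _) h = cancel-*≤ {+ 3} {ψ x} {+ 43 * (K * + x)} (+≤ (ℕ.s≤s ℕ.z≤n)) (core (ψ x) K (+ x) (sq (bl x)) 0≤K (ψ-sharp x h) (Kx-mono {1ℤ} {+ x} (+≤ (ℕ.s≤s ℕ.z≤n))) (Kx-mono (bl²≤ x)))
      where
      core : ∀ p k x s → 0ℤ ≤ k → + 3 * p ≤ + 5 * (k * x) + + 15 * k + + 9 * (k * s) → k * 1ℤ ≤ k * x → k * s ≤ k * (+ 12 * x) → + 3 * p ≤ + 3 * (+ 43 * (k * x))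
      core p k x s hk a b c = lin (a ⊕ 16 ⊗ b ⊕ 9 ⊗ c ⊕ hk) (solve (p ∷ k ∷ x ∷ s ∷ []))

    ψ-lower : ∀ y → 2 ℕ.* y ℕ.≤ X → + 7 * (K * + y) ≤ + 6 * ψ (2 ℕ.* y) + + 30 * K + + 6 * Kb (2 ℕ.* y)
    ψ-lower y h = core (ψ (2 ℕ.* y)) (E y) l₂ e (+ y) K (H (2 ℕ.* y)) (Kb (2 ℕ.* y)) (proj₂ (ψ-binomial y)) (proj₂ (E-bounds y h)) (mulʳ (+ 7 * K) (+ 12 * l₂ + + 24 * e) (+ y) (0≤+ y) (proj₂ l₂-bounds))
        (xe≤K y (ℕₚ.≤-trans (ℕₚ.m≤m+n y _) h)) (H≤Kb (2 ℕ.* y) h)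
      where
      core : ∀ p E l e y k h b → E ≤ p → y * (+ 2 * l) - h - y * e ≤ E → + 7 * k * y ≤ (+ 12 * l + + 24 * e) * y → y * e ≤ k → h ≤ b → + 7 * (k * y) ≤ + 6 * p + + 30 * k + + 6 * b
      core p E l e y k h b a c d f g = lin (6 ⊗ (a ⊕ c) ⊕ d ⊕ 30 ⊗ f ⊕ 6 ⊗ g) (solve (p ∷ E ∷ l ∷ e ∷ y ∷ k ∷ h ∷ b ∷ []))

    Sel : ℕ → ℤ
    Sel x = ψ x * L x + S x (λ k → Λ k * ψ (quo x k))

    -- With b = bl (x / n) the three factors are at most 1, 3 K b and 2 K b, and the squares b² sum
    -- to at most 12 x by `Σbl²`.
    error-sum : ∀ x → x ℕ.≤ X → (- (+ 72 * (K * (K * + x))) ≤ S x (λ n → (μ n * (L x - L n)) * S (quo x n) (λ m → F x (n ℕ.* m)))) ×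
                                (S x (λ n → (μ n * (L x - L n)) * S (quo x n) (λ m → F x (n ℕ.* m))) ≤ + 72 * (K * (K * + x)))
    error-sum x x≤X = lower , upper
      where
      t : ℕ → ℤ
      t n = (μ n * (L x - L n)) * S (quo x n) (λ m → F x (n ℕ.* m))
      c : ℕ → ℤ
      c n = + 6 * (K * K) * sq (bl (quo x n))
      each : ∀ n → 1 ℕ.≤ n → n ℕ.≤ x → (- c n ≤ t n) × (t n ≤ c n)
      each n 1≤n n≤x = subst (λ z → (- z ≤ t n) × (t n ≤ z)) (alg K (+ bl (quo x n)))
          (bound-* {1ℤ * (+ 3 * Kb (quo x n))} {+ 2 * Kb (quo x n)} {μ n * (L x - L n)} {S (quo x n) (λ m → F x (n ℕ.* m))} (proj₁ in₁) (proj₂ in₁) (≤-trans (neg-mono-≤ hk) (proj₁ ΣF)) (≤-trans (proj₂ ΣF) hk))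
        where
        alg : ∀ k b → 1ℤ * (+ 3 * (k * b)) * (+ 2 * (k * b)) ≡ + 6 * (k * k) * (b * b)
        alg = solve-∀
        ΣF = ΣF-bounds x n 1≤n n≤x x≤X
        hk : + 2 * H (quo x n) ≤ + 2 * Kb (quo x n)
        hk = 2 ⊗ H≤Kb (quo x n) (ℕₚ.≤-trans (quo-≤ x n) x≤X)
        lg = log-gap x n 1≤n n≤x x≤X
        in₁ : (- (1ℤ * (+ 3 * Kb (quo x n))) ≤ μ n * (L x - L n)) × (μ n * (L x - L n) ≤ 1ℤ * (+ 3 * Kb (quo x n)))
        in₁ = bound-* {1ℤ} {+ 3 * Kb (quo x n)} {μ n} {L x - L n} (proj₁ (μ-bounds n 1≤n)) (proj₂ (μ-bounds n 1≤n)) (proj₁ lg) (proj₂ lg)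
      total : S x c ≤ + 72 * (K * (K * + x))
      total = subst₂ _≤_ (sym (S-* x (+ 6 * (K * K)) (λ n → sq (bl (quo x n))))) (alg K (+ x)) (_⊛_ {+ 6 * (K * K)} {S x (λ n → sq (bl (quo x n)))} {+ 12 * + x} (*-nonneg {+ 6} {K * K} (0≤+ 6) (*-nonneg {K} {K} 0≤K 0≤K)) (Σbl² x))
        where
        alg : ∀ k x → + 6 * (k * k) * (+ 12 * x) ≡ + 72 * (k * (k * x))
        alg = solve-∀
      lower : - (+ 72 * (K * (K * + x))) ≤ S x t
      lower = ≤-trans (neg-mono-≤ total) (subst (_≤ S x t) (S-neg x c) (S-mono x (λ n p q → proj₁ (each n p q))))
      upper : S x t ≤ + 72 * (K * (K * + x))
      upper = ≤-trans (S-mono x (λ n p q → proj₂ (each n p q))) total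

    log-sum : ∀ x → x ℕ.≤ X → (- (K * + x) ≤ + x * L x - Lf x) × (+ x * L x - Lf x ≤ + 36 * (K * + x))
    log-sum x x≤X = subst (λ z → (- (K * + x) ≤ z) × (z ≤ + 36 * (K * + x))) eq (lower , upper)
      where
      eq : S x (λ n → L x - L n) ≡ + x * L x - Lf x
      eq = trans (S-minus x (λ _ → L x) L) (cong (_- Lf x) (S-const x (L x)))
      lower : - (K * + x) ≤ S x (λ n → L x - L n)
      lower = subst (_≤ S x (λ n → L x - L n)) (trans (S-const x (- K)) (alg (+ x) K)) (S-mono x (λ n p q → aux (L n) (L x) Xe K (L-mono n x p q x≤X) Xe≤K))
        where
        alg : ∀ x k → x * - k ≡ - (k * x)
        alg = solve-∀
        aux : ∀ a b c k → a ≤ b + c → c ≤ k → - k ≤ b - a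
        aux a b c k p q = lin (p ⊕ q) (solve (a ∷ b ∷ c ∷ k ∷ []))
      upper : S x (λ n → L x - L n) ≤ + 36 * (K * + x)
      upper = ≤-trans (S-mono x {λ n → L x - L n} {λ n → + 3 * K * sq (bl (quo x n))} (λ n p q → ≤-trans (proj₂ (log-gap x n p q x≤X)) (subst (_≤ + 3 * K * sq (bl (quo x n))) (*-assoc (+ 3) K (+ bl (quo x n))) (3K (bl≤bl² (quo x n))))))
        (subst₂ _≤_ (sym (S-* x (+ 3 * K) (λ n → sq (bl (quo x n))))) (alg K (+ x)) (3K (Σbl² x)))
        where
        alg : ∀ k x → + 3 * k * (+ 12 * x) ≡ + 36 * (k * x)
        alg = solve-∀
        3K : ∀ {a b : ℤ} → a ≤ b → + 3 * K * a ≤ + 3 * K * b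
        3K {a} {b} h = _⊛_ {+ 3 * K} {a} {b} (*-nonneg {+ 3} {K} (0≤+ 3) 0≤K) h

    -- With q the floor of x/k, the inequalities q k ≤ x ≤ (q + 1) k are multiplied by Λ k · inv k
    -- and summed; `Lf-Λ` is Legendre's formula for the sum of q Λ k.
    mertens : ∀ x → x ℕ.≤ X → (K * Lf x ≤ + x * S x (λ k → Λ k * inv k)) × (+ x * S x (λ k → Λ k * inv k) ≤ K * Lf x + K * ψ x)
    mertens x x≤X = subst₂ _≤_ (trans (S-* x K (λ k → + quo x k * Λ k)) (cong (K *_) (sym (Lf-Λ x)))) (S-* x (+ x) (λ k → Λ k * inv k)) (S-mono x (λ k p q → proj₁ (term k p q)))
      , subst₂ _≤_ (S-* x (+ x) (λ k → Λ k * inv k)) (trans (S-+ x (λ k → K * (+ quo x k * Λ k)) (λ k → K * Λ k)) (cong₂ _+_ (trans (S-* x K (λ k → + quo x k * Λ k)) (cong (K *_) (sym (Lf-Λ x)))) (S-* x K Λ))) (S-mono x (λ k p q → proj₂ (term k p q)))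
      where
      core : ∀ x k i K q Λ → k * i ≡ K → 0ℤ ≤ Λ → 0ℤ ≤ i → q * k ≤ x → x ≤ (1ℤ + q) * k → (K * (q * Λ) ≤ x * (Λ * i)) × (x * (Λ * i) ≤ K * (q * Λ) + K * Λ)
      core x k i .(k * i) q Λ refl hΛ hi a b = lin (_⊛_ {Λ * i} {q * k} {x} (*-nonneg {Λ} {i} hΛ hi) a) (solve (x ∷ k ∷ i ∷ q ∷ Λ ∷ []))
        , lin (_⊛_ {Λ * i} {x} {(1ℤ + q) * k} (*-nonneg {Λ} {i} hΛ hi) b) (solve (x ∷ k ∷ i ∷ q ∷ Λ ∷ []))
      term : ∀ k → 1 ℕ.≤ k → k ℕ.≤ x → (K * (+ quo x k * Λ k) ≤ + x * (Λ k * inv k)) × (+ x * (Λ k * inv k) ≤ K * (+ quo x k * Λ k) + K * Λ k)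
      term k p q = core (+ x) (+ k) (inv k) K (+ quo x k) (Λ k) (k*inv k p (ℕₚ.≤-trans q x≤X)) (Λ≥0′ k p) (inv≥0 k)
        (subst (_≤ + x) (pos-* (quo x k) k) (+≤ (quo-mul≤ x k))) (subst (+ x ≤_) (pos-* (suc (quo x k)) k) (+≤ (ℕₚ.<⇒≤ (<quo x k p))))

    -- In `tatuzawa-iseki` the terms x K L x and x Σ Λ(k) K/k each equal K log x! up to an error, by
    -- `log-sum` and `mertens`. The constant is 310 = 72 + 1 + 129 + 108, from `error-sum`,
    -- `log-sum` and the two products with c₀ ≤ 3 K.
    selberg : ∀ x → 1 ℕ.≤ x → x ℕ.≤ X → (- (+ 310 * (K * (K * + x))) ≤ Sel x - + 2 * (K * Lf x)) × (Sel x - + 2 * (K * Lf x) ≤ + 310 * (K * (K * + x)))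
    selberg x 1≤x x≤X = core (ψ x) (L x) (S x (λ k → Λ k * ψ (quo x k))) (S x (λ k → Λ k * inv k)) (Lf x) K c₀ (+ x) TI (F x 1) TI-eq F1 (proj₁ es) (proj₂ es)
        (K-mul (proj₁ (log-sum x x≤X))) (K-mul (proj₂ (log-sum x x≤X))) (proj₁ (mertens x x≤X)) (proj₂ (mertens x x≤X)) (K-mul (ψ≤ x x≤X))
        (c₀-mul (ψ x) (+ 43 * (K * + x)) (ψ≤ x x≤X) (0≤ψ x)) (c₀-mul (L x) (+ 36 * (K * + x)) L≤36 (L≥0 l≥0 x 1≤x))
      where
      es = error-sum x x≤X
      TI : ℤ
      TI = S x (λ n → (μ n * (L x - L n)) * S (quo x n) (λ m → F x (n ℕ.* m)))
      K-mul : ∀ {a b : ℤ} → a ≤ b → K * a ≤ K * b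
      K-mul = Kx-mono
      0≤c₀ : 0ℤ ≤ c₀
      0≤c₀ = ≤-trans 0≤K (proj₁ c₀-bounds)
      L≤36 : L x ≤ + 36 * (K * + x)
      L≤36 = aux (L x) K (+ bl x) (sq (bl x)) (+ x) (L≤3Kb x 1≤x x≤X) (Kx-mono (bl≤bl² x)) (Kx-mono (bl²≤ x))
        where
        aux : ∀ l k b s x → l ≤ + 3 * (k * b) → k * b ≤ k * s → k * s ≤ k * (+ 12 * x) → l ≤ + 36 * (k * x)
        aux l k b s x p q r = lin (p ⊕ 3 ⊗ (q ⊕ r)) (solve (l ∷ k ∷ b ∷ s ∷ x ∷ []))
      c₀-mul : ∀ a b → a ≤ b → 0ℤ ≤ a → (0ℤ ≤ c₀ * a) × (c₀ * a ≤ + 3 * (K * b))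
      c₀-mul a b a≤b 0≤a = *-nonneg {c₀} {a} 0≤c₀ 0≤a , ≤-trans (mulʳ c₀ (+ 3 * K) a 0≤a (proj₂ c₀-bounds)) (≤-trans (≤-of (*-assoc (+ 3) K a)) (3 ⊗ Kx-mono a≤b))
      F1 : F x 1 ≡ ψ x - + x * K + c₀
      F1 = cong₂ (λ u v → ψ u - + x * v + c₀) (quo-1 x) inv-1
      TI-eq : TI ≡ F x 1 * L x + (S x (λ k → Λ k * ψ (quo x k)) - + x * S x (λ k → Λ k * inv k) + c₀ * ψ x)
      TI-eq = trans (tatuzawa-iseki x 1≤x) (cong (λ z → F x 1 * L x + z) (trans (S-cong x (λ k _ _ → alg (Λ k) (ψ (quo x k)) (+ x) (inv k) c₀))
        (trans (S-+ x (λ k → Λ k * ψ (quo x k) - + x * (Λ k * inv k)) (λ k → c₀ * Λ k)) (cong₂ _+_ (trans (S-minus x _ _) (cong (λ z → S x (λ k → Λ k * ψ (quo x k)) - z) (S-* x (+ x) _))) (S-* x c₀ Λ)))))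
        where
        alg : ∀ a p x i c → a * (p - x * i + c) ≡ a * p - x * (a * i) + c * a
        alg = solve-∀
      core : ∀ p l s i f K c x ti F1 → ti ≡ F1 * l + (s - x * i + c * p) → F1 ≡ p - x * K + c → - (+ 72 * (K * (K * x))) ≤ ti → ti ≤ + 72 * (K * (K * x)) →
             K * - (K * x) ≤ K * (x * l - f) → K * (x * l - f) ≤ K * (+ 36 * (K * x)) → K * f ≤ x * i → x * i ≤ K * f + K * p → K * p ≤ K * (+ 43 * (K * x)) →
             (0ℤ ≤ c * p) × (c * p ≤ + 3 * (K * (+ 43 * (K * x)))) → (0ℤ ≤ c * l) × (c * l ≤ + 3 * (K * (+ 36 * (K * x)))) →
             (- (+ 310 * (K * (K * x))) ≤ p * l + s - + 2 * (K * f)) × (p * l + s - + 2 * (K * f) ≤ + 310 * (K * (K * x)))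
      core p l s i f K c x .((p - x * K + c) * l + (s - x * i + c * p)) .(p - x * K + c) refl refl a b d g h j kp (cp0 , cp) (cl0 , cl) =
          lin (a ⊕ d ⊕ h ⊕ cp ⊕ cl) (solve (p ∷ l ∷ s ∷ i ∷ f ∷ K ∷ c ∷ x ∷ []))
        , lin (b ⊕ g ⊕ j ⊕ kp ⊕ cp0 ⊕ cl0 ⊕ slack) (solve (p ∷ l ∷ s ∷ i ∷ f ∷ K ∷ c ∷ x ∷ []))
        where
        slack : 0ℤ ≤ + 159 * (K * (K * x))
        slack = ≤-trans (≤-of (sym (*-zeroʳ (+ 159)))) (159 ⊗ sl)
          where
          sl : 0ℤ ≤ K * (K * x)
          sl = cancel-*≤ {+ 144} {0ℤ} {K * (K * x)} (+≤ (ℕ.s≤s ℕ.z≤n)) (lin (≤-trans a b) (solve (K ∷ x ∷ p ∷ l ∷ s ∷ i ∷ c ∷ [])))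

    KK : ℤ → ℤ
    KK a = K * (K * a)

    KK-mono : ∀ {a b : ℤ} → a ≤ b → KK a ≤ KK b
    KK-mono {a} {b} h = Kx-mono {K * a} {K * b} (Kx-mono {a} {b} h)

    0≤KK : ∀ n → 0ℤ ≤ KK (+ n)
    0≤KK n = *-nonneg {K} {K * + n} 0≤K (*-nonneg {K} {+ n} 0≤K (0≤+ n))

    convolution-mono : ∀ {y w} → y ℕ.≤ w → S y (λ k → Λ k * ψ (quo y k)) ≤ S w (λ k → Λ k * ψ (quo w k))
    convolution-mono {y} {w} h = ≤-trans (S-mono y (λ k p _ → _⊛_ {Λ k} {ψ (quo y k)} {ψ (quo w k)} (Λ≥0′ k p) (ψ-mono (quo-monoˡ k h))))
      (S-mono-n y w {λ k → Λ k * ψ (quo w k)} h (λ k p _ → *-nonneg {Λ k} {ψ (quo w k)} (Λ≥0′ k (ℕₚ.≤-trans (ℕ.s≤s ℕ.z≤n) p)) (0≤ψ (quo w k))))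

    log-near : ∀ y k → 1 ℕ.≤ y → y ℕ.≤ k → k ℕ.< 4 ℕ.* y → k ℕ.≤ X → L k ≤ L y + + 6 * K
    log-near y k 1≤y y≤k k<4y k≤X = core (L k) (L y) K (+ bl (quo k y)) (proj₂ (log-gap k y 1≤y y≤k k≤X)) (Kx-mono (+≤ (bl-mono {quo k y} {3} (quo≤ k y 3 k<4y))))
      where
      core : ∀ a b k c → a - b ≤ + 3 * (k * c) → k * c ≤ k * + 2 → a ≤ b + + 6 * k
      core a b k c p q = lin (p ⊕ 3 ⊗ q) (solve (a ∷ b ∷ k ∷ c ∷ []))

    Lf-near : ∀ y w → 1 ℕ.≤ y → y ℕ.≤ w → w ℕ.< 4 ℕ.* y → w ℕ.≤ X → Lf w - Lf y ≤ (+ w - + y) * (L y + + 6 * K)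
    Lf-near y w 1≤y y≤w w<4y w≤X = subst (Lf w - Lf y ≤_) (trans (cong₂ _-_ (S-const w c) (S-const y c)) (alg (+ w) (+ y) c))
        (S-incr-mono y w {L} {λ _ → c} y≤w (λ k p q → log-near y k 1≤y (ℕₚ.<⇒≤ p) (ℕₚ.≤-<-trans q w<4y) (ℕₚ.≤-trans q w≤X)))
      where
      c : ℤ
      c = L y + + 6 * K
      alg : ∀ a b c → a * c - b * c ≡ (a - b) * c
      alg = solve-∀

    -- Selberg's formula bounds the density of prime powers in a short interval by 2.
    short-log : ∀ y w → 1 ℕ.≤ y → y ℕ.≤ w → w ℕ.< 4 ℕ.* y → w ℕ.≤ X →
                (ψ w - ψ y) * L y ≤ + 2 * (K * (+ w - + y)) * L y + + 700 * KK (+ w)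
    short-log y w 1≤y y≤w w<4y w≤X = core (ψ w) (ψ y) (L w) (L y) (S w (λ k → Λ k * ψ (quo w k))) (S y (λ k → Λ k * ψ (quo y k))) (Lf w) (Lf y) K (+ w) (+ y) Xe
        (proj₂ (selberg w (ℕₚ.≤-trans 1≤y y≤w) w≤X)) (proj₁ (selberg y 1≤y (ℕₚ.≤-trans y≤w w≤X))) (convolution-mono y≤w)
        (_⊛_ {ψ w} {L y} {L w + Xe} (0≤ψ w) (L-mono y w 1≤y y≤w w≤X)) (_⊛_ {ψ w} {Xe} {K} (0≤ψ w) Xe≤K) (Kx-mono (ψ≤ w w≤X)) (Kx-mono (Lf-near y w 1≤y y≤w w<4y w≤X)) (KK-mono (+≤ y≤w)) (0≤KK y) (0≤KK w)
      where
      core : ∀ pw py lw ly sw sy fw fy K w y xe → pw * lw + sw - + 2 * (K * fw) ≤ + 310 * (K * (K * w)) → - (+ 310 * (K * (K * y))) ≤ py * ly + sy - + 2 * (K * fy) → sy ≤ sw →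
             pw * ly ≤ pw * (lw + xe) → pw * xe ≤ pw * K → K * pw ≤ K * (+ 43 * (K * w)) → K * (fw - fy) ≤ K * ((w - y) * (ly + + 6 * K)) → K * (K * y) ≤ K * (K * w) → 0ℤ ≤ K * (K * y) → 0ℤ ≤ K * (K * w) →
             (pw - py) * ly ≤ + 2 * (K * (w - y)) * ly + + 700 * (K * (K * w))
      core pw py lw ly sw sy fw fy K w y xe a b c d f g h i j k = lin (a ⊕ b ⊕ c ⊕ d ⊕ f ⊕ g ⊕ 2 ⊗ h ⊕ 310 ⊗ i ⊕ 12 ⊗ j ⊕ 25 ⊗ k) (solve (pw ∷ py ∷ lw ∷ ly ∷ sw ∷ sy ∷ fw ∷ fy ∷ K ∷ w ∷ y ∷ xe ∷ []))

    -- The assumption on L y makes the error of `short-log`, taken g times, at most K w L y; then L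
    -- y cancels.
    short : ∀ g y w → 1 ℕ.≤ g → 1 ℕ.≤ y → y ℕ.≤ w → w ℕ.< 4 ℕ.* y → w ℕ.≤ X → + 700 * (+ g * K) ≤ L y →
            + g * (ψ w - ψ y) ≤ + 2 * (+ g * (K * (+ w - + y))) + K * + w
    short g y w 1≤g 1≤y y≤w w<4y w≤X hL = cancel-*≤ {L y} {+ g * (ψ w - ψ y)} {+ 2 * (+ g * (K * (+ w - + y))) + K * + w} 1≤Ly
        (core (+ g) (ψ w - ψ y) (+ w - + y) (+ w) K (L y) (g ⊗ short-log y w 1≤y y≤w w<4y w≤X) (_⊛_ {K * + w} {+ 700 * (+ g * K)} {L y} (*-nonneg {K} {+ w} 0≤K (0≤+ w)) hL))
      where
      1≤Ly : 1ℤ ≤ L y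
      1≤Ly = ≤-trans (aux K (+ g) 1≤K (_⊛_ {K} {1ℤ} {+ g} 0≤K (+≤ 1≤g))) hL
        where
        aux : ∀ k g → 1ℤ ≤ k → k * 1ℤ ≤ k * g → 1ℤ ≤ + 700 * (g * k)
        aux k g p q = lin (700 ⊗ (p ⊕ q) ⊕ 0≤+ 699) (solve (k ∷ g ∷ []))
      core : ∀ g p d w K l → g * (p * l) ≤ g * (+ 2 * (K * d) * l + + 700 * (K * (K * w))) → (K * w) * (+ 700 * (g * K)) ≤ (K * w) * l →
             l * (g * p) ≤ l * (+ 2 * (g * (K * d)) + K * w)
      core g p d w K l a b = lin (a ⊕ b) (solve (g ∷ p ∷ d ∷ w ∷ K ∷ l ∷ []))

    L-2^ : ∀ j → L (2 ℕ.^ j) ≡ + j * l₂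
    L-2^ zero = refl
    L-2^ (suc j) = trans (L-* 2 (ℕ.s≤s ℕ.z≤n) (2 ℕ.^ j) (ℕₚ.m^n>0 2 j)) (trans (cong (λ z → l₂ + z) (L-2^ j)) (alg l₂ (+ j)))
      where
      alg : ∀ l j → l + j * l ≡ (1ℤ + j) * l
      alg = solve-∀

    K≤2l₂ : K ≤ + 2 * l₂
    K≤2l₂ = cancel-*≤ {+ 6} {K} {+ 2 * l₂} (+≤ (ℕ.s≤s ℕ.z≤n)) (core K l₂ e (proj₂ l₂-bounds) (≤-trans (ne≤Xe 24 24≤X) Xe≤K))
      where
      core : ∀ k l e → + 7 * k ≤ + 12 * l + + 24 * e → + 24 * e ≤ k → + 6 * k ≤ + 6 * (+ 2 * l)
      core k l e p q = lin (p ⊕ q) (solve (k ∷ l ∷ e ∷ []))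

    -- `K≤2l₂` says log 2 ≥ 1/2, so 2(j + 1) factors 2 give (j + 1) K. The spare K pays for L being
    -- only nearly monotone.
    log-large : ∀ j y → 2 ℕ.^ (2 ℕ.* suc j) ℕ.≤ y → y ℕ.≤ X → + j * K ≤ L y
    log-large j y h y≤X = core (+ j) K l₂ Xe (L y) (subst (_≤ L y + Xe) (trans (L-2^ (2 ℕ.* suc j)) (cong (_* l₂) (pos-* 2 (suc j)))) (L-mono (2 ℕ.^ (2 ℕ.* suc j)) y (ℕₚ.m^n>0 2 (2 ℕ.* suc j)) h y≤X))
        Xe≤K (suc j ⊗ K≤2l₂)
      where
      core : ∀ j k l xe ly → (+ 2 * (1ℤ + j)) * l ≤ ly + xe → xe ≤ k → (1ℤ + j) * k ≤ (1ℤ + j) * (+ 2 * l) → j * k ≤ ly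
      core j k l xe ly p q r = lin (p ⊕ q ⊕ r) (solve (j ∷ k ∷ l ∷ xe ∷ ly ∷ []))

    -- Only powers p^a with a ≥ 2 are left, hence p < r. As z ≤ 2x, each p has at most one power in
    -- (x, z]. Grouping by `lpf` therefore gives r columns with at most one nonzero entry, which is
    -- bounded by L.
    primepower-gap : ∀ x z r → 1 ℕ.≤ x → x ℕ.≤ z → z ℕ.≤ 2 ℕ.* x → z ℕ.≤ X → z ℕ.< r ℕ.* r →
                     (∀ p → Prime p → x ℕ.< p → z ℕ.< p) → ψ z - ψ x ≤ + r * (+ 3 * Kb z)
    primepower-gap x z r 1≤x x≤z z≤2x z≤X z<r² noprime = subst (_≤ + r * (+ 3 * Kb z)) (S-tail Λ x z x≤z)
        (≤-trans (≤-of (trans (S-cong z spread) (S-swap z r (λ k p → χ (lpf k ℕ.≟ p) * f k)))) (≤-trans (S-mono r {λ p → S z (λ k → χ (lpf k ℕ.≟ p) * f k)} {λ _ → + 3 * Kb z} column) (≤-of (S-const r (+ 3 * Kb z)))))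
      where
      f : ℕ → ℤ
      f k = χ (suc x ℕ.≤? k) * Λ k
      0≤3Kb : 0ℤ ≤ + 3 * Kb z
      0≤3Kb = *-nonneg {+ 3} {Kb z} (0≤+ 3) (0≤Kb z)
      support : ∀ k → 1 ℕ.≤ k → k ℕ.≤ z → (f k ≡ 0ℤ) ⊎ (Σ ℕ λ p → Σ ℕ λ a → Prime p × (x ℕ.< k) × (k ≡ p ℕ.^ suc (suc a)) × (f k ≡ l p))
      support k 1≤k k≤z with suc x ℕ.≤? k | Λ k ℤ.≟ 0ℤ
      ... | no _ | _ = inj₁ refl
      ... | yes _ | yes e = inj₁ (cong (1ℤ *_) e)
      ... | yes x<k | no ne with Λ-support k 1≤k ne
      ...   | p , zero , pp , e , _ = ⊥-elim (ℕₚ.<⇒≱ (noprime k (subst Prime (sym (trans e (ℕₚ.*-identityʳ p))) pp) x<k) k≤z)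
      ...   | p , suc a , pp , e , Λ≡ = inj₂ (p , a , pp , x<k , e , trans (*-identityˡ (Λ k)) Λ≡)
      small : ∀ {p a} → Prime p → p ℕ.^ suc (suc a) ℕ.≤ z → p ℕ.< r
      small {p} {a} pp h = ℕₚ.≰⇒> (λ r≤p → ℕₚ.<⇒≱ z<r² (ℕₚ.≤-trans (ℕₚ.*-mono-≤ r≤p r≤p) (ℕₚ.≤-trans (ℕₚ.*-monoʳ-≤ p (ℕₚ.m≤m*n p (p ℕ.^ a) {{ℕ.>-nonZero (ℕₚ.m^n>0 p {{prime⇒nonZero pp}} a)}})) h)))
      spread : ∀ k → 1 ℕ.≤ k → k ℕ.≤ z → f k ≡ S r (λ p → χ (lpf k ℕ.≟ p) * f k)
      spread k 1≤k k≤z with support k 1≤k k≤z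
      ... | inj₁ e = trans e (sym (S-zero r (λ p _ _ → trans (cong (χ (lpf k ℕ.≟ p) *_) e) (*-zeroʳ (χ (lpf k ℕ.≟ p))))))
      ... | inj₂ (p , a , pp , _ , e , _) = sym (S-single r (lpf k) (f k) (subst (1 ℕ.≤_) (sym lk) (prime≥1 pp)) (subst (ℕ._≤ r) (sym lk) (ℕₚ.<⇒≤ (small {p} {a} pp (subst (ℕ._≤ z) e k≤z)))))
        where
        lk : lpf k ≡ p
        lk = trans (cong lpf e) (lpf-^ p (suc a) pp)
      column : ∀ q → 1 ℕ.≤ q → q ℕ.≤ r → S z (λ k → χ (lpf k ℕ.≟ q) * f k) ≤ + 3 * Kb z
      column q _ _ = S-atmost1 z 0≤3Kb bound one
        where
        h : ℕ → ℤ
        h k = χ (lpf k ℕ.≟ q) * f k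
        f≤ : ∀ k → 1 ℕ.≤ k → k ℕ.≤ z → f k ≤ + 3 * Kb z
        f≤ k 1≤k k≤z with suc x ℕ.≤? k
        ... | no _ = 0≤3Kb
        ... | yes _ = ≤-trans (≤-of (*-identityˡ (Λ k))) (≤-trans (Λ≤L k 1≤k) (≤-trans (L≤3Kb k 1≤k (ℕₚ.≤-trans k≤z z≤X)) (3 ⊗ Kx-mono (+≤ (bl-mono k≤z)))))
        bound : ∀ k → 1 ℕ.≤ k → k ℕ.≤ z → h k ≤ + 3 * Kb z
        bound k 1≤k k≤z with lpf k ℕ.≟ q
        ... | no _ = 0≤3Kb
        ... | yes _ = ≤-trans (≤-of (*-identityˡ (f k))) (f≤ k 1≤k k≤z)
        one : ∀ j k → 1 ℕ.≤ j → j ℕ.< k → k ℕ.≤ z → (h j ≡ 0ℤ) ⊎ (h k ≡ 0ℤ)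
        one j k 1≤j j<k k≤z with lpf j ℕ.≟ q | lpf k ℕ.≟ q | support j 1≤j (ℕₚ.≤-trans (ℕₚ.<⇒≤ j<k) k≤z) | support k (ℕₚ.≤-trans 1≤j (ℕₚ.<⇒≤ j<k)) k≤z
        ... | no _ | _ | _ | _ = inj₁ refl
        ... | yes _ | no _ | _ | _ = inj₂ refl
        ... | yes _ | yes _ | inj₁ e | _ = inj₁ (cong (1ℤ *_) e)
        ... | yes _ | yes _ | inj₂ _ | inj₁ e = inj₂ (cong (1ℤ *_) e)
        ... | yes lj | yes lk | inj₂ (p , a , pp , x<j , ej , _) | inj₂ (p′ , b , pp′ , _ , ek , _) = ⊥-elim (ℕₚ.<⇒≱ too-big (ℕₚ.≤-trans k≤z z≤2x))
          where
          pq : p ≡ q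
          pq = trans (sym (lpf-^ p (suc a) pp)) (trans (cong lpf (sym ej)) lj)
          pq′ : p′ ≡ q
          pq′ = trans (sym (lpf-^ p′ (suc b) pp′)) (trans (cong lpf (sym ek)) lk)
          k≡ : k ≡ p ℕ.^ suc (suc b)
          k≡ = trans ek (cong (ℕ._^ suc (suc b)) (trans pq′ (sym pq)))
          a<b : suc (suc a) ℕ.< suc (suc b)
          a<b = ℕₚ.≰⇒> (λ b≤a → ℕₚ.<⇒≱ j<k (subst₂ ℕ._≤_ (sym k≡) (sym ej) (ℕₚ.^-monoʳ-≤ p {{prime⇒nonZero pp}} b≤a)))
          too-big : 2 ℕ.* x ℕ.< k
          too-big = ℕₚ.<-≤-trans (ℕₚ.*-monoʳ-< 2 x<j) (ℕₚ.≤-trans (ℕₚ.*-mono-≤ (prime≥2 pp) (ℕₚ.≤-reflexive ej)) (subst (p ℕ.^ suc (suc (suc a)) ℕ.≤_) (sym k≡) (ℕₚ.^-monoʳ-≤ p {{prime⇒nonZero pp}} a<b)))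

    few-primepowers : ∀ x z h → 1 ℕ.≤ x → x ℕ.≤ z → z ℕ.≤ 2 ℕ.* x → z ℕ.≤ X → z ℕ.< 2 ℕ.^ h ℕ.* 2 ℕ.^ h → 9 ℕ.* (bl z ℕ.* bl z) ℕ.* 2 ℕ.^ h ℕ.≤ x →
                      (∀ p → Prime p → x ℕ.< p → z ℕ.< p) → (ψ z - ψ x) * L z ≤ KK (+ x)
    few-primepowers x z h 1≤x x≤z z≤2x z≤X z<r² rN²≤x noprime = core (ψ z - ψ x) (L z) K (+ (2 ℕ.^ h)) (+ bl z) (+ x) (primepower-gap x z (2 ℕ.^ h) 1≤x x≤z z≤2x z≤X z<r² noprime) (L≤3Kb z (ℕₚ.≤-trans 1≤x x≤z) z≤X) (i≤j⇒0≤j-i (ψ-mono x≤z)) 0≤K (0≤+ (bl z))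
        (Kx-mono (Kx-mono (subst (_≤ + x) (trans (pos-* (9 ℕ.* (bl z ℕ.* bl z)) (2 ℕ.^ h)) (cong (_* + (2 ℕ.^ h)) (trans (pos-* 9 (bl z ℕ.* bl z)) (cong (+ 9 *_) (pos-* (bl z) (bl z)))))) (+≤ rN²≤x))))
      where
      core : ∀ d l k r n x → d ≤ r * (+ 3 * (k * n)) → l ≤ + 3 * (k * n) → 0ℤ ≤ d → 0ℤ ≤ k → 0ℤ ≤ n → k * (k * (+ 9 * (n * n) * r)) ≤ k * (k * x) → d * l ≤ k * (k * x)
      core d l k r n x a b hd hk hn c = lin (mul d l (+ 3 * (k * n)) hd b ⊕ mul (+ 3 * (k * n)) d (r * (+ 3 * (k * n))) (*-nonneg {+ 3} {k * n} (0≤+ 3) (*-nonneg {k} {n} hk hn)) a ⊕ c) (solve (d ∷ l ∷ k ∷ r ∷ n ∷ x ∷ []))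

    -- If the von Mangoldt mass of (x, z] is negligible, Selberg's formula forces
    -- almost every interval (x/n, z/n] to have the maximal density 2.
    record Setting : Set where
      field
        x z : ℕ
        1≤x : 1 ℕ.≤ x
        x≤z : x ℕ.≤ z
        z≤2x : z ℕ.≤ 2 ℕ.* x
        z≤X : z ℕ.≤ X
        few : (ψ z - ψ x) * L z ≤ KK (+ x)
        -- 1/g₁ is the deficit tolerated in `Good`, the weight of the bad n is proportional to 1/g₂,
        -- and from Y₀ on `short` is available with precision g₁ g₂.
        g₁ g₂ Y₀ : ℕ
        1≤g₁ : 1 ℕ.≤ g₁
        1≤g₂ : 1 ℕ.≤ g₂
        1≤Y₀ : 1 ℕ.≤ Y₀
        2Y₀≤X : 2 ℕ.* Y₀ ℕ.≤ X
        Y₀-large : ∀ y → Y₀ ℕ.≤ y → y ℕ.≤ X → + 700 * (+ (g₁ ℕ.* g₂) * K) ≤ L y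
        N : ℕ
        N≡ : bl z ≡ N
        N-large : 1200 ℕ.* (g₁ ℕ.* g₂) ℕ.+ 3698 ℕ.* (g₁ ℕ.* g₂ ℕ.* bl (2 ℕ.* Y₀)) ℕ.≤ N
        m s : ℕ
        1≤m : 1 ℕ.≤ m
        s≡ : s ≡ 16 ℕ.* m
        g₁≡ : g₁ ≡ 256 ℕ.* m
        mz-lo : suc m ℕ.* x ℕ.< m ℕ.* z ℕ.+ m
        -- R is the ratio of the ends of a window, I the number of scales over which averages are
        -- taken, and Y a lower bound for the n in a window and for their quotients x / n.
        R I Y : ℕ
        1≤I : 1 ℕ.≤ I
        R-large : 2 ℕ.^ (198 ℕ.* m) ℕ.* 200 ℕ.≤ R
        budget : 27 ℕ.* (g₁ ℕ.* N) ℕ.≤ g₂ ℕ.* I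
        Y≤R^I : Y ℕ.≤ R ℕ.^ I
        YR≤x : Y ℕ.* R ℕ.^ suc (I ℕ.+ I) ℕ.≤ x
        Y-Y₀ : suc (2 ℕ.* Y₀) ℕ.≤ Y
        Y-s : suc (2 ℕ.* s) ℕ.≤ Y
        Y-2^ : 2 ℕ.^ 12 ℕ.≤ Y

    module Windows (σ : Setting) where
      open Setting σ

      1≤z : 1 ℕ.≤ z
      1≤z = ℕₚ.≤-trans 1≤x x≤z

      x≤X : x ℕ.≤ X
      x≤X = ℕₚ.≤-trans x≤z z≤X

      z≤2x′ : + z ≤ + 2 * + x
      z≤2x′ = subst (+ z ≤_) (pos-* 2 x) (+≤ z≤2x)

      -- By how much the mass of (x/n, z/n] falls short of density 2.
      D : ℕ → ℤ
      D n = + 2 * (K * (+ quo z n - + quo x n)) - (ψ (quo z n) - ψ (quo x n))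

      -- Selberg's formula at z minus the formula at x; ψ z L z - ψ x L x is small by `few` and
      -- `log-near`. The errors are 1 + 620 + 310 + 258 ≤ 1200, where 620 = 2 · 310 comes from z ≤
      -- 2x and 258 = 6 · 43.
      ΣΛD : S z (λ n → Λ n * D n) ≤ + 1200 * KK (+ x)
      ΣΛD = subst (_≤ + 1200 * KK (+ x)) (sym split)
          (ΣΛD-core (Lf z) (Lf x) cz cx (ψ z) (ψ x) (L z) (L x) K (+ z) (+ x) few (proj₁ (selberg z 1≤z z≤X)) (proj₂ (selberg x 1≤x x≤X))
            (_⊛_ {ψ x} {L z} {L x + + 6 * K} (0≤ψ x) (log-near x z 1≤x x≤z z<4x z≤X)) (Kx-mono (ψ≤ x x≤X)) (KK-mono z≤2x′) (0≤KK x))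
        where
        z<4x : z ℕ.< 4 ℕ.* x
        z<4x = ℕₚ.≤-<-trans z≤2x (ℕₚ.*-monoˡ-< x {{ℕ.>-nonZero 1≤x}} {2} {4} (ℕ.s≤s (ℕ.s≤s (ℕ.s≤s ℕ.z≤n))))
        cz cx : ℤ
        cz = S z (λ k → Λ k * ψ (quo z k))
        cx = S x (λ k → Λ k * ψ (quo x k))
        split : S z (λ n → Λ n * D n) ≡ + 2 * K * (Lf z - Lf x) - (cz - cx)
        split = trans (S-cong z (λ n _ _ → ΣΛD-alg (Λ n) K (+ quo z n) (+ quo x n) (ψ (quo z n)) (ψ (quo x n))))
          (trans (S-minus z _ _) (cong₂ _-_ (trans (S-* z (+ 2 * K) _) (cong (+ 2 * K *_) (trans (S-minus z _ _) (cong₂ _-_ (sym (Lf-Λ z)) (trans (S-trunc x z x≤z (λ k p _ → cong (λ q → + q * Λ k) (quo-small x k p))) (sym (Lf-Λ x)))))))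
            (trans (S-minus z _ _) (cong (λ c → cz - c) (S-trunc x z x≤z (λ k p _ → trans (cong (λ q → Λ k * ψ q) (quo-small x k p)) (*-zeroʳ (Λ k))))))))

      g : ℕ
      g = g₁ ℕ.* g₂
      1≤g : 1 ℕ.≤ g
      1≤g = 1≤* 1≤g₁ 1≤g₂

      f₁ : ℕ → ℤ
      f₁ n = + quo z n * Λ n

      0≤f₁ : ∀ n → 1 ℕ.≤ n → 0ℤ ≤ f₁ n
      0≤f₁ n 1≤n = *-nonneg {+ quo z n} {Λ n} (0≤+ (quo z n)) (Λ≥0′ n 1≤n)

      τ : ℕ → ℤ
      τ n = χ (suc (quo x n) ℕ.≤? Y₀)

      -- The deficit made nonnegative: where x/n ≥ Y₀ the added K z/n suffices by `short`, below Y₀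
      -- Chebyshev's constant 43 takes over.
      P : ℕ → ℤ
      P n = + g * D n + K * + quo z n + + 43 * (+ g * (K * + quo z n)) * τ n

      0≤P : ∀ n → 1 ℕ.≤ n → n ℕ.≤ z → 0ℤ ≤ P n
      0≤P n 1≤n n≤z = split (suc (quo x n) ℕ.≤? Y₀)
        where
        w<4y : 1 ℕ.≤ quo x n → quo z n ℕ.< 4 ℕ.* quo x n
        w<4y 1≤y = ℕₚ.*-cancelʳ-< n (quo z n) (4 ℕ.* quo x n) (ℕₚ.≤-<-trans (ℕₚ.≤-trans (quo-mul≤ z n) z≤2x)
          (ℕₚ.<-≤-trans (ℕₚ.*-monoʳ-< 2 (<quo x n 1≤n)) (ℕₚ.≤-trans (ℕₚ.≤-reflexive (sym (ℕₚ.*-assoc 2 (suc (quo x n)) n))) (ℕₚ.*-monoˡ-≤ n (ℕₚ.≤-trans (ℕₚ.*-monoʳ-≤ 2 (ℕₚ.+-monoˡ-≤ (quo x n) 1≤y)) (ℕₚ.≤-reflexive (double-double (quo x n))))))))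
        large : Y₀ ℕ.≤ quo x n → + g * (ψ (quo z n) - ψ (quo x n)) ≤ + 2 * (+ g * (K * (+ quo z n - + quo x n))) + K * + quo z n
        large Y₀≤y = short g (quo x n) (quo z n) 1≤g (ℕₚ.≤-trans 1≤Y₀ Y₀≤y) (quo-monoˡ n x≤z) (w<4y (ℕₚ.≤-trans 1≤Y₀ Y₀≤y)) (ℕₚ.≤-trans (quo-≤ z n) z≤X) (Y₀-large (quo x n) Y₀≤y (ℕₚ.≤-trans (quo-≤ x n) x≤X))
        split : (d : Dec (suc (quo x n) ℕ.≤ Y₀)) → 0ℤ ≤ + g * D n + K * + quo z n + + 43 * (+ g * (K * + quo z n)) * χ d
        split (yes _) = 0≤P-core (+ g) K (ψ (quo z n)) (ψ (quo x n)) (+ quo z n) (+ quo x n) (g ⊗ ψ≤ (quo z n) (ℕₚ.≤-trans (quo-≤ z n) z≤X)) (*-nonneg {+ g} {K * (+ quo z n - + quo x n)} (0≤+ g) (*-nonneg {K} {+ quo z n - + quo x n} 0≤K (i≤j⇒0≤j-i (+≤ (quo-monoˡ n x≤z)))))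
              (*-nonneg {+ g} {ψ (quo x n)} (0≤+ g) (0≤ψ (quo x n))) (*-nonneg {K} {+ quo z n} 0≤K (0≤+ _))
        split (no q) = 0≤P-core₂ (+ g) K (ψ (quo z n)) (ψ (quo x n)) (+ quo z n) (+ quo x n) (large (ℕₚ.≤-pred (ℕₚ.≰⇒> q)))

      -- The floor of z/n counts the j ≤ z/n, and these are at most 2 Y₀ where τ n = 1. After
      -- exchanging the sums, ψ(z/j) ≤ 43 K z/j leaves a harmonic sum up to 2 Y₀.
      V-bound : S z (λ n → τ n * f₁ n) ≤ + 86 * (+ x * Kb (2 ℕ.* Y₀))
      V-bound = ≤-trans (S-mono z {λ n → τ n * f₁ n} {λ n → S T₀ (λ j → h j n)} pointwise) (≤-trans (≤-of (S-swap z T₀ (λ n j → h j n))) (≤-trans (S-mono T₀ {λ j → S z (h j)} {λ j → + 43 * + z * inv j} column)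
          (≤-trans (≤-of (S-* T₀ (+ 43 * + z) inv)) (V-bound-core (+ z) (+ x) (H T₀) (Kb T₀) (_⊛_ {+ z} {H T₀} {Kb T₀} (0≤+ z) (H≤Kb T₀ 2Y₀≤X)) (mulʳ (+ z) (+ 2 * + x) (Kb T₀) (0≤Kb T₀) z≤2x′)))))
        where
        T₀ : ℕ
        T₀ = 2 ℕ.* Y₀
        h : ℕ → ℕ → ℤ
        h j n = χ (j ℕ.≤? quo z n) * Λ n
        pointwise : ∀ n → 1 ℕ.≤ n → n ℕ.≤ z → τ n * f₁ n ≤ S T₀ (λ j → h j n)
        pointwise n 1≤n _ = split (suc (quo x n) ℕ.≤? Y₀)
          where
          z/n≤T : suc (quo x n) ℕ.≤ Y₀ → quo z n ℕ.≤ T₀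
          z/n≤T q = quo≤ z n T₀ (ℕₚ.≤-<-trans z≤2x (ℕₚ.<-≤-trans (ℕₚ.*-monoʳ-< 2 (ℕₚ.<-≤-trans (<quo x n 1≤n) (ℕₚ.*-monoˡ-≤ n q))) (ℕₚ.≤-trans (ℕₚ.≤-reflexive (sym (ℕₚ.*-assoc 2 Y₀ n))) (ℕₚ.m≤n+m _ n))))
          split : (d : Dec (suc (quo x n) ℕ.≤ Y₀)) → χ d * f₁ n ≤ S T₀ (λ j → h j n)
          split (no _) = S-nonneg T₀ (λ j _ _ → *-nonneg {χ (j ℕ.≤? quo z n)} {Λ n} (0≤χ _) (Λ≥0′ n 1≤n))
          split (yes q) = ≤-of (trans (*-identityˡ (f₁ n)) (trans (sym (S-const (quo z n) (Λ n))) (sym (trans (S-trunc (quo z n) T₀ (z/n≤T q) (λ j p _ → cong (_* Λ n) (χ-no (j ℕ.≤? quo z n) (ℕₚ.<⇒≱ p))))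
                (S-cong (quo z n) (λ j _ p → trans (cong (_* Λ n) (χ-yes (j ℕ.≤? quo z n) p)) (*-identityˡ (Λ n))))))))
        column : ∀ j → 1 ℕ.≤ j → j ℕ.≤ T₀ → S z (h j) ≤ + 43 * + z * inv j
        column j 1≤j j≤T = ≤-trans (≤-of (S-trunc (quo z j) z (quo-≤ z j) (λ n p _ → cong (_* Λ n) (χ-no (j ℕ.≤? quo z n) (λ q → ℕₚ.<⇒≱ p (≤quo z j n 1≤j (ℕₚ.≤-trans (ℕₚ.≤-trans (ℕₚ.*-monoʳ-≤ n q) (ℕₚ.≤-reflexive (ℕₚ.*-comm n (quo z n)))) (quo-mul≤ z n))))))))
            (≤-trans (S-mono (quo z j) {h j} {Λ} drop) (≤-trans (ψ≤ (quo z j) (ℕₚ.≤-trans (quo-≤ z j) z≤X)) (V-bound-scaled K (+ j) (inv j) (+ quo z j) (+ z) (k*inv j 1≤j (ℕₚ.≤-trans j≤T 2Y₀≤X)) (inv≥0 j) (subst (_≤ + z) (pos-* (quo z j) j) (+≤ (quo-mul≤ z j))))))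
          where
          drop : ∀ n → 1 ℕ.≤ n → n ℕ.≤ quo z j → h j n ≤ Λ n
          drop n 1≤n _ = split (j ℕ.≤? quo z n)
            where
            split : (d : Dec (j ℕ.≤ quo z n)) → χ d * Λ n ≤ Λ n
            split (yes _) = ≤-of (*-identityˡ (Λ n))
            split (no _) = Λ≥0′ n 1≤n

      Lf-bound : Lf z ≤ + 8 * (K * (+ N * + x))
      Lf-bound = ≤-trans (S-mono z {L} {λ _ → + 4 * (K * + N)} (λ k p q → Lf-bound-each (L k) (L z) Xe K (+ N) (L-mono k z p q z≤X) (subst (λ t → L z ≤ + 3 * (K * + t)) N≡ (L≤3Kb z 1≤z z≤X)) Xe≤K (subst (λ t → K ≤ K * + t) N≡ (K≤Kb z 1≤z))))
          (≤-trans (≤-of (S-const z (+ 4 * (K * + N)))) (Lf-bound-core (+ z) (+ x) K (+ N) (mulʳ (+ z) (+ 2 * + x) (K * + N) (*-nonneg {K} {+ N} 0≤K (0≤+ N)) z≤2x′)))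

      ΣΛP : S z (λ n → Λ n * P n) ≤ + 9 * (K * (K * (+ N * + x)))
      ΣΛP = subst (_≤ + 9 * (K * (K * (+ N * + x)))) (sym split) (ΣΛP-core (+ g) K (+ N) (+ x) (+ bl (2 ℕ.* Y₀)) (S z (λ n → Λ n * D n)) (Lf z) (S z (λ n → τ n * f₁ n))
            (g ⊗ ΣΛD) (Kx-mono Lf-bound) (_⊛_ {+ g * K} {S z (λ n → τ n * f₁ n)} {+ 86 * (+ x * Kb (2 ℕ.* Y₀))} (*-nonneg {+ g} {K} (0≤+ g) 0≤K) V-bound)
            (_⊛_ {KK (+ x)} {+ 1200 * + g + + 3698 * (+ g * + bl (2 ℕ.* Y₀))} {+ N} (0≤KK x) (subst (_≤ + N) (cong₂ _+_ (pos-* 1200 g) (trans (pos-* 3698 (g ℕ.* bl (2 ℕ.* Y₀))) (cong (+ 3698 *_) (pos-* g (bl (2 ℕ.* Y₀)))))) (+≤ N-large))))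
        where
        split : S z (λ n → Λ n * P n) ≡ (+ g * S z (λ n → Λ n * D n) + K * Lf z) + + 43 * (+ g * K) * S z (λ n → τ n * f₁ n)
        split = trans (S-cong z (λ n _ _ → ΣΛP-alg (Λ n) (+ g) (D n) K (+ quo z n) (τ n))) (trans (S-+ z _ _) (cong₂ _+_ (trans (S-+ z _ _) (cong₂ _+_ (S-* z (+ g) _) (trans (S-* z K _) (cong (K *_) (sym (Lf-Λ z)))))) (S-* z (+ 43 * (+ g * K)) _)))

      Good : ℕ → Set
      Good n = + g₁ * D n ≤ K * + quo z n

      good? : ∀ n → Dec (Good n)
      good? n = + g₁ * D n ℤ.≤? K * + quo z n

      w : ℕ → ℤ
      w n = χ (¬? (good? n)) * f₁ n

      0≤w : ∀ n → 1 ℕ.≤ n → 0ℤ ≤ w n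
      0≤w n 1≤n = *-nonneg {χ (¬? (good? n))} {f₁ n} (0≤χ _) (0≤f₁ n 1≤n)

      -- Markov's inequality: a bad n has P n at least g₂ K z/n, all values of `P` are nonnegative,
      -- and `ΣΛP` bounds their total.
      bad-weight : + g₂ * S z w ≤ + 9 * (K * (+ N * + x))
      bad-weight = cancel-*≤ {K} {+ g₂ * S z w} {+ 9 * (K * (+ N * + x))} 1≤K (≤-trans (≤-of (trans (bad-weight-swap K (+ g₂) (S z w)) (sym (S-* z (+ g₂ * K) w)))) (≤-trans (S-mono z {λ n → + g₂ * K * w n} {λ n → Λ n * P n} (λ n 1≤n n≤z → weigh n 1≤n n≤z (good? n))) (≤-trans ΣΛP (≤-of (bad-weight-comm (K * (+ N * + x)) K)))))
        where
        0≤Kq : ∀ n → 0ℤ ≤ K * + quo z n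
        0≤Kq n = *-nonneg {K} {+ quo z n} 0≤K (0≤+ _)
        weigh : ∀ n → 1 ℕ.≤ n → n ℕ.≤ z → (G : Dec (Good n)) → + g₂ * K * (χ (¬? G) * f₁ n) ≤ Λ n * P n
        weigh n 1≤n n≤z (yes _) = subst (_≤ Λ n * P n) (sym (*-zeroʳ (+ g₂ * K))) (*-nonneg {Λ n} {P n} (Λ≥0′ n 1≤n) (0≤P n 1≤n n≤z))
        weigh n 1≤n n≤z (no bad) = bad-weight-core (+ g₁) (+ g₂) (D n) (Λ n) K (+ quo z n) (+ g) (τ n) (pos-* g₁ g₂) (_⊛_ {Λ n} {+ g₂ * (K * + quo z n)} {+ g₂ * (+ g₁ * D n)} (Λ≥0′ n 1≤n) (g₂ ⊗ <⇒≤ (≰⇒> bad)))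
              (*-nonneg {Λ n} {K * + quo z n} (Λ≥0′ n 1≤n) (0≤Kq n)) (*-nonneg {Λ n} {+ g * (K * + quo z n) * τ n} (Λ≥0′ n 1≤n) (*-nonneg {+ g * (K * + quo z n)} {τ n} (*-nonneg {+ g} {K * + quo z n} (0≤+ g) (0≤Kq n)) (0≤χ _)))

      200≤R : 200 ℕ.≤ R
      200≤R = ℕₚ.≤-trans (ℕₚ.*-monoˡ-≤ 200 (ℕₚ.m^n>0 2 (198 ℕ.* m))) R-large

      2≤R : 2 ℕ.≤ R
      2≤R = ℕₚ.≤-trans (ℕₚ.m≤m+n 2 198) 200≤R

      1≤R^ : ∀ i → 1 ℕ.≤ R ℕ.^ i
      1≤R^ i = ℕₚ.m^n>0 R {{ℕ.>-nonZero (ℕₚ.<⇒≤ 2≤R)}} i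

      B : ℕ → ℤ
      B u = S u w

      B-mono : ∀ {u v} → u ℕ.≤ v → B u ≤ B v
      B-mono {u} {v} h = S-mono-n u v {w} h (λ k p _ → 0≤w k (ℕₚ.≤-trans (ℕ.s≤s ℕ.z≤n) p))

      0≤B : ∀ u → 0ℤ ≤ B u
      0≤B u = S-nonneg u (λ k p _ → 0≤w k p)

      B≤Bz : ∀ u → B u ≤ B z
      B≤Bz u = [ B-mono , beyond ]′ (ℕₚ.≤-total u z)
        where
        beyond : z ℕ.≤ u → B u ≤ B z
        beyond h = ≤-of (S-trunc z u {w} h (λ k p _ → trans (cong (λ q → χ (¬? (good? k)) * (+ q * Λ k)) (quo-small z k p)) (*-zeroʳ (χ (¬? (good? k))))))

      h : ℕ → ℕ
      h i = quo x (R ℕ.^ i)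

      -- Its increment at i is the bad weight in (R^(i+1), R^(i+2)] plus that in the mirror image
      -- (x/R^(i+2), x/R^i]. So the increments telescope, to at most 3 B z.
      Φ : ℕ → ℤ
      Φ i = B (R ℕ.^ suc i) - B (h i) - B (h (suc i))

      shrink : ∀ i → quo (2 ℕ.* x) (R ℕ.^ suc i) ℕ.≤ h i
      shrink i = ≤quo x (R ℕ.^ i) q (1≤R^ i) (ℕₚ.*-cancelˡ-≤ R {{ℕ.>-nonZero (ℕₚ.<⇒≤ 2≤R)}} (ℕₚ.≤-trans (ℕₚ.≤-reflexive eq) (ℕₚ.≤-trans (quo-mul≤ (2 ℕ.* x) (R ℕ.^ suc i)) (ℕₚ.*-monoˡ-≤ x 2≤R))))
        where
        q : ℕ
        q = quo (2 ℕ.* x) (R ℕ.^ suc i)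
        eq : R ℕ.* (q ℕ.* R ℕ.^ i) ≡ q ℕ.* R ℕ.^ suc i
        eq = trans (sym (ℕₚ.*-assoc R q _)) (trans (cong (ℕ._* R ℕ.^ i) (ℕₚ.*-comm R q)) (ℕₚ.*-assoc q R _))

      record Window : Set where
        field
          a : ℕ
          1≤a : 1 ℕ.≤ a
          Y≤a : Y ℕ.≤ a
          YaR : Y ℕ.* (a ℕ.* R) ℕ.≤ x
          up : + g₁ * (B (a ℕ.* R) - B a) ≤ K * + x
          down : + g₁ * (B (quo (2 ℕ.* x) a) - B (quo x (a ℕ.* R))) ≤ K * + x

      not-all-heavy : + I * (K * + x + 1ℤ) ≤ + g₁ * (Φ (I ℕ.+ I) - Φ I) → ⊥
      not-all-heavy big = ≤⇒≯ nonpos (<-≤-trans (ℤ.+<+ (ℕ.s≤s ℕ.z≤n)) 1≤gI)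
        where
        1≤gI : 1ℤ ≤ + g₂ * + I
        1≤gI = subst (1ℤ ≤_) (pos-* g₂ I) (+≤ (1≤* 1≤g₂ 1≤I))
        budget′ : + 27 * (+ g₁ * + N) ≤ + g₂ * + I
        budget′ = subst₂ _≤_ (trans (pos-* 27 (g₁ ℕ.* N)) (cong (+ 27 *_) (pos-* g₁ N))) (pos-* g₂ I) (+≤ budget)
        ΔΦ : Φ (I ℕ.+ I) - Φ I ≤ + 3 * B z
        ΔΦ = window-lin₃ (B (R ℕ.^ suc (I ℕ.+ I))) (B z) (B (h (I ℕ.+ I))) (B (h (suc (I ℕ.+ I)))) (B (R ℕ.^ suc I)) (B (h I)) (B (h (suc I)))
          (B≤Bz (R ℕ.^ suc (I ℕ.+ I))) (0≤B (h (I ℕ.+ I))) (0≤B (h (suc (I ℕ.+ I)))) (0≤B (R ℕ.^ suc I)) (B≤Bz (h I)) (B≤Bz (h (suc I)))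
        nonpos : + g₂ * + I ≤ 0ℤ
        nonpos = window-core (+ g₁) (+ g₂) (+ I) K (+ x) (+ N) (Φ (I ℕ.+ I) - Φ I) (B z) (g₂ ⊗ big) (g₂ ⊗ (g₁ ⊗ ΔΦ)) (g₁ ⊗ bad-weight) (_⊛_ {K * + x} {+ 27 * (+ g₁ * + N)} {+ g₂ * + I} (*-nonneg {K} {+ x} 0≤K (0≤+ x)) budget′)

      light-window : ∀ i → I ℕ.≤ i → i ℕ.< I ℕ.+ I → + g₁ * (Φ (suc i) - Φ i) ≤ K * + x → Window
      light-window i I≤i i<2I small = record
        { a = a ; 1≤a = 1≤R^ (suc i) ; Y≤a = ℕₚ.≤-trans Y≤R^I (R^-mono (ℕₚ.m≤n⇒m≤1+n I≤i))
        ; YaR = ℕₚ.≤-trans (ℕₚ.*-monoʳ-≤ Y (subst (ℕ._≤ R ℕ.^ suc (I ℕ.+ I)) (ℕₚ.*-comm R a) (R^-mono (ℕ.s≤s i<2I)))) YR≤x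
        ; up = subst (λ t → + g₁ * (B t - B a) ≤ K * + x) (ℕₚ.*-comm R a) (≤-trans (g₁ ⊗ window-part₁ (B (R ℕ.^ suc (suc i))) (B a) (B (h i)) (B (h (suc i))) (B (h (suc (suc i)))) (B-mono h₂≤h)) small)
        ; down = subst (λ t → + g₁ * (B (quo (2 ℕ.* x) a) - B (quo x t)) ≤ K * + x) (ℕₚ.*-comm R a)
            (≤-trans (g₁ ⊗ window-part₂ (B (R ℕ.^ suc (suc i))) (B a) (B (h i)) (B (h (suc i))) (B (h (suc (suc i)))) (B (quo (2 ℕ.* x) a)) (B-mono (R^-mono (ℕₚ.n≤1+n (suc i)))) (B-mono (shrink i))) small)
        }
        where
        a : ℕ
        a = R ℕ.^ suc i
        R^-mono : ∀ {i j} → i ℕ.≤ j → R ℕ.^ i ℕ.≤ R ℕ.^ j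
        R^-mono = ℕₚ.^-monoʳ-≤ R {{ℕ.>-nonZero (ℕₚ.<⇒≤ 2≤R)}}
        h₂≤h : h (suc (suc i)) ℕ.≤ h i
        h₂≤h = quo-antiʳ x (1≤R^ i) (R^-mono (ℕₚ.m≤n⇒m≤1+n (ℕₚ.n≤1+n i)))

      -- Averaging over disjoint scales finds a window with little bad weight, on
      -- which the mirrored window under n ↦ x / n has little bad weight as well.
      window : Window
      window = [ (λ (i , I≤i , i<2I , small) → light-window i I≤i i<2I small) , ⊥-elim ∘ not-all-heavy ]′ (pigeonhole Φ (+ g₁) (K * + x) I I)

      -- If all k in (y, u] were bad, their weight would be at least z/u, rounded down, times ψ u -
      -- ψ y; in a dense interval this exceeds the K x / g₁ that is allowed.
      find-good : ∀ y u → y ℕ.≤ u → 1 ℕ.≤ u → u ℕ.≤ z → + g₁ * (B u - B y) ≤ K * + x → + 2 * (K * + u) + 1ℤ ≤ + g₁ * (ψ u - ψ y) →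
                  Σ ℕ λ k → (y ℕ.< k) × (k ℕ.≤ u) × Good k
      find-good y u y≤u 1≤u u≤z light dense = [ (λ (k , lo , hi , gk) → k , lo , subst (k ℕ.≤_) (ℕₚ.m∸n+n≡m y≤u) hi , gk) , ⊥-elim ∘ absurd ]′ (find-in good? y (u ℕ.∸ y))
        where
        n≤1+n′ : ∀ a → a ≤ 1ℤ + a
        n≤1+n′ a = i≤suc[i] a
        absurd : (∀ k → y ℕ.< k → k ℕ.≤ u ℕ.∸ y ℕ.+ y → ¬ Good k) → ⊥
        absurd none = ≤⇒≯ nonpos (<-≤-trans (ℤ.+<+ (ℕ.s≤s ℕ.z≤n)) (+≤ (1≤quo z u 1≤u u≤z)))
          where
          weigh : ∀ k → y ℕ.< k → k ℕ.≤ u → (G : Dec (Good k)) → + quo z u * Λ k ≤ χ (¬? G) * f₁ k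
          weigh k lo hi (yes gk) = ⊥-elim (none k lo (subst (k ℕ.≤_) (sym (ℕₚ.m∸n+n≡m y≤u)) hi) gk)
          weigh k lo hi (no _) = ≤-trans (mulʳ (+ quo z u) (+ quo z k) (Λ k) (Λ≥0′ k (ℕₚ.≤-trans (ℕ.s≤s ℕ.z≤n) lo)) (+≤ (quo-antiʳ z (ℕₚ.≤-trans (ℕ.s≤s ℕ.z≤n) lo) hi))) (≤-of (sym (*-identityˡ (f₁ k))))
          heavy : + quo z u * (ψ u - ψ y) ≤ B u - B y
          heavy = subst (_≤ B u - B y) (trans (cong₂ _-_ (S-* u (+ quo z u) Λ) (S-* y (+ quo z u) Λ)) (find-good-alg (+ quo z u) (ψ u) (ψ y))) (S-incr-mono y u {λ k → + quo z u * Λ k} {w} y≤u (λ k lo hi → weigh k lo hi (good? k)))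
          nonpos : + quo z u ≤ 0ℤ
          nonpos = find-good-core (+ quo z u) (ψ u - ψ y) (B u - B y) K (+ x) (+ z) (+ u) (+ g₁) (quo z u ⊗ dense) (g₁ ⊗ heavy) light (Kx-mono (+≤ x≤z)) (Kx-mono (≤-trans (n≤1+n′ (+ z)) (quo-hi z u 1≤u)))
            (Kx-mono (mulʳ 1ℤ (+ quo z u) (+ u) (0≤+ u) (+≤ (1≤quo z u 1≤u u≤z))))

      g₁≤g : + 700 * (+ g₁ * K) ≤ + 700 * (+ (g₁ ℕ.* g₂) * K)
      g₁≤g = 700 ⊗ mulʳ (+ g₁) (+ (g₁ ℕ.* g₂)) K 0≤K (+≤ (ℕₚ.m≤m*n g₁ g₂ {{ℕ.>-nonZero 1≤g₂}}))

      short₁ : ∀ y v → Y₀ ℕ.≤ y → y ℕ.≤ v → v ℕ.< 4 ℕ.* y → v ℕ.≤ X → + g₁ * (ψ v - ψ y) ≤ + 2 * (+ g₁ * (K * (+ v - + y))) + K * + v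
      short₁ y v Y₀≤y y≤v v<4y v≤X = short g₁ y v 1≤g₁ (ℕₚ.≤-trans 1≤Y₀ Y₀≤y) y≤v v<4y v≤X (≤-trans g₁≤g (Y₀-large y Y₀≤y (ℕₚ.≤-trans y≤v v≤X)))

      2y+1 : ∀ n → 1 ℕ.≤ n → quo z n ℕ.≤ suc (2 ℕ.* quo x n)
      2y+1 n 1≤n = quo≤ z n _ (ℕₚ.≤-<-trans z≤2x (subst (2 ℕ.* x ℕ.<_) (trans (sym (ℕₚ.*-assoc 2 (suc (quo x n)) n)) (cong (ℕ._* n) (ℕₚ.*-suc 2 (quo x n)))) (ℕₚ.*-monoʳ-< 2 (<quo x n 1≤n))))

      2y+1<4y : ∀ y → 1 ℕ.≤ y → suc (2 ℕ.* y) ℕ.< 4 ℕ.* y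
      2y+1<4y y 1≤y = subst (suc (suc (2 ℕ.* y)) ℕ.≤_) (sym (ℕₚ.*-distribʳ-+ y 2 2)) (ℕₚ.+-monoˡ-≤ (2 ℕ.* y) (ℕₚ.*-monoʳ-≤ 2 1≤y))

      1≤Y : 1 ℕ.≤ Y
      1≤Y = ℕₚ.≤-trans (ℕ.s≤s ℕ.z≤n) Y-s

      g₁ℤ : + g₁ ≡ + 256 * + m
      g₁ℤ = trans (cong +_ g₁≡) (pos-* 256 m)

      sℤ : + s ≡ + 16 * + m
      sℤ = trans (cong +_ s≡) (pos-* 16 m)

      1≤s : 1 ℕ.≤ s
      1≤s = subst (1 ℕ.≤_) (sym s≡) (1≤* {16} (ℕ.s≤s ℕ.z≤n) 1≤m)

      1≤mℤ : 1ℤ ≤ + m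
      1≤mℤ = +≤ 1≤m

      good-256 : ∀ n → Good n → + 256 * + m * D n ≤ K * + quo z n
      good-256 n = subst (λ g → g * D n ≤ K * + quo z n) g₁ℤ

      short-256 : ∀ y v → Y₀ ℕ.≤ y → y ℕ.≤ v → v ℕ.< 4 ℕ.* y → v ℕ.≤ X → + 256 * + m * (ψ v - ψ y) ≤ + 2 * (+ 256 * + m * (K * (+ v - + y))) + K * + v
      short-256 y v p q r t = subst (λ g → g * (ψ v - ψ y) ≤ + 2 * (g * (K * (+ v - + y))) + K * + v) g₁ℤ (short₁ y v p q r t)

      big : ∀ {y} → Y ℕ.≤ y → 1ℤ + + 2 * (+ 16 * + m) ≤ + y
      big {y} h = subst (_≤ + y) (cong (1ℤ +′_) (trans (pos-* 2 s) (cong (+ 2 *_) sℤ))) (+≤ (ℕₚ.≤-trans Y-s h))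
        where
        _+′_ : ℤ → ℤ → ℤ
        x +′ y = x + y

      qs-lo : ∀ y → + quo y s * (+ 16 * + m) ≤ + y
      qs-lo y = subst (λ t → + quo y s * t ≤ + y) sℤ (quo-lo y s)

      qs-hi : ∀ y → 1ℤ + + y ≤ (1ℤ + + quo y s) * (+ 16 * + m)
      qs-hi y = subst (λ t → 1ℤ + + y ≤ (1ℤ + + quo y s) * t) sℤ (quo-hi y s 1≤s)

      mz-lo′ : 1ℤ + (1ℤ + + m) * + x ≤ + m * + z + + m
      mz-lo′ = subst₂ _≤_ (cong (λ t → 1ℤ + t) (pos-* (suc m) x)) (cong (_+ + m) (pos-* m z)) (+≤ mz-lo)

      module Run (W : Window) where
        open Window W

        record Next (n : ℕ) : Set where
          field
            n′ : ℕ
            good′ : Good n′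
            n<n′ : n ℕ.< n′
            n′≤2n : n′ ℕ.≤ 2 ℕ.* n
            grow : (+ 2 * + m + 1ℤ) * + n ≤ + 2 * + m * + n′
            mass : + 2 * (+ 256 * + m * (K * (+ n′ - + n))) ≤ + 256 * + m * (ψ n′ - ψ n) + + 5 * (K * + n′)

        -- A good n gives a good k just above x / n, so (x/k, z/k] reaches from below n
        -- to above (1 + 1/2m) n with density 2, and it contains a good n′ near its end.
        next : ∀ n → Good n → a ℕ.< n → 2 ℕ.* n ℕ.≤ a ℕ.* R → Next n
        next n gn a<n 2n≤aR = record { n′ = n′ ; good′ = gn′ ; n<n′ = n<n′ ; n′≤2n = ℕₚ.≤-trans n′≤v₂ v₂≤2n ; grow = ≤-trans grow₂ (mul (+ 2 * + m) (+ u₂) (+ n′) (*-nonneg {+ 2} {+ m} (0≤+ 2) (0≤+ m)) (+≤ (ℕₚ.<⇒≤ u₂<n′)))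
            ; mass = advance (+ 256 * + m) K (+ n) (+ n′) (+ v₂) (+ y₂) (ψ v₂) (ψ y₂) (ψ n) (ψ n′) 0≤K (good-256 k gk) (short-256 n′ v₂ (ℕₚ.≤-trans Y₀≤n (ℕₚ.<⇒≤ n<n′)) n′≤v₂ v₂<4n′ v₂≤X) (short-256 y₂ n Y₀≤y₂ (ℕₚ.<⇒≤ y₂<n) (ℕₚ.≤-<-trans n≤v₂ v₂<4y₂) n≤X)
                (subst (+ v₂ ≤_) (pos-* 2 n) (+≤ v₂≤2n)) (+≤ (ℕₚ.<⇒≤ n<n′)) }
          where
          Y≤n : Y ℕ.≤ n
          Y≤n = ℕₚ.≤-trans Y≤a (ℕₚ.<⇒≤ a<n)
          1≤n : 1 ℕ.≤ n
          1≤n = ℕₚ.≤-trans 1≤Y Y≤n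
          n≤aR : n ℕ.≤ a ℕ.* R
          n≤aR = ℕₚ.≤-trans (ℕₚ.m≤m+n n _) 2n≤aR
          Y₀≤Y : Y₀ ℕ.≤ Y
          Y₀≤Y = ℕₚ.≤-trans (ℕₚ.m≤n⇒m≤1+n (ℕₚ.m≤m+n Y₀ _)) Y-Y₀
          Y₀≤n : Y₀ ℕ.≤ n
          Y₀≤n = ℕₚ.≤-trans Y₀≤Y Y≤n
          -- u exceeds y by y/(16 m): enough for (y, u] to be dense, and little enough for x/k to
          -- stay close to n when k lies in it.
          y v q u : ℕ
          y = quo x n
          v = quo z n
          q = quo y s
          u = y ℕ.+ q
          Y≤y : Y ℕ.≤ y
          Y≤y = ≤quo x n Y 1≤n (ℕₚ.≤-trans (ℕₚ.*-monoʳ-≤ Y n≤aR) YaR)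
          1≤y : 1 ℕ.≤ y
          1≤y = ℕₚ.≤-trans 1≤Y Y≤y
          q≤y : q ℕ.≤ y
          q≤y = quo-≤ y s
          u≤2y : u ℕ.≤ 2 ℕ.* y
          u≤2y = ℕₚ.+-monoʳ-≤ y (ℕₚ.≤-trans q≤y (ℕₚ.m≤m+n y 0))
          y≤u : y ℕ.≤ u
          y≤u = ℕₚ.m≤m+n y q
          yn≤x : + y * + n ≤ + x
          yn≤x = quo-lo x n
          u≤v : u ℕ.≤ v
          u≤v = ℤ.drop‿+≤+ (inside (+ m) (+ y) (+ v) (+ q) 1≤mℤ (stretch (+ m) (+ y) (+ v) (+ n) (+ x) (+ z) 1≤mℤ (+≤ 1≤n) yn≤x (quo-hi z n 1≤n) mz-lo′) (qs-lo y) (big Y≤y))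
          v≤2y+1 : v ℕ.≤ suc (2 ℕ.* y)
          v≤2y+1 = 2y+1 n 1≤n
          v<4u : v ℕ.< 4 ℕ.* u
          v<4u = ℕₚ.≤-<-trans v≤2y+1 (ℕₚ.<-≤-trans (2y+1<4y y 1≤y) (ℕₚ.*-monoʳ-≤ 4 y≤u))
          u≤z : u ℕ.≤ z
          u≤z = ℕₚ.≤-trans u≤v (quo-≤ z n)
          denseᵤ : + 2 * (K * + u) + 1ℤ ≤ + g₁ * (ψ u - ψ y)
          denseᵤ = subst (λ g → + 2 * (K * + u) + 1ℤ ≤ g * (ψ u - ψ y)) (sym g₁ℤ) (dense₁ (+ m) K (+ y) (+ v) (+ q) (ψ v) (ψ u) (ψ y) 1≤mℤ 1≤K (good-256 n gn)
            (short-256 u v (ℕₚ.≤-trans Y₀≤Y (ℕₚ.≤-trans Y≤y y≤u)) u≤v v<4u (ℕₚ.≤-trans (quo-≤ z n) z≤X)) (qs-hi y) (subst (λ t → + v ≤ 1ℤ + t) (pos-* 2 y) (+≤ v≤2y+1)) (+≤ q≤y) (big Y≤y))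
          lightᵤ : + g₁ * (B u - B y) ≤ K * + x
          lightᵤ = ≤-trans (g₁ ⊗ +-mono-≤ (B-mono u≤2x/a) (neg-mono-≤ (B-mono (quo-antiʳ x 1≤n n≤aR)))) down
            where
            u≤2x/a : u ℕ.≤ quo (2 ℕ.* x) a
            u≤2x/a = ≤quo (2 ℕ.* x) a u 1≤a (ℕₚ.≤-trans (ℕₚ.*-mono-≤ u≤2y (ℕₚ.<⇒≤ a<n)) (ℕₚ.≤-trans (ℕₚ.≤-reflexive (ℕₚ.*-assoc 2 y n)) (ℕₚ.*-monoʳ-≤ 2 (quo-mul≤ x n))))
          foundₖ = find-good y u y≤u (ℕₚ.≤-trans 1≤y y≤u) u≤z lightᵤ denseᵤ
          k : ℕ
          k = proj₁ foundₖ
          y<k : y ℕ.< k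
          y<k = proj₁ (proj₂ foundₖ)
          k≤u : k ℕ.≤ u
          k≤u = proj₁ (proj₂ (proj₂ foundₖ))
          gk : Good k
          gk = proj₂ (proj₂ (proj₂ foundₖ))
          1≤k : 1 ℕ.≤ k
          1≤k = ℕₚ.≤-trans (ℕ.s≤s ℕ.z≤n) y<k
          y₂ v₂ q₂ u₂ : ℕ
          y₂ = quo x k
          v₂ = quo z k
          q₂ = quo v₂ s
          u₂ = v₂ ℕ.∸ q₂
          x<kn : x ℕ.< n ℕ.* k
          x<kn = ℕₚ.<-≤-trans (<quo x n 1≤n) (ℕₚ.≤-trans (ℕₚ.*-monoˡ-≤ n y<k) (ℕₚ.≤-reflexive (ℕₚ.*-comm k n)))
          y₂<n : y₂ ℕ.< n
          y₂<n = ℕₚ.*-cancelʳ-< k y₂ n (ℕₚ.≤-<-trans (quo-mul≤ x k) x<kn)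
          v₂≤2n : v₂ ℕ.≤ 2 ℕ.* n
          v₂≤2n = ℕₚ.<⇒≤ (ℕₚ.*-cancelʳ-< k v₂ (2 ℕ.* n) (ℕₚ.≤-<-trans (quo-mul≤ z k) (ℕₚ.≤-<-trans z≤2x (subst (2 ℕ.* x ℕ.<_) (sym (ℕₚ.*-assoc 2 n k)) (ℕₚ.*-monoʳ-< 2 x<kn)))))
          u₂ℤ : + u₂ ≡ + v₂ - + q₂
          u₂ℤ = trans (sym (⊖-≥ (quo-≤ v₂ s))) (sym (m-n≡m⊖n v₂ q₂))
          grow₂ : (+ 2 * + m + 1ℤ) * + n ≤ + 2 * + m * + u₂
          grow₂ = subst (λ t → (+ 2 * + m + 1ℤ) * + n ≤ + 2 * + m * t) (sym u₂ℤ) (growth (+ m) (+ n) (+ v₂) (+ q₂) 1≤mℤ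
            (reflect (+ m) (+ n) (+ y) (+ x) (+ k) (+ q) (+ z) (+ v₂) 1≤mℤ (+≤ 1≤n) (+≤ 1≤k) yn≤x (+≤ k≤u) (qs-lo y) mz-lo′ (quo-hi z k 1≤k)) (qs-lo v₂) (big Y≤n))
          n≤u₂ : n ℕ.≤ u₂
          n≤u₂ = ℤ.drop‿+≤+ (cancel-ℤ (+ 2 * + m) (+ n) (+ u₂) (lin (1≤mℤ ⊕ 0≤m) (next-alg (+ m))) (lin (grow₂ ⊕ 0≤+ n) (next-alg′ (+ m) (+ n) (+ u₂))))
            where
            0≤m : 0ℤ ≤ + m
            0≤m = 0≤+ m
          u₂≤v₂ : u₂ ℕ.≤ v₂
          u₂≤v₂ = ℕₚ.m∸n≤m v₂ q₂
          n≤v₂ : n ℕ.≤ v₂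
          n≤v₂ = ℕₚ.≤-trans n≤u₂ u₂≤v₂
          v₂≤X : v₂ ℕ.≤ X
          v₂≤X = ℕₚ.≤-trans (quo-≤ z k) z≤X
          n≤X : n ℕ.≤ X
          n≤X = ℕₚ.≤-trans n≤v₂ v₂≤X
          v₂≤2y₂+1 : v₂ ℕ.≤ suc (2 ℕ.* y₂)
          v₂≤2y₂+1 = 2y+1 k 1≤k
          Y₀≤y₂ : Y₀ ℕ.≤ y₂
          Y₀≤y₂ = ℕₚ.*-cancelˡ-≤ 2 (ℕₚ.≤-pred (ℕₚ.≤-trans Y-Y₀ (ℕₚ.≤-trans Y≤n (ℕₚ.≤-trans n≤v₂ v₂≤2y₂+1))))
          v₂<4y₂ : v₂ ℕ.< 4 ℕ.* y₂
          v₂<4y₂ = ℕₚ.≤-<-trans v₂≤2y₂+1 (2y+1<4y y₂ (ℕₚ.≤-trans 1≤Y₀ Y₀≤y₂))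
          y₂≤u₂ : y₂ ℕ.≤ u₂
          y₂≤u₂ = ℕₚ.≤-trans (ℕₚ.<⇒≤ y₂<n) n≤u₂
          denseᵥ : + 2 * (K * + v₂) + 1ℤ ≤ + g₁ * (ψ v₂ - ψ u₂)
          denseᵥ = subst (λ g → + 2 * (K * + v₂) + 1ℤ ≤ g * (ψ v₂ - ψ u₂)) (sym g₁ℤ) (dense₂ (+ m) K (+ y₂) (+ v₂) (+ q₂) (ψ v₂) (ψ u₂) (ψ y₂) 1≤mℤ 1≤K (0≤+ q₂) (good-256 k gk)
            (subst (λ t → + 256 * + m * (ψ u₂ - ψ y₂) ≤ + 2 * (+ 256 * + m * (K * (t - + y₂))) + K * t) u₂ℤ (short-256 y₂ u₂ Y₀≤y₂ y₂≤u₂ (ℕₚ.≤-<-trans u₂≤v₂ v₂<4y₂) (ℕₚ.≤-trans u₂≤v₂ v₂≤X))) (qs-hi v₂) (big (ℕₚ.≤-trans Y≤n n≤v₂)))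
          lightᵥ : + g₁ * (B v₂ - B u₂) ≤ K * + x
          lightᵥ = ≤-trans (g₁ ⊗ +-mono-≤ (B-mono (ℕₚ.≤-trans v₂≤2n 2n≤aR)) (neg-mono-≤ (B-mono (ℕₚ.≤-trans (ℕₚ.<⇒≤ a<n) n≤u₂)))) up
          foundₙ = find-good u₂ v₂ u₂≤v₂ (ℕₚ.≤-trans 1≤n n≤v₂) (quo-≤ z k) lightᵥ denseᵥ
          n′ : ℕ
          n′ = proj₁ foundₙ
          u₂<n′ : u₂ ℕ.< n′
          u₂<n′ = proj₁ (proj₂ foundₙ)
          n′≤v₂ : n′ ℕ.≤ v₂
          n′≤v₂ = proj₁ (proj₂ (proj₂ foundₙ))
          gn′ : Good n′
          gn′ = proj₂ (proj₂ (proj₂ foundₙ))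
          n<n′ : n ℕ.< n′
          n<n′ = ℕₚ.≤-<-trans n≤u₂ u₂<n′
          v₂<4n′ : v₂ ℕ.< 4 ℕ.* n′
          v₂<4n′ = ℕₚ.≤-<-trans v₂≤2n (ℕₚ.≤-<-trans (ℕₚ.*-monoʳ-≤ 2 (ℕₚ.<⇒≤ n<n′)) (ℕₚ.*-monoˡ-< n′ {{ℕ.>-nonZero (ℕₚ.≤-trans 1≤n (ℕₚ.<⇒≤ n<n′))}} {2} {4} (ℕ.s≤s (ℕ.s≤s (ℕ.s≤s ℕ.z≤n)))))

        record Link (n₀ j : ℕ) : Set where
          field
            n : ℕ
            goodₙ : Good n
            n₀≤n : n₀ ℕ.≤ n
            n≤ : n ℕ.≤ 2 ℕ.^ j ℕ.* n₀
            grown : (+ 2 * + m + + j) * + n₀ ≤ + 2 * + m * + n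
            massₙ : + 2 * (+ 256 * + m * (K * (+ n - + n₀))) ≤ + 256 * + m * (ψ n - ψ n₀) + + 5 * (K * ((+ 2 * + m + 1ℤ) * (+ n - + n₀)))

        reach : ∀ n₀ n j → n₀ ℕ.≤ 200 ℕ.* a → n ℕ.≤ 2 ℕ.^ j ℕ.* n₀ → j ℕ.≤ 198 ℕ.* m → n ℕ.≤ a ℕ.* R
        reach n₀ n j h p q = ℕₚ.≤-trans p (ℕₚ.≤-trans (ℕₚ.*-mono-≤ (ℕₚ.^-monoʳ-≤ 2 q) h) (ℕₚ.≤-trans (ℕₚ.≤-reflexive (sym (ℕₚ.*-assoc (2 ℕ.^ (198 ℕ.* m)) 200 a))) (ℕₚ.≤-trans (ℕₚ.*-monoˡ-≤ a R-large) (ℕₚ.≤-reflexive (ℕₚ.*-comm R a)))))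

        chain : ∀ n₀ → Good n₀ → a ℕ.< n₀ → n₀ ℕ.≤ 200 ℕ.* a → ∀ j → j ℕ.≤ 198 ℕ.* m → Link n₀ j
        chain n₀ g₀ a<n₀ h zero _ = record { n = n₀ ; goodₙ = g₀ ; n₀≤n = ℕₚ.≤-refl ; n≤ = ℕₚ.≤-reflexive (sym (ℕₚ.+-identityʳ n₀)) ; grown = ≤-of (cong (_* + n₀) (+-identityʳ (+ 2 * + m))) ; massₙ = ≤-of (chain-alg (+ m) K (+ n₀) (ψ n₀)) }
        chain n₀ g₀ a<n₀ h (suc j) j<k = extend (chain n₀ g₀ a<n₀ h j (ℕₚ.<⇒≤ j<k))
          where
          extend : Link n₀ j → Link n₀ (suc j)
          extend l = record { n = Next.n′ s′ ; goodₙ = Next.good′ s′ ; n₀≤n = ℕₚ.≤-trans (Link.n₀≤n l) (ℕₚ.<⇒≤ (Next.n<n′ s′)) ; n≤ = ℕₚ.≤-trans (Next.n′≤2n s′) 2n≤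
              ; grown = chain-gr (+ m) (+ j) (+ n₀) (+ n) (+ Next.n′ s′) (Link.grown l) (+≤ (Link.n₀≤n l)) (Next.grow s′)
              ; massₙ = chain-step (+ 256 * + m) K (+ m) (+ n₀) (+ n) (+ Next.n′ s′) (ψ n₀) (ψ n) (ψ (Next.n′ s′)) 0≤K (Link.massₙ l) (Next.mass s′) (Next.grow s′) }
            where
            n : ℕ
            n = Link.n l
            2n≤ : 2 ℕ.* n ℕ.≤ 2 ℕ.^ suc j ℕ.* n₀
            2n≤ = ℕₚ.≤-trans (ℕₚ.*-monoʳ-≤ 2 (Link.n≤ l)) (ℕₚ.≤-reflexive (sym (ℕₚ.*-assoc 2 (2 ℕ.^ j) n₀)))
            s′ : Next n
            s′ = next n (Link.goodₙ l) (ℕₚ.<-≤-trans a<n₀ (Link.n₀≤n l)) (reach n₀ (2 ℕ.* n) (suc j) h 2n≤ j<k)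

        start : Σ ℕ λ n₀ → (a ℕ.< n₀) × (n₀ ℕ.≤ 200 ℕ.* a) × Good n₀
        start = proj₁ found , proj₁ (proj₂ found) , subst (proj₁ found ℕ.≤_) u≡ (proj₁ (proj₂ (proj₂ found))) , proj₂ (proj₂ (proj₂ found))
          where
          c y u : ℕ
          c = 25 ℕ.* a
          y = 2 ℕ.* (2 ℕ.* c)
          u = 2 ℕ.* y
          u≡ : u ≡ 200 ℕ.* a
          u≡ = trans (cong (2 ℕ.*_) (trans (cong (2 ℕ.*_) (sym (ℕₚ.*-assoc 2 25 a))) (sym (ℕₚ.*-assoc 2 50 a)))) (sym (ℕₚ.*-assoc 2 100 a))
          u≤aR : u ℕ.≤ a ℕ.* R
          u≤aR = subst₂ ℕ._≤_ (sym u≡) (ℕₚ.*-comm R a) (ℕₚ.*-monoˡ-≤ a 200≤R)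
          aR≤x : a ℕ.* R ℕ.≤ x
          aR≤x = ℕₚ.≤-trans (ℕₚ.m≤n*m (a ℕ.* R) Y {{ℕ.>-nonZero 1≤Y}}) YaR
          u≤x : u ℕ.≤ x
          u≤x = ℕₚ.≤-trans u≤aR aR≤x
          a≤u : a ℕ.≤ u
          a≤u = subst (a ℕ.≤_) (sym u≡) (ℕₚ.m≤n*m a 200)
          bl-double : ∀ n → 1 ℕ.≤ n → bl (2 ℕ.* n) ≡ suc (bl n)
          bl-double n h = trans (bl-half (2 ℕ.* n) (1≤* {2} (ℕ.s≤s ℕ.z≤n) h)) (cong (λ t → suc (bl t)) (quo-*ˡ 2 n (ℕ.s≤s ℕ.z≤n)))
          1≤c : 1 ℕ.≤ c
          1≤c = 1≤* {25} (ℕ.s≤s ℕ.z≤n) 1≤a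
          1≤2c : 1 ℕ.≤ 2 ℕ.* c
          1≤2c = 1≤* {2} (ℕ.s≤s ℕ.z≤n) 1≤c
          bl-u : bl u ℕ.≤ 3 ℕ.+ c
          bl-u = subst (ℕ._≤ 3 ℕ.+ c) (sym (trans (bl-double y (1≤* {2} (ℕ.s≤s ℕ.z≤n) 1≤2c)) (cong suc (trans (bl-double (2 ℕ.* c) 1≤2c) (cong suc (bl-double c 1≤c)))))) (ℕₚ.+-monoʳ-≤ 3 (bl≤ c))
          cℤ : + c ≡ + 25 * + a
          cℤ = pos-* 25 a
          yℤ : + y ≡ + 100 * + a
          yℤ = trans (cong +_ (trans (cong (2 ℕ.*_) (sym (ℕₚ.*-assoc 2 25 a))) (sym (ℕₚ.*-assoc 2 50 a)))) (pos-* 100 a)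
          uℤ : + u ≡ + 200 * + a
          uℤ = trans (cong +_ u≡) (pos-* 200 a)
          dense : + 2 * (K * + u) + 1ℤ ≤ + g₁ * (ψ u - ψ a)
          dense = subst₂ (λ t g → + 2 * (K * t) + 1ℤ ≤ g * (ψ u - ψ a)) (sym uℤ) (sym g₁ℤ) (start-dense (+ m) K (+ a) (+ bl u) (ψ u) (ψ a) 1≤mℤ 1≤K (+≤ 1≤a)
            (subst (λ t → + 7 * (K * t) ≤ + 6 * ψ u + + 30 * K + + 6 * Kb u) yℤ (ψ-lower y (ℕₚ.≤-trans u≤x x≤X))) (subst (λ t → + bl u ≤ + 3 + t) cℤ (+≤ bl-u)) (ψ≤ a (ℕₚ.≤-trans a≤u (ℕₚ.≤-trans u≤x x≤X))))
          found = find-good a u a≤u (ℕₚ.≤-trans 1≤a a≤u) (ℕₚ.≤-trans u≤x x≤z) (≤-trans (g₁ ⊗ +-monoˡ-≤ (- B a) (B-mono u≤aR)) up) dense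

        no-window : ⊥
        no-window = ℕₚ.<⇒≱ (ℕₚ.≤-<-trans ℕ.z≤n a<n₀) (ℤ.drop‿+≤+ (contradiction-end (+ m) K (+ n₀) (+ n) (ψ n₀) (ψ n) (sq (bl n)) 1≤mℤ 1≤K (0≤ψ n₀) (0≤+ n₀) (Link.massₙ lk)
            (cancel-ℤ (+ 2 * + m) (+ 100 * + n₀) (+ n) (lin (1≤mℤ ⊕ 0≤+ m) (no-window-alg (+ m))) (≤-trans (≤-of (no-window-alg′ (+ m) (+ n₀))) (subst (λ t → (+ 2 * + m + t) * + n₀ ≤ + 2 * + m * + n) (pos-* 198 m) (Link.grown lk))))
            (ψ-sharp n n≤X) (12bl²≤ n (ℕₚ.≤-trans Y-2^ (ℕₚ.≤-trans Y≤a (ℕₚ.≤-trans (ℕₚ.<⇒≤ a<n₀) (Link.n₀≤n lk)))))))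
          where
          n₀ : ℕ
          n₀ = proj₁ start
          a<n₀ : a ℕ.< n₀
          a<n₀ = proj₁ (proj₂ start)
          n₀≤ : n₀ ℕ.≤ 200 ℕ.* a
          n₀≤ = proj₁ (proj₂ (proj₂ start))
          -- Every step adds at least n₀/(2 m), so 198 m steps reach the ratio 1 + 198/2 = 100.
          lk : Link n₀ (198 ℕ.* m)
          lk = chain n₀ (proj₂ (proj₂ (proj₂ start))) a<n₀ n₀≤ (198 ℕ.* m) ℕₚ.≤-refl
          n : ℕ
          n = Link.n lk
          n≤X : n ℕ.≤ X
          n≤X = ℕₚ.≤-trans (reach n₀ n (198 ℕ.* m) n₀≤ (Link.n≤ lk) ℕₚ.≤-refl) (ℕₚ.≤-trans (ℕₚ.m≤n*m (a ℕ.* R) Y {{ℕ.>-nonZero 1≤Y}}) (ℕₚ.≤-trans YaR x≤X))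

      absurdity : ⊥
      absurdity = Run.no-window window

-- A prime in every interval (x, (1 + 1/m) x]

module PrimesInShortIntervals where

  open LinearArithmetic
  open Sums
  open ArithmeticFunctions
  open Logarithm
  open Halving
  open IntegerInequalities
  open SelbergFormula
  open import Data.Nat as ℕ using (ℕ; zero; suc)
  import Data.Nat.Properties as ℕₚ
  open import Data.Nat.Divisibility
  open import Data.Nat.Primality
  open import Data.Integer using (+_; _+_; _*_; _≤_)
  open import Data.Integer.Properties
  open import Data.Integer.Tactic.RingSolver using (solve)
  open import Function using (_∘_)

  open import Data.Nat.Solver using (module +-*-Solver)

  n<2^n : ∀ n → n ℕ.< 2 ℕ.^ n
  n<2^n zero = ℕ.s≤s ℕ.z≤n
  n<2^n (suc n) = ℕₚ.≤-trans (ℕₚ.+-mono-≤ (ℕₚ.m^n>0 2 n) (n<2^n n)) (ℕₚ.≤-reflexive (cong (λ t → 2 ℕ.^ n ℕ.+ t) (sym (ℕₚ.+-identityʳ (2 ℕ.^ n)))))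

  2^-mono : ∀ {i j} → i ℕ.≤ j → 2 ℕ.^ i ℕ.≤ 2 ℕ.^ j
  2^-mono = ℕₚ.^-monoʳ-≤ 2

  -- A and Y₀ are what `log-large` needs. The 8 in ρ gives 2^8 ≥ 200, and 216 = 27 · 8 meets the
  -- budget because N ≤ 8 ρ I. The numbers enter through equations so that such exponentials stay
  -- symbolic.
  module Constants (m s g₁ ρ g₂ A Y₀ E : ℕ) (1≤m : 1 ℕ.≤ m) (s≡ : s ≡ 16 ℕ.* m) (g₁≡ : g₁ ≡ 256 ℕ.* m) (ρ≡ : ρ ≡ 198 ℕ.* m ℕ.+ 8)
    (g₂≡ : g₂ ≡ 216 ℕ.* (ρ ℕ.* g₁)) (A≡ : A ≡ 700 ℕ.* (g₁ ℕ.* g₂)) (Y₀≡ : Y₀ ≡ 2 ℕ.^ (2 ℕ.* suc A)) (E≡ : E ≡ 2 ℕ.* suc A ℕ.+ 2 ℕ.* s ℕ.+ 13) where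
    1≤g₁ : 1 ℕ.≤ g₁
    1≤g₁ = subst (1 ℕ.≤_) (sym g₁≡) (1≤* {256} (ℕ.s≤s ℕ.z≤n) 1≤m)
    8≤ρ : 8 ℕ.≤ ρ
    8≤ρ = subst (8 ℕ.≤_) (sym ρ≡) (ℕₚ.m≤n+m 8 _)
    1≤ρ : 1 ℕ.≤ ρ
    1≤ρ = ℕₚ.≤-trans (ℕ.s≤s ℕ.z≤n) 8≤ρ
    1≤g₂ : 1 ℕ.≤ g₂
    1≤g₂ = subst (1 ℕ.≤_) (sym g₂≡) (1≤* {216} (ℕ.s≤s ℕ.z≤n) (1≤* 1≤ρ 1≤g₁))
    1≤Y₀ : 1 ℕ.≤ Y₀
    1≤Y₀ = subst (1 ℕ.≤_) (sym Y₀≡) (ℕₚ.m^n>0 2 (2 ℕ.* suc A))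

    R Y N₁ N₂ N₃ N₀ : ℕ
    R = 2 ℕ.^ ρ
    Y = 2 ℕ.^ E
    N₁ = 1200 ℕ.* (g₁ ℕ.* g₂) ℕ.+ 3698 ℕ.* (g₁ ℕ.* g₂ ℕ.* bl (2 ℕ.* Y₀))
    N₂ = E ℕ.* (4 ℕ.* ρ)
    N₃ = 2 ℕ.* E ℕ.+ 2 ℕ.* ρ ℕ.+ 52
    N₀ = N₁ ℕ.+ (N₂ ℕ.+ N₃)

    R-large : 2 ℕ.^ (198 ℕ.* m) ℕ.* 200 ℕ.≤ R
    R-large = ℕₚ.≤-trans (ℕₚ.*-monoʳ-≤ (2 ℕ.^ (198 ℕ.* m)) (ℕₚ.m≤m+n 200 56)) (ℕₚ.≤-reflexive (trans (sym (ℕₚ.^-distribˡ-+-* 2 (198 ℕ.* m) 8)) (cong (2 ℕ.^_) (sym ρ≡))))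

    Y-Y₀ : suc (2 ℕ.* Y₀) ℕ.≤ Y
    Y-Y₀ = ℕₚ.≤-trans (ℕₚ.+-monoˡ-≤ (2 ℕ.* Y₀) (1≤* {2} (ℕ.s≤s ℕ.z≤n) 1≤Y₀)) (subst₂ ℕ._≤_ eq (cong (2 ℕ.^_) (sym E≡)) (2^-mono {2 ℕ.+ 2 ℕ.* suc A} (ℕₚ.≤-trans (ℕₚ.≤-reflexive (ℕₚ.+-comm 2 _)) (ℕₚ.+-mono-≤ (ℕₚ.m≤m+n (2 ℕ.* suc A) (2 ℕ.* s)) (ℕₚ.m≤m+n 2 11)))))
      where
      eq : 2 ℕ.* (2 ℕ.* 2 ℕ.^ (2 ℕ.* suc A)) ≡ 2 ℕ.* Y₀ ℕ.+ 2 ℕ.* Y₀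
      eq = trans (cong (λ t → 2 ℕ.* (2 ℕ.* t)) (sym Y₀≡)) (cong (λ t → 2 ℕ.* Y₀ ℕ.+ t) (ℕₚ.+-identityʳ (2 ℕ.* Y₀)))

    Y-s : suc (2 ℕ.* s) ℕ.≤ Y
    Y-s = ℕₚ.≤-trans (n<2^n (2 ℕ.* s)) (2^-mono (subst (2 ℕ.* s ℕ.≤_) (sym E≡) (ℕₚ.≤-trans (ℕₚ.m≤n+m (2 ℕ.* s) (2 ℕ.* suc A)) (ℕₚ.m≤m+n _ 13))))

    Y-2^ : 2 ℕ.^ 12 ℕ.≤ Y
    Y-2^ = 2^-mono (subst (12 ℕ.≤_) (sym E≡) (ℕₚ.≤-trans (ℕₚ.m≤m+n 12 1) (ℕₚ.m≤n+m 13 (2 ℕ.* suc A ℕ.+ 2 ℕ.* s))))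

    module _ (x : ℕ) (x-large : 2 ℕ.^ N₀ ℕ.≤ x) where
      -- I = N / (4 ρ) makes R^(2I) at most 2^(N/2), so that Y R^(2I+1) ≤ x holds comfortably; h is
      -- just above N/2, so that 2^h exceeds the square root of z.
      z N I X h b : ℕ
      z = x ℕ.+ quo x m
      N = bl z
      I = quo N (4 ℕ.* ρ)
      X = 2 ℕ.* x
      h = suc (half N)
      b = quo N 4
      1≤x : 1 ℕ.≤ x
      1≤x = ℕₚ.≤-trans (ℕₚ.m^n>0 2 N₀) x-large
      x≤z : x ℕ.≤ z
      x≤z = ℕₚ.m≤m+n x _
      z≤2x : z ℕ.≤ 2 ℕ.* x
      z≤2x = ℕₚ.+-monoʳ-≤ x (ℕₚ.≤-trans (quo-≤ x m) (ℕₚ.m≤m+n x 0))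
      1≤z : 1 ℕ.≤ z
      1≤z = ℕₚ.≤-trans 1≤x x≤z
      N₀≤N : N₀ ℕ.≤ N
      N₀≤N = ℕₚ.<⇒≤ (ℕₚ.≰⇒> (λ N≤N₀ → ℕₚ.<⇒≱ (<2^bl z) (ℕₚ.≤-trans (2^-mono N≤N₀) (ℕₚ.≤-trans x-large x≤z))))
      N₁≤N : N₁ ℕ.≤ N
      N₁≤N = ℕₚ.≤-trans (ℕₚ.m≤m+n N₁ _) N₀≤N
      N₂≤N : N₂ ℕ.≤ N
      N₂≤N = ℕₚ.≤-trans (ℕₚ.≤-trans (ℕₚ.m≤m+n N₂ N₃) (ℕₚ.m≤n+m _ N₁)) N₀≤N
      N₃≤N : N₃ ℕ.≤ N
      N₃≤N = ℕₚ.≤-trans (ℕₚ.≤-trans (ℕₚ.m≤n+m N₃ N₂) (ℕₚ.m≤n+m _ N₁)) N₀≤N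
      52≤N : 52 ℕ.≤ N
      52≤N = ℕₚ.≤-trans (ℕₚ.m≤n+m 52 _) N₃≤N
      2^≤x : ∀ j → j ℕ.+ 2 ℕ.≤ N → 2 ℕ.^ j ℕ.≤ x
      2^≤x j q = ℕₚ.*-cancelˡ-≤ 4 (ℕₚ.≤-trans (ℕₚ.≤-reflexive (trans (ℕₚ.*-comm 4 (2 ℕ.^ j)) (sym (ℕₚ.^-distribˡ-+-* 2 j 2)))) (ℕₚ.≤-trans (2^-mono q) (ℕₚ.≤-trans (2^bl≤ z 1≤z) (ℕₚ.≤-trans (ℕₚ.*-monoʳ-≤ 2 z≤2x) (ℕₚ.≤-reflexive (sym (ℕₚ.*-assoc 2 2 x)))))))
      1≤4ρ : 1 ℕ.≤ 4 ℕ.* ρ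
      1≤4ρ = 1≤* {4} (ℕ.s≤s ℕ.z≤n) 1≤ρ
      E≤I : E ℕ.≤ I
      E≤I = ≤quo N (4 ℕ.* ρ) E 1≤4ρ N₂≤N
      13≤E : 13 ℕ.≤ E
      13≤E = subst (13 ℕ.≤_) (sym E≡) (ℕₚ.m≤n+m 13 (2 ℕ.* suc A ℕ.+ 2 ℕ.* s))
      1≤I : 1 ℕ.≤ I
      1≤I = ℕₚ.≤-trans (ℕ.s≤s ℕ.z≤n) (ℕₚ.≤-trans 13≤E E≤I)
      R^ : ∀ i → R ℕ.^ i ≡ 2 ℕ.^ (ρ ℕ.* i)
      R^ i = ℕₚ.^-*-assoc 2 ρ i
      Y≤R^I : Y ℕ.≤ R ℕ.^ I
      Y≤R^I = subst (Y ℕ.≤_) (sym (R^ I)) (2^-mono (ℕₚ.≤-trans E≤I (ℕₚ.m≤n*m I ρ {{ℕ.>-nonZero 1≤ρ}})))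
      YR≤x : Y ℕ.* R ℕ.^ suc (I ℕ.+ I) ℕ.≤ x
      YR≤x = subst (ℕ._≤ x) (trans (ℕₚ.^-distribˡ-+-* 2 E (ρ ℕ.* suc (I ℕ.+ I))) (cong (Y ℕ.*_) (sym (R^ (suc (I ℕ.+ I)))))) (2^≤x (E ℕ.+ ρ ℕ.* suc (I ℕ.+ I))
        (ℕₚ.*-cancelˡ-≤ 2 (ℕₚ.≤-trans (ℕₚ.≤-reflexive (expand E ρ I)) (ℕₚ.≤-trans (ℕₚ.+-mono-≤ (ℕₚ.≤-trans (ℕₚ.+-monoʳ-≤ (2 ℕ.* E ℕ.+ 2 ℕ.* ρ) (ℕₚ.m≤m+n 4 48)) N₃≤N) (quo-mul≤ N (4 ℕ.* ρ))) (ℕₚ.≤-reflexive (cong (N ℕ.+_) (sym (ℕₚ.+-identityʳ N))))))))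
        where
        open +-*-Solver using (_:+_; _:*_; con; _:=_) renaming (solve to solveℕ)
        expand : ∀ E ρ I → 2 ℕ.* (E ℕ.+ ρ ℕ.* suc (I ℕ.+ I) ℕ.+ 2) ≡ (2 ℕ.* E ℕ.+ 2 ℕ.* ρ ℕ.+ 4) ℕ.+ I ℕ.* (4 ℕ.* ρ)
        expand = solveℕ 3 (λ E ρ I → con 2 :* (E :+ ρ :* (con 1 :+ (I :+ I)) :+ con 2) := (con 2 :* E :+ con 2 :* ρ :+ con 4) :+ I :* (con 4 :* ρ)) refl
      Y≤x : Y ℕ.≤ x
      Y≤x = ℕₚ.≤-trans (ℕₚ.m≤m*n Y _ {{ℕ.>-nonZero (subst (1 ℕ.≤_) (sym (R^ (suc (I ℕ.+ I)))) (ℕₚ.m^n>0 2 (ρ ℕ.* suc (I ℕ.+ I))))}}) YR≤x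
      24≤X : 24 ℕ.≤ X
      24≤X = ℕₚ.≤-trans (ℕₚ.m≤m+n 24 4072) (ℕₚ.≤-trans Y-2^ (ℕₚ.≤-trans Y≤x (ℕₚ.m≤m+n x _)))
      2Y₀≤X : 2 ℕ.* Y₀ ℕ.≤ X
      2Y₀≤X = ℕₚ.≤-trans (ℕₚ.<⇒≤ Y-Y₀) (ℕₚ.≤-trans Y≤x (ℕₚ.m≤m+n x _))
      budget : 27 ℕ.* (g₁ ℕ.* N) ℕ.≤ g₂ ℕ.* I
      budget = ℕₚ.≤-trans (ℕₚ.*-monoʳ-≤ 27 (ℕₚ.*-monoʳ-≤ g₁ N≤8ρI)) (ℕₚ.≤-reflexive (trans (regroup g₁ ρ I) (cong (ℕ._* I) (sym g₂≡))))
        where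
        open +-*-Solver using (_:+_; _:*_; con; _:=_) renaming (solve to solveℕ)
        regroup : ∀ g ρ I → 27 ℕ.* (g ℕ.* ((I ℕ.+ I) ℕ.* (4 ℕ.* ρ))) ≡ 216 ℕ.* (ρ ℕ.* g) ℕ.* I
        regroup = solveℕ 3 (λ g ρ I → con 27 :* (g :* ((I :+ I) :* (con 4 :* ρ))) := con 216 :* (ρ :* g) :* I) refl
        N≤8ρI : N ℕ.≤ (I ℕ.+ I) ℕ.* (4 ℕ.* ρ)
        N≤8ρI = ℕₚ.<⇒≤ (ℕₚ.<-≤-trans (<quo N (4 ℕ.* ρ) 1≤4ρ) (ℕₚ.*-monoˡ-≤ (4 ℕ.* ρ) (ℕₚ.+-monoˡ-≤ I 1≤I)))
      m*quo : m ℕ.* quo x m ℕ.≤ x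
      m*quo = subst (ℕ._≤ x) (ℕₚ.*-comm (quo x m) m) (quo-mul≤ x m)
      mz-lo : suc m ℕ.* x ℕ.< m ℕ.* z ℕ.+ m
      mz-lo = ℕₚ.<-≤-trans (ℕₚ.+-monoˡ-< (m ℕ.* x) (<quo x m 1≤m)) (ℕₚ.≤-reflexive (regroup m x (quo x m)))
        where
        open +-*-Solver using (_:+_; _:*_; con; _:=_) renaming (solve to solveℕ)
        regroup : ∀ m x q → suc q ℕ.* m ℕ.+ m ℕ.* x ≡ m ℕ.* (x ℕ.+ q) ℕ.+ m
        regroup = solveℕ 3 (λ m x q → (con 1 :+ q) :* m :+ m :* x := m :* (x :+ q) :+ m) refl
      mz-hi : m ℕ.* z ℕ.≤ suc m ℕ.* x
      mz-hi = ℕₚ.≤-trans (ℕₚ.≤-reflexive (ℕₚ.*-distribˡ-+ m x (quo x m))) (ℕₚ.≤-trans (ℕₚ.+-monoʳ-≤ (m ℕ.* x) m*quo) (ℕₚ.≤-reflexive (ℕₚ.+-comm (m ℕ.* x) x)))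
      z<r² : z ℕ.< 2 ℕ.^ h ℕ.* 2 ℕ.^ h
      z<r² = ℕₚ.<-≤-trans (<2^bl z) (subst (2 ℕ.^ N ℕ.≤_) (ℕₚ.^-distribˡ-+-* 2 h h) (2^-mono (ℕₚ.≤-trans (ℕₚ.<⇒≤ (<2*half+2 N)) (ℕₚ.≤-reflexive (cong (h ℕ.+_) (ℕₚ.+-identityʳ h))))))
      -- With b = N/4 the factor 9 N² is at most 64 · 2^b, and 6 + b + h is at most N - 2 because b
      -- + h is about 3N/4.
      rN²≤x : 9 ℕ.* (N ℕ.* N) ℕ.* 2 ℕ.^ h ℕ.≤ x
      rN²≤x = ℕₚ.≤-trans (ℕₚ.*-monoˡ-≤ (2 ℕ.^ h) (ℕₚ.≤-trans (ℕₚ.*-monoʳ-≤ 9 (ℕₚ.*-mono-≤ N≤8b N≤8b)) (ℕₚ.≤-trans (ℕₚ.≤-reflexive (regroup b)) (ℕₚ.*-monoʳ-≤ 48 12b²)))) (ℕₚ.≤-trans (ℕₚ.*-monoˡ-≤ (2 ℕ.^ h) (ℕₚ.*-monoˡ-≤ (2 ℕ.^ b) (ℕₚ.m≤m+n 48 16)))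
          (subst (ℕ._≤ x) (trans (ℕₚ.^-distribˡ-+-* 2 (6 ℕ.+ b) h) (cong (ℕ._* 2 ℕ.^ h) (ℕₚ.^-distribˡ-+-* 2 6 b))) (2^≤x (6 ℕ.+ b ℕ.+ h) small)))
        where
        open +-*-Solver using (_:+_; _:*_; con; _:=_) renaming (solve to solveℕ)
        regroup : ∀ b → 9 ℕ.* ((b ℕ.+ b) ℕ.* 4 ℕ.* ((b ℕ.+ b) ℕ.* 4)) ≡ 48 ℕ.* (12 ℕ.* (b ℕ.* b))
        regroup = solveℕ 1 (λ b → con 9 :* ((b :+ b) :* con 4 :* ((b :+ b) :* con 4)) := con 48 :* (con 12 :* (b :* b))) refl
        13≤b : 13 ℕ.≤ b
        13≤b = ≤quo N 4 13 (ℕ.s≤s ℕ.z≤n) 52≤N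
        N≤8b : N ℕ.≤ (b ℕ.+ b) ℕ.* 4
        N≤8b = ℕₚ.<⇒≤ (ℕₚ.<-≤-trans (<quo N 4 (ℕ.s≤s ℕ.z≤n)) (ℕₚ.*-monoˡ-≤ 4 (ℕₚ.+-monoˡ-≤ b (ℕₚ.≤-trans (ℕ.s≤s ℕ.z≤n) 13≤b))))
        c : ℕ
        c = b ℕ.∸ 12
        b≡ : 12 ℕ.+ c ≡ b
        b≡ = ℕₚ.m+[n∸m]≡n {12} {b} (ℕₚ.≤-trans (ℕₚ.m≤m+n 12 1) 13≤b)
        12b² : 12 ℕ.* (b ℕ.* b) ℕ.≤ 2 ℕ.^ b
        12b² = subst (λ t → 12 ℕ.* (t ℕ.* t) ℕ.≤ 2 ℕ.^ t) b≡ (ℕₚ.≤-trans (ℕₚ.m≤m+n _ 20) (ℕₚ.≤-trans (12sq≤2^ c) (2^-mono (ℕₚ.n≤1+n (11 ℕ.+ c)))))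
        small : 6 ℕ.+ b ℕ.+ h ℕ.+ 2 ℕ.≤ N
        small = ℕₚ.*-cancelˡ-≤ 4 (ℕₚ.≤-trans (ℕₚ.≤-reflexive (regroup₂ b (half N))) (ℕₚ.≤-trans (ℕₚ.+-mono-≤ (ℕₚ.+-mono-≤ (ℕₚ.≤-trans (ℕₚ.m≤m+n 36 16) 52≤N) (quo-mul≤ N 4)) (ℕₚ.*-monoʳ-≤ 2 (2*half≤ N))) (ℕₚ.≤-reflexive (regroup₃ N))))
          where
          regroup₂ : ∀ b k → 4 ℕ.* (6 ℕ.+ b ℕ.+ suc k ℕ.+ 2) ≡ 36 ℕ.+ b ℕ.* 4 ℕ.+ 2 ℕ.* (2 ℕ.* k)
          regroup₂ = solveℕ 2 (λ b k → con 4 :* (con 6 :+ b :+ (con 1 :+ k) :+ con 2) := con 36 :+ b :* con 4 :+ con 2 :* (con 2 :* k)) refl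
          regroup₃ : ∀ N → N ℕ.+ N ℕ.+ 2 ℕ.* N ≡ 4 ℕ.* N
          regroup₃ = solveℕ 1 (λ N → N :+ N :+ con 2 :* N := con 4 :* N) refl

      sc : Scale X
      sc = HarmonicLog.scale X (ℕₚ.≤-trans (ℕ.s≤s ℕ.z≤n) 24≤X)

      Y₀-large : ∀ y → Y₀ ℕ.≤ y → y ℕ.≤ X → + 700 * (+ (g₁ ℕ.* g₂) * Scale.K sc) ≤ Scale.L sc y
      Y₀-large y Y₀≤y y≤X = ≤-trans (≤-of (trans (sym (*-assoc (+ 700) (+ (g₁ ℕ.* g₂)) (Scale.K sc))) (cong (_* Scale.K sc) (trans (sym (pos-* 700 (g₁ ℕ.* g₂))) (cong +_ (sym A≡)))))) (Bounds.log-large X sc 24≤X A y (subst (ℕ._≤ y) Y₀≡ Y₀≤y) y≤X)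

      some-prime : Σ ℕ λ p → Prime p × (x ℕ.< p) × (m ℕ.* p ℕ.≤ suc m ℕ.* x)
      some-prime = [ (λ (p , lo , hi , pp) → p , pp , lo , ℕₚ.≤-trans (ℕₚ.*-monoʳ-≤ m (subst (p ℕ.≤_) (ℕₚ.+-comm (quo x m) x) hi)) mz-hi) , ⊥-elim ∘ absurd ]′ (find-in prime? x (quo x m))
        where
        absurd : (∀ k → x ℕ.< k → k ℕ.≤ quo x m ℕ.+ x → ¬ Prime k) → ⊥
        absurd none = Bounds.Windows.absurdity X sc 24≤X record
            { x = x ; z = z ; 1≤x = 1≤x ; x≤z = x≤z ; z≤2x = z≤2x ; z≤X = z≤2x
            ; few = Bounds.few-primepowers X sc 24≤X x z h 1≤x x≤z z≤2x z≤2x z<r² rN²≤x noprime ; g₁ = g₁ ; g₂ = g₂ ; Y₀ = Y₀ ; 1≤g₁ = 1≤g₁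
            ; 1≤g₂ = 1≤g₂ ; 1≤Y₀ = 1≤Y₀ ; 2Y₀≤X = 2Y₀≤X ; Y₀-large = Y₀-large ; N = N ; N≡ = refl ; N-large = N₁≤N ; m = m ; s = s ; 1≤m = 1≤m
            ; s≡ = s≡ ; g₁≡ = g₁≡ ; mz-lo = mz-lo ; R = R ; I = I ; Y = Y ; 1≤I = 1≤I ; R-large = R-large ; budget = budget ; Y≤R^I = Y≤R^I
            ; YR≤x = YR≤x ; Y-Y₀ = Y-Y₀ ; Y-s = Y-s ; Y-2^ = Y-2^ }
          where
          noprime : ∀ p → Prime p → x ℕ.< p → z ℕ.< p
          noprime p pp lo = ℕₚ.≰⇒> (λ hi → none p lo (subst (p ℕ.≤_) (ℕₚ.+-comm x (quo x m)) hi) pp)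

  abstract
    prime-in-short-interval : ∀ m → 1 ℕ.≤ m → Σ ℕ λ x₀ → ∀ x → x₀ ℕ.≤ x → Σ ℕ λ p → Prime p × (x ℕ.< p) × (m ℕ.* p ℕ.≤ suc m ℕ.* x)
    prime-in-short-interval m 1≤m = instantiate _ _ _ _ _ _ _ refl refl refl refl refl refl refl
      where
      instantiate : ∀ s g₁ ρ g₂ A Y₀ E → s ≡ 16 ℕ.* m → g₁ ≡ 256 ℕ.* m → ρ ≡ 198 ℕ.* m ℕ.+ 8 → g₂ ≡ 216 ℕ.* (ρ ℕ.* g₁) → A ≡ 700 ℕ.* (g₁ ℕ.* g₂) → Y₀ ≡ 2 ℕ.^ (2 ℕ.* suc A) → E ≡ 2 ℕ.* suc A ℕ.+ 2 ℕ.* s ℕ.+ 13 →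
                    Σ ℕ λ x₀ → ∀ x → x₀ ℕ.≤ x → Σ ℕ λ p → Prime p × (x ℕ.< p) × (m ℕ.* p ℕ.≤ suc m ℕ.* x)
      instantiate s g₁ ρ g₂ A Y₀ E s≡ g₁≡ ρ≡ g₂≡ A≡ Y₀≡ E≡ = 2 ℕ.^ Constants.N₀ m s g₁ ρ g₂ A Y₀ E 1≤m s≡ g₁≡ ρ≡ g₂≡ A≡ Y₀≡ E≡ , Constants.some-prime m s g₁ ρ g₂ A Y₀ E 1≤m s≡ g₁≡ ρ≡ g₂≡ A≡ Y₀≡ E≡

-- Rings, Frobenius, roots of polynomials and finite fields

module FiniteFields where

  open import Algebra.Bundles using (CommutativeRing)
  open import Data.Nat as ℕ using (ℕ; zero; suc)
  import Data.Nat.Properties as ℕₚ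
  open import Data.Nat.Divisibility using (_∣_; divides; ∣⇒≤; m∣m*n)
  open import Data.Nat.Combinatorics using (_C_; nCk+nC[k+1]≡[n+1]C[k+1]; nCn≡1; nC1≡n; k>n⇒nCk≡0)
  open import Data.Nat.Primality using (Prime; euclidsLemma)
  open import Data.Fin as Fin using (Fin; toℕ; fromℕ; inject₁)
  import Data.Fin.Properties as Finₚ
  open import Data.List using (List; []; _∷_; length; replicate; tabulate)
  open import Data.List.Properties using (length-tabulate; length-replicate)
  open import Data.List.Relation.Unary.All as All using (All; []; _∷_)
  open import Data.List.Relation.Unary.AllPairs using ([]; _∷_)
  open import Data.List.Relation.Unary.Unique.Propositional using (Unique)
  open import Data.List.Relation.Unary.Unique.Propositional.Properties using (tabulate⁺)
  open import Function using (_∘_)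
  open import Function.Bundles using (_↔_; module Inverse)
  open import Level using (0ℓ)
  open import Relation.Binary.PropositionalEquality using (isEquivalence)

  record Ring≡ : Set₁ where
    infixl 6 _+_
    infixl 7 _*_
    field
      F : Set
      _+_ _*_ : F → F → F
      -_ : F → F
      0# 1# : F
      +-assoc : ∀ x y z → (x + y) + z ≡ x + (y + z)
      +-comm : ∀ x y → x + y ≡ y + x
      +-idˡ : ∀ x → 0# + x ≡ x
      +-invˡ : ∀ x → (- x) + x ≡ 0#
      *-assoc : ∀ x y z → (x * y) * z ≡ x * (y * z)
      *-comm : ∀ x y → x * y ≡ y * x
      *-idˡ : ∀ x → 1# * x ≡ x
      distribˡ : ∀ x y z → x * (y + z) ≡ x * y + x * z

    +-idʳ : ∀ x → x + 0# ≡ x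
    +-idʳ x = trans (+-comm x 0#) (+-idˡ x)

    *-idʳ : ∀ x → x * 1# ≡ x
    *-idʳ x = trans (*-comm x 1#) (*-idˡ x)

    distribʳ : ∀ x y z → (y + z) * x ≡ y * x + z * x
    distribʳ x y z = trans (*-comm (y + z) x) (trans (distribˡ x y z) (cong₂ _+_ (*-comm x y) (*-comm x z)))

    bundle : CommutativeRing 0ℓ 0ℓ
    bundle = record
      { Carrier = F ; _≈_ = _≡_ ; _+_ = _+_ ; _*_ = _*_ ; -_ = -_ ; 0# = 0# ; 1# = 1#
      ; isCommutativeRing = record
        { isRing = record
          { +-isAbelianGroup = record
            { isGroup = record
              { isMonoid = record { isSemigroup = record { isMagma = record { isEquivalence = isEquivalence ; ∙-cong = cong₂ _+_ } ; assoc = +-assoc } ; identity = +-idˡ , +-idʳ }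
              ; inverse = +-invˡ , (λ x → trans (+-comm x (- x)) (+-invˡ x)) ; ⁻¹-cong = cong -_ }
            ; comm = +-comm }
          ; *-cong = cong₂ _*_ ; *-assoc = *-assoc ; *-identity = *-idˡ , *-idʳ ; distrib = distribˡ , distribʳ }
        ; *-comm = *-comm } }

  absorption : ∀ n k → suc k ℕ.* (suc n C suc k) ≡ suc n ℕ.* (n C k)
  absorption zero zero = refl
  absorption zero (suc k) = trans (cong (suc (suc k) ℕ.*_) (k>n⇒nCk≡0 {1} {suc (suc k)} (ℕ.s≤s (ℕ.s≤s ℕ.z≤n)))) (trans (ℕₚ.*-zeroʳ (suc (suc k))) (sym (cong (1 ℕ.*_) (k>n⇒nCk≡0 {0} {suc k} (ℕ.s≤s ℕ.z≤n)))))
  absorption (suc n) zero = trans (ℕₚ.+-identityʳ _) (trans (nC1≡n (suc (suc n))) (sym (ℕₚ.*-identityʳ (suc (suc n)))))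
  absorption (suc n) (suc k) = begin
    suc (suc k) ℕ.* (suc (suc n) C suc (suc k)) ≡⟨ cong (suc (suc k) ℕ.*_) (sym (nCk+nC[k+1]≡[n+1]C[k+1] (suc n) (suc k))) ⟩
    suc (suc k) ℕ.* (suc n C suc k ℕ.+ suc n C suc (suc k)) ≡⟨ ℕₚ.*-distribˡ-+ (suc (suc k)) (suc n C suc k) (suc n C suc (suc k)) ⟩
    (suc n C suc k ℕ.+ suc k ℕ.* (suc n C suc k)) ℕ.+ suc (suc k) ℕ.* (suc n C suc (suc k)) ≡⟨ cong₂ (λ a b → (suc n C suc k ℕ.+ a) ℕ.+ b) (absorption n k) (absorption n (suc k)) ⟩
    (suc n C suc k ℕ.+ suc n ℕ.* (n C k)) ℕ.+ suc n ℕ.* (n C suc k) ≡⟨ ℕₚ.+-assoc (suc n C suc k) _ _ ⟩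
    suc n C suc k ℕ.+ (suc n ℕ.* (n C k) ℕ.+ suc n ℕ.* (n C suc k)) ≡⟨ cong (suc n C suc k ℕ.+_) (sym (ℕₚ.*-distribˡ-+ (suc n) (n C k) (n C suc k))) ⟩
    suc n C suc k ℕ.+ suc n ℕ.* (n C k ℕ.+ n C suc k) ≡⟨ cong (λ z → suc n C suc k ℕ.+ suc n ℕ.* z) (nCk+nC[k+1]≡[n+1]C[k+1] n k) ⟩
    suc (suc n) ℕ.* (suc n C suc k) ∎
    where open ≡-Reasoning

  -- By `absorption` the prime p = n + 1 divides (k + 1) C(p, k + 1), and it does not divide k + 1 ≤
  -- n.
  prime-∣-C : ∀ {n} → Prime (suc n) → ∀ k → k ℕ.< n → suc n ∣ (suc n C suc k)
  prime-∣-C {n} pp k k<n with euclidsLemma (suc k) (suc n C suc k) pp (subst (suc n ∣_) (sym (absorption n k)) (m∣m*n (n C k)))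
  ... | inj₂ h = h
  ... | inj₁ h = ⊥-elim (ℕₚ.<⇒≱ (ℕ.s≤s k<n) (∣⇒≤ h))

  module RingKit (R : Ring≡) where
    open Ring≡ R public
    open CommutativeRing bundle using (commutativeSemiring; semiring; +-monoid; +-group; ring; +-abelianGroup)
    open import Algebra.Properties.Semiring.Exp semiring public using (_^_; ^-homo-*; ^-assocʳ)
    open import Algebra.Properties.CommutativeSemiring.Exp commutativeSemiring public using (^-distrib-*)
    open import Algebra.Properties.Semiring.Mult semiring public using (×-assoc-*; ×-assocˡ; ×-homo-1#) renaming (_×_ to _·_)
    open import Algebra.Properties.Semiring.Sum semiring using (sum; sum-cong-≋; sum-init-last; sum-replicate-zero)
    open import Algebra.Properties.Group +-group public using () renaming (∙-cancelˡ to +-cancelˡ; ∙-cancelʳ to +-cancelʳ)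
    open import Algebra.Properties.CommutativeSemiring.Binomial commutativeSemiring using (binomialTerm) renaming (theorem to binomial-theorem)
    open import Algebra.Solver.Ring.NaturalCoefficients.Default commutativeSemiring public using (solve; _:+_; _:*_; con; _:=_)

    zeroʳ : ∀ x → x * 0# ≡ 0#
    zeroʳ = CommutativeRing.zeroʳ bundle

    zeroˡ : ∀ x → 0# * x ≡ 0#
    zeroˡ = CommutativeRing.zeroˡ bundle

    +-invʳ : ∀ x → x + - x ≡ 0#
    +-invʳ x = trans (+-comm x (- x)) (+-invˡ x)

    diff-zero : ∀ x y → x + - y ≡ 0# → x ≡ y
    diff-zero x y h = +-cancelʳ (- y) x y (trans h (sym (+-invʳ y)))

    add-diff : ∀ x y → y + (x + - y) ≡ x
    add-diff x y = trans (cong (y +_) (+-comm x (- y))) (trans (sym (+-assoc y (- y) x)) (trans (cong (_+ x) (+-invʳ y)) (+-idˡ x)))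

    1^ : ∀ n → 1# ^ n ≡ 1#
    1^ zero = refl
    1^ (suc n) = trans (*-idˡ _) (1^ n)

    module Frobenius {p} (pp : Prime p) (char : p · 1# ≡ 0#) where
      ∣-·-zero : ∀ {n} → p ∣ n → ∀ x → n · x ≡ 0#
      ∣-·-zero {n} (divides c refl) x = begin
        (c ℕ.* p) · x ≡⟨ cong (λ z → z · x) (ℕₚ.*-comm c p) ⟩
        (p ℕ.* c) · x ≡⟨ sym (×-assocˡ x p c) ⟩
        p · (c · x) ≡⟨ cong (p ·_) (sym (*-idˡ (c · x))) ⟩
        p · (1# * (c · x)) ≡⟨ sym (×-assoc-* p 1# (c · x)) ⟩
        (p · 1#) * (c · x) ≡⟨ cong (_* (c · x)) char ⟩
        0# * (c · x) ≡⟨ zeroˡ (c · x) ⟩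
        0# ∎
        where open ≡-Reasoning

      frobenius-+ : ∀ x y → (x + y) ^ p ≡ x ^ p + y ^ p
      frobenius-+ x y = go p pp ∣-·-zero
        where
        go : ∀ p → Prime p → (∀ {n} → p ∣ n → ∀ x → n · x ≡ 0#) → (x + y) ^ p ≡ x ^ p + y ^ p
        go zero pr _ = ⊥-elim (Data.Nat.Primality.¬prime[0] pr)
        go (suc n) pr van = begin
          (x + y) ^ suc n ≡⟨ binomial-theorem (suc n) x y ⟩
          term Fin.zero + sum (λ k → term (Fin.suc k)) ≡⟨ cong (term Fin.zero +_) (sum-init-last (λ k → term (Fin.suc k))) ⟩
          term Fin.zero + (sum (λ k → term (Fin.suc (inject₁ k))) + term (Fin.suc (fromℕ n)))
            ≡⟨ cong₂ _+_ head (cong₂ _+_ (trans (sum-cong-≋ mid) (sum-replicate-zero n)) last) ⟩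
          y ^ suc n + (0# + x ^ suc n) ≡⟨ cong (y ^ suc n +_) (+-idˡ (x ^ suc n)) ⟩
          y ^ suc n + x ^ suc n ≡⟨ +-comm (y ^ suc n) (x ^ suc n) ⟩
          x ^ suc n + y ^ suc n ∎
          where
          open ≡-Reasoning
          term : Fin (suc (suc n)) → F
          term = binomialTerm x y (suc n)
          head : term Fin.zero ≡ y ^ suc n
          head = trans (+-idʳ (1# * y ^ suc n)) (*-idˡ (y ^ suc n))
          mid : ∀ k → term (Fin.suc (inject₁ k)) ≡ 0#
          mid k = van (prime-∣-C pr (toℕ (inject₁ k)) (subst (ℕ._< n) (sym (Finₚ.toℕ-inject₁ k)) (Finₚ.toℕ<n k))) _
          last : term (Fin.suc (fromℕ n)) ≡ x ^ suc n
          last = trans (cong (λ z → (suc n C suc z) · (x ^ suc z * y ^ (n ℕ.∸ z))) (Finₚ.toℕ-fromℕ n)) (trans (cong₂ (λ u v → u · (x ^ suc n * y ^ v)) (nCn≡1 (suc n)) (ℕₚ.n∸n≡0 n)) (trans (+-idʳ _) (*-idʳ (x ^ suc n))))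

      frobenius^-+ : ∀ k x y → (x + y) ^ (p ℕ.^ k) ≡ x ^ (p ℕ.^ k) + y ^ (p ℕ.^ k)
      frobenius^-+ zero x y = trans (*-idʳ (x + y)) (sym (cong₂ _+_ (*-idʳ x) (*-idʳ y)))
      frobenius^-+ (suc k) x y = begin
        (x + y) ^ (p ℕ.* p ℕ.^ k) ≡⟨ sym (^-assocʳ (x + y) p (p ℕ.^ k)) ⟩
        ((x + y) ^ p) ^ (p ℕ.^ k) ≡⟨ cong (_^ (p ℕ.^ k)) (frobenius-+ x y) ⟩
        (x ^ p + y ^ p) ^ (p ℕ.^ k) ≡⟨ frobenius^-+ k (x ^ p) (y ^ p) ⟩
        (x ^ p) ^ (p ℕ.^ k) + (y ^ p) ^ (p ℕ.^ k) ≡⟨ cong₂ _+_ (^-assocʳ x p (p ℕ.^ k)) (^-assocʳ y p (p ℕ.^ k)) ⟩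
        x ^ (p ℕ.* p ℕ.^ k) + y ^ (p ℕ.* p ℕ.^ k) ∎
        where open ≡-Reasoning

    -- A list of coefficients encodes the monic polynomial whose degree is its length.
    eval : List F → F → F
    eval [] x = 1#
    eval (c ∷ cs) x = c + x * eval cs x

    -- Synthetic division by X - r. The quotient of a monic polynomial is monic, so the leading
    -- coefficient need never be stored.
    quotient : F → List F → List F
    quotient r [] = []
    quotient r (c ∷ []) = []
    quotient r (c ∷ cs@(_ ∷ _)) = eval cs r ∷ quotient r cs

    length-quotient : ∀ r c cs → length (quotient r (c ∷ cs)) ≡ length cs
    length-quotient r c [] = refl
    length-quotient r c (d ∷ cs) = cong suc (length-quotient r d cs)

    -- Evaluating at r + d avoids subtraction, so each induction step is an identity in a
    -- commutative semiring.
    factor : ∀ r c cs d → eval (c ∷ cs) (r + d) ≡ eval (c ∷ cs) r + d * eval (quotient r (c ∷ cs)) (r + d)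
    factor r c [] d = solve 3 (λ r c d → c :+ (r :+ d) :* con 1 := (c :+ r :* con 1) :+ d :* con 1) refl r c d
    factor r c cs@(e ∷ es) d = trans (cong (λ z → c + (r + d) * z) (factor r e es d))
      (solve 5 (λ r c d a b → c :+ (r :+ d) :* (a :+ d :* b) := (c :+ r :* a) :+ d :* (a :+ (r :+ d) :* b)) refl r c d (eval cs r) (eval (quotient r cs) (r + d)))

    module Domain (0≢1 : 0# ≢ 1#) (nozero : ∀ x y → x * y ≡ 0# → (x ≡ 0#) ⊎ (y ≡ 0#)) where
      roots≤degree : ∀ n cs → length cs ≡ n → ∀ rs → Unique rs → All (λ r → eval cs r ≡ 0#) rs → length rs ℕ.≤ length cs
      roots≤degree n cs _ [] _ _ = ℕ.z≤n
      roots≤degree n [] _ (r ∷ rs) _ (h ∷ _) = ⊥-elim (0≢1 (sym h))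
      roots≤degree (suc n) (c ∷ cs) e (r ∷ rs) (r∉ ∷ u) (h ∷ hs) = ℕ.s≤s (subst (length rs ℕ.≤_) lq (roots≤degree n (quotient r (c ∷ cs)) (trans lq (ℕₚ.suc-injective e)) rs u (All.zipWith (λ {x} → step {x}) (r∉ , hs))))
        where
        lq : length (quotient r (c ∷ cs)) ≡ length cs
        lq = length-quotient r c cs
        step : ∀ {x} → (r ≢ x) × (eval (c ∷ cs) x ≡ 0#) → eval (quotient r (c ∷ cs)) x ≡ 0#
        step {x} (r≢x , hx) with nozero (x + - r) (eval (quotient r (c ∷ cs)) x) prod
          where
          prod : (x + - r) * eval (quotient r (c ∷ cs)) x ≡ 0#
          prod = trans (sym (+-idˡ _)) (trans (cong (_+ (x + - r) * eval (quotient r (c ∷ cs)) x) (sym h))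
            (trans (cong (λ z → eval (c ∷ cs) r + (x + - r) * eval (quotient r (c ∷ cs)) z) (sym (add-diff x r))) (trans (sym (factor r c cs (x + - r))) (trans (cong (eval (c ∷ cs)) (add-diff x r)) hx))))
        ... | inj₁ z = ⊥-elim (r≢x (sym (diff-zero x r z)))
        ... | inj₂ z = z

      power-poly : F → ℕ → List F
      power-poly c n = c ∷ replicate n 0#

      eval-power-poly : ∀ c n x → eval (power-poly c n) x ≡ c + x ^ suc n
      eval-power-poly c n x = cong (λ z → c + x * z) (go n)
        where
        go : ∀ n → eval (replicate n 0#) x ≡ x ^ n
        go zero = refl
        go (suc n) = trans (+-idˡ _) (cong (x *_) (go n))

      nth-roots : ∀ c n rs → Unique rs → All (λ r → r ^ suc n ≡ c) rs → length rs ℕ.≤ suc n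
      nth-roots c n rs u h = subst (length rs ℕ.≤_) (cong suc (length-replicate n)) (roots≤degree _ (power-poly (- c) n) refl rs u
        (All.map (λ {r} e → trans (eval-power-poly (- c) n r) (trans (cong (- c +_) e) (+-invˡ c))) h))

  -- The identity x^q = x is part of the data: it yields x^(q-1) = 1 for x ≠ 0 without counting the
  -- unit group, and each extension establishes it from an explicit form of its Frobenius map.
  record FiniteField (p k : ℕ) : Set₁ where
    field
      R : Ring≡
    open RingKit R public
    field
      0≢1 : 0# ≢ 1#
      nozero : ∀ x y → x * y ≡ 0# → (x ≡ 0#) ⊎ (y ≡ 0#)
      char : p · 1# ≡ 0#
      frob : ∀ x → x ^ (p ℕ.^ k) ≡ x
      enum : F ↔ Fin (p ℕ.^ k)
    open Domain 0≢1 nozero public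

    q : ℕ
    q = p ℕ.^ k

    to : F → Fin q
    to = Inverse.to enum

    from : Fin q → F
    from = Inverse.from enum

    to-from : ∀ i → to (from i) ≡ i
    to-from i = Inverse.strictlyInverseˡ enum i

    from-to : ∀ x → from (to x) ≡ x
    from-to x = Inverse.strictlyInverseʳ enum x

    from-injective : ∀ {i j} → from i ≡ from j → i ≡ j
    from-injective {i} {j} e = trans (sym (to-from i)) (trans (cong to e) (to-from j))

    infix 4 _≟_
    _≟_ : (x y : F) → Dec (x ≡ y)
    x ≟ y with to x Fin.≟ to y
    ... | yes e = yes (trans (sym (from-to x)) (trans (cong from e) (from-to y)))
    ... | no ne = no (ne ∘ cong to)

    elements : List F
    elements = tabulate from

    elements-unique : Unique elements
    elements-unique = tabulate⁺ from-injective

    length-elements : length elements ≡ q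
    length-elements = length-tabulate from

    cancelˡ : ∀ x {y z} → x ≢ 0# → x * y ≡ x * z → y ≡ z
    cancelˡ x {y} {z} x≢0 e with nozero x (y + - z) (trans (distribˡ x y (- z)) (trans (cong (_+ x * - z) e) (trans (sym (distribˡ x z (- z))) (trans (cong (x *_) (+-invʳ z)) (zeroʳ x)))))
    ... | inj₁ h = ⊥-elim (x≢0 h)
    ... | inj₂ h = diff-zero y z h

    unit-power : ∀ {n} → q ≡ suc n → ∀ x → x ≢ 0# → x ^ n ≡ 1#
    unit-power {n} e x x≢0 = cancelˡ x x≢0 (trans (cong (x ^_) (sym e)) (trans (frob x) (sym (*-idʳ x))))

-- The field of p elements

module PrimeFields where

  open FiniteFields
  open import Data.Nat as ℕ using (ℕ; zero; suc)
  import Data.Nat.Properties as ℕₚ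
  open import Data.Nat.Divisibility using (_∣_; ∣⇒≤)
  open import Data.Nat.Primality using (Prime; euclidsLemma)
  open import Data.Fin using (Fin; toℕ)
  import Data.Fin.Properties as Finₚ
  open import Function.Bundles using (_↔_)
  open import Data.Nat.Primality using (prime⇒nonZero; prime⇒nonTrivial)
  open import Data.Nat.DivMod using (_%_; _mod_; m%n<n; m<n⇒m%n≡m; %-distribˡ-+; %-distribˡ-*; [m+n]%n≡m%n)
  open import Data.Nat.Divisibility using (m%n≡0⇒n∣m)
  open import Function.Bundles using (mk↔ₛ′)

  module _ (p : ℕ) (pp : Prime p) where
    private instance
      p≢0 : ℕ.NonZero p
      p≢0 = prime⇒nonZero pp

    π : ℕ → Fin p
    π n = n mod p

    toℕ-π : ∀ n → toℕ (π n) ≡ n % p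
    toℕ-π n = Finₚ.toℕ-fromℕ< (m%n<n n p)

    π-≡ : ∀ {m n} → m % p ≡ n % p → π m ≡ π n
    π-≡ {m} {n} e = Finₚ.toℕ-injective (trans (toℕ-π m) (trans e (sym (toℕ-π n))))

    π-toℕ : ∀ x → π (toℕ x) ≡ x
    π-toℕ x = Finₚ.toℕ-injective (trans (toℕ-π (toℕ x)) (m<n⇒m%n≡m (Finₚ.toℕ<n x)))

    _⊞_ _⊠_ : Fin p → Fin p → Fin p
    x ⊞ y = π (toℕ x ℕ.+ toℕ y)
    x ⊠ y = π (toℕ x ℕ.* toℕ y)

    π-+ : ∀ m n → π m ⊞ π n ≡ π (m ℕ.+ n)
    π-+ m n = trans (cong₂ (λ a b → π (a ℕ.+ b)) (toℕ-π m) (toℕ-π n)) (π-≡ (sym (%-distribˡ-+ m n p)))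

    π-* : ∀ m n → π m ⊠ π n ≡ π (m ℕ.* n)
    π-* m n = trans (cong₂ (λ a b → π (a ℕ.* b)) (toℕ-π m) (toℕ-π n)) (π-≡ (sym (%-distribˡ-* m n p)))

    π-+ʳ : ∀ x n → x ⊞ π n ≡ π (toℕ x ℕ.+ n)
    π-+ʳ x n = trans (cong (_⊞ π n) (sym (π-toℕ x))) (π-+ (toℕ x) n)

    π-+ˡ : ∀ m y → π m ⊞ y ≡ π (m ℕ.+ toℕ y)
    π-+ˡ m y = trans (cong (π m ⊞_) (sym (π-toℕ y))) (π-+ m (toℕ y))

    π-*ʳ : ∀ x n → x ⊠ π n ≡ π (toℕ x ℕ.* n)
    π-*ʳ x n = trans (cong (_⊠ π n) (sym (π-toℕ x))) (π-* (toℕ x) n)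

    π-*ˡ : ∀ m y → π m ⊠ y ≡ π (m ℕ.* toℕ y)
    π-*ˡ m y = trans (cong (π m ⊠_) (sym (π-toℕ y))) (π-* m (toℕ y))

    π-p : π p ≡ π 0
    π-p = π-≡ ([m+n]%n≡m%n 0 p)

    ring-mod : Ring≡
    ring-mod = record
      { F = Fin p ; _+_ = _⊞_ ; _*_ = _⊠_ ; -_ = λ x → π (p ℕ.∸ toℕ x) ; 0# = π 0 ; 1# = π 1
      ; +-assoc = λ x y z → trans (π-+ˡ _ z) (trans (cong π (ℕₚ.+-assoc (toℕ x) (toℕ y) (toℕ z))) (sym (π-+ʳ x _)))
      ; +-comm = λ x y → cong π (ℕₚ.+-comm (toℕ x) (toℕ y))
      ; +-idˡ = λ x → trans (π-+ˡ 0 x) (π-toℕ x)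
      ; +-invˡ = λ x → trans (π-+ˡ _ x) (trans (cong π (ℕₚ.m∸n+n≡m (ℕₚ.<⇒≤ (Finₚ.toℕ<n x)))) π-p)
      ; *-assoc = λ x y z → trans (π-*ˡ _ z) (trans (cong π (ℕₚ.*-assoc (toℕ x) (toℕ y) (toℕ z))) (sym (π-*ʳ x _)))
      ; *-comm = λ x y → cong π (ℕₚ.*-comm (toℕ x) (toℕ y))
      ; *-idˡ = λ x → trans (π-*ˡ 1 x) (trans (cong π (ℕₚ.*-identityˡ (toℕ x))) (π-toℕ x))
      ; distribˡ = λ x y z → trans (π-*ʳ x _) (trans (cong π (ℕₚ.*-distribˡ-+ (toℕ x) (toℕ y) (toℕ z))) (sym (π-+ _ _)))
      }

    primeField : FiniteField p 1
    primeField = record { R = ring-mod ; 0≢1 = 0≢1 ; nozero = nozero ; char = char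
        ; frob = λ x → trans (cong (x ^_) (ℕₚ.*-identityʳ p)) (trans (cong (_^ p) (sym (π-toℕ x))) (trans (fermat (toℕ x)) (π-toℕ x)))
        ; enum = subst (λ z → Fin p ↔ Fin z) (sym (ℕₚ.*-identityʳ p)) (mk↔ₛ′ (λ x → x) (λ x → x) (λ _ → refl) (λ _ → refl)) }
      where
      open RingKit ring-mod
      1<p : 1 ℕ.< p
      1<p = ℕ.nonTrivial⇒n>1 p {{prime⇒nonTrivial pp}}
      toℕ-π0 : toℕ (π 0) ≡ 0
      toℕ-π0 = trans (toℕ-π 0) (m<n⇒m%n≡m (ℕₚ.<⇒≤ 1<p))
      zero-∣ : ∀ n → π n ≡ π 0 → p ∣ n
      zero-∣ n e = m%n≡0⇒n∣m n p (trans (sym (toℕ-π n)) (trans (cong toℕ e) toℕ-π0))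
      0≢1 : π 0 ≢ π 1
      0≢1 e with () ← trans (sym (trans (toℕ-π 1) (m<n⇒m%n≡m 1<p))) (trans (cong toℕ (sym e)) toℕ-π0)
      zero-if : ∀ x → p ∣ toℕ x → x ≡ π 0
      zero-if x h = Finₚ.toℕ-injective (trans (go (toℕ x) (Finₚ.toℕ<n x) h) (sym toℕ-π0))
        where
        go : ∀ n → n ℕ.< p → p ∣ n → n ≡ 0
        go zero _ _ = refl
        go (suc n) lt d = ⊥-elim (ℕₚ.<⇒≱ lt (∣⇒≤ d))
      nozero : ∀ x y → x ⊠ y ≡ π 0 → (x ≡ π 0) ⊎ (y ≡ π 0)
      nozero x y e with euclidsLemma (toℕ x) (toℕ y) pp (zero-∣ _ e)
      ... | inj₁ h = inj₁ (zero-if x h)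
      ... | inj₂ h = inj₂ (zero-if y h)
      ·-π : ∀ n → n · π 1 ≡ π n
      ·-π zero = refl
      ·-π (suc n) = trans (cong (π 1 ⊞_) (·-π n)) (π-+ 1 n)
      char : p · π 1 ≡ π 0
      char = trans (·-π p) π-p
      open Frobenius pp char
      -- Induction on n, since Frobenius is additive: (1 + n)^p = 1 + n^p.
      fermat : ∀ n → π n ^ p ≡ π n
      fermat zero = go p pp
        where
        go : ∀ m → Prime m → π 0 ^ m ≡ π 0
        go zero pr = ⊥-elim (Data.Nat.Primality.¬prime[0] pr)
        go (suc m) _ = zeroˡ (π 0 ^ m)
      fermat (suc n) = trans (cong (_^ p) (sym (π-+ 1 n))) (trans (frobenius-+ (π 1) (π n)) (trans (cong₂ _⊞_ (1^ p) (fermat n)) (π-+ 1 n)))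

-- Kummer extensions of prime degree

module Kummer where

  open FiniteFields
  open import Data.Nat as ℕ using (ℕ; zero; suc)
  import Data.Nat.Properties as ℕₚ
  open import Data.Nat.Primality using (Prime)
  open import Data.Fin as Fin using (Fin)
  import Data.Fin.Properties as Finₚ
  open import Data.List as List using (List; []; _∷_; length; replicate)
  open import Data.List.Properties using (length-replicate)
  open import Data.List.Relation.Unary.All using ([]; _∷_)
  import Data.List.Relation.Unary.All.Properties as Allₚ
  open import Data.List.Relation.Unary.AllPairs using ([]; _∷_)
  open import Data.List.Relation.Unary.Unique.Propositional.Properties using (tabulate⁺)
  open import Data.Sum as Sum using (_⊎_; inj₁; inj₂)
  open import Function.Bundles using (_↔_)
  open import Data.Vec as Vec using (Vec; []; _∷_)
  open import Data.Nat.Coprimality using (prime⇒coprime; coprime-Bézout)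
  open import Data.Nat.GCD using (module Bézout)
  open import Data.Fin.Properties using (*↔×)
  open import Function.Bundles using (mk↔ₛ′)
  open import Function.Properties.Inverse using (↔-sym; ↔-trans)
  open import Data.Product.Function.NonDependent.Propositional using (_×-↔_)

  -- The Kummer extension F[x]/(xˡ - a), where a has no ℓ-th root because
  -- a^((q-1)/ℓ) ≠ 1.  Elements are coefficient vectors, T is multiplication by x.
  module Extension {p k} (pp : Prime p) (𝔽 : FiniteField p k) (ℓ′ : ℕ) (ℓ-prime : Prime (suc ℓ′)) (c : ℕ) (q≡ : p ℕ.^ k ≡ suc (suc ℓ′ ℕ.* c)) where
    open FiniteField 𝔽

    ℓ : ℕ
    ℓ = suc ℓ′

    2≤ℓ : 2 ℕ.≤ ℓ
    2≤ℓ = ℕ.nonTrivial⇒n>1 ℓ {{Data.Nat.Primality.prime⇒nonTrivial ℓ-prime}}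

    1≤c : 1 ℕ.≤ c
    1≤c = go c q≡
      where
      only : ∀ {n} → n ≡ 1 → (i j : Fin n) → i ≡ j
      only refl Fin.zero Fin.zero = refl
      go : ∀ c → q ≡ suc (ℓ ℕ.* c) → 1 ℕ.≤ c
      go zero e = ⊥-elim (0≢1 (trans (sym (from-to 0#)) (trans (cong from (only (trans e (cong suc (ℕₚ.*-zeroʳ ℓ))) (to 0#) (to 1#))) (from-to 1#))))
      go (suc _) _ = ℕ.s≤s ℕ.z≤n

    -- x (x^c - 1) has degree c + 1, which is less than q = ℓ c + 1, so some field element is not a
    -- root.
    non-residue : Σ F λ a → (a ≢ 0#) × (a ^ c ≢ 1#)
    non-residue with Finₚ.any? (λ i → Relation.Nullary.Decidable.¬? (from i * (- 1# + from i ^ c) ≟ 0#))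
      where import Relation.Nullary.Decidable
    ... | yes (i , h) = from i , (λ e → h (trans (cong (_* (- 1# + from i ^ c)) e) (zeroˡ _))) , (λ e → h (trans (cong (λ z → from i * (- 1# + z)) e) (trans (cong (from i *_) (+-invˡ 1#)) (zeroʳ (from i)))))
    ... | no none = ⊥-elim (ℕₚ.<⇒≱ too-few (subst (ℕ._≤ suc (suc c′)) length-elements (subst (length elements ℕ.≤_) (cong (λ z → suc (suc z)) (length-replicate c′)) (roots≤degree _ poly refl elements elements-unique (Allₚ.tabulate⁺ root)))))
      where
      c′ : ℕ
      c′ = ℕ.pred c
      c≡ : suc c′ ≡ c
      c≡ = ℕₚ.suc-pred c {{ℕ.>-nonZero 1≤c}}
      poly : List F
      poly = 0# ∷ power-poly (- 1#) c′
      root : ∀ i → eval poly (from i) ≡ 0#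
      root i with from i * (- 1# + from i ^ c) ≟ 0#
      ... | yes e = trans (+-idˡ _) (trans (cong (from i *_) (trans (eval-power-poly (- 1#) c′ (from i)) (cong (λ z → - 1# + from i ^ z) c≡))) e)
      ... | no ne = ⊥-elim (none (i , ne))
      too-few : suc (suc c′) ℕ.< q
      too-few = subst₂′ (ℕ.s≤s (ℕₚ.≤-trans (ℕₚ.+-monoˡ-≤ c 1≤c) (ℕₚ.≤-trans (ℕₚ.≤-reflexive (cong (c ℕ.+_) (sym (ℕₚ.+-identityʳ c)))) (ℕₚ.*-monoˡ-≤ c 2≤ℓ))))
        where
        subst₂′ : suc (suc c) ℕ.≤ suc (ℓ ℕ.* c) → suc (suc c′) ℕ.< q
        subst₂′ h = subst₂ ℕ._≤_ (cong (λ z → suc (suc z)) (sym c≡)) (sym q≡) h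
          where open import Relation.Binary.PropositionalEquality using (subst₂)

    a : F
    a = proj₁ non-residue

    ζ : F
    ζ = a ^ c

    ζ≢1 : ζ ≢ 1#
    ζ≢1 = proj₂ (proj₂ non-residue)

    ζ^ℓ : ζ ^ ℓ ≡ 1#
    ζ^ℓ = trans (^-assocʳ a c ℓ) (trans (cong (a ^_) (ℕₚ.*-comm c ℓ)) (unit-power q≡ a (proj₁ (proj₂ non-residue))))

    -- i is invertible modulo the prime ℓ, so ζ^i = 1 and ζ^ℓ = 1 would give ζ = 1.
    ζ^≢1 : ∀ i → 1 ℕ.≤ i → i ℕ.< ℓ → ζ ^ i ≢ 1#
    ζ^≢1 i 1≤i i<ℓ e with coprime-Bézout (prime⇒coprime ℓ-prime {{ℕ.>-nonZero 1≤i}} i<ℓ)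
    ... | Bézout.+- x y eq = ζ≢1 (trans (sym (*-idʳ ζ)) (trans (cong (ζ *_) (sym (mult y i e))) (trans (cong (ζ ^_) eq) (mult x ℓ ζ^ℓ))))
      where
      mult : ∀ x n → ζ ^ n ≡ 1# → ζ ^ (x ℕ.* n) ≡ 1#
      mult x n h = trans (cong (ζ ^_) (ℕₚ.*-comm x n)) (trans (sym (^-assocʳ ζ n x)) (trans (cong (_^ x) h) (1^ x)))
    ... | Bézout.-+ x y eq = ζ≢1 (trans (sym (*-idʳ ζ)) (trans (cong (ζ *_) (sym (mult x ℓ ζ^ℓ))) (trans (cong (ζ ^_) eq) (mult y i e))))
      where
      mult : ∀ x n → ζ ^ n ≡ 1# → ζ ^ (x ℕ.* n) ≡ 1#
      mult x n h = trans (cong (ζ ^_) (ℕₚ.*-comm x n)) (trans (sym (^-assocʳ ζ n x)) (trans (cong (_^ x) h) (1^ x)))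

    infixl 6 _⊕_
    infixr 7 _⋆_

    _⊕_ : ∀ {n} → Vec F n → Vec F n → Vec F n
    [] ⊕ [] = []
    (x ∷ v) ⊕ (y ∷ w) = (x + y) ∷ (v ⊕ w)

    _⋆_ : ∀ {n} → F → Vec F n → Vec F n
    c ⋆ [] = []
    c ⋆ (x ∷ v) = (c * x) ∷ (c ⋆ v)

    𝟘 : ∀ {n} → Vec F n
    𝟘 {zero} = []
    𝟘 {suc n} = 0# ∷ 𝟘

    ⊖_ : ∀ {n} → Vec F n → Vec F n
    ⊖ [] = []
    ⊖ (x ∷ v) = (- x) ∷ (⊖ v)

    ⊕-assoc : ∀ {n} (u v w : Vec F n) → (u ⊕ v) ⊕ w ≡ u ⊕ (v ⊕ w)
    ⊕-assoc [] [] [] = refl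
    ⊕-assoc (x ∷ u) (y ∷ v) (z ∷ w) = cong₂ _∷_ (+-assoc x y z) (⊕-assoc u v w)

    ⊕-comm : ∀ {n} (u v : Vec F n) → u ⊕ v ≡ v ⊕ u
    ⊕-comm [] [] = refl
    ⊕-comm (x ∷ u) (y ∷ v) = cong₂ _∷_ (+-comm x y) (⊕-comm u v)

    ⊕-idˡ : ∀ {n} (u : Vec F n) → 𝟘 ⊕ u ≡ u
    ⊕-idˡ [] = refl
    ⊕-idˡ (x ∷ u) = cong₂ _∷_ (+-idˡ x) (⊕-idˡ u)

    ⊕-idʳ : ∀ {n} (u : Vec F n) → u ⊕ 𝟘 ≡ u
    ⊕-idʳ u = trans (⊕-comm u 𝟘) (⊕-idˡ u)

    ⊕-invˡ : ∀ {n} (u : Vec F n) → (⊖ u) ⊕ u ≡ 𝟘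
    ⊕-invˡ [] = refl
    ⊕-invˡ (x ∷ u) = cong₂ _∷_ (+-invˡ x) (⊕-invˡ u)

    ⋆-⊕ : ∀ {n} c (u v : Vec F n) → c ⋆ (u ⊕ v) ≡ c ⋆ u ⊕ c ⋆ v
    ⋆-⊕ c [] [] = refl
    ⋆-⊕ c (x ∷ u) (y ∷ v) = cong₂ _∷_ (distribˡ c x y) (⋆-⊕ c u v)

    +-⋆ : ∀ {n} c d (u : Vec F n) → (c + d) ⋆ u ≡ c ⋆ u ⊕ d ⋆ u
    +-⋆ c d [] = refl
    +-⋆ c d (x ∷ u) = cong₂ _∷_ (distribʳ x c d) (+-⋆ c d u)

    *-⋆ : ∀ {n} c d (u : Vec F n) → (c * d) ⋆ u ≡ c ⋆ d ⋆ u
    *-⋆ c d [] = refl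
    *-⋆ c d (x ∷ u) = cong₂ _∷_ (*-assoc c d x) (*-⋆ c d u)

    1⋆ : ∀ {n} (u : Vec F n) → 1# ⋆ u ≡ u
    1⋆ [] = refl
    1⋆ (x ∷ u) = cong₂ _∷_ (*-idˡ x) (1⋆ u)

    0⋆ : ∀ {n} (u : Vec F n) → 0# ⋆ u ≡ 𝟘
    0⋆ [] = refl
    0⋆ (x ∷ u) = cong₂ _∷_ (zeroˡ x) (0⋆ u)

    ⋆𝟘 : ∀ {n} c → c ⋆ 𝟘 {n} ≡ 𝟘
    ⋆𝟘 {zero} c = refl
    ⋆𝟘 {suc n} c = cong₂ _∷_ (zeroʳ c) (⋆𝟘 c)

    ⊕-swap : ∀ {n} (u v w x : Vec F n) → (u ⊕ v) ⊕ (w ⊕ x) ≡ (u ⊕ w) ⊕ (v ⊕ x)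
    ⊕-swap u v w x = trans (⊕-assoc u v (w ⊕ x)) (trans (cong (u ⊕_) (trans (sym (⊕-assoc v w x)) (trans (cong (_⊕ x) (⊕-comm v w)) (⊕-assoc w v x)))) (sym (⊕-assoc u w (v ⊕ x))))

    shift : ∀ {n} → F → Vec F n → Vec F n
    shift c [] = []
    shift c (x ∷ v) = c ∷ shift x v

    over : ∀ {n} → F → Vec F n → F
    over c [] = c
    over c (x ∷ v) = over x v

    shift-⊕ : ∀ {n} c d (u v : Vec F n) → shift (c + d) (u ⊕ v) ≡ shift c u ⊕ shift d v
    shift-⊕ c d [] [] = refl
    shift-⊕ c d (x ∷ u) (y ∷ v) = cong ((c + d) ∷_) (shift-⊕ x y u v)

    over-⊕ : ∀ {n} c d (u v : Vec F n) → over (c + d) (u ⊕ v) ≡ over c u + over d v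
    over-⊕ c d [] [] = refl
    over-⊕ c d (x ∷ u) (y ∷ v) = over-⊕ x y u v

    shift-⋆ : ∀ {n} c d (u : Vec F n) → shift (c * d) (c ⋆ u) ≡ c ⋆ shift d u
    shift-⋆ c d [] = refl
    shift-⋆ c d (x ∷ u) = cong ((c * d) ∷_) (shift-⋆ c x u)

    over-⋆ : ∀ {n} c d (u : Vec F n) → over (c * d) (c ⋆ u) ≡ c * over d u
    over-⋆ c d [] = refl
    over-⋆ c d (x ∷ u) = over-⋆ c x u

    A : Set
    A = Vec F ℓ

    e₀ : A
    e₀ = 1# ∷ 𝟘

    T : A → A
    T w = shift 0# w ⊕ (over 0# w * a) ⋆ e₀

    T-⊕ : ∀ u v → T (u ⊕ v) ≡ T u ⊕ T v
    T-⊕ u v = trans (cong₂ (λ s o → s ⊕ (o * a) ⋆ e₀) (trans (cong (λ z → shift z (u ⊕ v)) (sym (+-idˡ 0#))) (shift-⊕ 0# 0# u v)) (trans (cong (λ z → over z (u ⊕ v)) (sym (+-idˡ 0#))) (over-⊕ 0# 0# u v)))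
      (trans (cong ((shift 0# u ⊕ shift 0# v) ⊕_) (trans (cong (_⋆ e₀) (distribʳ a (over 0# u) (over 0# v))) (+-⋆ _ _ e₀))) (⊕-swap _ _ _ _))

    T-⋆ : ∀ c u → T (c ⋆ u) ≡ c ⋆ T u
    T-⋆ c u = trans (cong₂ (λ s o → s ⊕ (o * a) ⋆ e₀) (trans (cong (λ z → shift z (c ⋆ u)) (sym (zeroʳ c))) (shift-⋆ c 0# u)) (trans (cong (λ z → over z (c ⋆ u)) (sym (zeroʳ c))) (over-⋆ c 0# u)))
      (trans (cong (c ⋆ shift 0# u ⊕_) (trans (cong (_⋆ e₀) (*-assoc c (over 0# u) a)) (*-⋆ c (over 0# u * a) e₀))) (sym (⋆-⊕ c _ _)))

    T-𝟘 : T 𝟘 ≡ 𝟘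
    T-𝟘 = trans (cong T (sym (0⋆ 𝟘))) (trans (T-⋆ 0# 𝟘) (0⋆ (T 𝟘)))

    T^ : ℕ → A → A
    T^ zero w = w
    T^ (suc n) w = T (T^ n w)

    comb : ∀ {n} → Vec F n → A → A
    comb [] w = 𝟘
    comb (c ∷ v) w = c ⋆ w ⊕ T (comb v w)

    comb-⊕ˡ : ∀ {n} (u v : Vec F n) w → comb (u ⊕ v) w ≡ comb u w ⊕ comb v w
    comb-⊕ˡ [] [] w = sym (⊕-idˡ 𝟘)
    comb-⊕ˡ (x ∷ u) (y ∷ v) w = trans (cong₂ _⊕_ (+-⋆ x y w) (trans (cong T (comb-⊕ˡ u v w)) (T-⊕ _ _))) (⊕-swap _ _ _ _)

    comb-⊕ʳ : ∀ {n} (u : Vec F n) v w → comb u (v ⊕ w) ≡ comb u v ⊕ comb u w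
    comb-⊕ʳ [] v w = sym (⊕-idˡ 𝟘)
    comb-⊕ʳ (x ∷ u) v w = trans (cong₂ _⊕_ (⋆-⊕ x v w) (trans (cong T (comb-⊕ʳ u v w)) (T-⊕ _ _))) (⊕-swap _ _ _ _)

    comb-⋆ʳ : ∀ {n} c (u : Vec F n) w → comb u (c ⋆ w) ≡ c ⋆ comb u w
    comb-⋆ʳ c [] w = sym (⋆𝟘 c)
    comb-⋆ʳ c (x ∷ u) w = trans (cong₂ _⊕_ (trans (sym (*-⋆ x c w)) (trans (cong (_⋆ w) (*-comm x c)) (*-⋆ c x w))) (trans (cong T (comb-⋆ʳ c u w)) (T-⋆ c _))) (sym (⋆-⊕ c _ _))

    comb-⋆ˡ : ∀ {n} c (u : Vec F n) w → comb (c ⋆ u) w ≡ c ⋆ comb u w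
    comb-⋆ˡ c [] w = sym (⋆𝟘 c)
    comb-⋆ˡ c (x ∷ u) w = trans (cong₂ _⊕_ (*-⋆ c x w) (trans (cong T (comb-⋆ˡ c u w)) (T-⋆ c _))) (sym (⋆-⊕ c _ _))

    comb-T : ∀ {n} (u : Vec F n) w → comb u (T w) ≡ T (comb u w)
    comb-T [] w = sym T-𝟘
    comb-T (x ∷ u) w = trans (cong₂ _⊕_ (sym (T-⋆ x w)) (cong T (comb-T u w))) (sym (T-⊕ _ _))

    comb-T^ : ∀ {n} (u : Vec F n) m w → comb u (T^ m w) ≡ T^ m (comb u w)
    comb-T^ u zero w = refl
    comb-T^ u (suc m) w = trans (comb-T u (T^ m w)) (cong T (comb-T^ u m w))

    comb-𝟘ˡ : ∀ n w → comb (𝟘 {n}) w ≡ 𝟘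
    comb-𝟘ˡ zero w = refl
    comb-𝟘ˡ (suc n) w = trans (cong₂ _⊕_ (0⋆ w) (trans (cong T (comb-𝟘ˡ n w)) T-𝟘)) (⊕-idˡ 𝟘)

    pad : ∀ n → List F → Vec F n
    pad n [] = 𝟘
    pad zero (c ∷ cs) = []
    pad (suc n) (c ∷ cs) = c ∷ pad n cs

    shift-𝟘 : ∀ n → (shift 0# (𝟘 {n}) ≡ 𝟘) × (over 0# (𝟘 {n}) ≡ 0#)
    shift-𝟘 zero = refl , refl
    shift-𝟘 (suc n) = cong (0# ∷_) (proj₁ (shift-𝟘 n)) , proj₂ (shift-𝟘 n)

    shift-pad : ∀ n cs d → length cs ℕ.< n → (shift d (pad n cs) ≡ pad n (d ∷ cs)) × (over d (pad n cs) ≡ 0#)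
    shift-pad (suc n) [] d _ = cong (d ∷_) (proj₁ (shift-𝟘 n)) , proj₂ (shift-𝟘 n)
    shift-pad (suc n) (c ∷ cs) d h = cong (d ∷_) (proj₁ (shift-pad n cs c (ℕₚ.≤-pred h))) , proj₂ (shift-pad n cs c (ℕₚ.≤-pred h))

    T-pad : ∀ cs → length cs ℕ.< ℓ → T (pad ℓ cs) ≡ pad ℓ (0# ∷ cs)
    T-pad cs h = trans (cong₂ (λ s o → s ⊕ (o * a) ⋆ e₀) (proj₁ (shift-pad ℓ cs 0# h)) (proj₂ (shift-pad ℓ cs 0# h))) (trans (cong (pad ℓ (0# ∷ cs) ⊕_) (trans (cong (_⋆ e₀) (zeroˡ a)) (0⋆ e₀))) (⊕-idʳ _))

    monomial : ℕ → List F
    monomial n = replicate n 0# List.++ (1# ∷ [])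

    length-monomial : ∀ n → length (monomial n) ≡ suc n
    length-monomial zero = refl
    length-monomial (suc n) = cong suc (length-monomial n)

    T^-e₀ : ∀ n → n ℕ.< ℓ → T^ n e₀ ≡ pad ℓ (monomial n)
    T^-e₀ zero h = refl
    T^-e₀ (suc n) h = trans (cong T (T^-e₀ n (ℕₚ.<⇒≤ h))) (T-pad (monomial n) (subst (ℕ._< ℓ) (sym (length-monomial n)) h))

    shift-top : ∀ n d → (shift 0# (pad (suc n) (monomial n)) ≡ 𝟘) × (over d (pad (suc n) (monomial n)) ≡ 1#)
    shift-top zero d = refl , refl
    shift-top (suc n) d = cong (0# ∷_) (proj₁ (shift-top n 0#)) , proj₂ (shift-top n 0#)

    T^ℓ-e₀ : T^ ℓ e₀ ≡ a ⋆ e₀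
    T^ℓ-e₀ = trans (cong T (T^-e₀ ℓ′ ℕₚ.≤-refl)) (trans (cong₂ (λ s o → s ⊕ (o * a) ⋆ e₀) (proj₁ (shift-top ℓ′ 0#)) (proj₂ (shift-top ℓ′ 0#))) (trans (⊕-idˡ _) (cong (_⋆ e₀) (*-idˡ a))))

    comb-e₀ : ∀ {n} (v : Vec F n) → n ℕ.≤ ℓ → comb v e₀ ≡ pad ℓ (Vec.toList v)
    comb-e₀ [] _ = refl
    comb-e₀ {suc n} (c ∷ v) h = trans (cong (c ⋆ e₀ ⊕_) (trans (cong T (comb-e₀ v (ℕₚ.<⇒≤ h))) (T-pad (Vec.toList v) (subst (ℕ._< ℓ) (sym (length-toList v)) h))))
      (cong₂ _∷_ (trans (+-idʳ _) (*-idʳ c)) (trans (cong (_⊕ pad ℓ′ (Vec.toList v)) (⋆𝟘 c)) (⊕-idˡ _)))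
      where
      length-toList : ∀ {n} (v : Vec F n) → length (Vec.toList v) ≡ n
      length-toList [] = refl
      length-toList (x ∷ v) = cong suc (length-toList v)

    pad-toList : ∀ {n} (v : Vec F n) → pad n (Vec.toList v) ≡ v
    pad-toList [] = refl
    pad-toList (x ∷ v) = cong (x ∷_) (pad-toList v)

    infixl 7 _⊗_
    _⊗_ : A → A → A
    _⊗_ = comb

    ⊗-e₀ : ∀ v → v ⊗ e₀ ≡ v
    ⊗-e₀ v = trans (comb-e₀ v ℕₚ.≤-refl) (pad-toList v)

    e₀-⊗ : ∀ v → e₀ ⊗ v ≡ v
    e₀-⊗ v = trans (cong₂ _⊕_ (1⋆ v) (trans (cong T (comb-𝟘ˡ ℓ′ v)) T-𝟘)) (⊕-idʳ v)

    T^ℓ : ∀ w → T^ ℓ w ≡ a ⋆ w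
    T^ℓ w = trans (cong (T^ ℓ) (sym (⊗-e₀ w))) (trans (sym (comb-T^ w ℓ e₀)) (trans (cong (w ⊗_) T^ℓ-e₀) (trans (comb-⋆ʳ a w e₀) (cong (a ⋆_) (⊗-e₀ w)))))

    -- Multiplication by T shifts the coefficients, and the one pushed out at the top comes back
    -- with T^n. For n = ℓ the relation T^ℓ = a turns this into `T-⊗`.
    comb-shift : ∀ {n} c (v : Vec F n) w → comb (shift c v) w ⊕ over c v ⋆ T^ n w ≡ c ⋆ w ⊕ T (comb v w)
    comb-shift c [] w = trans (⊕-idˡ _) (sym (trans (cong (c ⋆ w ⊕_) T-𝟘) (⊕-idʳ _)))
    comb-shift c (x ∷ v) w = trans (⊕-assoc _ _ _) (cong (c ⋆ w ⊕_) (trans (cong (T (comb (shift x v) w) ⊕_) (sym (T-⋆ (over x v) _))) (trans (sym (T-⊕ _ _)) (cong T (comb-shift x v w)))))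

    T-⊗ : ∀ v w → T v ⊗ w ≡ T (v ⊗ w)
    T-⊗ v w = begin
      comb (shift 0# v ⊕ (o * a) ⋆ e₀) w ≡⟨ comb-⊕ˡ (shift 0# v) ((o * a) ⋆ e₀) w ⟩
      comb (shift 0# v) w ⊕ comb ((o * a) ⋆ e₀) w ≡⟨ cong (comb (shift 0# v) w ⊕_) (trans (comb-⋆ˡ (o * a) e₀ w) (trans (cong ((o * a) ⋆_) (e₀-⊗ w)) (trans (*-⋆ o a w) (cong (o ⋆_) (sym (T^ℓ w)))))) ⟩
      comb (shift 0# v) w ⊕ o ⋆ T^ ℓ w ≡⟨ comb-shift 0# v w ⟩
      0# ⋆ w ⊕ T (comb v w) ≡⟨ trans (cong (_⊕ T (comb v w)) (0⋆ w)) (⊕-idˡ _) ⟩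
      T (v ⊗ w) ∎
      where
      open ≡-Reasoning
      o : F
      o = over 0# v

    comb-⊗ : ∀ {n} (u : Vec F n) v w → comb u v ⊗ w ≡ comb u (v ⊗ w)
    comb-⊗ [] v w = comb-𝟘ˡ ℓ w
    comb-⊗ (c ∷ u) v w = trans (comb-⊕ˡ (c ⋆ v) (T (comb u v)) w) (cong₂ _⊕_ (comb-⋆ˡ c v w) (trans (T-⊗ (comb u v) w) (cong T (comb-⊗ u v w))))

    -- Multiplication by w commutes with scalars and with T, so the polynomial u in T can be pulled
    -- out of the product.
    comb-comm : ∀ {n} (u : Vec F n) w → comb u w ≡ w ⊗ comb u e₀
    comb-comm [] w = sym (trans (cong (w ⊗_) (sym (0⋆ 𝟘))) (trans (comb-⋆ʳ 0# w 𝟘) (0⋆ _)))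
    comb-comm (c ∷ u) w = sym (trans (comb-⊕ʳ w (c ⋆ e₀) (T (comb u e₀))) (cong₂ _⊕_ (trans (comb-⋆ʳ c w e₀) (cong (c ⋆_) (⊗-e₀ w))) (trans (comb-T w (comb u e₀)) (cong T (sym (comb-comm u w))))))

    ring-A : Ring≡
    ring-A = record
      { F = A ; _+_ = _⊕_ ; _*_ = _⊗_ ; -_ = ⊖_ ; 0# = 𝟘 ; 1# = e₀ ; +-assoc = ⊕-assoc ; +-comm = ⊕-comm ; +-idˡ = ⊕-idˡ ; +-invˡ = ⊕-invˡ
      ; *-assoc = comb-⊗ ; *-comm = λ u w → trans (comb-comm u w) (cong (w ⊗_) (⊗-e₀ u)) ; *-idˡ = e₀-⊗ ; distribˡ = comb-⊕ʳ }

    module 𝔸 = RingKit ring-A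

    ι : F → A
    ι c = c ⋆ e₀

    ι-* : ∀ c d → ι (c * d) ≡ ι c ⊗ ι d
    ι-* c d = sym (trans (comb-⋆ˡ c e₀ (ι d)) (trans (cong (c ⋆_) (e₀-⊗ (ι d))) (sym (*-⋆ c d e₀))))

    ι-⊗ : ∀ c v → ι c ⊗ v ≡ c ⋆ v
    ι-⊗ c v = trans (comb-⋆ˡ c e₀ v) (cong (c ⋆_) (e₀-⊗ v))

    ι-^ : ∀ c n → ι c 𝔸.^ n ≡ ι (c ^ n)
    ι-^ c zero = sym (1⋆ e₀)
    ι-^ c (suc n) = trans (cong (ι c ⊗_) (ι-^ c n)) (sym (ι-* c (c ^ n)))

    char-A : p 𝔸.· e₀ ≡ 𝟘
    char-A = trans (go p) (trans (cong ι char) (0⋆ e₀))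
      where
      go : ∀ n → n 𝔸.· e₀ ≡ ι (n · 1#)
      go zero = sym (0⋆ e₀)
      go (suc n) = trans (cong₂ _⊕_ (sym (1⋆ e₀)) (go n)) (sym (+-⋆ 1# (n · 1#) e₀))

    open 𝔸.Frobenius pp char-A using (frobenius^-+)

    φ : A → A
    φ v = v 𝔸.^ (p ℕ.^ k)

    ξ : A
    ξ = T e₀

    ξ-⊗ : ∀ v → ξ ⊗ v ≡ T v
    ξ-⊗ v = trans (T-⊗ e₀ v) (cong T (e₀-⊗ v))

    ξ^ : ∀ n → ξ 𝔸.^ n ≡ T^ n e₀
    ξ^ zero = refl
    ξ^ (suc n) = trans (ξ-⊗ _) (cong T (ξ^ n))

    -- q = 1 + ℓ c, so ξ^q = ξ (ξ^ℓ)^c = ξ a^c.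
    φ-ξ : φ ξ ≡ ζ ⋆ ξ
    φ-ξ = trans (cong (ξ 𝔸.^_) q≡) (trans (cong (ξ ⊗_) (trans (sym (𝔸.^-assocʳ ξ ℓ c)) (trans (cong (𝔸._^ c) (trans (ξ^ ℓ) T^ℓ-e₀)) (ι-^ a c)))) (trans (𝔸.*-comm ξ (ι ζ)) (ι-⊗ ζ ξ)))

    φ-ι⋆ : ∀ c v → φ (c ⋆ v) ≡ c ⋆ φ v
    φ-ι⋆ c v = trans (cong φ (sym (ι-⊗ c v))) (trans (𝔸.^-distrib-* (ι c) v (p ℕ.^ k)) (trans (cong (_⊗ φ v) (trans (ι-^ c (p ℕ.^ k)) (cong ι (frob c)))) (ι-⊗ c (φ v))))

    φ-T : ∀ v → φ (T v) ≡ ζ ⋆ T (φ v)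
    φ-T v = trans (cong φ (sym (ξ-⊗ v))) (trans (𝔸.^-distrib-* ξ v (p ℕ.^ k)) (trans (cong (_⊗ φ v) φ-ξ) (trans (comb-⋆ˡ ζ ξ (φ v)) (cong (ζ ⋆_) (ξ-⊗ (φ v))))))

    -- Multiplies the coefficient with index i by d g^i. For g = ζ and d = 1 this is the q-power
    -- map, by `φ-D`; its iterate of order ℓ is trivial because ζ^ℓ = 1, which gives `frob-A`.
    D : ∀ {n} → F → F → Vec F n → Vec F n
    D g d [] = []
    D g d (x ∷ v) = (d * x) ∷ D g (g * d) v

    D-scale : ∀ {n} g c d (v : Vec F n) → D g (c * d) v ≡ c ⋆ D g d v
    D-scale g c d [] = refl
    D-scale g c d (x ∷ v) = cong₂ _∷_ (*-assoc c d x) (trans (cong (λ z → D g z v) (trans (sym (*-assoc g c d)) (trans (cong (_* d) (*-comm g c)) (*-assoc c g d)))) (D-scale g c (g * d) v))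

    φ-comb : ∀ {n} (v : Vec F n) → φ (comb v e₀) ≡ comb (D ζ 1# v) e₀
    φ-comb [] = trans (cong φ (sym (0⋆ e₀))) (trans (φ-ι⋆ 0# e₀) (0⋆ (φ e₀)))
    φ-comb (x ∷ v) = trans (frobenius^-+ k (x ⋆ e₀) (T (comb v e₀))) (cong₂ _⊕_ (trans (φ-ι⋆ x e₀) (trans (cong (x ⋆_) (𝔸.1^ (p ℕ.^ k))) (cong (_⋆ e₀) (sym (*-idˡ x)))))
      (trans (φ-T (comb v e₀)) (trans (cong (λ z → ζ ⋆ T z) (φ-comb v)) (trans (sym (T-⋆ ζ _)) (cong T (trans (sym (comb-⋆ˡ ζ (D ζ 1# v) e₀)) (cong (λ z → comb z e₀) (sym (D-scale ζ ζ 1# v)))))))))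

    φ-D : ∀ v → φ v ≡ D ζ 1# v
    φ-D v = trans (cong φ (sym (⊗-e₀ v))) (trans (φ-comb v) (⊗-e₀ (D ζ 1# v)))

    D-D : ∀ {n} g h d e (v : Vec F n) → D g d (D h e v) ≡ D (g * h) (d * e) v
    D-D g h d e [] = refl
    D-D g h d e (x ∷ v) = cong₂ _∷_ (sym (*-assoc d e x)) (trans (D-D g h (g * d) (h * e) v) (cong (λ z → D (g * h) z v) (solve 4 (λ g h d e → (g :* d) :* (h :* e) := (g :* h) :* (d :* e)) refl g h d e)))

    D-1 : ∀ {n} (v : Vec F n) → D 1# 1# v ≡ v
    D-1 [] = refl
    D-1 (x ∷ v) = cong₂ _∷_ (*-idˡ x) (trans (cong (λ z → D 1# z v) (*-idˡ 1#)) (D-1 v))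

    φ^ : ∀ j v → v 𝔸.^ ((p ℕ.^ k) ℕ.^ j) ≡ D (ζ ^ j) 1# v
    φ^ zero v = trans (𝔸.*-idʳ v) (sym (D-1 v))
    φ^ (suc j) v = trans (sym (𝔸.^-assocʳ v (p ℕ.^ k) ((p ℕ.^ k) ℕ.^ j))) (trans (φ^ j (φ v)) (trans (cong (D (ζ ^ j) 1#) (φ-D v)) (trans (D-D (ζ ^ j) ζ 1# 1# v) (cong₂ (λ g d → D g d v) (*-comm (ζ ^ j) ζ) (*-idˡ 1#)))))

    Q : ℕ
    Q = p ℕ.^ (k ℕ.* ℓ)

    frob-A : ∀ v → v 𝔸.^ Q ≡ v
    frob-A v = trans (cong (v 𝔸.^_) (sym (ℕₚ.^-*-assoc p k ℓ))) (trans (φ^ ℓ v) (trans (cong (λ g → D g 1# v) ζ^ℓ) (D-1 v)))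

    -- A coefficient with index 1 ≤ i < ℓ is fixed under multiplication by ζ^i ≠ 1 and so vanishes.
    -- Hence the fixed elements of the q-power map are the constants.
    fixed-tail : ∀ {n} i (v : Vec F n) → 1 ℕ.≤ i → i ℕ.+ n ℕ.≤ ℓ → D ζ (ζ ^ i) v ≡ v → v ≡ 𝟘
    fixed-tail i [] _ _ _ = refl
    fixed-tail {suc n} i (x ∷ v) 1≤i h e = cong₂ _∷_ head (fixed-tail (suc i) v (ℕ.s≤s ℕ.z≤n) (subst (ℕ._≤ ℓ) (ℕₚ.+-suc i n) h) (cong Vec.tail e))
      where
      head : x ≡ 0#
      head with x ≟ 0#
      ... | yes z = z
      ... | no nz = ⊥-elim (ζ^≢1 i 1≤i (ℕₚ.<-≤-trans (ℕₚ.m<m+n i (ℕ.s≤s ℕ.z≤n)) h) (cancelˡ x nz (trans (*-comm x (ζ ^ i)) (trans (cong Vec.head e) (sym (*-idʳ x))))))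

    idempotent-^ : ∀ v → v ⊗ v ≡ v → ∀ n → v 𝔸.^ suc n ≡ v
    idempotent-^ v h zero = 𝔸.*-idʳ v
    idempotent-^ v h (suc n) = trans (cong (v ⊗_) (idempotent-^ v h n)) h

    -- An idempotent is fixed by the q-power map, hence lies in F.
    idempotent-tail : ∀ v → v ⊗ v ≡ v → Vec.tail v ≡ 𝟘
    idempotent-tail v@(_ ∷ w) h = fixed-tail 1 w ℕₚ.≤-refl ℕₚ.≤-refl (cong Vec.tail (trans (sym (φ-D v)) (trans (cong (v 𝔸.^_) q≡) (idempotent-^ v h (ℓ ℕ.* c)))))

    idempotent : ∀ v → v ⊗ v ≡ v → (v ≡ 𝟘) ⊎ (v ≡ e₀)
    idempotent v@(x ∷ w) h = Sum.map (λ e → cong₂ _∷_ e (idempotent-tail v h)) (λ e → cong₂ _∷_ (diff-zero x 1# e) (idempotent-tail v h)) (nozero x (x + - 1#) x²)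
      where
      v≡ι : v ≡ ι x
      v≡ι = cong₂ _∷_ (sym (*-idʳ x)) (trans (idempotent-tail v h) (sym (⋆𝟘 x)))
      xx : x * x ≡ x
      xx = trans (sym (*-idʳ (x * x))) (cong Vec.head (trans (ι-* x x) (trans (cong₂ _⊗_ (sym v≡ι) (sym v≡ι)) h)))
      x² : x * (x + - 1#) ≡ 0#
      x² = trans (distribˡ x x (- 1#)) (trans (cong (_+ x * - 1#) (trans xx (sym (*-idʳ x)))) (trans (sym (distribˡ x 1# (- 1#))) (trans (cong (x *_) (+-invʳ 1#)) (zeroʳ x))))

    2≤Q : 2 ℕ.≤ Q
    2≤Q = ℕₚ.≤-trans (subst (2 ℕ.≤_) (sym q≡) (ℕ.s≤s (1≤ℓc 1≤c))) (subst (p ℕ.^ k ℕ.≤_) (ℕₚ.^-*-assoc p k ℓ) (ℕₚ.m≤m*n (p ℕ.^ k) ((p ℕ.^ k) ℕ.^ ℓ′) {{ℕ.>-nonZero (ℕₚ.m^n>0 (p ℕ.^ k) {{q≢0}} ℓ′)}}))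
      where
      1≤ℓc : 1 ℕ.≤ c → 1 ℕ.≤ ℓ ℕ.* c
      1≤ℓc h = ℕₚ.≤-trans h (ℕₚ.m≤m+n c _)
      q≢0 : ℕ.NonZero (p ℕ.^ k)
      q≢0 = subst ℕ.NonZero (sym q≡) _

    -- v^(Q-1) is idempotent, so it is 1 unless v = 0.
    unit-A : ∀ v → v ≢ 𝟘 → Σ A λ w → v ⊗ w ≡ e₀
    unit-A v v≢𝟘 = go Q 2≤Q (frob-A v)
      where
      go : ∀ n → 2 ℕ.≤ n → v 𝔸.^ n ≡ v → Σ A λ w → v ⊗ w ≡ e₀
      go (suc zero) (ℕ.s≤s ()) _
      go (suc (suc n)) _ h with idempotent (v 𝔸.^ suc n) idem
        where
        idem : v 𝔸.^ suc n ⊗ v 𝔸.^ suc n ≡ v 𝔸.^ suc n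
        idem = trans (sym (𝔸.^-homo-* v (suc n) (suc n))) (trans (cong (v 𝔸.^_) (cong suc (trans (ℕₚ.+-comm n (suc n)) refl))) (trans (𝔸.^-homo-* v (suc (suc n)) n) (cong (_⊗ v 𝔸.^ n) h)))
      ... | inj₁ z = ⊥-elim (v≢𝟘 (trans (sym h) (trans (cong (v ⊗_) z) (𝔸.zeroʳ v))))
      ... | inj₂ e = v 𝔸.^ n , e

    nozero-A : ∀ u v → u ⊗ v ≡ 𝟘 → (u ≡ 𝟘) ⊎ (v ≡ 𝟘)
    nozero-A u v h = decide (zero? u)
      where
      zero? : ∀ {n} (u : Vec F n) → Dec (u ≡ 𝟘)
      zero? [] = yes refl
      zero? (x ∷ u) with x ≟ 0# | zero? u
      ... | yes e | yes e′ = yes (cong₂ _∷_ e e′)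
      ... | no ne | _ = no (λ e → ne (cong Vec.head e))
      ... | yes _ | no ne = no (λ e → ne (cong Vec.tail e))
      decide : Dec (u ≡ 𝟘) → (u ≡ 𝟘) ⊎ (v ≡ 𝟘)
      decide (yes e) = inj₁ e
      decide (no ne) = let (w , uw) = unit-A u ne in inj₂ (trans (sym (e₀-⊗ v)) (trans (cong (_⊗ v) (trans (sym uw) (𝔸.*-comm u w))) (trans (comb-⊗ w u v) (trans (cong (w ⊗_) h) (𝔸.zeroʳ w)))))

    enum-Vec : ∀ n → Vec F n ↔ Fin ((p ℕ.^ k) ℕ.^ n)
    enum-Vec zero = mk↔ₛ′ (λ _ → Fin.zero) (λ _ → []) (λ { Fin.zero → refl ; (Fin.suc ()) }) (λ { [] → refl })
    enum-Vec (suc n) = ↔-trans (mk↔ₛ′ (λ v → Vec.head v , Vec.tail v) (λ { (x , v) → x ∷ v }) (λ _ → refl) (λ { (x ∷ v) → refl })) (↔-trans (enum ×-↔ enum-Vec n) (↔-sym *↔×))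

    extension : FiniteField p (k ℕ.* ℓ)
    extension = record { R = ring-A ; 0≢1 = λ e → 0≢1 (cong Vec.head e) ; nozero = nozero-A ; char = char-A ; frob = frob-A
      ; enum = subst (λ z → A ↔ Fin z) (ℕₚ.^-*-assoc p k ℓ) (enum-Vec ℓ) }

-- Fields whose order is 1 modulo all small numbers

module Tower where

  open ArithmeticFunctions using (factor-ind; Least; prime≥1)
  open FiniteFields
  open PrimeFields using (primeField)
  open Kummer using (module Extension)
  open import Data.Nat as ℕ using (ℕ; zero; suc; _+_; _*_; _^_; _≤_; _<_; _!; z≤n; s≤s)
  open import Data.Nat.Properties
  open import Data.Nat.DivMod using (_%_; _/_; m≡m%n+[m/n]*n; m%n<n)
  open import Data.Nat.Divisibility
  open import Data.Nat.Primality using (Prime; euclidsLemma; ¬prime[0]; ¬prime[1]; prime⇒nonZero)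
  open import Data.Nat.Coprimality using (Coprime; coprime-divisor; prime⇒coprime) renaming (sym to coprime-sym)
  open import Data.Nat.Solver using (module +-*-Solver)
  open import Data.Fin as Fin using (Fin; toℕ; fromℕ<)
  open import Data.Fin.Properties using (pigeonhole; toℕ-fromℕ<; toℕ<n)

  OneMod : ℕ → ℕ → Set
  OneMod d n = Σ ℕ λ c → n ≡ suc (d * c)

  OneMod-* : ∀ d {m n} → OneMod d m → OneMod d n → OneMod d (m * n)
  OneMod-* d (a , refl) (b , refl) = a + b + d * (a * b) , alg d a b
    where
    open +-*-Solver
    alg : ∀ d a b → suc (d * a) * suc (d * b) ≡ suc (d * (a + b + d * (a * b)))
    alg = solve 3 (λ d a b → (con 1 :+ d :* a) :* (con 1 :+ d :* b) := con 1 :+ d :* (a :+ b :+ d :* (a :* b))) refl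

  OneMod-^ : ∀ d {m} n → OneMod d m → OneMod d (m ^ n)
  OneMod-^ d zero h = 0 , cong suc (sym (*-zeroʳ d))
  OneMod-^ d (suc n) h = OneMod-* d h (OneMod-^ d n h)

  OneMod-∣ : ∀ {d n} → d ∣ n → OneMod d (suc n)
  OneMod-∣ {d} (divides c refl) = c , cong suc (*-comm c d)

  coprime-^ : ∀ {n q} → Coprime n q → ∀ i → Coprime n (q ^ i)
  coprime-^ h zero (_ , c∣1) = ∣1⇒≡1 c∣1
  coprime-^ {n} {q} h (suc i) {c} (c∣n , c∣) = coprime-^ h i (c∣n , coprime-divisor (λ { (d∣c , d∣q) → h (∣-trans d∣c c∣n , d∣q) }) c∣)

  same-mod : ∀ n .{{_ : ℕ.NonZero n}} m k → (m + k) % n ≡ m % n → n ∣ k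
  same-mod n m k e = ∣m+n∣m⇒∣n (divides ((m + k) / n) (+-cancelˡ-≡ (m % n) _ _ (trans (sym (+-assoc (m % n) _ k)) (trans (cong (_+ k) (sym (m≡m%n+[m/n]*n m n))) (trans (m≡m%n+[m/n]*n (m + k) n) (cong (_+ (m + k) / n * n) e)))))) (divides (m / n) refl)

  -- The powers q^0, ..., q^j take only the j nonzero residues modulo j + 1, so two of them agree,
  -- and the smaller one can be cancelled because it is prime to j + 1.
  order : ∀ j q → 1 ≤ j → 1 ≤ q → Coprime (suc j) q → Σ ℕ λ d → (1 ≤ d) × (d ≤ j) × OneMod (suc j) (q ^ d)
  order j q 1≤j 1≤q cop = go (pigeonhole (n<1+n j) f)
    where
    n : ℕ
    n = suc j
    r : ℕ → ℕ
    r i = q ^ i % n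
    r≢0 : ∀ i → 1 ≤ r i
    r≢0 i = n≢0⇒n>0 (λ e → <-irrefl (sym (coprime-^ cop i (∣-refl , m%n≡0⇒n∣m (q ^ i) n e))) (s≤s 1≤j))
    f : Fin (suc j) → Fin j
    f i = fromℕ< {ℕ.pred (r (toℕ i))} (<-≤-trans (≤-reflexive (suc-pred (r (toℕ i)) {{ℕ.>-nonZero (r≢0 (toℕ i))}})) (≤-pred (m%n<n (q ^ toℕ i) n)))
    go : Σ (Fin (suc j)) (λ a → Σ (Fin (suc j)) λ b → (a Fin.< b) × (f a ≡ f b)) → Σ ℕ λ d → (1 ≤ d) × (d ≤ j) × OneMod n (q ^ d)
    go (a , b , a<b , e) = d , m<n⇒0<n∸m a<b , ≤-trans (m∸n≤m (toℕ b) (toℕ a)) (≤-pred (toℕ<n b)) , subst (OneMod n) e≡ (OneMod-∣ (coprime-divisor (coprime-^ cop (toℕ a)) (same-mod n (q ^ toℕ a) (q ^ toℕ a * E) eq)))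
      where
      d E : ℕ
      d = toℕ b ℕ.∸ toℕ a
      E = ℕ.pred (q ^ d)
      e≡ : suc E ≡ q ^ d
      e≡ = suc-pred (q ^ d) {{ℕ.>-nonZero (m^n>0 q {{ℕ.>-nonZero 1≤q}} d)}}
      r≡ : r (toℕ a) ≡ r (toℕ b)
      r≡ = trans (sym (suc-pred (r (toℕ a)) {{ℕ.>-nonZero (r≢0 (toℕ a))}})) (trans (cong suc (trans (sym (toℕ-fromℕ< _)) (trans (cong toℕ e) (toℕ-fromℕ< _)))) (suc-pred (r (toℕ b)) {{ℕ.>-nonZero (r≢0 (toℕ b))}}))
      eq : (q ^ toℕ a + q ^ toℕ a * E) % n ≡ q ^ toℕ a % n
      eq = trans (cong (_% n) (trans (sym (*-suc (q ^ toℕ a) E)) (trans (cong (q ^ toℕ a *_) e≡) (trans (sym (^-distribˡ-+-* q (toℕ a) d)) (cong (q ^_) (m+[n∸m]≡n (<⇒≤ a<b))))))) (sym r≡)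

  -- The prime factors ℓ of N are adjoined one at a time. Being 1 modulo the remaining primes passes
  -- from q to its powers, so every later Kummer step stays available.
  extend : ∀ {p} → Prime p → ∀ N → 1 ≤ N → ∀ k → FiniteField p k → (∀ ℓ → Prime ℓ → ℓ ∣ N → OneMod ℓ (p ^ k)) → FiniteField p (k * N)
  extend {p} pp = factor-ind _ (λ k 𝔽 _ → subst (FiniteField p) (sym (*-identityʳ k)) 𝔽) step
    where
    step : ∀ ℓ m → Prime ℓ → 1 ≤ m → Least ℓ m → (∀ k → FiniteField p k → (∀ r → Prime r → r ∣ m → OneMod r (p ^ k)) → FiniteField p (k * m)) →
           ∀ k → FiniteField p k → (∀ r → Prime r → r ∣ ℓ * m → OneMod r (p ^ k)) → FiniteField p (k * (ℓ * m))
    step zero m pℓ = ⊥-elim (¬prime[0] pℓ)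
    step (suc ℓ) m pℓ _ _ ih k 𝔽 h = subst (FiniteField p) (*-assoc k (suc ℓ) m) (ih (k * suc ℓ) (Extension.extension pp 𝔽 ℓ pℓ (proj₁ one) (proj₂ one))
        (λ r pr r∣m → subst (OneMod r) (^-*-assoc p k (suc ℓ)) (OneMod-^ r (suc ℓ) (h r pr (∣n⇒∣m*n (suc ℓ) r∣m)))))
      where
      one = h (suc ℓ) pℓ (m∣m*n m)

  prime-∣! : ∀ {ℓ} j → Prime ℓ → ℓ ∣ j ! → ℓ ≤ j
  prime-∣! zero pℓ h = ⊥-elim (¬prime[1] (subst Prime (∣1⇒≡1 h) pℓ))
  prime-∣! (suc j) pℓ h with euclidsLemma (suc j) (j !) pℓ h
  ... | inj₁ d = ∣⇒≤ d
  ... | inj₂ d = m≤n⇒m≤1+n (prime-∣! j pℓ d)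

  ∣! : ∀ {d j} → 1 ≤ d → d ≤ j → d ∣ j !
  ∣! {suc d} _ h = ∣-trans (m∣m*n (d !)) (m≤n⇒m!∣n! h)

  order-! : ∀ j q → 1 ≤ q → Coprime (suc j) q → OneMod (suc j) (q ^ (j !))
  order-! zero q 1≤q _ = ℕ.pred (q ^ 1) , trans (sym (suc-pred (q ^ 1) {{ℕ.>-nonZero (m^n>0 q {{ℕ.>-nonZero 1≤q}} 1)}})) (cong suc (sym (*-identityˡ _)))
  order-! j@(suc _) q 1≤q cop = raise (order j q (s≤s z≤n) 1≤q cop)
    where
    raise : (Σ ℕ λ d → (1 ≤ d) × (d ≤ j) × OneMod (suc j) (q ^ d)) → OneMod (suc j) (q ^ (j !))
    raise (d , 1≤d , d≤j , o) = subst (OneMod (suc j)) (trans (^-*-assoc q d (quotient d∣)) (cong (q ^_) (trans (*-comm d (quotient d∣)) (sym (_∣_.equality d∣))))) (OneMod-^ (suc j) (quotient d∣) o)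
      where
      d∣ : d ∣ j !
      d∣ = ∣! 1≤d d≤j

  -- The step from j to j + 1 has degree j!. The exponent supplied by `order` is at most j and so
  -- divides j!, which makes the new order 1 modulo j + 1; the prime factors of j! are at most j and
  -- were dealt with before.
  exponent : ℕ → ℕ
  exponent zero = 1
  exponent (suc j) = exponent j * (j !)

  Stage : ℕ → ℕ → Set₁
  Stage p j = FiniteField p (exponent j) × (∀ i → 1 ≤ i → i ≤ j → OneMod i (p ^ exponent j))

  next-stage : ∀ {p} → Prime p → ∀ j → suc j < p → Stage p j → Stage p (suc j)
  next-stage {p} pp j j<p (𝔽 , one) = extend pp (j !) (1≤n! j) (exponent j) 𝔽 (λ ℓ pℓ d → one ℓ (prime≥1 pℓ) (prime-∣! j pℓ d)) , one′
    where
    q : ℕ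
    q = p ^ exponent j
    1≤q : 1 ≤ q
    1≤q = m^n>0 p {{prime⇒nonZero pp}} (exponent j)
    up : ∀ i → OneMod i (q ^ (j !)) → OneMod i (p ^ exponent (suc j))
    up i = subst (OneMod i) (^-*-assoc p (exponent j) (j !))
    one′ : ∀ i → 1 ≤ i → i ≤ suc j → OneMod i (p ^ exponent (suc j))
    one′ i 1≤i i≤ with m≤n⇒m<n∨m≡n i≤
    ... | inj₁ (s≤s i≤j) = up i (OneMod-^ i (j !) (one i 1≤i i≤j))
    ... | inj₂ refl = up (suc j) (order-! j q 1≤q (coprime-^ (coprime-sym (prime⇒coprime pp j<p)) (exponent j)))

  abstract
    fields : ∀ {p} → Prime p → ∀ j → j < p → Stage p j
    fields {p} pp zero _ = primeField p pp , (λ i 1≤i i≤0 → ⊥-elim (<⇒≱ 1≤i i≤0))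
    fields {p} pp (suc j) j<p = next-stage pp j j<p (fields pp j (<⇒≤ j<p))

-- Sums and counting over finite index sets

module FinSum where

  open import Defs hiding (sym; irrefl)
  open import Data.Nat using (ℕ; zero; suc; _+_; _*_; _≤_; _<_; _<ᵇ_; z≤n)
  open import Data.Nat.Properties
  open import Data.Nat.Solver using (module +-*-Solver)
  open import Data.Bool using (Bool; true; false; if_then_else_; _∧_; not)
  open import Data.Fin as Fin using (Fin; toℕ)
  import Data.Fin.Properties as Finₚ
  open import Data.List as List using (List; []; _∷_; length; map; allFin)
  open import Data.List.Relation.Unary.All as All using (All; []; _∷_)
  open import Data.List.Relation.Unary.AllPairs using ([]; _∷_)
  open import Data.List.Relation.Unary.Unique.Propositional using (Unique)
  open import Function using (_∘_)

  open import Data.List.Relation.Unary.Unique.Propositional.Properties using () renaming (map⁺ to unique-map)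
  open import Data.List.Relation.Unary.Any using (here; there)
  open import Data.List.Membership.Propositional using (_∈_)
  open import Data.List.Membership.Propositional.Properties using (∈-map⁺)
  import Data.List.Relation.Unary.All.Properties as Allₚ
  open import Data.List.Properties using (length-map; map-tabulate)
  open import Data.Nat.ListAction using (sum)

  ∑ : ∀ {n} → (Fin n → ℕ) → ℕ
  ∑ {zero} f = 0
  ∑ {suc n} f = f Fin.zero + ∑ (f ∘ Fin.suc)

  +-swap : ∀ a b c d → (a + b) + (c + d) ≡ (a + c) + (b + d)
  +-swap = solve 4 (λ a b c d → (a :+ b) :+ (c :+ d) := (a :+ c) :+ (b :+ d)) refl
    where open +-*-Solver

  ∑-cong : ∀ {n} {f g : Fin n → ℕ} → (∀ i → f i ≡ g i) → ∑ f ≡ ∑ g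
  ∑-cong {zero} h = refl
  ∑-cong {suc n} h = cong₂ _+_ (h Fin.zero) (∑-cong (h ∘ Fin.suc))

  ∑-mono : ∀ {n} {f g : Fin n → ℕ} → (∀ i → f i ≤ g i) → ∑ f ≤ ∑ g
  ∑-mono {zero} h = z≤n
  ∑-mono {suc n} h = +-mono-≤ (h Fin.zero) (∑-mono (h ∘ Fin.suc))

  ∑-+ : ∀ {n} (f g : Fin n → ℕ) → ∑ (λ i → f i + g i) ≡ ∑ f + ∑ g
  ∑-+ {zero} f g = refl
  ∑-+ {suc n} f g = trans (cong (f Fin.zero + g Fin.zero +_) (∑-+ (f ∘ Fin.suc) (g ∘ Fin.suc))) (+-swap (f Fin.zero) _ _ _)

  ∑-* : ∀ {n} c (f : Fin n → ℕ) → ∑ (λ i → c * f i) ≡ c * ∑ f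
  ∑-* {zero} c f = sym (*-zeroʳ c)
  ∑-* {suc n} c f = trans (cong (c * f Fin.zero +_) (∑-* c (f ∘ Fin.suc))) (sym (*-distribˡ-+ c (f Fin.zero) _))

  ∑-*ʳ : ∀ {n} (f : Fin n → ℕ) c → ∑ (λ i → f i * c) ≡ ∑ f * c
  ∑-*ʳ f c = trans (∑-cong (λ i → *-comm (f i) c)) (trans (∑-* c f) (*-comm c (∑ f)))

  ∑-const : ∀ n c → ∑ {n} (λ _ → c) ≡ n * c
  ∑-const zero c = refl
  ∑-const (suc n) c = cong (c +_) (∑-const n c)

  ∑-zero : ∀ {n} {f : Fin n → ℕ} → (∀ i → f i ≡ 0) → ∑ f ≡ 0
  ∑-zero {n} h = trans (∑-cong h) (trans (∑-const n 0) (*-zeroʳ n))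

  ∑-swap : ∀ {m n} (f : Fin m → Fin n → ℕ) → ∑ (λ i → ∑ (f i)) ≡ ∑ (λ j → ∑ (λ i → f i j))
  ∑-swap {zero} {n} f = sym (∑-zero {n} {λ _ → 0} (λ _ → refl))
  ∑-swap {suc m} f = trans (cong (∑ (f Fin.zero) +_) (∑-swap (f ∘ Fin.suc))) (sym (∑-+ (f Fin.zero) _))

  ∑-member : ∀ {n} (f : Fin n → ℕ) i → f i ≤ ∑ f
  ∑-member f Fin.zero = m≤m+n _ _
  ∑-member f (Fin.suc i) = ≤-trans (∑-member (f ∘ Fin.suc) i) (m≤n+m _ (f Fin.zero))

  ∑-++ : ∀ m {n} (f : Fin (m + n) → ℕ) → ∑ f ≡ ∑ (λ i → f (i Fin.↑ˡ n)) + ∑ (λ j → f (m Fin.↑ʳ j))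
  ∑-++ zero f = refl
  ∑-++ (suc m) f = trans (cong (f Fin.zero +_) (∑-++ m (f ∘ Fin.suc))) (sym (+-assoc (f Fin.zero) _ _))

  ∑-combine : ∀ m {n} (f : Fin (m * n) → ℕ) → ∑ f ≡ ∑ {m} (λ i → ∑ {n} (λ j → f (Fin.combine i j)))
  ∑-combine zero f = refl
  ∑-combine (suc m) {n} f = trans (∑-++ n f) (cong (∑ (λ i → f (i Fin.↑ˡ (m * n))) +_) (∑-combine m (λ j → f (n Fin.↑ʳ j))))

  ind : Bool → ℕ
  ind b = if b then 1 else 0

  ind≤1 : ∀ b → ind b ≤ 1
  ind≤1 true = ≤-refl
  ind≤1 false = z≤n

  ind-∧ : ∀ a b → ind (a ∧ b) ≡ ind a * ind b
  ind-∧ true b = sym (+-identityʳ (ind b))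
  ind-∧ false b = refl

  sum-allFin : ∀ {n} (f : Fin n → ℕ) → sum (map f (allFin n)) ≡ ∑ f
  sum-allFin f = trans (cong sum (map-tabulate (λ i → i) f)) (go f)
    where
    go : ∀ {n} (f : Fin n → ℕ) → sum (List.tabulate f) ≡ ∑ f
    go {zero} f = refl
    go {suc n} f = cong (f Fin.zero +_) (go (f ∘ Fin.suc))

  doubleSum : ∀ {n} → Graph n → ℕ
  doubleSum G = ∑ (λ i → ∑ (λ j → ind (adj G i j)))

  <ᵇ-split : ∀ a b → a ≢ b → ind (a <ᵇ b) + ind (b <ᵇ a) ≡ 1
  <ᵇ-split zero zero ne = ⊥-elim (ne refl)
  <ᵇ-split zero (suc b) ne = refl
  <ᵇ-split (suc a) zero ne = refl
  <ᵇ-split (suc a) (suc b) ne = <ᵇ-split a b (ne ∘ cong suc)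

  doubleSum≡ : ∀ {n} (G : Graph n) → doubleSum G ≡ 2 * edgeCount G
  doubleSum≡ {n} G = trans (∑-cong (λ i → ∑-cong (split i))) (trans (∑-cong (λ i → ∑-+ (e i) (λ j → e j i))) (trans (∑-+ (λ i → ∑ (e i)) (λ i → ∑ (λ j → e j i)))
      (cong₂ _+_ (sym count) (trans (∑-swap (λ i j → e j i)) (trans (sym count) (sym (+-identityʳ (edgeCount G))))))))
    where
    e : Fin n → Fin n → ℕ
    e i j = ind ((toℕ i <ᵇ toℕ j) ∧ adj G i j)
    count : edgeCount G ≡ ∑ (λ i → ∑ (e i))
    count = trans (sum-allFin (λ i → sum (map (e i) (allFin n)))) (∑-cong (λ i → sum-allFin (e i)))
    split : ∀ i j → ind (adj G i j) ≡ e i j + e j i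
    split i j with i Fin.≟ j
    ... | yes refl = trans (cong ind (Graph.irrefl G i)) (sym (trans (cong₂ _+_ z z) refl))
      where
      z : e i i ≡ 0
      z = trans (ind-∧ (toℕ i <ᵇ toℕ i) (adj G i i)) (trans (cong (λ b → ind (toℕ i <ᵇ toℕ i) * ind b) (Graph.irrefl G i)) (*-zeroʳ (ind (toℕ i <ᵇ toℕ i))))
    ... | no ne = sym (trans (cong₂ _+_ (ind-∧ (toℕ i <ᵇ toℕ j) _) (trans (ind-∧ (toℕ j <ᵇ toℕ i) _) (cong (λ b → ind (toℕ j <ᵇ toℕ i) * ind b) (Graph.sym G j i))))
        (trans (sym (*-distribʳ-+ (ind (adj G i j)) (ind (toℕ i <ᵇ toℕ j)) (ind (toℕ j <ᵇ toℕ i)))) (trans (cong (_* ind (adj G i j)) (<ᵇ-split (toℕ i) (toℕ j) (ne ∘ Finₚ.toℕ-injective))) (*-identityˡ _))))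

  count : ∀ {n} → (Fin n → Bool) → ℕ
  count P = ∑ (ind ∘ P)

  count≤n : ∀ {n} (P : Fin n → Bool) → count P ≤ n
  count≤n {n} P = ≤-trans (∑-mono (λ i → ind≤1 (P i))) (≤-reflexive (trans (∑-const n 1) (*-identityʳ n)))

  record Members {n} (P : Fin n → Bool) : Set where
    field
      list : List (Fin n)
      unique : Unique list
      sound : All (λ i → P i ≡ true) list
      complete : ∀ i → P i ≡ true → i ∈ list
      len : length list ≡ count P

  members : ∀ {n} (P : Fin n → Bool) → Members P
  members {zero} P = record { list = [] ; unique = [] ; sound = [] ; complete = λ () ; len = refl }
  members {suc n} P with P Fin.zero in eq | members (P ∘ Fin.suc)
  ... | b | M = build b eq
    where
    open Members M
    rest : List (Fin (suc n))
    rest = map Fin.suc list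
    rest-complete : ∀ i → P (Fin.suc i) ≡ true → Fin.suc i ∈ rest
    rest-complete i h = ∈-map⁺ Fin.suc (complete i h)
    build : ∀ b → P Fin.zero ≡ b → Members P
    build true e = record { list = Fin.zero ∷ rest ; unique = Allₚ.map⁺ (All.universal (λ _ ()) list) ∷ unique-map Finₚ.suc-injective unique ; sound = e ∷ Allₚ.map⁺ sound
      ; complete = λ { Fin.zero _ → here refl ; (Fin.suc i) h → there (rest-complete i h) } ; len = trans (cong suc (trans (length-map Fin.suc list) len)) (cong (λ b → ind b + count (P ∘ Fin.suc)) (sym e)) }
    build false e = record { list = rest ; unique = unique-map Finₚ.suc-injective unique ; sound = Allₚ.map⁺ sound
      ; complete = λ { Fin.zero h → ⊥-elim (false≢true (trans (sym e) h)) ; (Fin.suc i) h → rest-complete i h } ; len = trans (trans (length-map Fin.suc list) len) (cong (λ b → ind b + count (P ∘ Fin.suc)) (sym e)) }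
      where
      false≢true : false ≢ true
      false≢true ()

  count-≟ : ∀ {n} (x : Fin n) → count (λ i → does (i Fin.≟ x)) ≡ 1
  count-≟ {suc n} Fin.zero = cong suc (∑-zero {n} {λ _ → 0} (λ _ → refl))
  count-≟ (Fin.suc x) = trans (∑-cong (λ i → cong ind (same i x))) (count-≟ x)
    where
    same : ∀ {n} (i x : Fin n) → does (Fin.suc i Fin.≟ Fin.suc x) ≡ does (i Fin.≟ x)
    same i x with i Fin.≟ x
    ... | yes _ = refl
    ... | no _ = refl

  exists : ∀ {n} (P : Fin n → Bool) → 1 ≤ count P → Σ (Fin n) λ i → P i ≡ true
  exists P h with Members.list (members P) | Members.sound (members P) | Members.len (members P)
  ... | [] | _ | e = ⊥-elim (<⇒≱ h (≤-reflexive (sym e)))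
  ... | x ∷ _ | p ∷ _ | _ = x , p

  -- Each element of the list rules out at most one candidate.
  pick : ∀ {n} (P : Fin n → Bool) xs → length xs < count P → Σ (Fin n) λ i → (P i ≡ true) × All (i ≢_) xs
  pick P [] h = let (i , p) = exists P h in i , p , []
  pick {n} P (x ∷ xs) h with pick P′ xs (+-cancelʳ-≤ 1 _ _ (subst (_≤ count P′ + 1) (+-comm 1 (suc (length xs))) (≤-trans h bound)))
    where
    P′ : Fin n → Bool
    P′ i = P i ∧ not (does (i Fin.≟ x))
    bound : count P ≤ count P′ + 1
    bound = ≤-trans (∑-mono each) (≤-reflexive (trans (∑-+ (ind ∘ P′) (λ i → ind (does (i Fin.≟ x)))) (cong (count P′ +_) (count-≟ x))))
      where
      cases : ∀ a b → ind a ≤ ind (a ∧ not b) + ind b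
      cases true true = ≤-refl
      cases true false = ≤-refl
      cases false _ = z≤n
      each : ∀ i → ind (P i) ≤ ind (P′ i) + ind (does (i Fin.≟ x))
      each i = cases (P i) (does (i Fin.≟ x))
  ... | i , p , all = i , split₁ (P i) _ p , (λ e → split₂ (P i) (i Fin.≟ x) p e) ∷ all
    where
    split₁ : ∀ a b → a ∧ b ≡ true → a ≡ true
    split₁ true _ _ = refl
    split₂ : ∀ a (d : Dec (i ≡ x)) → a ∧ not (does d) ≡ true → i ≢ x
    split₂ true (no ne) _ = ne

  count-≤ : ∀ {n} (P : Fin n → Bool) K → (∀ xs → Unique xs → All (λ i → P i ≡ true) xs → length xs ≤ K) → count P ≤ K
  count-≤ P K h = subst (_≤ K) (Members.len (members P)) (h _ (Members.unique (members P)) (Members.sound (members P)))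

-- Füredi's bipartite graph over a finite field

module Furedi where

  open FinSum
  open FiniteFields
  open import Defs hiding (sym; irrefl)
  open import Data.Nat as ℕ using (ℕ; zero; suc; _+_; _*_; _∸_; _^_; _≤_; _<_; z≤n; s≤s)
  open import Data.Nat.Properties hiding (_≟_)
  open import Data.Bool using (Bool; true; false; not)
  open import Data.Fin as Fin using (Fin; toℕ)
  import Data.Fin.Properties as Finₚ
  open import Data.List as List using (List; _∷_; length; map)
  open import Data.List.Relation.Unary.All as All using (All; _∷_)
  open import Data.List.Relation.Unary.AllPairs using (_∷_)
  open import Data.List.Relation.Unary.Unique.Propositional using (Unique)
  open import Function using (Injective)
  open import Relation.Nullary.Decidable using (dec-true)

  open import Data.List.Membership.Propositional using (_∈_)
  open import Data.List.Membership.Propositional.Properties using (∈-lookup)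
  import Data.List.Relation.Unary.Any as Any
  open import Data.List.Relation.Unary.Any.Properties using (lookup-index)
  open import Data.List.Relation.Unary.Unique.Propositional.Properties using () renaming (map⁺ to unique-map; tabulate⁺ to unique-tabulate)
  import Data.List.Relation.Unary.All.Properties as Allₚ
  open import Data.List.Properties using (length-map; length-tabulate)
  open import Data.Nat.DivMod using (m<n⇒m%n≡m; n%n≡0)

  true≢false : true ≢ false
  true≢false ()

  lookup-injective : ∀ {A : Set} {xs : List A} → Unique xs → ∀ i j → List.lookup xs i ≡ List.lookup xs j → i ≡ j
  lookup-injective (_ ∷ _) Fin.zero Fin.zero _ = refl
  lookup-injective (p ∷ _) Fin.zero (Fin.suc j) e = ⊥-elim (All.lookup p (∈-lookup j) e)
  lookup-injective (p ∷ _) (Fin.suc i) Fin.zero e = ⊥-elim (All.lookup p (∈-lookup i) (sym e))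
  lookup-injective (_ ∷ u) (Fin.suc i) (Fin.suc j) e = cong Fin.suc (lookup-injective u i j e)

  does-true : ∀ {P : Set} (d : Dec P) → does d ≡ true → P
  does-true (yes p) _ = p

  -- A bipartite graph on two copies of Fin A given by a symmetric relation, with
  -- isolated vertices added.
  module Bipartite (A r : ℕ) (inc : Fin A → Fin A → Bool) (inc-comm : ∀ i j → inc i j ≡ inc j i) where
    data Kind : Set where
      left right : Fin A → Kind
      none : Kind

    n : ℕ
    n = (A + A) + r

    kind : Fin n → Kind
    kind i with Fin.splitAt (A + A) i
    ... | inj₂ _ = none
    ... | inj₁ j with Fin.splitAt A j
    ...   | inj₁ l = left l
    ...   | inj₂ l = right l

    -- A vertex is determined by its kind on the two sides only; for an isolated vertex the
    -- condition is a trivially true one.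
    place : Kind → Fin n → Set
    place (left l) i = i ≡ (l Fin.↑ˡ A) Fin.↑ˡ r
    place (right l) i = i ≡ (A Fin.↑ʳ l) Fin.↑ˡ r
    place none i = ⊥ → ⊥

    place-kind : ∀ i → place (kind i) i
    place-kind i with Fin.splitAt (A + A) i in eq
    ... | inj₂ _ = λ z → z
    ... | inj₁ j with Fin.splitAt A j in eq′
    ...   | inj₁ l = trans (sym (Finₚ.splitAt⁻¹-↑ˡ eq)) (cong (Fin._↑ˡ r) (sym (Finₚ.splitAt⁻¹-↑ˡ eq′)))
    ...   | inj₂ l = trans (sym (Finₚ.splitAt⁻¹-↑ˡ eq)) (cong (Fin._↑ˡ r) (sym (Finₚ.splitAt⁻¹-↑ʳ eq′)))

    kind-left : ∀ l → kind ((l Fin.↑ˡ A) Fin.↑ˡ r) ≡ left l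
    kind-left l rewrite Finₚ.splitAt-↑ˡ (A + A) (l Fin.↑ˡ A) r | Finₚ.splitAt-↑ˡ A l A = refl

    kind-right : ∀ l → kind ((A Fin.↑ʳ l) Fin.↑ˡ r) ≡ right l
    kind-right l rewrite Finₚ.splitAt-↑ˡ (A + A) (A Fin.↑ʳ l) r | Finₚ.splitAt-↑ʳ A A l = refl

    rel : Kind → Kind → Bool
    rel (left i) (right j) = inc i j
    rel (right i) (left j) = inc i j
    rel _ _ = false

    rel-comm : ∀ a b → rel a b ≡ rel b a
    rel-comm (left i) (right j) = inc-comm i j
    rel-comm (right i) (left j) = inc-comm i j
    rel-comm (left _) (left _) = refl
    rel-comm (left _) none = refl
    rel-comm (right _) (right _) = refl
    rel-comm (right _) none = refl
    rel-comm none (left _) = refl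
    rel-comm none (right _) = refl
    rel-comm none none = refl

    rel-irrefl : ∀ a → rel a a ≡ false
    rel-irrefl (left _) = refl
    rel-irrefl (right _) = refl
    rel-irrefl none = refl

    graph : Graph n
    graph = record { adj = λ i j → rel (kind i) (kind j) ; sym = λ i j → rel-comm (kind i) (kind j) ; irrefl = λ i → rel-irrefl (kind i) }

    many-edges : ∀ D → (∀ l → D ≤ ∑ (λ m → ind (inc l m))) → A * D ≤ edgeCount graph
    many-edges D h = *-cancelˡ-≤ 2 (≤-trans (≤-reflexive (cong (A * D +_) (+-identityʳ (A * D)))) (≤-trans (+-mono-≤ (side left-sum) (side right-sum)) (≤-trans (m≤m+n _ (∑ (λ j → row ((A + A) Fin.↑ʳ j)))) (≤-trans (≤-reflexive (sym (split row))) (≤-reflexive (doubleSum≡ graph))))))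
      where
      row : Fin n → ℕ
      row i = ∑ (λ j → ind (rel (kind i) (kind j)))
      split : ∀ (f : Fin n → ℕ) → ∑ f ≡ (∑ (λ l → f ((l Fin.↑ˡ A) Fin.↑ˡ r)) + ∑ (λ l → f ((A Fin.↑ʳ l) Fin.↑ˡ r))) + ∑ (λ j → f ((A + A) Fin.↑ʳ j))
      split f = trans (∑-++ (A + A) f) (cong (λ z → z + ∑ (λ j → f ((A + A) Fin.↑ʳ j))) (∑-++ A (λ i → f (i Fin.↑ˡ r))))
      lefts : ∀ (f : Fin n → ℕ) → ∑ (λ l → f ((l Fin.↑ˡ A) Fin.↑ˡ r)) ≤ ∑ f
      lefts f = ≤-trans (≤-trans (m≤m+n _ (∑ (λ l → f ((A Fin.↑ʳ l) Fin.↑ˡ r)))) (m≤m+n _ (∑ (λ j → f ((A + A) Fin.↑ʳ j))))) (≤-reflexive (sym (split f)))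
      rights : ∀ (f : Fin n → ℕ) → ∑ (λ l → f ((A Fin.↑ʳ l) Fin.↑ˡ r)) ≤ ∑ f
      rights f = ≤-trans (≤-trans (m≤n+m _ (∑ (λ l → f ((l Fin.↑ˡ A) Fin.↑ˡ r)))) (m≤m+n _ (∑ (λ j → f ((A + A) Fin.↑ʳ j))))) (≤-reflexive (sym (split f)))
      left-sum : ∀ l → ∑ (λ m → ind (inc l m)) ≤ row ((l Fin.↑ˡ A) Fin.↑ˡ r)
      left-sum l = ≤-trans (≤-reflexive (∑-cong (λ m → cong ind (sym (cong₂ rel (kind-left l) (kind-right m)))))) (rights (λ j → ind (rel (kind ((l Fin.↑ˡ A) Fin.↑ˡ r)) (kind j))))
      right-sum : ∀ l → ∑ (λ m → ind (inc l m)) ≤ row ((A Fin.↑ʳ l) Fin.↑ˡ r)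
      right-sum l = ≤-trans (≤-reflexive (∑-cong (λ m → cong ind (sym (cong₂ rel (kind-right l) (kind-left m)))))) (lefts (λ j → ind (rel (kind ((A Fin.↑ʳ l) Fin.↑ˡ r)) (kind j))))
      side : ∀ {f : Fin A → ℕ} → (∀ l → ∑ (λ m → ind (inc l m)) ≤ f l) → A * D ≤ ∑ f
      side p = ≤-trans (≤-reflexive (sym (∑-const A D))) (∑-mono (λ l → ≤-trans (h l) (p l)))

    isLeft : Kind → Bool
    isLeft (left _) = true
    isLeft _ = false

    flips : ∀ a b → rel a b ≡ true → isLeft b ≡ not (isLeft a)
    flips (left _) (right _) _ = refl
    flips (right _) (left _) _ = refl

    -- The side changes along every edge, so the vertex with index 2k is on the side of the vertex
    -- with index 0, although the closing edge joins them.
    no-odd-cycle : ∀ k → ¬ ContainsCycle (2 * k) graph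
    no-odd-cycle k (f , _ , h) = bad (isLeft (kind (f Fin.zero))) (trans (cong not (sym (colour k M refl ≤-refl))) (sym (flips _ _ closing)))
      where
      M : ℕ
      M = 2 * k
      at : ∀ i → i < suc M → Fin (suc M)
      at i lt = Fin.fromℕ< lt
      edge : ∀ i (lt : suc i < suc M) → adj graph (f (at i (<⇒≤ lt))) (f (at (suc i) lt)) ≡ true
      edge i lt = h _ _ (trans (Finₚ.toℕ-fromℕ< lt) (sym (trans (cong (λ z → suc z ℕ.% suc M) (Finₚ.toℕ-fromℕ< (<⇒≤ lt))) (m<n⇒m%n≡m lt))))
      colour : ∀ j i → i ≡ 2 * j → (lt : i < suc M) → isLeft (kind (f (at i lt))) ≡ isLeft (kind (f Fin.zero))
      colour zero .0 refl lt = refl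
      colour (suc j) i e lt = go i (trans e (*-suc 2 j)) lt
        where
        go : ∀ i → i ≡ 2 + 2 * j → (lt : i < suc M) → isLeft (kind (f (at i lt))) ≡ isLeft (kind (f Fin.zero))
        go (suc (suc i)) e lt = trans (flips _ _ (edge (suc i) lt)) (trans (cong not (flips _ _ (edge i (<⇒≤ lt)))) (trans (not-not _) (colour j i (suc-injective (suc-injective e)) (<⇒≤ (<⇒≤ lt)))))
          where
          not-not : ∀ b → not (not b) ≡ b
          not-not true = refl
          not-not false = refl
      last : Fin (suc M)
      last = at M ≤-refl
      closing : adj graph (f last) (f Fin.zero) ≡ true
      closing = h last Fin.zero (sym (trans (cong (λ z → suc z ℕ.% suc M) (Finₚ.toℕ-fromℕ< {M} ≤-refl)) (n%n≡0 (suc M))))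
      bad : ∀ b → not b ≡ b → ⊥
      bad true ()
      bad false ()

    -- The two vertices of the small part have a common neighbour because t ≥ 1, hence lie on one
    -- side, and `bound` applies to their t common neighbours on the other.
    no-induced-K : ∀ t → (∀ l l′ (g : Fin t → Fin A) → l ≢ l′ → Injective _≡_ _≡_ g → (∀ i → inc l (g i) ≡ true) → (∀ i → inc l′ (g i) ≡ true) → ⊥) → 1 ≤ t → ¬ ContainsInducedK2t t graph
    no-induced-K t@(suc t′) bound _ (f , inj , h) = main (kind (f Fin.zero)) (kind (f (Fin.suc Fin.zero))) refl refl
      where
      v : Fin t → Fin n
      v i = f (Fin.suc (Fin.suc i))
      a₀ : ∀ i → rel (kind (f Fin.zero)) (kind (v i)) ≡ true
      a₀ i = h Fin.zero (Fin.suc (Fin.suc i)) (λ ())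
      a₁ : ∀ i → rel (kind (f (Fin.suc Fin.zero))) (kind (v i)) ≡ true
      a₁ i = h (Fin.suc Fin.zero) (Fin.suc (Fin.suc i)) (λ ())
      place-at : ∀ {i a} → kind i ≡ a → place a i
      place-at {i} refl = place-kind i
      v-inj : ∀ {i j} → v i ≡ v j → i ≡ j
      v-inj e = Finₚ.suc-injective (Finₚ.suc-injective (inj e))
      f₀≢f₁ : f Fin.zero ≢ f (Fin.suc Fin.zero)
      f₀≢f₁ e with inj e
      ... | ()
      right-nbr : ∀ {l} b → rel (left l) b ≡ true → Σ (Fin A) λ m → (b ≡ right m) × (inc l m ≡ true)
      right-nbr (right m) e = m , refl , e
      left-nbr : ∀ {l} b → rel (right l) b ≡ true → Σ (Fin A) λ m → (b ≡ left m) × (inc l m ≡ true)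
      left-nbr (left m) e = m , refl , e
      main : ∀ a b → kind (f Fin.zero) ≡ a → kind (f (Fin.suc Fin.zero)) ≡ b → ⊥
      main none _ e₀ _ = true≢false (trans (sym (a₀ Fin.zero)) (cong (λ a → rel a (kind (v Fin.zero))) e₀))
      main (left l) b e₀ e₁ = finish b (subst (λ b → rel b (right (g Fin.zero)) ≡ true) e₁ (subst (λ c → rel (kind (f (Fin.suc Fin.zero))) c ≡ true) (g-kind Fin.zero) (a₁ Fin.zero))) e₁
        where
        nb : ∀ i → Σ (Fin A) λ m → (kind (v i) ≡ right m) × (inc l m ≡ true)
        nb i = right-nbr (kind (v i)) (subst (λ a → rel a (kind (v i)) ≡ true) e₀ (a₀ i))
        g : Fin t → Fin A
        g i = proj₁ (nb i)
        g-kind : ∀ i → kind (v i) ≡ right (g i)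
        g-kind i = proj₁ (proj₂ (nb i))
        finish : ∀ b → rel b (right (g Fin.zero)) ≡ true → kind (f (Fin.suc Fin.zero)) ≡ b → ⊥
        finish (left l′) _ e₁ = bound l l′ g (λ { refl → f₀≢f₁ (trans (place-at e₀) (sym (place-at e₁))) }) (λ {i} {j} e → v-inj (trans (place-at (g-kind i)) (trans (cong (λ m → (A Fin.↑ʳ m) Fin.↑ˡ r) e) (sym (place-at (g-kind j))))))
          (λ i → proj₂ (proj₂ (nb i))) (λ i → trans (sym (cong₂ rel e₁ (g-kind i))) (a₁ i))
      main (right l) b e₀ e₁ = finish b (subst (λ b → rel b (left (g Fin.zero)) ≡ true) e₁ (subst (λ c → rel (kind (f (Fin.suc Fin.zero))) c ≡ true) (g-kind Fin.zero) (a₁ Fin.zero))) e₁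
        where
        nb : ∀ i → Σ (Fin A) λ m → (kind (v i) ≡ left m) × (inc l m ≡ true)
        nb i = left-nbr (kind (v i)) (subst (λ a → rel a (kind (v i)) ≡ true) e₀ (a₀ i))
        g : Fin t → Fin A
        g i = proj₁ (nb i)
        g-kind : ∀ i → kind (v i) ≡ left (g i)
        g-kind i = proj₁ (proj₂ (nb i))
        finish : ∀ b → rel b (left (g Fin.zero)) ≡ true → kind (f (Fin.suc Fin.zero)) ≡ b → ⊥
        finish (right l′) _ e₁ = bound l l′ g (λ { refl → f₀≢f₁ (trans (place-at e₀) (sym (place-at e₁))) }) (λ {i} {j} e → v-inj (trans (place-at (g-kind i)) (trans (cong (λ m → (m Fin.↑ˡ A) Fin.↑ˡ r) e) (sym (place-at (g-kind j))))))
          (λ i → proj₂ (proj₂ (nb i))) (λ i → trans (sym (cong₂ rel e₁ (g-kind i))) (a₁ i))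

  -- Füredi's graph: (x, u) ~ (y, v) iff (x + y)^λ = u v, where u and v run through
  -- the group of s-th roots of unity and λ s = q - 1.
  module Construction {p k} (𝔽 : FiniteField p k) (λ′ s′ : ℕ) (q≡ : p ^ k ≡ suc (suc λ′ * suc s′)) where
    open FiniteField 𝔽 using (F; 0#; 1#; 0≢1; nozero; from; to; from-to; from-injective; _≟_; q; nth-roots; unit-power; cancelˡ; zeroˡ; zeroʳ; distribˡ; diff-zero; +-invˡ; +-invʳ; add-diff)
    module 𝔽 = FiniteField 𝔽
    open 𝔽 using () renaming (_+_ to _⊕_; _*_ to _⊗_; -_ to ⊖_; _^_ to _^^_)

    Λ s : ℕ
    Λ = suc λ′
    s = suc s′

    isRoot : Fin q → Bool
    isRoot i = does (from i ^^ s ≟ 1#)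

    module I = Members (members isRoot)

    roots≤s : length I.list ≤ s
    roots≤s = subst (_≤ s) (length-map from I.list) (nth-roots 1# s′ (map from I.list) (unique-map from-injective I.unique) (Allₚ.map⁺ (All.map (λ {i} → does-true (from i ^^ s ≟ 1#)) I.sound)))

    index : ∀ x → x ^^ s ≡ 1# → Σ (Fin (length I.list)) λ j → from (List.lookup I.list j) ≡ x
    index x h = Any.index mem , trans (cong from (sym (lookup-index mem))) (from-to x)
      where
      mem : to x ∈ I.list
      mem = I.complete (to x) (dec-true (from (to x) ^^ s ≟ 1#) (trans (cong (_^^ s) (from-to x)) h))

    power-root : ∀ x → x ≢ 0# → (x ^^ Λ) ^^ s ≡ 1#
    power-root x x≢0 = trans (𝔽.^-assocʳ x Λ s) (unit-power q≡ x x≢0)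

    -- x ↦ x^Λ sends the q - 1 = Λ s nonzero elements to s-th roots of unity, with at most Λ
    -- elements in each fibre.
    s≤roots : s ≤ length I.list
    s≤roots = *-cancelˡ-≤ Λ (≤-pred (≤-trans (≤-reflexive (sym q≡)) (≤-trans (≤-reflexive (sym (trans (∑-const q 1) (*-identityʳ q)))) (≤-trans (∑-mono each) (≤-trans (≤-reflexive (∑-+ {q} zeroᵢ (λ i → ∑ (λ j → fib j i)))) (+-mono-≤ one-zero fibres))))))
      where
      m : ℕ
      m = length I.list
      zeroᵢ : Fin q → ℕ
      zeroᵢ i = ind (does (i Fin.≟ to 0#))
      fib : Fin m → Fin q → ℕ
      fib j i = ind (does (from i ^^ Λ ≟ from (List.lookup I.list j)))
      one-zero : ∑ zeroᵢ ≤ 1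
      one-zero = ≤-reflexive (count-≟ (to 0#))
      fibres : ∑ (λ i → ∑ (λ j → fib j i)) ≤ Λ * m
      fibres = ≤-trans (≤-reflexive (∑-swap (λ i j → fib j i))) (≤-trans (∑-mono (λ j → count-≤ (λ i → does (from i ^^ Λ ≟ from (List.lookup I.list j))) Λ (λ xs u all →
          subst (_≤ Λ) (length-map from xs) (nth-roots _ λ′ (map from xs) (unique-map from-injective u) (Allₚ.map⁺ (All.map (λ {i} → does-true (from i ^^ Λ ≟ _)) all)))))) (≤-reflexive (trans (∑-const m Λ) (*-comm m Λ))))
      each : ∀ i → 1 ≤ zeroᵢ i + ∑ (λ j → fib j i)
      each i = split (i Fin.≟ to 0#)
        where
        covered : i ≢ to 0# → 1 ≤ ∑ (λ j → fib j i)
        covered ne = ≤-trans (≤-reflexive (sym (cong ind (dec-true (from i ^^ Λ ≟ from (List.lookup I.list (proj₁ ix))) (sym (proj₂ ix)))))) (∑-member (λ j → fib j i) (proj₁ ix))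
          where
          ix = index (from i ^^ Λ) (power-root (from i) (λ e → ne (from-injective (trans e (sym (from-to 0#))))))
        split : (d : Dec (i ≡ to 0#)) → 1 ≤ ind (does d) + ∑ (λ j → fib j i)
        split (yes _) = m≤m+n 1 _
        split (no ne) = covered ne

    |I| : length I.list ≡ s
    |I| = ≤-antisym roots≤s s≤roots

    I : Fin s → F
    I j = from (List.lookup I.list (Fin.cast (sym |I|) j))

    I-injective : ∀ {i j} → I i ≡ I j → i ≡ j
    I-injective {i} {j} e = Finₚ.toℕ-injective (trans (sym (Finₚ.toℕ-cast (sym |I|) i)) (trans (cong toℕ (lookup-injective I.unique _ _ (from-injective e))) (Finₚ.toℕ-cast (sym |I|) j)))

    I-root : ∀ j → I j ^^ s ≡ 1#
    I-root j = does-true (I j ^^ s ≟ 1#) (All.lookup I.sound (∈-lookup {xs = I.list} (Fin.cast (sym |I|) j)))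

    I-index : ∀ x → x ^^ s ≡ 1# → Σ (Fin s) λ j → I j ≡ x
    I-index x h = let (j , e) = index x h in Fin.cast |I| j , trans (cong (λ z → from (List.lookup I.list z)) (Finₚ.toℕ-injective (trans (Finₚ.toℕ-cast (sym |I|) _) (Finₚ.toℕ-cast |I| j)))) e

    I≢0 : ∀ j → I j ≢ 0#
    I≢0 j e = 0≢1 (trans (sym (zeroˡ (0# ^^ s′))) (trans (cong (_^^ s) (sym e)) (I-root j)))

    A : ℕ
    A = q * s

    px : Fin A → F
    px l = from (proj₁ (Fin.remQuot {q} s l))

    pu : Fin A → F
    pu l = I (proj₂ (Fin.remQuot {q} s l))

    inc : Fin A → Fin A → Bool
    inc l m = does ((px l ⊕ px m) ^^ Λ ≟ pu l ⊗ pu m)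

    inc-comm : ∀ l m → inc l m ≡ inc m l
    inc-comm l m = cong₂ (λ a b → does (a ^^ Λ ≟ b)) (𝔽.+-comm (px l) (px m)) (𝔽.*-comm (pu l) (pu m))

    inc-eq : ∀ l m → inc l m ≡ true → (px l ⊕ px m) ^^ Λ ≡ pu l ⊗ pu m
    inc-eq l m = does-true ((px l ⊕ px m) ^^ Λ ≟ pu l ⊗ pu m)

    same-vertex : ∀ l m → px l ≡ px m → pu l ≡ pu m → l ≡ m
    same-vertex l m e e′ = trans (sym (Finₚ.combine-remQuot {q} s l)) (trans (cong₂ Fin.combine (from-injective e) (I-injective e′)) (Finₚ.combine-remQuot {q} s m))

    product≢0 : ∀ l m → pu l ⊗ pu m ≢ 0#
    product≢0 l m e = [ I≢0 _ , I≢0 _ ]′ (nozero (pu l) (pu m) e)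

    0^Λ : ∀ {x} → x ≡ 0# → x ^^ Λ ≡ 0#
    0^Λ {x} e = trans (cong (_⊗ (x ^^ λ′)) e) (zeroˡ _)

    -- For each of the q - 1 elements y ≠ -x the quotient (x + y)^Λ / u is an s-th root of unity v,
    -- which gives a neighbour (y, v).
    degree : ∀ l → Λ * s ≤ ∑ (λ m → ind (inc l m))
    degree l = ≤-trans (+-cancelˡ-≤ 1 _ _ (≤-trans (≤-reflexive (sym q≡)) (≤-trans (≤-reflexive (sym (trans (∑-const q 1) (*-identityʳ q)))) (≤-trans (∑-mono each) (≤-trans (≤-reflexive (∑-+ {q} zeroᵢ row)) (+-monoˡ-≤ (∑ row) (≤-reflexive (count-≟ (to (⊖ px l))))))))))
        (≤-reflexive (sym (∑-combine q (λ m → ind (inc l m)))))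
      where
      zeroᵢ row : Fin q → ℕ
      zeroᵢ i = ind (does (i Fin.≟ to (⊖ px l)))
      row i = ∑ {s} (λ j → ind (inc l (Fin.combine i j)))
      inverse : Σ F λ w → (w ^^ s ≡ 1#) × (pu l ⊗ w ≡ 1#)
      inverse = pu l ^^ s′ , trans (𝔽.^-assocʳ (pu l) s′ s) (trans (cong (pu l ^^_) (*-comm s′ s)) (trans (sym (𝔽.^-assocʳ (pu l) s s′)) (trans (cong (_^^ s′) (I-root _)) (𝔽.1^ s′)))) , I-root _
      covered : ∀ i → i ≢ to (⊖ px l) → 1 ≤ row i
      covered i ne = ≤-trans (≤-reflexive (sym (cong ind (dec-true ((px l ⊕ px (Fin.combine i (proj₁ ix))) ^^ Λ ≟ pu l ⊗ pu (Fin.combine i (proj₁ ix))) eq)))) (∑-member (λ j → ind (inc l (Fin.combine i j))) (proj₁ ix))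
        where
        y : F
        y = px l ⊕ from i
        y≢0 : y ≢ 0#
        y≢0 e = ne (from-injective (trans (𝔽.+-cancelˡ (px l) (from i) (⊖ px l) (trans e (sym (+-invʳ (px l))))) (sym (from-to (⊖ px l)))))
        w : F
        w = proj₁ inverse
        ix = I-index (w ⊗ y ^^ Λ) (trans (𝔽.^-distrib-* w (y ^^ Λ) s) (trans (cong₂ _⊗_ (proj₁ (proj₂ inverse)) (power-root y y≢0)) (𝔽.*-idˡ 1#)))
        eq : (px l ⊕ px (Fin.combine i (proj₁ ix))) ^^ Λ ≡ pu l ⊗ pu (Fin.combine i (proj₁ ix))
        eq = trans (cong (λ z → (px l ⊕ from (proj₁ z)) ^^ Λ) (Finₚ.remQuot-combine {q} {s} i (proj₁ ix))) (trans (trans (sym (𝔽.*-idˡ (y ^^ Λ))) (trans (cong (_⊗ y ^^ Λ) (sym (proj₂ (proj₂ inverse)))) (𝔽.*-assoc (pu l) w (y ^^ Λ))))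
          (cong (pu l ⊗_) (trans (sym (proj₂ ix)) (cong (λ z → I (proj₂ z)) (sym (Finₚ.remQuot-combine {q} {s} i (proj₁ ix)))))))
      each : ∀ i → 1 ≤ zeroᵢ i + row i
      each i = split (i Fin.≟ to (⊖ px l))
        where
        split : (d : Dec (i ≡ to (⊖ px l))) → 1 ≤ ind (does d) + row i
        split (yes _) = m≤m+n 1 _
        split (no ne) = covered i ne

    -- Two vertices (x, u) and (x′, u′) with a common neighbour (y, v) give a root
    -- (x + y)/(x′ + y) of the polynomial X^λ - u/u′.
    distinct-codegree : ∀ l l′ (g : Fin (suc Λ) → Fin A) → px l ≢ px l′ → Injective _≡_ _≡_ g → (∀ i → inc l (g i) ≡ true) → (∀ i → inc l′ (g i) ≡ true) → ⊥
    distinct-codegree l l′ g ne g-inj h h′ = <⇒≱ ≤-refl (subst (_≤ Λ) (length-tabulate b) (nth-roots c λ′ (List.tabulate b) (unique-tabulate b-inj) (Allₚ.tabulate⁺ b-root)))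
      where
      x x′ : F
      x = px l
      x′ = px l′
      Y : Fin (suc Λ) → F
      Y i = px (g i)
      N : ℕ
      N = ℕ.pred (Λ * s)
      N≡ : Λ * s ≡ suc N
      N≡ = refl
      inv : F → F
      inv y = y ^^ N
      inv-* : ∀ y → y ≢ 0# → y ⊗ inv y ≡ 1#
      inv-* y y≢0 = unit-power q≡ y y≢0
      den≢0 : ∀ i → x′ ⊕ Y i ≢ 0#
      den≢0 i e = product≢0 l′ (g i) (trans (sym (inc-eq l′ (g i) (h′ i))) (0^Λ e))
      b : Fin (suc Λ) → F
      b i = (x ⊕ Y i) ⊗ inv (x′ ⊕ Y i)
      c : F
      c = pu l ⊗ inv (pu l′)
      b-root : ∀ i → b i ^^ Λ ≡ c
      b-root i = cancelˡ (pu l′ ⊗ pu (g i)) (product≢0 l′ (g i)) (begin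
          (pu l′ ⊗ pu (g i)) ⊗ b i ^^ Λ ≡⟨ cong (_⊗ b i ^^ Λ) (sym (inc-eq l′ (g i) (h′ i))) ⟩
          (x′ ⊕ Y i) ^^ Λ ⊗ b i ^^ Λ ≡⟨ sym (𝔽.^-distrib-* (x′ ⊕ Y i) (b i) Λ) ⟩
          ((x′ ⊕ Y i) ⊗ b i) ^^ Λ ≡⟨ cong (_^^ Λ) (clear (x ⊕ Y i) (x′ ⊕ Y i) (den≢0 i)) ⟩
          (x ⊕ Y i) ^^ Λ ≡⟨ inc-eq l (g i) (h i) ⟩
          pu l ⊗ pu (g i) ≡⟨ cong (_⊗ pu (g i)) (sym (clear (pu l) (pu l′) (I≢0 _))) ⟩
          (pu l′ ⊗ c) ⊗ pu (g i) ≡⟨ 𝔽.solve 3 (λ u c v → (u 𝔽.:* c) 𝔽.:* v 𝔽.:= (u 𝔽.:* v) 𝔽.:* c) refl (pu l′) c (pu (g i)) ⟩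
          (pu l′ ⊗ pu (g i)) ⊗ c ∎)
        where
        open ≡-Reasoning
        clear : ∀ a y → y ≢ 0# → y ⊗ (a ⊗ inv y) ≡ a
        clear a y y≢0 = trans (cong (y ⊗_) (𝔽.*-comm a (inv y))) (trans (sym (𝔽.*-assoc y (inv y) a)) (trans (cong (_⊗ a) (inv-* y y≢0)) (𝔽.*-idˡ a)))
      -- For x ≠ x′ the quotient (x + y)/(x′ + y) determines y, and then the equation of the graph
      -- determines v.
      b-inj : ∀ {i j} → b i ≡ b j → i ≡ j
      b-inj {i} {j} e = g-inj (same-vertex (g i) (g j) Y≡ u≡)
        where
        open 𝔽 using (solve; _:+_; _:*_; _:=_)
        cross : (x ⊕ Y i) ⊗ (x′ ⊕ Y j) ≡ (x ⊕ Y j) ⊗ (x′ ⊕ Y i)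
        cross = trans (cong (_⊗ (x′ ⊕ Y j)) (sym (mulback i))) (trans (cong (λ z → z ⊗ (x′ ⊕ Y i) ⊗ (x′ ⊕ Y j)) e) (trans (solve 3 (λ a b c → (a :* b) :* c := (a :* c) :* b) refl (b j) (x′ ⊕ Y i) (x′ ⊕ Y j)) (cong (_⊗ (x′ ⊕ Y i)) (mulback j))))
          where
          mulback : ∀ i → b i ⊗ (x′ ⊕ Y i) ≡ x ⊕ Y i
          mulback i = trans (𝔽.*-assoc (x ⊕ Y i) (inv (x′ ⊕ Y i)) (x′ ⊕ Y i)) (trans (cong ((x ⊕ Y i) ⊗_) (trans (𝔽.*-comm _ _) (inv-* _ (den≢0 i)))) (𝔽.*-idʳ _))
        swap : x ⊗ Y j ⊕ Y i ⊗ x′ ≡ x ⊗ Y i ⊕ Y j ⊗ x′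
        swap = 𝔽.+-cancelˡ (x ⊗ x′ ⊕ Y i ⊗ Y j) _ _ (trans (solve 4 (λ x x′ a c → (x :* x′ :+ a :* c) :+ (x :* c :+ a :* x′) := (x :+ a) :* (x′ :+ c)) refl x x′ (Y i) (Y j)) (trans cross (solve 4 (λ x x′ a c → (x :+ c) :* (x′ :+ a) := (x :* x′ :+ a :* c) :+ (x :* a :+ c :* x′)) refl x x′ (Y i) (Y j))))
        Y≡ : Y i ≡ Y j
        Y≡ = cancelˡ (x ⊕ ⊖ x′) (λ z → ne (diff-zero x x′ z)) (𝔽.+-cancelʳ (x′ ⊗ Y i ⊕ x′ ⊗ Y j) _ _
          (trans (flatten (Y i) (Y j)) (trans (sym swap) (sym (trans (cong ((x ⊕ ⊖ x′) ⊗ Y j ⊕_) (𝔽.+-comm _ _)) (flatten (Y j) (Y i)))))))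
          where
          flatten : ∀ a c → (x ⊕ ⊖ x′) ⊗ a ⊕ (x′ ⊗ a ⊕ x′ ⊗ c) ≡ x ⊗ a ⊕ c ⊗ x′
          flatten a c = trans (solve 5 (λ x m x′ a c → (x :+ m) :* a :+ (x′ :* a :+ x′ :* c) := (x′ :+ (x :+ m)) :* a :+ c :* x′) refl x (⊖ x′) x′ a c) (cong (λ z → z ⊗ a ⊕ c ⊗ x′) (add-diff x x′))
        u≡ : pu (g i) ≡ pu (g j)
        u≡ = cancelˡ (pu l) (I≢0 _) (trans (sym (inc-eq l (g i) (h i))) (trans (cong (λ z → (x ⊕ z) ^^ Λ) Y≡) (inc-eq l (g j) (h j))))

    -- If x = x′, a single common neighbour already forces u = u′.
    codegree : ∀ l l′ (g : Fin (suc Λ) → Fin A) → l ≢ l′ → Injective _≡_ _≡_ g → (∀ i → inc l (g i) ≡ true) → (∀ i → inc l′ (g i) ≡ true) → ⊥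
    codegree l l′ g l≢l′ g-inj h h′ = split (px l ≟ px l′)
      where
      split : Dec (px l ≡ px l′) → ⊥
      split (yes e) = l≢l′ (same-vertex l l′ e (cancelˡ (pu (g Fin.zero)) (I≢0 _) (trans (𝔽.*-comm _ (pu l)) (trans (sym (inc-eq l _ (h Fin.zero))) (trans (cong (λ z → (z ⊕ px (g Fin.zero)) ^^ Λ) e) (trans (inc-eq l′ _ (h′ Fin.zero)) (𝔽.*-comm (pu l′) _)))))))
      split (no ne) = distinct-codegree l l′ g ne g-inj h h′

    füredi : ∀ k′ n → A + A ≤ n → Σ (Graph n) λ G → Admissible k′ (suc Λ) G × (A * (Λ * s) ≤ edgeCount G)
    füredi k′ n h = subst (λ n → Σ (Graph n) λ G → Admissible k′ (suc Λ) G × (A * (Λ * s) ≤ edgeCount G)) (m+[n∸m]≡n h)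
      (graph , (no-odd-cycle k′ , no-induced-K (suc Λ) codegree (s≤s z≤n)) , many-edges (Λ * s) degree)
      where open Bipartite A (n ∸ (A + A)) inc inc-comm

-- Choice of the field and the lower bound

module LowerBound where

  open FinSum
  open FiniteFields
  open Furedi
  open Tower
  open import Defs hiding (sym; irrefl)
  open import Data.Nat as ℕ using (ℕ; zero; suc; _+_; _*_; _∸_; _^_; _≤_; _<_; z≤n; s≤s)
  open import Data.Nat.Properties
  open import Data.Nat.Solver using (module +-*-Solver)

  open Sums using (quo; quo-mul≤; <quo; ≤quo)
  open PrimesInShortIntervals using (prime-in-short-interval)
  open import Data.Nat.Primality using (Prime)

  crossing : ∀ (f : ℕ → ℕ) N b → f 0 ≤ N → N < f b → Σ ℕ λ w → (f w ≤ N) × (N < f (suc w))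
  crossing f N zero lo hi = ⊥-elim (<⇒≱ hi lo)
  crossing f N (suc b) lo hi with f b ≤? N
  ... | yes h = b , h , hi
  ... | no h = crossing f N b lo (≰⇒> h)

  bernoulli : ∀ c D → suc c ^ D ≤ c ^ D + D * suc c ^ ℕ.pred D
  bernoulli c zero = s≤s z≤n
  bernoulli c (suc D) = ≤-trans (+-monoʳ-≤ (suc c ^ D) (≤-trans (*-monoʳ-≤ c (bernoulli c D)) (≤-reflexive (*-distribˡ-+ c (c ^ D) (D * suc c ^ ℕ.pred D)))))
      (≤-trans (≤-reflexive (alg (suc c ^ D) (c ^ suc D) (c * (D * suc c ^ ℕ.pred D)))) (+-monoʳ-≤ (c ^ suc D) (+-monoʳ-≤ (suc c ^ D) (last D))))
    where
    alg : ∀ a b d → a + (b + d) ≡ b + (a + d)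
    alg = solve 3 (λ a b d → a :+ (b :+ d) := b :+ (a :+ d)) refl
      where open +-*-Solver
    last : ∀ D → c * (D * suc c ^ ℕ.pred D) ≤ D * suc c ^ D
    last zero = ≤-reflexive (*-zeroʳ c)
    last (suc D) = ≤-trans (≤-reflexive (trans (sym (*-assoc c (suc D) _)) (trans (cong (_* suc c ^ D) (*-comm c (suc D))) (*-assoc (suc D) c _)))) (*-monoʳ-≤ (suc D) (*-monoˡ-≤ (suc c ^ D) (n≤1+n c)))

  -- Bernoulli's inequality (1 - 1/(Dm))^D ≥ 1 - 1/m, with w/x at most (c + 1)/c.
  power-ratio : ∀ m D c w x → suc c ≡ suc D * suc m → w * c ≤ x * suc c → m * w ^ suc D ≤ suc m * x ^ suc D
  power-ratio m D c w x e h = *-cancelʳ-≤ _ _ (suc c ^ suc D) {{ℕ.>-nonZero (m^n>0 (suc c) (suc D))}} (begin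
      m * w ^ suc D * suc c ^ suc D ≡⟨ regroup m (w ^ suc D) (suc c ^ suc D) ⟩
      w ^ suc D * (m * suc c ^ suc D) ≤⟨ *-monoʳ-≤ (w ^ suc D) key ⟩
      w ^ suc D * (suc m * c ^ suc D) ≡⟨ sym (regroup (suc m) (w ^ suc D) (c ^ suc D)) ⟩
      suc m * w ^ suc D * c ^ suc D ≡⟨ trans (*-assoc (suc m) (w ^ suc D) (c ^ suc D)) (cong (suc m *_) (sym (^-distribʳ-* (suc D) w c))) ⟩
      suc m * (w * c) ^ suc D ≤⟨ *-monoʳ-≤ (suc m) (^-monoˡ-≤ (suc D) h) ⟩
      suc m * (x * suc c) ^ suc D ≡⟨ trans (cong (suc m *_) (^-distribʳ-* (suc D) x (suc c))) (sym (*-assoc (suc m) (x ^ suc D) (suc c ^ suc D))) ⟩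
      suc m * x ^ suc D * suc c ^ suc D ∎)
    where
    open ≤-Reasoning
    regroup : ∀ a b d → a * b * d ≡ b * (a * d)
    regroup = solve 3 (λ a b d → a :* b :* d := b :* (a :* d)) refl
      where open +-*-Solver
    ^-distribʳ-* : ∀ n a b → (a * b) ^ n ≡ a ^ n * b ^ n
    ^-distribʳ-* zero a b = refl
    ^-distribʳ-* (suc n) a b = trans (cong (a * b *_) (^-distribʳ-* n a b)) (solve 4 (λ a b p q → a :* b :* (p :* q) := a :* p :* (b :* q)) refl a b (a ^ n) (b ^ n))
      where open +-*-Solver
    C = suc c ^ D
    key : m * suc c ^ suc D ≤ suc m * c ^ suc D
    key = +-cancelʳ-≤ (suc c * C) _ _ (begin
      m * (suc c * C) + suc c * C ≡⟨ +-comm (m * (suc c * C)) (suc c * C) ⟩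
      suc m * (suc c ^ suc D) ≤⟨ *-monoʳ-≤ (suc m) (bernoulli c (suc D)) ⟩
      suc m * (c ^ suc D + suc D * C) ≡⟨ *-distribˡ-+ (suc m) (c ^ suc D) (suc D * C) ⟩
      suc m * c ^ suc D + suc m * (suc D * C) ≡⟨ cong (suc m * c ^ suc D +_) (trans (sym (*-assoc (suc m) (suc D) C)) (cong (_* C) (trans (*-comm (suc m) (suc D)) (sym e)))) ⟩
      suc m * c ^ suc D + suc c * C ∎)

  -- The second hypothesis keeps x within a factor 1 + 1/(2 (c + 1)) of w up to rounding, half of
  -- what the conclusion allows; for w as large as in the first one, the other half absorbs the
  -- rounding and the passage from w to w + 1.
  approximation : ∀ c w x → 4 * (suc c * suc c) + 2 * suc c ≤ w → 2 * suc c * w ≤ suc (2 * suc c) * x + 2 * suc c * (2 * suc c) → suc w * c ≤ x * suc c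
  approximation c w x h₁ h₂ = *-cancelˡ-≤ K (+-cancelʳ-≤ (C * (M * M)) _ _ (begin
      K * (suc w * c) + C * (M * M) ≤⟨ m≤m+n _ (suc C * v + 4 * (C * C) + 3 * C + 1) ⟩
      K * (suc w * c) + C * (M * M) + (suc C * v + 4 * (C * C) + 3 * C + 1) ≡⟨ cong (λ w → K * (suc w * c) + C * (M * M) + (suc C * v + 4 * (C * C) + 3 * C + 1)) (sym w≡) ⟩
      K * (suc (4 * (C * C) + 2 * C + v) * c) + C * (M * M) + (suc C * v + 4 * (C * C) + 3 * C + 1) ≡⟨ alg c v ⟩
      C * (M * (4 * (C * C) + 2 * C + v)) ≡⟨ cong (λ w → C * (M * w)) w≡ ⟩
      C * (M * w) ≤⟨ *-monoʳ-≤ C h₂ ⟩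
      C * (K * x + M * M) ≡⟨ alg′ C K x (M * M) ⟩
      K * (x * C) + C * (M * M) ∎))
    where
    open ≤-Reasoning
    open +-*-Solver
    C M K v : ℕ
    C = suc c
    M = 2 * C
    K = suc M
    v = w ∸ (4 * (C * C) + 2 * C)
    w≡ : 4 * (C * C) + 2 * C + v ≡ w
    w≡ = m+[n∸m]≡n h₁
    alg : ∀ c v → suc (2 * suc c) * (suc (4 * (suc c * suc c) + 2 * suc c + v) * c) + suc c * (2 * suc c * (2 * suc c)) + (suc (suc c) * v + 4 * (suc c * suc c) + 3 * suc c + 1) ≡ suc c * (2 * suc c * (4 * (suc c * suc c) + 2 * suc c + v))
    alg = solve 2 (λ c v → (con 1 :+ con 2 :* (con 1 :+ c)) :* ((con 1 :+ (con 4 :* ((con 1 :+ c) :* (con 1 :+ c)) :+ con 2 :* (con 1 :+ c) :+ v)) :* c) :+ (con 1 :+ c) :* (con 2 :* (con 1 :+ c) :* (con 2 :* (con 1 :+ c)))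
        :+ ((con 2 :+ c) :* v :+ con 4 :* ((con 1 :+ c) :* (con 1 :+ c)) :+ con 3 :* (con 1 :+ c) :+ con 1) := (con 1 :+ c) :* (con 2 :* (con 1 :+ c) :* (con 4 :* ((con 1 :+ c) :* (con 1 :+ c)) :+ con 2 :* (con 1 :+ c) :+ v))) refl
    alg′ : ∀ C K x m → C * (K * x + m) ≡ K * (x * C) + C * m
    alg′ = solve 4 (λ C K x m → C :* (K :* x :+ m) := K :* (x :* C) :+ C :* m) refl

  lower-bound : ∀ k λ′ m → 1 ≤ m → Σ ℕ λ N → ∀ n → N ≤ n → Σ (Graph n) λ G → Admissible k (suc (suc λ′)) G × ((m ∸ 1) ^ 2 * suc λ′ * n ^ 3 ≤ 8 * m ^ 2 * edgeCount G ^ 2)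
  lower-bound k λ′ (suc m) _ = 2 * W₀ ^ (2 * r) , build
    where
    Λ r D c M x₀ X₀ W₀ : ℕ
    Λ = suc λ′
    r = exponent Λ
    -- The square of the number of edges is of order p^(6r), so a power 6r of the ratio between the
    -- target w and the prime p has to be controlled.
    D = 6 * r ∸ 1
    c = suc D * suc m ∸ 1
    M = 2 * suc c
    x₀ = proj₁ (prime-in-short-interval M (s≤s z≤n))
    X₀ = x₀ + Λ
    W₀ = X₀ * suc M + (4 * (suc c * suc c) + 2 * suc c)
    1≤exponent : ∀ j → 1 ≤ exponent j
    1≤exponent zero = s≤s z≤n
    1≤exponent (suc j) = *-mono-≤ (1≤exponent j) (1≤n! j)
    1≤r : 1 ≤ r
    1≤r = 1≤exponent Λ
    D≡ : suc D ≡ 6 * r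
    D≡ = m+[n∸m]≡n {1} {6 * r} (≤-trans 1≤r (m≤n*m r 6))
    c≡ : suc c ≡ suc D * suc m
    c≡ = refl
    build : ∀ n → 2 * W₀ ^ (2 * r) ≤ n → Σ (Graph n) λ G → Admissible k (suc Λ) G × (m ^ 2 * Λ * n ^ 3 ≤ 8 * suc m ^ 2 * edgeCount G ^ 2)
    -- w is the last value with 2 w^(2r) ≤ Λ n. A field with q ≤ w^r elements gives 2 q s vertices,
    -- and 2 q s < 2 q²/Λ ≤ n.
    build n n≥ with crossing (λ w → 2 * w ^ (2 * r)) (Λ * n) (suc (Λ * n)) (subst (_≤ Λ * n) (sym f0) z≤n) (≤-trans (m^n≥m (suc (Λ * n)) (2 * r) (≤-trans 1≤r (m≤n*m r 2))) (m≤n*m _ 2))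
      where
      f0 : 2 * 0 ^ (2 * r) ≡ 0
      f0 = cong (2 *_) (0^ (2 * r) (≤-trans 1≤r (m≤n*m r 2)))
        where
        0^ : ∀ e → 1 ≤ e → 0 ^ e ≡ 0
        0^ (suc e) _ = refl
      m^n≥m : ∀ a e → 1 ≤ e → a ≤ a ^ e
      m^n≥m zero e _ = z≤n
      m^n≥m a@(suc _) (suc e) _ = m≤m*n a (a ^ e) {{ℕ.>-nonZero (m^n>0 a e)}}
    ... | w , lo , hi = G , admissible , final
      where
      W₀≤w : W₀ ≤ w
      W₀≤w = ≤-pred (≰⇒> (λ w<W₀ → <⇒≱ (<-≤-trans hi (*-monoʳ-≤ 2 (^-monoˡ-≤ (2 * r) w<W₀))) (≤-trans n≥ (m≤n*m n Λ))))
      -- As x is a multiple of M, the bound (1 + 1/M) x for the prime is the integer (M + 1) y ≤ w.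
      y x : ℕ
      y = quo w (suc M)
      x = M * y
      X₀≤y : X₀ ≤ y
      X₀≤y = ≤quo w (suc M) X₀ (s≤s z≤n) (≤-trans (m≤m+n _ _) W₀≤w)
      y≤x : y ≤ x
      y≤x = m≤n*m y M
      prime = proj₂ (prime-in-short-interval M (s≤s z≤n)) x (≤-trans (≤-trans (m≤m+n x₀ Λ) X₀≤y) y≤x)
      p : ℕ
      p = proj₁ prime
      pp : Prime p
      pp = proj₁ (proj₂ prime)
      x<p : x < p
      x<p = proj₁ (proj₂ (proj₂ prime))
      p≤w : p ≤ w
      p≤w = ≤-trans (*-cancelˡ-≤ M (≤-trans (proj₂ (proj₂ (proj₂ prime))) (≤-reflexive (trans (sym (*-assoc (suc M) M y)) (trans (cong (_* y) (*-comm (suc M) M)) (*-assoc M (suc M) y)))))) (≤-trans (≤-reflexive (*-comm (suc M) y)) (quo-mul≤ w (suc M)))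
      Λ<p : Λ < p
      Λ<p = ≤-<-trans (≤-trans (m≤n+m Λ x₀) (≤-trans X₀≤y y≤x)) x<p
      tower = fields pp Λ Λ<p
      q : ℕ
      q = p ^ r
      one = proj₂ tower Λ (s≤s z≤n) ≤-refl
      s₀ : ℕ
      s₀ = proj₁ one
      q≡₀ : q ≡ suc (Λ * s₀)
      q≡₀ = proj₂ one
      x^r<q : x ^ r < q
      x^r<q = ^-monoˡ-< r {{ℕ.>-nonZero 1≤r}} x<p
      1≤s₀ : 1 ≤ s₀
      1≤s₀ = go s₀ (≤-pred (≤-trans (≤-trans (s≤s (1≤x^r)) x^r<q) (≤-reflexive q≡₀)))
        where
        1≤x^r : 1 ≤ x ^ r
        1≤x^r = m^n>0 x {{ℕ.>-nonZero (≤-trans (≤-trans (s≤s z≤n) (m≤n+m Λ x₀)) (≤-trans X₀≤y y≤x))}} r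
        go : ∀ s → 1 ≤ Λ * s → 1 ≤ s
        go zero h = ⊥-elim (<⇒≱ h (≤-reflexive (*-zeroʳ Λ)))
        go (suc s) _ = s≤s z≤n
      s S : ℕ
      s = suc (ℕ.pred s₀)
      S = Λ * s
      s≡ : s ≡ s₀
      s≡ = suc-pred s₀ {{ℕ.>-nonZero 1≤s₀}}
      q≡ : q ≡ suc S
      q≡ = trans q≡₀ (cong (λ z → suc (Λ * z)) (sym s≡))
      A : ℕ
      A = q * s
      2A≤n : A + A ≤ n
      2A≤n = *-cancelˡ-≤ Λ (begin
        Λ * (q * s + q * s) ≡⟨ solve 3 (λ l q s → l :* (q :* s :+ q :* s) := con 2 :* (q :* (l :* s))) refl Λ q s ⟩
        2 * (q * S) ≤⟨ *-monoʳ-≤ 2 (*-monoʳ-≤ q (≤-trans (n≤1+n S) (≤-reflexive (sym q≡)))) ⟩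
        2 * (q * q) ≤⟨ *-monoʳ-≤ 2 (*-mono-≤ (^-monoˡ-≤ r p≤w) (^-monoˡ-≤ r p≤w)) ⟩
        2 * (w ^ r * w ^ r) ≡⟨ cong (2 *_) (trans (sym (^-distribˡ-+-* w r r)) (cong (λ z → w ^ (r + z)) (sym (+-identityʳ r)))) ⟩
        2 * w ^ (2 * r) ≤⟨ lo ⟩
        Λ * n ∎)
        where
        open ≤-Reasoning
        open +-*-Solver
      graph = Construction.füredi (proj₁ tower) λ′ (ℕ.pred s₀) q≡ k n 2A≤n
      G : Graph n
      G = proj₁ graph
      admissible = proj₁ (proj₂ graph)
      e : ℕ
      e = edgeCount G
      ratio : m * suc w ^ suc D ≤ suc m * x ^ suc D
      ratio = power-ratio m D c (suc w) x c≡ (approximation c w x (≤-trans (m≤n+m _ (X₀ * suc M)) W₀≤w) (begin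
          M * w ≤⟨ *-monoʳ-≤ M (≤-pred (<quo w (suc M) (s≤s z≤n))) ⟩
          M * (M + y * suc M) ≡⟨ solve 2 (λ M y → M :* (M :+ y :* (con 1 :+ M)) := (con 1 :+ M) :* (M :* y) :+ M :* M) refl M y ⟩
          suc M * x + M * M ∎))
        where
        open ≤-Reasoning
        open +-*-Solver
      cube : ∀ a → a ^ (6 * r) ≡ (a ^ r) ^ 6
      cube a = trans (cong (a ^_) (*-comm 6 r)) (sym (^-*-assoc a r 6))
      cube′ : ∀ a → a ^ (6 * r) ≡ (a ^ (2 * r)) ^ 3
      cube′ a = trans (cong (a ^_) (solve 1 (λ r → con 6 :* r := con 2 :* r :* con 3) refl r)) (sym (^-*-assoc a (2 * r) 3))
        where open +-*-Solver
      S³≤Λe : S ^ 3 ≤ Λ * e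
      S³≤Λe = begin
        S ^ 3 ≡⟨ solve 1 (λ S → S :^ 3 := S :* S :* S) refl S ⟩
        S * S * S ≤⟨ *-monoˡ-≤ S (*-monoˡ-≤ S (≤-trans (n≤1+n S) (≤-reflexive (sym q≡)))) ⟩
        q * S * S ≡⟨ solve 4 (λ q l s S → q :* (l :* s) :* S := l :* (q :* s :* S)) refl q Λ s S ⟩
        Λ * (A * S) ≤⟨ *-monoʳ-≤ Λ (proj₂ (proj₂ graph)) ⟩
        Λ * e ∎
        where
        open ≤-Reasoning
        open +-*-Solver
      final : m ^ 2 * Λ * n ^ 3 ≤ 8 * suc m ^ 2 * e ^ 2
      final = *-cancelˡ-≤ (Λ * Λ) (begin
        Λ * Λ * (m ^ 2 * Λ * n ^ 3) ≡⟨ solve 3 (λ l m n → l :* l :* (m :^ 2 :* l :* n :^ 3) := m :* (m :* (l :* n) :^ 3)) refl Λ m n ⟩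
        m * (m * (Λ * n) ^ 3) ≤⟨ *-monoʳ-≤ m (*-monoʳ-≤ m (^-monoˡ-≤ 3 (<⇒≤ hi))) ⟩
        m * (m * (2 * suc w ^ (2 * r)) ^ 3) ≡⟨ solve 2 (λ m v → m :* (m :* (con 2 :* v) :^ 3) := con 8 :* (m :* (m :* v :^ 3))) refl m (suc w ^ (2 * r)) ⟩
        8 * (m * (m * (suc w ^ (2 * r)) ^ 3)) ≡⟨ cong (λ z → 8 * (m * (m * z))) (trans (sym (cube′ (suc w))) (cong (suc w ^_) (sym D≡))) ⟩
        -- `ratio` is already an estimate for the squares; the second factor m is merely enlarged to
        -- match the form of the claim.
        8 * (m * (m * suc w ^ suc D)) ≤⟨ *-monoʳ-≤ 8 (*-mono-≤ (n≤1+n m) ratio) ⟩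
        8 * (suc m * (suc m * x ^ suc D)) ≡⟨ cong (λ z → 8 * (suc m * (suc m * z))) (trans (cong (x ^_) D≡) (cube x)) ⟩
        8 * (suc m * (suc m * (x ^ r) ^ 6)) ≤⟨ *-monoʳ-≤ 8 (*-monoʳ-≤ (suc m) (*-monoʳ-≤ (suc m) (^-monoˡ-≤ 6 (≤-pred (≤-trans x^r<q (≤-reflexive q≡)))))) ⟩
        8 * (suc m * (suc m * S ^ 6)) ≡⟨ cong (λ z → 8 * (suc m * (suc m * z))) (sym (^-*-assoc S 3 2)) ⟩
        8 * (suc m * (suc m * (S ^ 3) ^ 2)) ≤⟨ *-monoʳ-≤ 8 (*-monoʳ-≤ (suc m) (*-monoʳ-≤ (suc m) (^-monoˡ-≤ 2 S³≤Λe))) ⟩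
        8 * (suc m * (suc m * (Λ * e) ^ 2)) ≡⟨ solve 3 (λ l m e → con 8 :* (m :* (m :* (l :* e) :^ 2)) := l :* l :* (con 8 :* m :^ 2 :* e :^ 2)) refl Λ (suc m) e ⟩
        Λ * Λ * (8 * suc m ^ 2 * e ^ 2) ∎)
        where
        open ≤-Reasoning
        open +-*-Solver

-- Paths, cycles and Ramsey's theorem in a graph

module Graphs where

  open FinSum
  open import Defs hiding (sym; irrefl)
  open import Data.Nat as ℕ using (ℕ; zero; suc; _+_; _^_; _≤_)
  open import Data.Nat.Properties
  open import Data.Bool using (Bool; true; false; _∧_; not)
  open import Data.Fin as Fin using (Fin; toℕ)
  import Data.Fin.Properties as Finₚ
  open import Data.List as List using (List; []; _∷_; length; map)
  open import Data.List.Relation.Unary.All as All using (All; []; _∷_)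
  open import Data.List.Relation.Unary.AllPairs using ([]; _∷_)
  open import Data.List.Relation.Unary.Unique.Propositional using (Unique)
  open import Function using (_∘_; Injective)

  open import Data.List.Relation.Unary.AllPairs using (AllPairs)
  open import Data.List.Membership.Propositional using (_∈_)
  open import Data.List.Membership.Propositional.Properties using (∈-lookup)
  open import Data.List.Relation.Unary.Any using (here; there)
  open import Data.Nat.DivMod using (m<n⇒m%n≡m; n%n≡0)

  ∧-true : ∀ {a b} → a ∧ b ≡ true → (a ≡ true) × (b ≡ true)
  ∧-true {true} {true} _ = refl , refl

  ∧-intro : ∀ {a b} → a ≡ true → b ≡ true → a ∧ b ≡ true
  ∧-intro refl refl = refl

  not-true : ∀ {b} → not b ≡ true → b ≡ false
  not-true {false} _ = refl

  t≢f : ∀ {b} → b ≡ true → b ≡ false → ⊥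
  t≢f refl ()

  bool-cases : ∀ b → (b ≡ true) ⊎ (b ≡ false)
  bool-cases true = inj₁ refl
  bool-cases false = inj₂ refl

  module PathsIn {n : ℕ} (G : Graph n) where
    a : Fin n → Fin n → Bool
    a = adj G

    E : Fin n → Fin n → Set
    E u v = a u v ≡ true

    E-sym : ∀ {u v} → E u v → E v u
    E-sym {u} {v} h = trans (Graph.sym G v u) h

    a-sym : ∀ u v → a u v ≡ a v u
    a-sym = Graph.sym G

    E-irrefl : ∀ {u v} → E u v → u ≢ v
    E-irrefl {u} h refl = t≢f h (Graph.irrefl G u)

    data Path : Fin n → Fin n → ℕ → List (Fin n) → Set where
      [_]  : ∀ v → Path v v 0 (v ∷ [])
      cons : ∀ {u v w ℓ vs} → E u v → Path v w ℓ vs → All (u ≢_) vs → Path u w (suc ℓ) (u ∷ vs)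

    head-∈ : ∀ {u w ℓ vs} → Path u w ℓ vs → u ∈ vs
    head-∈ [ v ] = here refl
    head-∈ (cons _ _ _) = here refl

    last-∈ : ∀ {u w ℓ vs} → Path u w ℓ vs → w ∈ vs
    last-∈ [ v ] = here refl
    last-∈ (cons _ p _) = there (last-∈ p)

    path-length : ∀ {u w ℓ vs} → Path u w ℓ vs → length vs ≡ suc ℓ
    path-length [ v ] = refl
    path-length (cons _ p _) = cong suc (path-length p)

    at : ∀ {u w ℓ vs} → Path u w ℓ vs → Fin (suc ℓ) → Fin n
    at {u} _ Fin.zero = u
    at (cons _ p _) (Fin.suc i) = at p i

    at-∈ : ∀ {u w ℓ vs} (p : Path u w ℓ vs) i → at p i ∈ vs
    at-∈ p Fin.zero = head-∈ p
    at-∈ (cons _ p _) (Fin.suc i) = there (at-∈ p i)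

    at-injective : ∀ {u w ℓ vs} (p : Path u w ℓ vs) i j → at p i ≡ at p j → i ≡ j
    at-injective p Fin.zero Fin.zero _ = refl
    at-injective (cons _ p u∉) Fin.zero (Fin.suc j) e = ⊥-elim (All.lookup u∉ (at-∈ p j) e)
    at-injective (cons _ p u∉) (Fin.suc i) Fin.zero e = ⊥-elim (All.lookup u∉ (at-∈ p i) (sym e))
    at-injective (cons _ p _) (Fin.suc i) (Fin.suc j) e = cong Fin.suc (at-injective p i j e)

    at-step : ∀ {u w ℓ vs} (p : Path u w ℓ vs) i j → toℕ j ≡ suc (toℕ i) → E (at p i) (at p j)
    at-step (cons e p _) Fin.zero (Fin.suc Fin.zero) refl = e
    at-step (cons e p _) Fin.zero (Fin.suc (Fin.suc j)) ()
    at-step (cons _ p _) (Fin.suc i) (Fin.suc j) e = at-step p i j (suc-injective e)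

    at-last : ∀ {u w ℓ vs} (p : Path u w ℓ vs) i → toℕ i ≡ ℓ → at p i ≡ w
    at-last [ v ] Fin.zero _ = refl
    at-last (cons _ p _) (Fin.suc i) e = at-last p i (suc-injective e)

    -- m is the number of edges of the path; the cycle has m + 1 vertices, which is what
    -- `ContainsCycle m` stands for.
    cycle : ∀ {u w m vs} → Path u w m vs → E w u → ContainsCycle m G
    cycle {u} {w} {m} p close = at p , (λ {i} {j} → at-injective p i j) , edge
      where
      edge : ∀ i j → toℕ j ≡ suc (toℕ i) ℕ.% suc m → E (at p i) (at p j)
      edge i j e with m≤n⇒m<n∨m≡n (Finₚ.toℕ<n i)
      ... | inj₁ lt = at-step p i j (trans e (m<n⇒m%n≡m lt))
      ... | inj₂ eq = subst₂ E (sym (at-last p i (suc-injective eq))) (cong (at p) (Finₚ.toℕ-injective {i = Fin.zero} (sym (trans e (trans (cong (ℕ._% suc m) eq) (n%n≡0 (suc m))))))) close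

    lookup-pairs : ∀ {R : Fin n → Fin n → Set} → (∀ {x y} → R x y → R y x) → ∀ {xs} → AllPairs R xs → ∀ i j → i ≢ j → R (List.lookup xs i) (List.lookup xs j)
    lookup-pairs s (r ∷ _) Fin.zero Fin.zero ne = ⊥-elim (ne refl)
    lookup-pairs s (r ∷ _) Fin.zero (Fin.suc j) _ = All.lookup r (∈-lookup j)
    lookup-pairs s (r ∷ _) (Fin.suc i) Fin.zero _ = s (All.lookup r (∈-lookup i))
    lookup-pairs s (_ ∷ rs) (Fin.suc i) (Fin.suc j) ne = lookup-pairs s rs i j (ne ∘ cong Fin.suc)

    Clique Independent : List (Fin n) → Set
    Clique = AllPairs E
    Independent = AllPairs (λ x y → (x ≢ y) × (a x y ≡ false))

    clique-path : ∀ y ys → Clique (y ∷ ys) → Σ (Fin n) λ w → Path y w (length ys) (y ∷ ys)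
    clique-path y [] _ = y , [ y ]
    clique-path y (z ∷ ys) (h ∷ hs) = let (w , p) = clique-path z ys hs in w , cons (All.head h) p (All.map E-irrefl h)

    record Split (P : Fin n → Bool) (xs : List (Fin n)) : Set₁ where
      field
        ys zs : List (Fin n)
        len : length ys + length zs ≡ length xs
        ys-P : All (λ x → P x ≡ true) ys
        zs-P : All (λ x → P x ≡ false) zs
        ys-all : ∀ {Q : Fin n → Set} → All Q xs → All Q ys
        zs-all : ∀ {Q : Fin n → Set} → All Q xs → All Q zs
        ys-unique : Unique xs → Unique ys
        zs-unique : Unique xs → Unique zs

    split : ∀ P xs → Split P xs
    split P [] = record { ys = [] ; zs = [] ; len = refl ; ys-P = [] ; zs-P = [] ; ys-all = λ h → h ; zs-all = λ h → h ; ys-unique = λ h → h ; zs-unique = λ h → h }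
    split P (x ∷ xs) = add (P x) refl (split P xs)
      where
      add : ∀ b → P x ≡ b → Split P xs → Split P (x ∷ xs)
      add true e s = record { ys = x ∷ ys ; zs = zs ; len = cong suc len ; ys-P = e ∷ ys-P ; zs-P = zs-P ; ys-all = λ { (h ∷ hs) → h ∷ ys-all hs } ; zs-all = λ { (_ ∷ hs) → zs-all hs }
        ; ys-unique = λ { (h ∷ u) → ys-all h ∷ ys-unique u } ; zs-unique = λ { (_ ∷ u) → zs-unique u } }
        where open Split s
      add false e s = record { ys = ys ; zs = x ∷ zs ; len = trans (+-suc (length ys) (length zs)) (cong suc len) ; ys-P = ys-P ; zs-P = e ∷ zs-P ; ys-all = λ { (_ ∷ hs) → ys-all hs } ; zs-all = λ { (h ∷ hs) → h ∷ zs-all hs }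
        ; ys-unique = λ { (_ ∷ u) → ys-unique u } ; zs-unique = λ { (h ∷ u) → zs-all h ∷ zs-unique u } }
        where open Split s

    record Homogeneous (R : List (Fin n) → Set) (s : ℕ) (Q : Fin n → Set) : Set where
      field
        vs : List (Fin n)
        size : length vs ≡ s
        pairs : R vs
        all : All Q vs

    -- For targets s + 1 and t + 1 the vertices other than x number at least 2^(s+t+2) - 1, so its
    -- neighbours or its non-neighbours number at least 2^(s+t+1), and one target drops by one. `Q`
    -- carries the relations to the vertices chosen before.
    ramsey : ∀ s t xs (Q : Fin n → Set) → Unique xs → All Q xs → 2 ^ (s + t) ≤ length xs → Homogeneous Clique s Q ⊎ Homogeneous Independent t Q
    ramsey zero t xs Q _ _ _ = inj₁ (record { vs = [] ; size = refl ; pairs = [] ; all = [] })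
    ramsey (suc s) zero xs Q _ _ _ = inj₂ (record { vs = [] ; size = refl ; pairs = [] ; all = [] })
    ramsey (suc s) (suc t) [] Q _ _ h = ⊥-elim (<⇒≱ (m^n>0 2 (suc s + suc t)) h)
    ramsey (suc s) (suc t) (x ∷ xs) Q (x∉ ∷ u) (q ∷ qs) h with 2 ^ (s + suc t) ≤? length (Split.ys (split (a x) xs))
    ... | yes big = clique (ramsey s (suc t) ys (λ y → Q y × E x y) (ys-unique u) (All.zip (ys-all qs , ys-P)) big)
      where
      open Split (split (a x) xs)
      clique : Homogeneous Clique s (λ y → Q y × E x y) ⊎ Homogeneous Independent (suc t) (λ y → Q y × E x y) → Homogeneous Clique (suc s) Q ⊎ Homogeneous Independent (suc t) Q
      clique (inj₁ H) = let open Homogeneous H in inj₁ (record { vs = x ∷ vs ; size = cong suc size ; pairs = All.map proj₂ all ∷ pairs ; all = q ∷ All.map proj₁ all })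
      clique (inj₂ H) = let open Homogeneous H in inj₂ (record { vs = vs ; size = size ; pairs = pairs ; all = All.map proj₁ all })
    ... | no small = indep (ramsey (suc s) t zs (λ y → Q y × ((x ≢ y) × (a x y ≡ false))) (zs-unique u) (All.zip (zs-all qs , All.zip (zs-all x∉ , zs-P))) big)
      where
      open Split (split (a x) xs)
      big : 2 ^ (suc s + t) ≤ length zs
      big = +-cancelˡ-≤ (length ys) _ _ (≤-trans (≤-pred (≤-trans (+-mono-≤ (≰⇒> small) (≤-reflexive (cong (2 ^_) (sym (+-suc s t))))) (≤-trans (≤-reflexive (cong (2 ^ (s + suc t) +_) (sym (+-identityʳ _)))) h))) (≤-reflexive (sym len)))
      indep : Homogeneous Clique (suc s) (λ y → Q y × ((x ≢ y) × (a x y ≡ false))) ⊎ Homogeneous Independent t (λ y → Q y × ((x ≢ y) × (a x y ≡ false))) → Homogeneous Clique (suc s) Q ⊎ Homogeneous Independent (suc t) Q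
      indep (inj₁ H) = let open Homogeneous H in inj₁ (record { vs = vs ; size = size ; pairs = pairs ; all = All.map proj₁ all })
      indep (inj₂ H) = let open Homogeneous H in inj₂ (record { vs = x ∷ vs ; size = cong suc size ; pairs = All.map proj₂ all ∷ pairs ; all = q ∷ All.map proj₁ all })

    induced-K : ∀ t u w → u ≢ w → a u w ≡ false → Homogeneous Independent t (λ x → E u x × E w x) → ContainsInducedK2t t G
    induced-K t u w u≢w uw record { vs = vs ; size = refl ; pairs = pairs ; all = all } = f , inj , adj-f
      where
      f : Fin (2 + t) → Fin n
      f Fin.zero = u
      f (Fin.suc Fin.zero) = w
      f (Fin.suc (Fin.suc i)) = List.lookup vs i
      nb : ∀ i → E u (List.lookup vs i) × E w (List.lookup vs i)
      nb i = All.lookup all (∈-lookup i)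
      pr : ∀ i j → i ≢ j → (List.lookup vs i ≢ List.lookup vs j) × (a (List.lookup vs i) (List.lookup vs j) ≡ false)
      pr = lookup-pairs (λ {x} {y} (ne , e) → (ne ∘ sym) , trans (a-sym y x) e) pairs
      inj : Injective _≡_ _≡_ f
      inj {Fin.zero} {Fin.zero} _ = refl
      inj {Fin.zero} {Fin.suc Fin.zero} e = ⊥-elim (u≢w e)
      inj {Fin.zero} {Fin.suc (Fin.suc j)} e = ⊥-elim (E-irrefl (proj₁ (nb j)) e)
      inj {Fin.suc Fin.zero} {Fin.zero} e = ⊥-elim (u≢w (sym e))
      inj {Fin.suc Fin.zero} {Fin.suc Fin.zero} _ = refl
      inj {Fin.suc Fin.zero} {Fin.suc (Fin.suc j)} e = ⊥-elim (E-irrefl (proj₂ (nb j)) e)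
      inj {Fin.suc (Fin.suc i)} {Fin.zero} e = ⊥-elim (E-irrefl (proj₁ (nb i)) (sym e))
      inj {Fin.suc (Fin.suc i)} {Fin.suc Fin.zero} e = ⊥-elim (E-irrefl (proj₂ (nb i)) (sym e))
      inj {Fin.suc (Fin.suc i)} {Fin.suc (Fin.suc j)} e with i Fin.≟ j
      ... | yes refl = refl
      ... | no ne = ⊥-elim (proj₁ (pr i j ne) e)
      adj-f : ∀ i j → i ≢ j → a (f i) (f j) ≡ K2tAdj {t} i j
      adj-f Fin.zero Fin.zero ne = ⊥-elim (ne refl)
      adj-f Fin.zero (Fin.suc Fin.zero) _ = uw
      adj-f Fin.zero (Fin.suc (Fin.suc j)) _ = proj₁ (nb j)
      adj-f (Fin.suc Fin.zero) Fin.zero _ = trans (a-sym w u) uw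
      adj-f (Fin.suc Fin.zero) (Fin.suc Fin.zero) ne = ⊥-elim (ne refl)
      adj-f (Fin.suc Fin.zero) (Fin.suc (Fin.suc j)) _ = proj₂ (nb j)
      adj-f (Fin.suc (Fin.suc i)) Fin.zero _ = E-sym (proj₁ (nb i))
      adj-f (Fin.suc (Fin.suc i)) (Fin.suc Fin.zero) _ = E-sym (proj₂ (nb i))
      adj-f (Fin.suc (Fin.suc i)) (Fin.suc (Fin.suc j)) ne = proj₂ (pr i j (ne ∘ cong (Fin.suc ∘ Fin.suc)))

-- Repeated removal of low degrees and greedy paths

module Levels where

  open FinSum
  open Graphs
  open import Defs hiding (sym; irrefl)
  open import Data.Nat as ℕ using (ℕ; zero; suc; _+_; _*_; _≤_; z≤n; s≤s)
  open import Data.Nat.Properties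
  open import Data.Bool using (Bool; true; false; if_then_else_; _∧_)
  open import Data.Fin using (Fin)
  open import Data.List using (List; _∷_; length)
  open import Data.List.Relation.Unary.All as All using (All; _∷_)
  open import Data.List.Relation.Unary.AllPairs using (_∷_)
  open import Function using (_∘_)

  open import Data.List using (_++_)
  open import Data.List.Properties using (length-++)
  import Data.List.Relation.Unary.All.Properties as Allₚ
  open import Data.Bool.Properties using (T-≡)
  open import Function.Bundles using (module Equivalence)

  -- This is 2j + i, by a recursion in steps of two that matches paths growing by two edges at a
  -- time.
  dbl : ℕ → ℕ → ℕ
  dbl zero i = i
  dbl (suc j) i = suc (suc (dbl j i))

  dbl-+ : ∀ j i k → dbl j (i + k) ≡ dbl j i + k
  dbl-+ zero i k = refl
  dbl-+ (suc j) i k = cong (suc ∘ suc) (dbl-+ j i k)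

  dbl-suc : ∀ j i → dbl j (suc i) ≡ suc (dbl j i)
  dbl-suc j i = trans (cong (dbl j) (+-comm 1 i)) (trans (dbl-+ j i 1) (+-comm (dbl j i) 1))

  dbl≡ : ∀ j i → dbl j i ≡ 2 * j + i
  dbl≡ zero i = refl
  dbl≡ (suc j) i = trans (cong (suc ∘ suc) (dbl≡ j i)) (cong (λ z → suc z + i) (sym (+-suc j (j + 0))))

  dbl≥ : ∀ j i → i ≤ dbl j i
  dbl≥ zero i = ≤-refl
  dbl≥ (suc j) i = m≤n⇒m≤1+n (m≤n⇒m≤1+n (dbl≥ j i))

  ≤ᵇ-true : ∀ {m n} → (m ℕ.≤ᵇ n) ≡ true → m ≤ n
  ≤ᵇ-true {m} {n} h = ≤ᵇ⇒≤ m n (Equivalence.from T-≡ h)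

  ≤ᵇ-intro : ∀ {m n} → m ≤ n → (m ℕ.≤ᵇ n) ≡ true
  ≤ᵇ-intro h = Equivalence.to T-≡ (≤⇒≤ᵇ h)

  -- Level i + 1 keeps the edges of level i whose two ends have degree at least c
  -- in level i; from an edge of level i a path can be extended greedily i times.
  module LevelsIn {n : ℕ} (G : Graph n) (E₀ : Fin n → Fin n → Bool) (E₀⊆ : ∀ {w z} → E₀ w z ≡ true → adj G w z ≡ true) (c : ℕ) where
    open PathsIn G

    Lev : ℕ → Fin n → Fin n → Bool
    row col : ℕ → Fin n → ℕ
    Lev zero w z = E₀ w z
    Lev (suc i) w z = Lev i w z ∧ ((c ℕ.≤ᵇ row i w) ∧ (c ℕ.≤ᵇ col i z))
    row i w = count (Lev i w)
    col i z = count (λ w → Lev i w z)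

    total : ℕ → ℕ
    total i = ∑ (row i)

    lev-E₀ : ∀ i {w z} → Lev i w z ≡ true → E₀ w z ≡ true
    lev-E₀ zero h = h
    lev-E₀ (suc i) h = lev-E₀ i (proj₁ (∧-true h))

    lev-row : ∀ i {w z} → Lev (suc i) w z ≡ true → c ≤ row i w
    lev-row i {w} {z} h = ≤ᵇ-true (proj₁ (∧-true (proj₂ (∧-true {Lev i w z} h))))

    lev-col : ∀ i {w z} → Lev (suc i) w z ≡ true → c ≤ col i z
    lev-col i {w} {z} h = ≤ᵇ-true (proj₂ (∧-true {c ℕ.≤ᵇ row i w} (proj₂ (∧-true {Lev i w z} h))))

    module Loss (A B : Fin n → Bool) (inA : ∀ {w z} → E₀ w z ≡ true → A w ≡ true) (inB : ∀ {w z} → E₀ w z ≡ true → B z ≡ true) where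
      keep : Bool → ℕ → ℕ
      keep p x = if p then 0 else x

      pointwise : ∀ e p q → ind e ≤ ind (e ∧ (p ∧ q)) + keep p (ind e) + keep q (ind e)
      pointwise false p q = z≤n
      pointwise true true true = ≤-refl
      pointwise true true false = ≤-refl
      pointwise true false q = m≤m+n 1 _

      keep-∑ : ∀ p (f : Fin n → ℕ) → ∑ (λ i → keep p (f i)) ≡ keep p (∑ f)
      keep-∑ true f = ∑-zero {n} {λ _ → 0} (λ _ → refl)
      keep-∑ false f = refl

      bound : ∀ (P : Fin n → Bool) b → (∀ i → P i ≡ true → b ≡ true) → keep (c ℕ.≤ᵇ count P) (count P) ≤ c * ind b
      bound P b h with bool-cases (c ℕ.≤ᵇ count P)
      ... | inj₁ e = subst (λ t → keep t (count P) ≤ c * ind b) (sym e) z≤n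
      ... | inj₂ e with b
      ...   | true = subst (λ t → keep t (count P) ≤ c * 1) (sym e) (≤-trans (<⇒≤ (≰⇒> (λ p → t≢f (≤ᵇ-intro p) e))) (≤-reflexive (sym (*-identityʳ c))))
      ...   | false = subst (λ t → keep t (count P) ≤ c * 0) (sym e) (≤-trans (≤-reflexive (∑-zero (λ i → cong ind (none i)))) z≤n)
        where
        none : ∀ i → P i ≡ false
        none i with P i in eq
        ... | false = refl
        ... | true = ⊥-elim (t≢f (h i eq) refl)

      -- A lost edge has an end of degree below c in level i, and each such end accounts for fewer
      -- than c lost edges. Only ends in `A` or `B` carry any.
      loss : ∀ i → total i ≤ total (suc i) + c * (count A + count B)
      loss i = begin
        total i ≤⟨ ∑-mono (λ w → ∑-mono (λ z → pointwise (Lev i w z) (c ℕ.≤ᵇ row i w) (c ℕ.≤ᵇ col i z))) ⟩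
        ∑ (λ w → ∑ (λ z → ind (Lev (suc i) w z) + r w z + s w z))
          ≡⟨ trans (∑-cong (λ w → trans (∑-+ (λ z → ind (Lev (suc i) w z) + r w z) (s w)) (cong (_+ ∑ (s w)) (∑-+ (λ z → ind (Lev (suc i) w z)) (r w))))) (trans (∑-+ (λ w → row (suc i) w + ∑ (r w)) (λ w → ∑ (s w))) (cong (_+ ∑ (λ w → ∑ (s w))) (∑-+ (row (suc i)) (λ w → ∑ (r w))))) ⟩
        total (suc i) + ∑ (λ w → ∑ (r w)) + ∑ (λ w → ∑ (s w)) ≤⟨ +-mono-≤ (+-monoʳ-≤ (total (suc i)) rows) cols ⟩
        total (suc i) + c * count A + c * count B ≡⟨ trans (+-assoc (total (suc i)) _ _) (cong (total (suc i) +_) (sym (*-distribˡ-+ c (count A) (count B)))) ⟩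
        total (suc i) + c * (count A + count B) ∎
        where
        open ≤-Reasoning
        r s : Fin n → Fin n → ℕ
        r w z = keep (c ℕ.≤ᵇ row i w) (ind (Lev i w z))
        s w z = keep (c ℕ.≤ᵇ col i z) (ind (Lev i w z))
        rows : ∑ (λ w → ∑ (r w)) ≤ c * count A
        rows = ≤-trans (∑-mono (λ w → ≤-trans (≤-reflexive (keep-∑ (c ℕ.≤ᵇ row i w) (λ z → ind (Lev i w z)))) (bound (Lev i w) (A w) (λ z h → inA (lev-E₀ i h))))) (≤-reflexive (∑-* c (ind ∘ A)))
        cols : ∑ (λ w → ∑ (s w)) ≤ c * count B
        cols = ≤-trans (≤-reflexive (∑-swap s)) (≤-trans (∑-mono (λ z → ≤-trans (≤-reflexive (keep-∑ (c ℕ.≤ᵇ col i z) (λ w → ind (Lev i w z)))) (bound (λ w → Lev i w z) (B z) (λ w h → inB (lev-E₀ i h))))) (≤-reflexive (∑-* c (ind ∘ B))))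

      losses : ∀ i → total 0 ≤ total i + i * (c * (count A + count B))
      losses zero = m≤m+n _ 0
      losses (suc i) = ≤-trans (losses i) (≤-trans (+-monoˡ-≤ (i * (c * (count A + count B))) (loss i)) (≤-reflexive (+-assoc (total (suc i)) _ _)))

      few : ∀ i → (∀ w z → Lev i w z ≡ true → ⊥) → total 0 ≤ i * (c * (count A + count B))
      few i none = ≤-trans (losses i) (≤-reflexive (cong (_+ i * (c * (count A + count B))) (∑-zero (λ w → ∑-zero (λ z → cong ind (empty w z))))))
        where
        empty : ∀ w z → Lev i w z ≡ false
        empty w z with bool-cases (Lev i w z)
        ... | inj₁ h = ⊥-elim (none w z h)
        ... | inj₂ h = h

    Head : ℕ → Fin n → Set
    Head i w = Σ (Fin n) λ z → Lev i w z ≡ true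

    record Step (i : ℕ) (w : Fin n) (F : List (Fin n)) : Set where
      field
        z w′ : Fin n
        lev-w : Lev (suc i) w z ≡ true
        lev-w′ : Lev i w′ z ≡ true
        z-new : All (z ≢_) F
        w′-new : All (w′ ≢_) (z ∷ F)

    step : ∀ i w F → Head (suc (suc i)) w → suc (suc (length F)) ≤ c → Step i w F
    step i w F (z₀ , h₀) len =
      let (z , lz , z∉) = pick (Lev (suc i) w) F (≤-trans (≤-trans (n≤1+n _) len) (lev-row (suc i) h₀))
          (w′ , lw , w′∉) = pick (λ w → Lev i w z) (z ∷ F) (≤-trans len (lev-col i lz))
      in record { z = z ; w′ = w′ ; lev-w = lz ; lev-w′ = lw ; z-new = z∉ ; w′-new = w′∉ }

    Avoids : List (Fin n) → Fin n → Set
    Avoids F v = All (v ≢_) F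

    module Grow (Ok : Fin n → Set) (ok-w : ∀ {w z} → E₀ w z ≡ true → Ok w) (ok-z : ∀ {w z} → E₀ w z ≡ true → Ok z) where
      record Grown (i ℓ : ℕ) (b : Fin n) (F : List (Fin n)) : Set where
        field
          w : Fin n
          vs : List (Fin n)
          head : Head i w
          path : Path w b ℓ vs
          ok : All Ok vs
          avoids : All (Avoids F) vs

      -- Each round spends two levels, one to choose z and one to choose w′, both outside `F` and
      -- the path so far; the bound by c says that there are always enough candidates.
      grow : ∀ j i F {w b ℓ vs} → Head (dbl j i) w → Path w b ℓ vs → All Ok vs → All (Avoids F) vs → length F + dbl j (length vs) ≤ c → Grown i (dbl j ℓ) b F
      grow zero i F {w} {b} {ℓ} {vs} hd p ok av _ = record { w = w ; vs = vs ; head = hd ; path = p ; ok = ok ; avoids = av }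
      grow (suc j) i F {w} {b} {ℓ} {vs} hd p ok av len = subst (λ ℓ → Grown i ℓ b F) (trans (dbl-suc j (suc ℓ)) (cong suc (dbl-suc j ℓ)))
          (grow j i F (z , lev-w′) (cons (E₀⊆ ew′) (cons (E-sym (E₀⊆ ew)) p z∉vs) w′∉zvs) (ok-w ew′ ∷ ok-z ew ∷ ok) (Allₚ.++⁻ˡ F (All.tail w′-new) ∷ Allₚ.++⁻ˡ F z-new ∷ av)
            (≤-trans (≤-reflexive (cong (length F +_) (trans (dbl-suc j (suc (length vs))) (cong suc (dbl-suc j (length vs)))))) len))
        where
        lenF : suc (suc (length (F ++ vs))) ≤ c
        lenF = ≤-trans (≤-trans (≤-reflexive (trans (cong (suc ∘ suc) (length-++ F)) (sym (trans (+-suc (length F) (suc (length vs))) (cong suc (+-suc (length F) (length vs))))))) (+-monoʳ-≤ (length F) (s≤s (s≤s (dbl≥ j (length vs)))))) len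
        open Step (step (dbl j i) w (F ++ vs) hd lenF)
        ew : E₀ w z ≡ true
        ew = lev-E₀ (suc (dbl j i)) lev-w
        ew′ : E₀ w′ z ≡ true
        ew′ = lev-E₀ (dbl j i) lev-w′
        z∉vs : All (z ≢_) vs
        z∉vs = Allₚ.++⁻ʳ F z-new
        w′∉zvs : All (w′ ≢_) (z ∷ vs)
        w′∉zvs = All.head w′-new ∷ Allₚ.++⁻ʳ F (All.tail w′-new)

    lev-≤ : ∀ {i j} → i ≤ j → ∀ {w z} → Lev j w z ≡ true → Lev i w z ≡ true
    lev-≤ {i} {j} h with m≤n⇒m<n∨m≡n h
    ... | inj₂ refl = λ e → e
    lev-≤ {i} {suc j} h | inj₁ (s≤s i≤j) = λ e → lev-≤ i≤j (proj₁ (∧-true e))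

    heavy-rows : ∀ (W : Fin n → Bool) h → (∀ w → W w ≡ true → h ≤ row 0 w) → h * count W ≤ total 0
    heavy-rows W h rows = ≤-trans (≤-reflexive (sym (∑-* h (ind ∘ W)))) (∑-mono each)
      where
      each : ∀ w → h * ind (W w) ≤ row 0 w
      each w with W w in e
      ... | true = ≤-trans (≤-reflexive (*-identityʳ h)) (rows w e)
      ... | false = ≤-trans (≤-reflexive (*-zeroʳ h)) z≤n

    -- If level i is empty, there are at most i c · 2n edges, while each w in `W` has at least g (i
    -- + 1) · 2c. Writing i + 1 keeps the cancelled factor positive for i = 0.
    sparse : ∀ (W Z : Fin n → Bool) → (∀ {w z} → E₀ w z ≡ true → W w ≡ true) → (∀ {w z} → E₀ w z ≡ true → Z z ≡ true) → 1 ≤ c → ∀ g i →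
             (∀ w → W w ≡ true → g * (suc i * (c * 2)) ≤ row 0 w) → (∀ w z → Lev i w z ≡ true → ⊥) → g * count W ≤ n
    sparse W Z inW inZ 1≤c g i rows none = *-cancelˡ-≤ K {{ℕ.>-nonZero (*-mono-≤ {1} {suc i} (s≤s z≤n) (*-mono-≤ {1} {c} {1} {2} 1≤c (s≤s z≤n)))}} (begin
        K * (g * count W) ≡⟨ trans (sym (*-assoc K g (count W))) (cong (_* count W) (*-comm K g)) ⟩
        g * K * count W ≤⟨ heavy-rows W (g * K) rows ⟩
        total 0 ≤⟨ Loss.few W Z inW inZ i none ⟩
        i * (c * (count W + count Z)) ≤⟨ *-mono-≤ (n≤1+n i) (*-monoʳ-≤ c (+-mono-≤ (count≤n W) (count≤n Z))) ⟩
        suc i * (c * (n + n)) ≡⟨ cong (λ z → suc i * (c * z)) (trans (cong (n +_) (sym (+-identityʳ n))) refl) ⟩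
        suc i * (c * (2 * n)) ≡⟨ trans (cong (suc i *_) (sym (*-assoc c 2 n))) (sym (*-assoc (suc i) (c * 2) n)) ⟩
        K * n ∎)
      where
      open ≤-Reasoning
      K : ℕ
      K = suc i * (c * 2)

-- Local consequences of the forbidden odd cycle

module Structure where

  open FinSum
  open Graphs
  open Levels
  open import Defs hiding (sym; irrefl)
  open import Data.Nat as ℕ using (ℕ; zero; suc; _+_; _*_; _^_; _≤_; _<_; z≤n; s≤s)
  open import Data.Nat.Properties
  open import Data.Bool using (Bool; true; false; _∧_; not)
  open import Data.Fin as Fin using (Fin; toℕ)
  import Data.Fin.Properties as Finₚ
  open import Data.List as List using (List; []; _∷_; length; map)
  open import Data.List.Relation.Unary.All as All using (All; []; _∷_)
  open import Data.List.Relation.Unary.AllPairs using ([]; _∷_)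
  open import Data.List.Relation.Unary.Unique.Propositional using (Unique)
  open import Function using (_∘_)
  open import Relation.Binary.Definitions using (tri<; tri≈; tri>)

  open import Data.List.Properties using (length-take)
  import Data.List.Relation.Unary.All.Properties as Allₚ
  import Data.List.Relation.Unary.AllPairs.Properties as AllPairsₚ
  import Data.Bool.Properties as Boolₚ

  module StructureOf {n : ℕ} (G : Graph n) (k′ t : ℕ) (1≤k′ : 1 ≤ k′) (noC : ¬ ContainsCycle (2 * suc k′) G) (noK : ¬ ContainsInducedK2t t G) where
    open PathsIn G

    k c C : ℕ
    k = suc k′
    -- Covers the 2k + 1 vertices of the forbidden cycle and a few more to be avoided, so that
    -- greedy choices never fail.
    c = 2 * k + 4
    C = 2 ^ (2 * k + t)

    d : Fin n → ℕ
    d u = count (a u)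

    cod : Fin n → Fin n → ℕ
    cod u w = count (λ x → a u x ∧ a w x)

    no-cycle : ∀ {u w ℓ vs} → ℓ ≡ dbl k 0 → Path u w ℓ vs → E w u → ⊥
    no-cycle refl p e = noC (subst (λ m → ContainsCycle m G) (trans (dbl≡ k 0) (+-identityʳ (2 * k))) (cycle p e))

    c≥ : ∀ j i → dbl j i ≤ dbl k 4 → dbl j i ≤ c
    c≥ j i h = ≤-trans h (≤-reflexive (dbl≡ k 4))

    all-≢ : ∀ {P : Fin n → Set} {x vs} → All P vs → ¬ P x → All (x ≢_) vs
    all-≢ ps ¬px = All.map (λ p e → ¬px (subst _ (sym e) p)) ps

    -- A path with 2k vertices inside the neighbourhood of x closes to a C_(2k+1) through x. So
    -- level 2k of the edges inside that neighbourhood is empty and `Loss.few` applies.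
    triangles : ∀ x → ∑ (λ w → ∑ (λ z → ind (a x w ∧ (a x z ∧ a w z)))) ≤ dbl k′ 2 * (c * (d x + d x))
    triangles x = Loss.few (a x) (a x) (λ h → proj₁ (∧-true h)) (λ {w} h → proj₁ (∧-true (proj₂ (∧-true {a x w} h)))) (dbl k′ 2) none
      where
      E₀ : Fin n → Fin n → Bool
      E₀ w z = a x w ∧ (a x z ∧ a w z)
      open LevelsIn G E₀ (λ {w} {z} h → proj₂ (∧-true {a x z} (proj₂ (∧-true {a x w} h)))) c
      okw : ∀ {w z} → E₀ w z ≡ true → E x w
      okw h = proj₁ (∧-true h)
      okz : ∀ {w z} → E₀ w z ≡ true → E x z
      okz {w} h = proj₁ (∧-true (proj₂ (∧-true {a x w} h)))
      open Grow (E x) okw okz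
      none : ∀ w z → Lev (dbl k′ 2) w z ≡ true → ⊥
      none w z h = finish (grow k′ 2 [] {w} (z , h) [ w ] (okw (lev-E₀ (dbl k′ 2) h) ∷ []) ([] ∷ []) (c≥ k′ 1 (≤-trans (≤-trans (≤-reflexive (dbl-suc k′ 0)) (n≤1+n _)) (≤-trans (m≤m+n (dbl k 0) 4) (≤-reflexive (sym (dbl-+ k 0 4)))))))
        where
        finish : Grown 2 (dbl k′ 0) w [] → ⊥
        finish gr = let (z₁ , l₁) = Grown.head gr
                        len : suc (length (Grown.vs gr)) ≤ c
                        len = ≤-trans (≤-reflexive (cong suc (path-length (Grown.path gr)))) (c≥ k 0 (≤-trans (m≤m+n (dbl k 0) 4) (≤-reflexive (sym (dbl-+ k 0 4)))))
                        (z₂ , l₂ , z₂∉) = pick (Lev 1 (Grown.w gr)) (Grown.vs gr) (≤-trans len (lev-row 1 l₁))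
                        e₂ = lev-E₀ 1 l₂
                    in no-cycle refl (cons (okz e₂) (cons (E-sym (proj₂ (∧-true {a x z₂} (proj₂ (∧-true {a x (Grown.w gr)} e₂))))) (Grown.path gr) z₂∉) (all-≢ (okz e₂ ∷ Grown.ok gr) (λ e → E-irrefl e refl))) (E-sym (okw (lev-E₀ (dbl k′ 2) h)))

    codegree≤ : ∀ u w → u ≢ w → a u w ≡ false → cod u w ≤ C
    codegree≤ u w u≢w uw with C ≤? cod u w
    ... | no h = <⇒≤ (≰⇒> h)
    ... | yes h = ⊥-elim (case (ramsey (2 * k) t M.list (λ x → E u x × E w x) M.unique (All.map (λ {x} e → ∧-true {a u x} e) M.sound) (≤-trans h (≤-reflexive (sym M.len)))))
      where
      module M = Members (members (λ x → a u x ∧ a w x))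
      case : Homogeneous Clique (2 * k) (λ x → E u x × E w x) ⊎ Homogeneous Independent t (λ x → E u x × E w x) → ⊥
      case (inj₂ H) = noK (induced-K t u w u≢w uw H)
      case (inj₁ record { vs = y ∷ ys ; size = size ; pairs = pairs ; all = all }) = let (v , p) = clique-path y ys pairs
          in no-cycle (trans size (sym (trans (dbl≡ k 0) (+-identityʳ (2 * k))))) (cons (proj₁ (All.head all)) p (all-≢ (All.map proj₁ all) (λ e → E-irrefl e refl))) (E-sym (proj₁ (All.lookup all (last-∈ p))))

    CommonEdge : Fin n → Fin n → Fin n → Fin n → Set
    CommonEdge u w x y = (E u x × E w x) × (E u y × E w y) × E x y × toℕ x < toℕ y

    common-edge? : ∀ u w → Dec (Σ (Fin n) λ x → Σ (Fin n) λ y → CommonEdge u w x y)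
    common-edge? u w = Finₚ.any? (λ x → Finₚ.any? (λ y → ((a u x Boolₚ.≟ true) ×-dec (a w x Boolₚ.≟ true)) ×-dec (((a u y Boolₚ.≟ true) ×-dec (a w y Boolₚ.≟ true)) ×-dec ((a x y Boolₚ.≟ true) ×-dec (toℕ x ℕ.<? toℕ y)))))
      where open import Relation.Nullary.Decidable using (_×-dec_)

    -- Otherwise t of the common neighbours would be pairwise nonadjacent and form an induced
    -- K_(2,t) with u and w.
    common-edge : ∀ u w → u ≢ w → a u w ≡ false → t ≤ cod u w → Σ (Fin n) λ x → Σ (Fin n) λ y → CommonEdge u w x y
    common-edge u w u≢w uw t≤ with common-edge? u w
    ... | yes e = e
    ... | no none = ⊥-elim (noK (induced-K t u w u≢w uw (record { vs = List.take t M.list ; size = trans (length-take t M.list) (m≤n⇒m⊓n≡m (≤-trans t≤ (≤-reflexive (sym M.len)))) ; pairs = AllPairsₚ.take⁺ t (independent M.unique nbrs) ; all = Allₚ.take⁺ t nbrs })))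
      where
      module M = Members (members (λ x → a u x ∧ a w x))
      nbrs : All (λ x → E u x × E w x) M.list
      nbrs = All.map (λ {x} e → ∧-true {a u x} e) M.sound
      non-adj : ∀ {x y} → x ≢ y → E u x × E w x → E u y × E w y → a x y ≡ false
      non-adj {x} {y} x≢y ex ey with bool-cases (a x y)
      ... | inj₂ e = e
      ... | inj₁ e with <-cmp (toℕ x) (toℕ y)
      ...   | tri< lt _ _ = ⊥-elim (none (x , y , ex , ey , e , lt))
      ...   | tri≈ _ eq _ = ⊥-elim (x≢y (Finₚ.toℕ-injective eq))
      ...   | tri> _ _ gt = ⊥-elim (none (y , x , ey , ex , E-sym e , gt))
      independent : ∀ {xs} → Unique xs → All (λ x → E u x × E w x) xs → Independent xs
      independent [] [] = []
      independent (x∉ ∷ u) (p ∷ ps) = All.zipWith (λ (ne , q) → ne , non-adj ne p q) (x∉ , ps) ∷ independent u ps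

    -- A chosen edge in the common neighbourhood, with its ends in increasing order so that
    -- different pairs are different edges. The pair w , w is a default where there is no such edge.
    colour : Fin n → Fin n → Fin n × Fin n
    colour u w with common-edge? u w
    ... | yes (x , y , _) = x , y
    ... | no _ = w , w

    colour-edge : ∀ u w → u ≢ w → a u w ≡ false → t ≤ cod u w → CommonEdge u w (proj₁ (colour u w)) (proj₂ (colour u w))
    colour-edge u w u≢w uw t≤ with common-edge? u w
    ... | yes (_ , _ , e) = e
    ... | no none = ⊥-elim (none (common-edge u w u≢w uw t≤))

    Ob : Fin n → Fin n → Bool
    Ob u z = not (a u z) ∧ not (does (z Fin.≟ u))

    Ob-ok : ∀ u {z} → Ob u z ≡ true → (a u z ≡ false) × (z ≢ u)
    Ob-ok u {z} h = not-true (proj₁ (∧-true h)) , ne (z Fin.≟ u) (not-true (proj₂ (∧-true {not (a u z)} h)))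
      where
      ne : ∀ {P : Set} (D : Dec P) → does D ≡ false → ¬ P
      ne (no ¬p) _ = ¬p

    -- The bound δ on the degree lets paths be grown from w; the vertices of smaller degree are
    -- accounted for in `low-total`.
    Excess : ℕ → Fin n → Fin n → Bool
    Excess δ u w = Ob u w ∧ ((t ℕ.≤ᵇ cod u w) ∧ (δ ℕ.≤ᵇ d w))

    excess-ok : ∀ δ u {w} → Excess δ u w ≡ true → ((a u w ≡ false) × (w ≢ u)) × (t ≤ cod u w) × (δ ≤ d w)
    excess-ok δ u {w} h = let (o , r) = ∧-true {Ob u w} h ; (p , q) = ∧-true {t ℕ.≤ᵇ cod u w} r in Ob-ok u o , ≤ᵇ-true p , ≤ᵇ-true q

    survivors : ∀ u w → a u w ≡ false → d w ≤ count (λ z → Ob u z ∧ a w z) + cod u w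
    survivors u w uw = ≤-trans (∑-mono each) (≤-reflexive (∑-+ (λ z → ind (Ob u z ∧ a w z)) (λ z → ind (a u z ∧ a w z))))
      where
      cases : ∀ x y (D : Dec (x ≡ y)) p q → (x ≡ y → q ≡ false) → ind q ≤ ind ((not p ∧ not (does D)) ∧ q) + ind (p ∧ q)
      cases x y D p false _ = z≤n
      cases x y (yes e) false true h = ⊥-elim (t≢f refl (h e))
      cases x y (no _) false true _ = ≤-refl
      cases x y D true true _ = ≤-refl
      each : ∀ z → ind (a w z) ≤ ind (Ob u z ∧ a w z) + ind (a u z ∧ a w z)
      each z = cases z u (z Fin.≟ u) (a u z) (a w z) (λ { refl → trans (a-sym w u) uw })

    module LongCycles (k″ : ℕ) (k≡ : k′ ≡ suc (suc k″)) (u : Fin n) (δ : ℕ) where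
      W : Fin n → Bool
      W = Excess δ u

      E₀ : Fin n → Fin n → Bool
      E₀ w z = W w ∧ (Ob u z ∧ a w z)

      open LevelsIn G E₀ (λ {w} {z} h → proj₂ (∧-true {Ob u z} (proj₂ (∧-true {W w} h)))) c

      Ok : Fin n → Set
      Ok v = (a u v ≡ false) × (v ≢ u)

      E₀-W : ∀ {w z} → E₀ w z ≡ true → W w ≡ true
      E₀-W h = proj₁ (∧-true h)

      E₀-Z : ∀ {w z} → E₀ w z ≡ true → Ob u z ≡ true
      E₀-Z {w} {z} h = proj₁ (∧-true {Ob u z} (proj₂ (∧-true {W w} h)))

      E₀-E : ∀ {w z} → E₀ w z ≡ true → E w z
      E₀-E {w} {z} h = proj₂ (∧-true {Ob u z} (proj₂ (∧-true {W w} h)))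

      ok-w : ∀ {w z} → E₀ w z ≡ true → Ok w
      ok-w h = proj₁ (excess-ok δ u (E₀-W h))

      ok-z : ∀ {w z} → E₀ w z ≡ true → Ok z
      ok-z h = Ob-ok u (E₀-Z h)

      open Grow Ok ok-w ok-z

      W-edge : ∀ {w} → W w ≡ true → CommonEdge u w (proj₁ (colour u w)) (proj₂ (colour u w))
      W-edge {w} h = let ((uw , ne) , t≤ , _) = excess-ok δ u h in colour-edge u w (ne ∘ sym) uw t≤

      nbr∉ : ∀ {x vs} → E u x → All Ok vs → All (x ≢_) vs
      nbr∉ ux oks = all-≢ oks (λ (e , _) → t≢f ux e)

      i₀ L : ℕ
      i₀ = dbl k″ 0
      L = dbl k′ i₀

      k-dbl : dbl k 0 ≡ suc (suc (suc (suc (suc (dbl k″ 1)))))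
      k-dbl = trans (cong (λ z → dbl (suc z) 0) k≡) (cong (λ z → suc (suc (suc (suc (suc z))))) (sym (dbl-suc k″ 0)))

      -- A vertex z with neighbours of two different colours. The degree bound at level i₀ leaves
      -- room for a third neighbour from which a path can still be grown.
      record Conflict : Set where
        field
          z w w′ : Fin n
          ez : E₀ w z ≡ true
          ez′ : E₀ w′ z ≡ true
          differ : colour u w ≢ colour u w′
          rich : c ≤ col i₀ z

      record Monochromatic (w b : Fin n) (ℓ : ℕ) : Set where
        field
          w′ : Fin n
          vs : List (Fin n)
          path : Path w′ b ℓ vs
          ok : All Ok vs
          W-w′ : W w′ ≡ true
          same : colour u w′ ≡ colour u w

      _≟ₚ_ : (p q : Fin n × Fin n) → Dec (p ≡ q)
      _≟ₚ_ = Data.Product.Properties.≡-dec Fin._≟_ Fin._≟_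
        where import Data.Product.Properties

      -- The path grows two edges at a time until the colour changes for the first time. The levels
      -- below i₀ are left for `conflict-cycle`.
      walk : ∀ j {w b ℓ vs} → Head (dbl j i₀) w → Path w b ℓ vs → All Ok vs → W w ≡ true → dbl j (length vs) ≤ c → Conflict ⊎ Monochromatic w b (dbl j ℓ)
      walk zero {w} {b} {ℓ} {vs} _ p ok Ww _ = inj₂ (record { w′ = w ; vs = vs ; path = p ; ok = ok ; W-w′ = Ww ; same = refl })
      walk (suc j) {w} {b} {ℓ} {vs} hd p ok Ww len with step (dbl j i₀) w vs hd (≤-trans (s≤s (s≤s (dbl≥ j (length vs)))) len)
      ... | record { z = z ; w′ = w′ ; lev-w = lw ; lev-w′ = lw′ ; z-new = z∉ ; w′-new = w′∉ } with colour u w ≟ₚ colour u w′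
      ...   | no ne = inj₁ (record { z = z ; w = w ; w′ = w′ ; ez = lev-E₀ (suc (dbl j i₀)) lw ; ez′ = lev-E₀ (dbl j i₀) lw′ ; differ = ne
                ; rich = ≤-trans (lev-col (dbl j i₀) lw) (∑-mono {n} {λ v → ind (Lev (dbl j i₀) v z)} {λ v → ind (Lev i₀ v z)} (λ v → mono (lev-≤ (dbl≥ j i₀) {v} {z}))) })
        where
        mono : ∀ {p q} → (p ≡ true → q ≡ true) → ind p ≤ ind q
        mono {false} _ = z≤n
        mono {true} h = ≤-reflexive (sym (cong ind (h refl)))
      ...   | yes eq = recolour (walk j (z , lw′) (cons (E₀-E e′) (cons (E-sym (E₀-E e)) p z∉) w′∉) (ok-w e′ ∷ ok-z e ∷ ok) (E₀-W e′) (≤-trans (≤-reflexive (trans (dbl-suc j _) (cong suc (dbl-suc j _)))) len))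
        where
        e : E₀ w z ≡ true
        e = lev-E₀ (suc (dbl j i₀)) lw
        e′ : E₀ w′ z ≡ true
        e′ = lev-E₀ (dbl j i₀) lw′
        recolour : Conflict ⊎ Monochromatic w′ b (dbl j (suc (suc ℓ))) → Conflict ⊎ Monochromatic w b (suc (suc (dbl j ℓ)))
        recolour (inj₁ conflict) = inj₁ conflict
        recolour (inj₂ m) = inj₂ (record { w′ = M.w′ ; vs = M.vs ; path = subst (λ ℓ → Path M.w′ b ℓ M.vs) (trans (dbl-suc j (suc ℓ)) (cong suc (dbl-suc j ℓ))) M.path ; ok = M.ok ; W-w′ = M.W-w′ ; same = trans M.same (sym eq) })
          where module M = Monochromatic m

      -- The path from w′ to w has 2k - 1 vertices, and the edge xy of the common colour closes it
      -- by w, y, x, w′. Both x and y are neighbours of u, whereas the path avoids the neighbourhood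
      -- of u.
      monochromatic-cycle : ∀ {w} → W w ≡ true → Monochromatic w w (dbl k′ 0) → ⊥
      monochromatic-cycle {w} Ww m = no-cycle refl (cons (E-sym (proj₁ (proj₂ (proj₂ ew)))) (cons (E-sym (subst (λ q → E M.w′ (proj₁ q)) M.same (proj₂ (proj₁ ew′)))) M.path x∉) ((λ e → E-irrefl (proj₁ (proj₂ (proj₂ ew))) (sym e)) ∷ nbr∉ (proj₁ (proj₁ (proj₂ ew))) M.ok)) (proj₂ (proj₁ (proj₂ ew)))
        where
        module M = Monochromatic m
        ew = W-edge Ww
        ew′ = W-edge M.W-w′
        x∉ = nbr∉ (proj₁ (proj₁ ew)) M.ok

      -- The ends are in increasing order, so unequal pairs are unequal as sets and some end of the
      -- first edge is not on the second.
      new-end : ∀ {x₀ y₀ x₁ y₁ w₀ w₁} → CommonEdge u w₀ x₀ y₀ → CommonEdge u w₁ x₁ y₁ → (x₀ , y₀) ≢ (x₁ , y₁) → Σ (Fin n) λ x → (E u x × E w₀ x) × (x ≢ x₁) × (x ≢ y₁)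
      new-end {x₀} {y₀} {x₁} {y₁} (px , py , _ , lt₀) (_ , _ , _ , lt₁) ne with x₀ Fin.≟ x₁ | x₀ Fin.≟ y₁ | y₀ Fin.≟ x₁ | y₀ Fin.≟ y₁
      ... | no p | no q | _ | _ = x₀ , px , p , q
      ... | _ | _ | no p | no q = y₀ , py , p , q
      ... | yes refl | _ | _ | yes refl = ⊥-elim (ne refl)
      ... | yes refl | _ | yes refl | _ = ⊥-elim (<-irrefl refl lt₀)
      ... | _ | yes refl | _ | yes refl = ⊥-elim (<-irrefl refl lt₀)
      ... | _ | yes refl | yes refl | _ = ⊥-elim (<-asym lt₀ lt₁)

      -- A path with 2k - 4 vertices is grown from z to some w₀ outside w and w′. One of these two,
      -- called w*, has another colour x₁y₁ than w₀, so w₀ has a neighbour x in its own colour off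
      -- x₁y₁. The cycle is w*, y₁, x₁, u, x, w₀ and back to z; for k ≥ 3 the path has at least the
      -- two vertices z and w₀.
      conflict-cycle : Conflict → ⊥
      conflict-cycle K = close (grow k″ 0 F {w₁} {z} {1} (z , l₁) (cons (E₀-E e₁) [ z ] (E-irrefl (E₀-E e₁) ∷ [])) (ok-w e₁ ∷ ok-z ez ∷ []) ((All.head w₁∉ ∷ All.head (All.tail w₁∉) ∷ []) ∷ ((λ e → E-irrefl (E₀-E ez) (sym e)) ∷ (λ e → E-irrefl (E₀-E ez′) (sym e)) ∷ []) ∷ []) len)
        where
        open Conflict K
        F : List (Fin n)
        F = w ∷ w′ ∷ []
        k≤c : dbl k 0 ≤ c
        k≤c = c≥ k 0 (≤-trans (m≤m+n (dbl k 0) 4) (≤-reflexive (sym (dbl-+ k 0 4))))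
        len : 2 + dbl k″ 2 ≤ c
        len = ≤-trans (≤-trans (≤-reflexive (cong (suc ∘ suc) (dbl-suc k″ 1))) (≤-trans (m≤n+m _ 2) (≤-reflexive (sym k-dbl)))) k≤c
        3≤c : 3 ≤ c
        3≤c = ≤-trans (m≤m+n 3 1) (m≤n+m 4 (2 * k))
        picked = pick (λ w → Lev i₀ w z) F (≤-trans 3≤c rich)
        w₁ : Fin n
        w₁ = proj₁ picked
        l₁ : Lev i₀ w₁ z ≡ true
        l₁ = proj₁ (proj₂ picked)
        w₁∉ : All (w₁ ≢_) F
        w₁∉ = proj₂ (proj₂ picked)
        e₁ : E₀ w₁ z ≡ true
        e₁ = lev-E₀ i₀ l₁
        finish : ∀ w* (gr : Grown 0 (dbl k″ 1) z F) → E₀ w* z ≡ true → All (w* ≢_) (Grown.vs gr) → colour u (Grown.w gr) ≢ colour u w* → ⊥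
        finish w* gr e* w*∉ ne = no-cycle (sym k-dbl)
            (cons (proj₂ (proj₁ (proj₂ ew))) (cons (E-sym (proj₁ (proj₂ (proj₂ ew)))) (cons (E-sym ux₁) (cons (proj₁ (proj₁ (proj₂ nx))) (cons (E-sym (proj₂ (proj₁ (proj₂ nx)))) path x∉) (E-irrefl (proj₁ (proj₁ (proj₂ nx))) ∷ all-≢ ok (λ (_ , ne) → ne refl)))
              ((λ e → E-irrefl ux₁ (sym e)) ∷ (λ e → proj₁ (proj₂ (proj₂ nx)) (sym e)) ∷ nbr∉ ux₁ ok))
              ((λ e → E-irrefl (proj₁ (proj₂ (proj₂ ew))) (sym e)) ∷ (λ e → E-irrefl uy₁ (sym e)) ∷ (λ e → proj₂ (proj₂ (proj₂ nx)) (sym e)) ∷ nbr∉ uy₁ ok))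
              (far uy₁ ∷ far ux₁ ∷ (proj₂ ok*) ∷ far (proj₁ (proj₁ (proj₂ nx))) ∷ w*∉)) (E-sym (E₀-E e*))
          where
          open Grown gr renaming (w to w₀)
          ok* : Ok w*
          ok* = ok-w e*
          ew = W-edge (E₀-W e*)
          ux₁ : E u (proj₁ (colour u w*))
          ux₁ = proj₁ (proj₁ ew)
          uy₁ : E u (proj₂ (colour u w*))
          uy₁ = proj₁ (proj₁ (proj₂ ew))
          nx = new-end (W-edge (E₀-W (proj₂ head))) ew ne
          x∉ = nbr∉ (proj₁ (proj₁ (proj₂ nx))) ok
          far : ∀ {y} → E u y → w* ≢ y
          far uy refl = t≢f uy (proj₁ ok*)
        close : Grown 0 (dbl k″ 1) z F → ⊥
        close gr with colour u (Grown.w gr) ≟ₚ colour u w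
        ... | no ne = finish w gr ez (All.map (λ { (p ∷ _) e → p (sym e) }) (Grown.avoids gr)) ne
        ... | yes eq = finish w′ gr ez′ (All.map (λ { (_ ∷ p ∷ _) e → p (sym e) }) (Grown.avoids gr)) (λ e → differ (trans (sym eq) e))

      no-level : ∀ w z → Lev L w z ≡ true → ⊥
      no-level w z h = finish (walk k′ (z , h) [ w ] (ok-w e ∷ []) (E₀-W e) (≤-trans (≤-trans (≤-reflexive (dbl-suc k′ 0)) (≤-trans (n≤1+n _) (m≤m+n (dbl k 0) 4))) (≤-reflexive (trans (sym (dbl-+ k 0 4)) (dbl≡ k 4)))))
        where
        e : E₀ w z ≡ true
        e = lev-E₀ L h
        finish : Conflict ⊎ Monochromatic w w (dbl k′ 0) → ⊥
        finish (inj₁ K) = conflict-cycle K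
        finish (inj₂ m) = monochromatic-cycle (E₀-W e) m

      few-excess : ∀ g → C + g * (suc L * (c * 2)) ≤ δ → g * count W ≤ n
      few-excess g δ≥ = sparse W (Ob u) E₀-W E₀-Z (≤-trans (s≤s z≤n) (m≤n+m 4 (2 * k))) g L rows no-level
        where
        rows : ∀ w → W w ≡ true → g * (suc L * (c * 2)) ≤ row 0 w
        rows w Ww = let ((uw , ne) , _ , δ≤) = excess-ok δ u Ww in
          +-cancelˡ-≤ C _ _ (≤-trans δ≥ (≤-trans δ≤ (≤-trans (survivors u w uw) (≤-trans (+-mono-≤ (≤-reflexive (∑-cong (λ z → cong (λ b → ind (b ∧ (Ob u z ∧ a w z))) (sym Ww)))) (codegree≤ u w (ne ∘ sym) uw)) (≤-reflexive (+-comm _ C))))))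

    -- The cycle is u, x, y, w, z with xy an edge of common neighbours and z a further common
    -- neighbour, which exists because t ≥ 3.
    no-excess-C₅ : k′ ≡ 1 → 3 ≤ t → ∀ δ u w → Excess δ u w ≡ true → ⊥
    no-excess-C₅ refl 3≤t δ u w h = no-cycle refl (cons ux (cons xy (cons (E-sym wy) (cons wz [ z ] (E-irrefl wz ∷ [])) ((λ e → E-irrefl wy (sym e)) ∷ (λ e → z≢y (sym e)) ∷ []))
        (E-irrefl xy ∷ (λ e → E-irrefl wx (sym e)) ∷ (λ e → z≢x (sym e)) ∷ [])) (E-irrefl ux ∷ E-irrefl uy ∷ (λ e → ne (sym e)) ∷ E-irrefl uz ∷ [])) (E-sym uz)
      where
      ok = excess-ok δ u h
      uw : a u w ≡ false
      uw = proj₁ (proj₁ ok)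
      ne : w ≢ u
      ne = proj₂ (proj₁ ok)
      edge = common-edge u w (ne ∘ sym) uw (proj₁ (proj₂ ok))
      x y : Fin n
      x = proj₁ edge
      y = proj₁ (proj₂ edge)
      ce = proj₂ (proj₂ edge)
      ux = proj₁ (proj₁ ce)
      wx = proj₂ (proj₁ ce)
      uy = proj₁ (proj₁ (proj₂ ce))
      wy = proj₂ (proj₁ (proj₂ ce))
      xy = proj₁ (proj₂ (proj₂ ce))
      third = pick (λ v → a u v ∧ a w v) (x ∷ y ∷ []) (≤-trans 3≤t (proj₁ (proj₂ ok)))
      z : Fin n
      z = proj₁ third
      uz : E u z
      uz = proj₁ (∧-true (proj₁ (proj₂ third)))
      wz : E w z
      wz = proj₂ (∧-true {a u z} (proj₁ (proj₂ third)))
      z≢x : z ≢ x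
      z≢x = All.head (proj₂ (proj₂ third))
      z≢y : z ≢ y
      z≢y = All.head (All.tail (proj₂ (proj₂ third)))

    com : Fin n → Fin n → Fin n → ℕ
    com u v w = count (λ p → a u p ∧ (a v p ∧ a w p))

    Ob₂ : Fin n → Fin n → Fin n → Bool
    Ob₂ u v z = not (a u z) ∧ not (a v z)

    -- The last condition leaves out the w that u and v reach through one and the same middle
    -- vertex; those come from triangles on uv and are counted in `2X≤`.
    Both : ℕ → Fin n → Fin n → Fin n → Bool
    Both δ u v w = Ob₂ u v w ∧ ((1 ℕ.≤ᵇ cod u w) ∧ ((1 ℕ.≤ᵇ cod v w) ∧ ((δ ℕ.≤ᵇ d w) ∧ not (1 ℕ.≤ᵇ com u v w))))

    module Edges (j : ℕ) (k≡ : k′ ≡ suc j) (u v : Fin n) (uv : E u v) (δ : ℕ) where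
      W : Fin n → Bool
      W = Both δ u v

      E₀ : Fin n → Fin n → Bool
      E₀ w z = W w ∧ (Ob₂ u v z ∧ a w z)

      open LevelsIn G E₀ (λ {w} {z} h → proj₂ (∧-true {Ob₂ u v z} (proj₂ (∧-true {W w} h)))) c

      Ok : Fin n → Set
      Ok z = (a u z ≡ false) × (a v z ≡ false)

      Ob₂-ok : ∀ {z} → Ob₂ u v z ≡ true → Ok z
      Ob₂-ok {z} h = not-true (proj₁ (∧-true h)) , not-true (proj₂ (∧-true {not (a u z)} h))

      E₀-W : ∀ {w z} → E₀ w z ≡ true → W w ≡ true
      E₀-W h = proj₁ (∧-true h)

      E₀-Z : ∀ {w z} → E₀ w z ≡ true → Ob₂ u v z ≡ true
      E₀-Z {w} {z} h = proj₁ (∧-true {Ob₂ u v z} (proj₂ (∧-true {W w} h)))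

      W-ok : ∀ {w} → W w ≡ true → Ok w × (1 ≤ cod u w) × (1 ≤ cod v w) × (δ ≤ d w) × ¬ (1 ≤ com u v w)
      W-ok {w} h = let (o , r) = ∧-true {Ob₂ u v w} h ; (p , r′) = ∧-true {1 ℕ.≤ᵇ cod u w} r ; (q , r″) = ∧-true {1 ℕ.≤ᵇ cod v w} r′ ; (s , m) = ∧-true {δ ℕ.≤ᵇ d w} r″
        in Ob₂-ok o , ≤ᵇ-true p , ≤ᵇ-true q , ≤ᵇ-true s , λ b → t≢f (≤ᵇ-intro b) (not-true m)

      open Grow Ok (λ h → proj₁ (W-ok (E₀-W h))) (λ h → Ob₂-ok (E₀-Z h))

      -- A path with 2k - 3 vertices from w₀ to w is closed by w, y, v, u, x, w₀. Here x ≠ y, as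
      -- otherwise x would be adjacent to u, v and w₀, against `com` being 0 at w₀.
      no-level : ∀ w z → Lev (dbl j 0) w z ≡ true → ⊥
      no-level w z h = finish (grow j 0 [] {w} (z , h) [ w ] (proj₁ (W-ok Ww) ∷ []) ([] ∷ []) len)
        where
        Ww : W w ≡ true
        Ww = E₀-W (lev-E₀ (dbl j 0) h)
        len : dbl j 1 ≤ c
        len = ≤-trans (≤-trans (≤-reflexive (dbl-suc j 0)) (≤-trans (n≤1+n _) (≤-reflexive (cong (λ z → dbl z 0) (sym k≡))))) (≤-trans (≤-trans (n≤1+n _) (n≤1+n _)) (≤-trans (≤-reflexive (trans (dbl≡ k 0) (+-identityʳ (2 * k)))) (m≤m+n (2 * k) 4)))
        finish : Grown 0 (dbl j 0) w [] → ⊥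
        finish gr = no-cycle (cong (λ z → dbl (suc z) 0) (sym k≡)) (cons (E-sym vy) (cons (E-sym uv) (cons ux (cons (E-sym w₀x) path (all-≢ ok (λ (p , _) → t≢f ux p)))
              (E-irrefl ux ∷ all-≢ ok (λ (_ , q) → t≢f (E-sym uv) q)))
              ((λ e → E-irrefl uv (sym e)) ∷ (λ e → t≢f w₀x (trans (a-sym w₀ x) (trans (cong (λ b → a b w₀) (sym e)) (proj₂ ok₀)))) ∷ all-≢ ok (λ (p , _) → t≢f uv p)))
              ((λ e → E-irrefl vy (sym e)) ∷ (λ e → t≢f wy (trans (a-sym w y) (trans (cong (λ b → a b w) e) (proj₁ (proj₁ (W-ok Ww)))))) ∷ y≢x ∷ all-≢ ok (λ (_ , q) → t≢f vy q))) wy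
          where
          open Grown gr renaming (w to w₀)
          W₀ = W-ok (E₀-W (proj₂ head))
          ok₀ : Ok w₀
          ok₀ = proj₁ W₀
          ex = exists (λ x → a u x ∧ a w₀ x) (proj₁ (proj₂ W₀))
          ey = exists (λ y → a v y ∧ a w y) (proj₁ (proj₂ (proj₂ (W-ok Ww))))
          x y : Fin n
          x = proj₁ ex
          y = proj₁ ey
          ux : E u x
          ux = proj₁ (∧-true (proj₂ ex))
          w₀x : E w₀ x
          w₀x = proj₂ (∧-true {a u x} (proj₂ ex))
          vy : E v y
          vy = proj₁ (∧-true (proj₂ ey))
          wy : E w y
          wy = proj₂ (∧-true {a v y} (proj₂ ey))
          y≢x : y ≢ x
          y≢x e = proj₂ (proj₂ (proj₂ (proj₂ W₀))) (≤-trans (≤-reflexive (sym (cong ind (∧-intro ux (∧-intro (subst (E v) e vy) w₀x))))) (∑-member (λ p → ind (a u p ∧ (a v p ∧ a w₀ p))) x))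

      few-both : ∀ g → C + C + g * (suc (dbl j 0) * (c * 2)) ≤ δ → g * count W ≤ n
      few-both g δ≥ = sparse W (Ob₂ u v) E₀-W E₀-Z (≤-trans (s≤s z≤n) (m≤n+m 4 (2 * k))) g (dbl j 0) rows no-level
        where
        cases : ∀ p q r → ind r ≤ ind ((not p ∧ not q) ∧ r) + ind (p ∧ r) + ind (q ∧ r)
        cases p q false = z≤n
        cases false false true = ≤-refl
        cases false true true = ≤-refl
        cases true q true = s≤s z≤n
        rows : ∀ w → W w ≡ true → g * (suc (dbl j 0) * (c * 2)) ≤ row 0 w
        rows w Ww = +-cancelˡ-≤ (C + C) _ _ (≤-trans δ≥ (≤-trans δ≤ (≤-trans (∑-mono (λ z → cases (a u z) (a v z) (a w z))) (≤-trans (≤-reflexive (trans (∑-+ (λ z → ind (Ob₂ u v z ∧ a w z) + ind (a u z ∧ a w z)) (λ z → ind (a v z ∧ a w z))) (cong (_+ cod v w) (∑-+ (λ z → ind (Ob₂ u v z ∧ a w z)) (λ z → ind (a u z ∧ a w z))))))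
            (≤-trans (+-mono-≤ (+-mono-≤ (≤-reflexive (∑-cong (λ z → cong (λ b → ind (b ∧ (Ob₂ u v z ∧ a w z))) (sym Ww)))) (codegree≤ u w u≢w uw)) (codegree≤ v w v≢w vw)) (≤-reflexive (trans (+-assoc (row 0 w) C C) (+-comm (row 0 w) (C + C))))))))) 
          where
          r = W-ok Ww
          uw = proj₁ (proj₁ r)
          vw = proj₂ (proj₁ r)
          δ≤ = proj₁ (proj₂ (proj₂ (proj₂ r)))
          u≢w : u ≢ w
          u≢w refl = t≢f (E-sym uv) vw
          v≢w : v ≢ w
          v≢w refl = t≢f uv uw

-- Counting walks of length three

module CountingWalks where

  open FinSum
  open Graphs
  open Levels
  open Structure
  open import Defs hiding (sym; irrefl)
  open import Data.Nat as ℕ using (ℕ; zero; suc; _+_; _*_; _≤_; z≤n; s≤s)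
  open import Data.Nat.Properties
  open import Data.Nat.Solver using (module +-*-Solver)
  open import Data.Bool using (Bool; true; false; _∧_; not)
  open import Data.Fin as Fin using (Fin)
  open import Function using (_∘_)

  -- Wedges u - x - w mostly end at a vertex w not adjacent to u, with at most Λ
  -- middle vertices each; and for an edge uv the sets of such endpoints S(u) and
  -- S(v) are almost disjoint.  Hence the number of 3-walks is at most about Λ e n.
  module CountIn {n : ℕ} (G : Graph n) (k′ Λ : ℕ) (1≤k′ : 1 ≤ k′) (noC : ¬ ContainsCycle (2 * suc k′) G) (noK : ¬ ContainsInducedK2t (suc Λ) G)
    (δ g : ℕ) (few-Excess : ∀ u → g * count (StructureOf.Excess G k′ (suc Λ) 1≤k′ noC noK δ u) ≤ n)
    (few-Both : ∀ u v → adj G u v ≡ true → g * count (StructureOf.Both G k′ (suc Λ) 1≤k′ noC noK δ u v) ≤ n) where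
    open PathsIn G
    open StructureOf G k′ (suc Λ) 1≤k′ noC noK

    e : Fin n → Fin n → ℕ
    e u v = ind (a u v)

    e-sym : ∀ u v → e u v ≡ e v u
    e-sym u v = cong ind (a-sym u v)

    c₁ C′ : ℕ
    c₁ = dbl k′ 2 * (c * 2)
    C′ = C + c₁ + 1

    cod-e : ∀ u w → cod u w ≡ ∑ (λ x → e u x * e w x)
    cod-e u w = ∑-cong (λ x → ind-∧ (a u x) (a w x))

    cod≤d : ∀ u w → cod u w ≤ d u
    cod≤d u w = ∑-mono (λ x → le (a u x) (a w x))
      where
      le : ∀ p q → ind (p ∧ q) ≤ ind p
      le true q = ind≤1 q
      le false q = z≤n

    wedges : Fin n → ℕ
    wedges u = ∑ (λ x → e u x * d x)

    wedges-cod : ∀ u → ∑ (cod u) ≡ wedges u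
    wedges-cod u = trans (∑-cong (cod-e u)) (trans (∑-swap (λ w x → e u x * e w x)) (∑-cong (λ x → trans (∑-* (e u x) (λ w → e w x)) (cong (e u x *_) (∑-cong (λ w → e-sym w x))))))

    Tri : Fin n → ℕ
    Tri x = ∑ (λ w → ∑ (λ z → ind (a x w ∧ (a x z ∧ a w z))))

    Tri≤ : ∀ x → Tri x ≤ c₁ * d x
    Tri≤ x = ≤-trans (triangles x) (≤-reflexive (alg (dbl k′ 2) c (d x)))
      where
      open +-*-Solver
      alg : ∀ i c d → i * (c * (d + d)) ≡ i * (c * 2) * d
      alg = solve 3 (λ i c d → i :* (c :* (d :+ d)) := i :* (c :* con 2) :* d) refl

    Tri-cod : ∀ x → ∑ (λ w → e x w * cod x w) ≡ Tri x
    Tri-cod x = ∑-cong (λ w → trans (sym (∑-* (e x w) (λ z → ind (a x z ∧ a w z)))) (∑-cong (λ z → sym (ind-∧ (a x w) (a x z ∧ a w z)))))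

    diagonal : ∀ u → ∑ (λ w → ind (does (w Fin.≟ u)) * cod u w) ≤ d u
    diagonal u = ≤-trans (∑-mono (λ w → *-monoʳ-≤ (ind (does (w Fin.≟ u))) (cod≤d u w))) (≤-reflexive (trans (∑-*ʳ (λ w → ind (does (w Fin.≟ u))) (d u)) (trans (cong (_* d u) (count-≟ u)) (*-identityˡ (d u)))))

    -- The codegrees of u sum to O(n): a nonadjacent w contributes at most C, the adjacent ones the
    -- triangles at u, and w = u its degree.
    wedges≤ : ∀ u → wedges u ≤ n * C′
    wedges≤ u = begin
      wedges u ≡⟨ sym (wedges-cod u) ⟩
      ∑ (cod u) ≤⟨ ∑-mono (λ w → each w (w Fin.≟ u) (a u w) refl) ⟩
      ∑ (λ w → C + e u w * cod u w + ind (does (w Fin.≟ u)) * cod u w) ≡⟨ trans (∑-+ (λ w → C + e u w * cod u w) (λ w → ind (does (w Fin.≟ u)) * cod u w)) (cong (_+ ∑ (λ w → ind (does (w Fin.≟ u)) * cod u w)) (trans (∑-+ (λ _ → C) (λ w → e u w * cod u w)) (cong₂ _+_ (∑-const n C) (Tri-cod u)))) ⟩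
      n * C + Tri u + ∑ (λ w → ind (does (w Fin.≟ u)) * cod u w) ≤⟨ +-mono-≤ (+-monoʳ-≤ (n * C) (≤-trans (Tri≤ u) (≤-trans (*-monoʳ-≤ c₁ (count≤n (a u))) (≤-reflexive (*-comm c₁ n))))) (≤-trans (diagonal u) (≤-trans (count≤n (a u)) (≤-reflexive (sym (*-identityʳ n))))) ⟩
      n * C + n * c₁ + n * 1 ≡⟨ trans (cong (_+ n * 1) (sym (*-distribˡ-+ n C c₁))) (sym (*-distribˡ-+ n (C + c₁) 1)) ⟩
      n * C′ ∎
      where
      open ≤-Reasoning
      each : ∀ w (D : Dec (w ≡ u)) b → a u w ≡ b → cod u w ≤ C + ind b * cod u w + ind (does D) * cod u w
      each w (yes _) b _ = ≤-trans (≤-reflexive (sym (*-identityˡ (cod u w)))) (m≤n+m _ (C + ind b * cod u w))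
      each w (no _) true _ = ≤-trans (≤-reflexive (sym (*-identityˡ (cod u w)))) (≤-trans (m≤n+m _ C) (m≤m+n _ 0))
      each w (no ne) false eq = ≤-trans (codegree≤ u w (ne ∘ sym) eq) (≤-trans (m≤m+n C 0) (m≤m+n _ 0))

    D² : ℕ
    D² = ∑ (λ u → d u * d u)

    D²≤ : D² ≤ n * (n * C′)
    D²≤ = ≤-trans (≤-reflexive (trans (∑-cong (λ u → sym (∑-*ʳ (e u) (d u)))) (trans (∑-swap (λ u x → e u x * d u)) (∑-cong (λ x → ∑-cong (λ u → cong (_* d u) (e-sym u x))))))) (≤-trans (∑-mono wedges≤) (≤-reflexive (∑-const n (n * C′))))

    sᵇ : Fin n → Fin n → Bool
    sᵇ u w = Ob u w ∧ ((1 ℕ.≤ᵇ cod u w) ∧ (δ ℕ.≤ᵇ d w))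

    low : Fin n → ℕ
    low w = ind (not (δ ℕ.≤ᵇ d w))

    -- `W₃` counts walks of length 3 by their middle edge and `E₂` is twice the number of edges. `X`
    -- is the main term of the walks, `Y` belongs to the excess, and `V` to the overlap of endpoint
    -- sets.
    W₃ E₂ X Y V : ℕ
    Sᵤ Wᵤ Lowᵤ : Fin n → ℕ
    Sᵤ u = count (sᵇ u)
    Wᵤ u = count (Excess δ u)
    Lowᵤ u = ∑ (λ w → low w * cod u w)
    W₃ = ∑ (λ u → d u * wedges u)
    E₂ = ∑ d
    X = ∑ (λ u → d u * Sᵤ u)
    Y = ∑ (λ u → d u * Wᵤ u)
    V = ∑ (λ u → ∑ (λ v → e u v * count (Both δ u v)))

    -- Each w lies in one of five classes: a regular endpoint with at most Λ middle vertices, an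
    -- excess vertex with at most C, a neighbour of u, u itself, or a vertex of low degree.
    endpoints : ∀ u → wedges u ≤ Λ * Sᵤ u + C * Wᵤ u + c₁ * d u + d u + Lowᵤ u
    endpoints u = begin
      wedges u ≡⟨ sym (wedges-cod u) ⟩
      ∑ (cod u) ≤⟨ ∑-mono (λ w → each w (w Fin.≟ u) (a u w) (δ ℕ.≤ᵇ d w) refl refl) ⟩
      ∑ (λ w → f₁ w + f₂ w + f₃ w + f₄ w + f₅ w) ≡⟨ trans (∑-+ (λ w → f₁ w + f₂ w + f₃ w + f₄ w) f₅) (cong (_+ ∑ f₅) (trans (∑-+ (λ w → f₁ w + f₂ w + f₃ w) f₄) (cong (_+ ∑ f₄) (trans (∑-+ (λ w → f₁ w + f₂ w) f₃) (cong (_+ ∑ f₃) (∑-+ f₁ f₂)))))) ⟩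
      ∑ f₁ + ∑ f₂ + ∑ f₃ + ∑ f₄ + ∑ f₅ ≤⟨ +-monoˡ-≤ (∑ f₅) (+-mono-≤ (+-mono-≤ (+-mono-≤ (≤-reflexive (∑-* Λ (ind ∘ sᵇ u))) (≤-reflexive (∑-* C (ind ∘ Excess δ u)))) (≤-trans (≤-reflexive (Tri-cod u)) (Tri≤ u))) (diagonal u)) ⟩
      Λ * Sᵤ u + C * Wᵤ u + c₁ * d u + d u + Lowᵤ u ∎
      where
      open ≤-Reasoning
      f₁ f₂ f₃ f₄ f₅ : Fin n → ℕ
      f₁ w = Λ * ind (sᵇ u w)
      f₂ w = C * ind (Excess δ u w)
      f₃ w = e u w * cod u w
      f₄ w = ind (does (w Fin.≟ u)) * cod u w
      f₅ w = low w * cod u w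
      one : ∀ x → x ≤ 1 * x
      one x = ≤-reflexive (sym (*-identityˡ x))
      each : ∀ w (D : Dec (w ≡ u)) b h → a u w ≡ b → (δ ℕ.≤ᵇ d w) ≡ h →
             cod u w ≤ Λ * ind ((not b ∧ not (does D)) ∧ ((1 ℕ.≤ᵇ cod u w) ∧ h)) + C * ind ((not b ∧ not (does D)) ∧ ((suc Λ ℕ.≤ᵇ cod u w) ∧ h)) + ind b * cod u w + ind (does D) * cod u w + ind (not h) * cod u w
      each w D b false _ _ = ≤-trans (one (cod u w)) (m≤n+m (1 * cod u w) (Λ * ind ((not b ∧ not (does D)) ∧ ((1 ℕ.≤ᵇ cod u w) ∧ false)) + C * ind ((not b ∧ not (does D)) ∧ ((suc Λ ℕ.≤ᵇ cod u w) ∧ false)) + ind b * cod u w + ind (does D) * cod u w))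
      each w (yes _) b true _ _ = ≤-trans (one (cod u w)) (≤-trans (m≤n+m (1 * cod u w) (Λ * ind ((not b ∧ false) ∧ ((1 ℕ.≤ᵇ cod u w) ∧ true)) + C * ind ((not b ∧ false) ∧ ((suc Λ ℕ.≤ᵇ cod u w) ∧ true)) + ind b * cod u w)) (m≤m+n _ 0))
      each w (no _) true true _ _ = ≤-trans (one (cod u w)) (≤-trans (m≤n+m (1 * cod u w) (Λ * 0 + C * 0)) (≤-trans (m≤m+n _ 0) (m≤m+n _ 0)))
      each w (no ne) false true eq _ with suc Λ ≤? cod u w | cod u w in ce
      ... | yes big | m = ≤-trans (≤-trans (≤-reflexive (sym ce)) (codegree≤ u w (ne ∘ sym) eq)) (≤-trans (≤-reflexive (sym (trans (cong (λ b → C * ind (b ∧ true)) (≤ᵇ-intro {suc Λ} {m} (subst (suc Λ ≤_) ce big))) (*-identityʳ C))))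
            (≤-trans (m≤n+m _ _) (≤-trans (m≤m+n _ 0) (≤-trans (m≤m+n _ 0) (m≤m+n _ 0)))))
      ... | no small | zero = z≤n
      ... | no small | suc m = ≤-trans (≤-trans (≤-reflexive (sym ce)) (≤-pred (≰⇒> small))) (≤-trans (≤-reflexive (sym (*-identityʳ Λ))) (≤-trans (m≤m+n (Λ * 1) _) (≤-trans (m≤m+n _ 0) (≤-trans (m≤m+n _ 0) (m≤m+n _ 0)))))

    -- For fixed w the sum of d u times the codegree is the sum of `wedges x` over the neighbours x
    -- of w. A low w has fewer than δ of them, each with at most n C′ wedges.
    low-total : ∑ (λ u → d u * Lowᵤ u) ≤ n * (δ * (n * C′))
    low-total = begin
      ∑ (λ u → d u * Lowᵤ u) ≡⟨ trans (∑-cong (λ u → sym (∑-* (d u) (λ w → low w * cod u w)))) (∑-swap (λ u w → d u * (low w * cod u w))) ⟩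
      ∑ (λ w → ∑ (λ u → d u * (low w * cod u w))) ≤⟨ ∑-mono column ⟩
      ∑ {n} (λ _ → δ * (n * C′)) ≡⟨ ∑-const n _ ⟩
      n * (δ * (n * C′)) ∎
      where
      open ≤-Reasoning
      open +-*-Solver
      walks : ∀ w → ∑ (λ u → d u * cod u w) ≤ d w * (n * C′)
      walks w = ≤-trans (≤-reflexive (trans (∑-cong (λ u → trans (cong (d u *_) (cod-e u w)) (sym (∑-* (d u) (λ x → e u x * e w x))))) (trans (∑-swap (λ u x → d u * (e u x * e w x))) (∑-cong (λ x → trans (∑-cong (λ u → trans (solve 3 (λ d e f → d :* (e :* f) := f :* (e :* d)) refl (d u) (e u x) (e w x)) (cong (λ z → e w x * (z * d u)) (e-sym u x)))) (∑-* (e w x) (λ u → e x u * d u)))))))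
          (≤-trans (∑-mono (λ x → *-monoʳ-≤ (e w x) (wedges≤ x))) (≤-reflexive (∑-*ʳ (e w) (n * C′))))
      column : ∀ w → ∑ (λ u → d u * (low w * cod u w)) ≤ δ * (n * C′)
      column w = ≤-trans (≤-reflexive (trans (∑-cong (λ u → solve 3 (λ d l c → d :* (l :* c) := l :* (d :* c)) refl (d u) (low w) (cod u w))) (∑-* (low w) (λ u → d u * cod u w)))) (≤-trans (*-monoʳ-≤ (low w) (walks w)) (cut (δ ℕ.≤ᵇ d w) refl))
        where
        cut : ∀ b → (δ ℕ.≤ᵇ d w) ≡ b → ind (not b) * (d w * (n * C′)) ≤ δ * (n * C′)
        cut true _ = z≤n
        cut false eq = ≤-trans (≤-reflexive (*-identityˡ _)) (*-monoˡ-≤ (n * C′) (<⇒≤ (≰⇒> {δ} {d w} (λ p → t≢f (≤ᵇ-intro p) eq))))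

    W₃≤ : W₃ ≤ Λ * X + C * Y + (c₁ + 1) * D² + n * (δ * (n * C′))
    W₃≤ = begin
      W₃ ≤⟨ ∑-mono (λ u → *-monoʳ-≤ (d u) (endpoints u)) ⟩
      ∑ (λ u → d u * (Λ * Sᵤ u + C * Wᵤ u + c₁ * d u + d u + Lowᵤ u)) ≡⟨ ∑-cong (λ u → solve 7 (λ d l s c w p o → d :* (l :* s :+ c :* w :+ p :* d :+ d :+ o) := l :* (d :* s) :+ c :* (d :* w) :+ (p :+ con 1) :* (d :* d) :+ d :* o) refl (d u) Λ (Sᵤ u) C (Wᵤ u) c₁ (Lowᵤ u)) ⟩
      ∑ (λ u → Λ * (d u * Sᵤ u) + C * (d u * Wᵤ u) + (c₁ + 1) * (d u * d u) + d u * Lowᵤ u)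
        ≡⟨ trans (∑-+ (λ u → Λ * (d u * Sᵤ u) + C * (d u * Wᵤ u) + (c₁ + 1) * (d u * d u)) (λ u → d u * Lowᵤ u)) (cong (_+ ∑ (λ u → d u * Lowᵤ u)) (trans (∑-+ (λ u → Λ * (d u * Sᵤ u) + C * (d u * Wᵤ u)) (λ u → (c₁ + 1) * (d u * d u))) (cong₂ _+_ (trans (∑-+ (λ u → Λ * (d u * Sᵤ u)) (λ u → C * (d u * Wᵤ u))) (cong₂ _+_ (∑-* Λ (λ u → d u * Sᵤ u)) (∑-* C (λ u → d u * Wᵤ u)))) (∑-* (c₁ + 1) (λ u → d u * d u))))) ⟩
      Λ * X + C * Y + (c₁ + 1) * D² + ∑ (λ u → d u * Lowᵤ u) ≤⟨ +-monoʳ-≤ _ low-total ⟩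
      Λ * X + C * Y + (c₁ + 1) * D² + n * (δ * (n * C′)) ∎
      where
      open ≤-Reasoning
      open +-*-Solver

    gY≤ : g * Y ≤ n * E₂
    gY≤ = ≤-trans (≤-reflexive (trans (sym (∑-* g (λ u → d u * Wᵤ u))) (∑-cong (λ u → solve 3 (λ g d w → g :* (d :* w) := d :* (g :* w)) refl g (d u) (Wᵤ u))))) (≤-trans (∑-mono (λ u → *-monoʳ-≤ (d u) (few-Excess u))) (≤-reflexive (trans (∑-*ʳ d n) (*-comm E₂ n))))
      where open +-*-Solver

    gV≤ : g * V ≤ n * E₂
    gV≤ = ≤-trans (≤-reflexive (trans (sym (∑-* g (λ u → ∑ (λ v → e u v * count (Both δ u v))))) (∑-cong (λ u → sym (∑-* g (λ v → e u v * count (Both δ u v))))))) (≤-trans (∑-mono (λ u → ∑-mono (λ v → each u v (a u v) refl))) (≤-reflexive (trans (∑-cong (λ u → ∑-*ʳ (e u) n)) (trans (∑-*ʳ d n) (*-comm E₂ n)))))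
      where
      each : ∀ u v b → a u v ≡ b → g * (ind b * count (Both δ u v)) ≤ ind b * n
      each u v false _ = ≤-reflexive (*-zeroʳ g)
      each u v true eq = ≤-trans (≤-reflexive (cong (g *_) (*-identityˡ _))) (≤-trans (few-Both u v eq) (≤-reflexive (sym (*-identityˡ n))))

    Q : Fin n → Fin n → ℕ
    Q u v = ∑ (λ p → e u p * (e v p * d p))

    -- A vertex counted on both sides lies in `Both` or has `com` at least 1, and the sum of `com`
    -- over all w is `Q`.
    S-overlap : ∀ u v → Sᵤ u + Sᵤ v ≤ n + count (Both δ u v) + Q u v
    S-overlap u v = begin
      Sᵤ u + Sᵤ v ≡⟨ sym (∑-+ (ind ∘ sᵇ u) (ind ∘ sᵇ v)) ⟩
      ∑ (λ w → ind (sᵇ u w) + ind (sᵇ v w)) ≤⟨ ∑-mono each ⟩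
      ∑ (λ w → 1 + ind (Both δ u v w) + com u v w) ≡⟨ trans (∑-+ (λ w → 1 + ind (Both δ u v w)) (com u v)) (cong₂ _+_ (trans (∑-+ (λ _ → 1) (ind ∘ Both δ u v)) (cong (_+ count (Both δ u v)) (trans (∑-const n 1) (*-identityʳ n)))) com-Q) ⟩
      n + count (Both δ u v) + Q u v ∎
      where
      open ≤-Reasoning
      com-Q : ∑ (com u v) ≡ Q u v
      com-Q = trans (∑-cong (λ w → ∑-cong (λ p → trans (ind-∧ (a u p) _) (cong (e u p *_) (ind-∧ (a v p) (a w p)))))) (trans (∑-swap (λ w p → e u p * (e v p * e w p))) (∑-cong (λ p → trans (∑-* (e u p) (λ w → e v p * e w p)) (cong (e u p *_) (trans (∑-* (e v p) (λ w → e w p)) (cong (e v p *_) (∑-cong (λ w → e-sym w p))))))))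
      logic : ∀ au av du dv cu cv h m → (m ≡ false → ind ((not au ∧ not du) ∧ (cu ∧ h)) + ind ((not av ∧ not dv) ∧ (cv ∧ h)) ≤ 1 + ind ((not au ∧ not av) ∧ (cu ∧ (cv ∧ (h ∧ not m)))))
      logic true av du dv cu cv h m _ = ≤-trans (ind≤1 _) (m≤m+n 1 _)
      logic false av true dv cu cv h m _ = ≤-trans (ind≤1 _) (m≤m+n 1 _)
      logic false av false dv false cv h m _ = ≤-trans (ind≤1 _) (m≤m+n 1 _)
      logic false av false dv true cv false m _ = ≤-trans (ind≤1 ((not av ∧ not dv) ∧ (cv ∧ false))) (m≤m+n 1 _)
      logic false true false dv true cv true m _ = s≤s z≤n
      logic false false false true true cv true m _ = s≤s z≤n
      logic false false false false true false true m _ = s≤s z≤n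
      logic false false false false true true true false _ = ≤-refl
      logic false false false false true true true true ()
      each : ∀ w → ind (sᵇ u w) + ind (sᵇ v w) ≤ 1 + ind (Both δ u v w) + com u v w
      each w with bool-cases (1 ℕ.≤ᵇ com u v w)
      ... | inj₂ eq = ≤-trans (logic (a u w) (a v w) (does (w Fin.≟ u)) (does (w Fin.≟ v)) (1 ℕ.≤ᵇ cod u w) (1 ℕ.≤ᵇ cod v w) (δ ℕ.≤ᵇ d w) _ eq) (m≤m+n _ _)
      ... | inj₁ eq = ≤-trans (+-mono-≤ (ind≤1 (sᵇ u w)) (ind≤1 (sᵇ v w))) (+-mono-≤ (m≤m+n 1 (ind (Both δ u v w))) (≤ᵇ-true {1} {com u v w} eq))

    -- `X` is written as a sum over directed edges in two ways, by either end, and `S-overlap` is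
    -- applied to each edge. Summed over all edges, `Q` counts triangles at p with weight d p.
    2X≤ : 2 * X ≤ n * E₂ + V + c₁ * D²
    2X≤ = begin
      2 * X ≡⟨ cong (X +_) (+-identityʳ X) ⟩
      X + X ≡⟨ cong₂ _+_ X₁ X₂ ⟩
      ∑ (λ u → ∑ (λ v → e u v * Sᵤ u)) + ∑ (λ u → ∑ (λ v → e u v * Sᵤ v)) ≡⟨ trans (sym (∑-+ (λ u → ∑ (λ v → e u v * Sᵤ u)) (λ u → ∑ (λ v → e u v * Sᵤ v)))) (∑-cong (λ u → trans (sym (∑-+ (λ v → e u v * Sᵤ u) (λ v → e u v * Sᵤ v))) (∑-cong (λ v → sym (*-distribˡ-+ (e u v) (Sᵤ u) (Sᵤ v)))))) ⟩
      ∑ (λ u → ∑ (λ v → e u v * (Sᵤ u + Sᵤ v))) ≤⟨ ∑-mono (λ u → ∑-mono (λ v → *-monoʳ-≤ (e u v) (S-overlap u v))) ⟩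
      ∑ (λ u → ∑ (λ v → e u v * (n + count (Both δ u v) + Q u v)))
        ≡⟨ trans (∑-cong (λ u → trans (∑-cong (λ v → trans (*-distribˡ-+ (e u v) (n + count (Both δ u v)) (Q u v)) (cong (_+ e u v * Q u v) (*-distribˡ-+ (e u v) n (count (Both δ u v)))))) (trans (∑-+ (λ v → e u v * n + e u v * count (Both δ u v)) (λ v → e u v * Q u v)) (cong (_+ ∑ (λ v → e u v * Q u v)) (trans (∑-+ (λ v → e u v * n) (λ v → e u v * count (Both δ u v))) (cong (_+ ∑ (λ v → e u v * count (Both δ u v))) (∑-*ʳ (e u) n)))))))
           (trans (∑-+ (λ u → d u * n + ∑ (λ v → e u v * count (Both δ u v))) (λ u → ∑ (λ v → e u v * Q u v))) (cong (_+ ∑ (λ u → ∑ (λ v → e u v * Q u v))) (trans (∑-+ (λ u → d u * n) (λ u → ∑ (λ v → e u v * count (Both δ u v)))) (cong (_+ V) (trans (∑-*ʳ d n) (*-comm E₂ n)))))) ⟩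
      n * E₂ + V + ∑ (λ u → ∑ (λ v → e u v * Q u v)) ≤⟨ +-monoʳ-≤ (n * E₂ + V) U≤ ⟩
      n * E₂ + V + c₁ * D² ∎
      where
      open ≤-Reasoning
      open +-*-Solver
      X₁ : X ≡ ∑ (λ u → ∑ (λ v → e u v * Sᵤ u))
      X₁ = ∑-cong (λ u → sym (∑-*ʳ (e u) (Sᵤ u)))
      X₂ : X ≡ ∑ (λ u → ∑ (λ v → e u v * Sᵤ v))
      X₂ = trans X₁ (trans (∑-swap (λ u v → e u v * Sᵤ u)) (∑-cong (λ v → ∑-cong (λ u → cong (_* Sᵤ u) (e-sym u v)))))
      U≤ : ∑ (λ u → ∑ (λ v → e u v * Q u v)) ≤ c₁ * D²
      U≤ = ≤-trans (≤-reflexive (trans (∑-cong (λ u → trans (∑-cong (λ v → sym (∑-* (e u v) (λ p → e u p * (e v p * d p))))) (∑-swap (λ v p → e u v * (e u p * (e v p * d p)))))) (trans (∑-swap (λ u p → ∑ (λ v → e u v * (e u p * (e v p * d p))))) (∑-cong col))))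
          (≤-trans (∑-mono (λ p → *-monoˡ-≤ (d p) (Tri≤ p))) (≤-reflexive (trans (∑-cong (λ p → *-assoc c₁ (d p) (d p))) (∑-* c₁ (λ p → d p * d p)))))
        where
        col : ∀ p → ∑ (λ u → ∑ (λ v → e u v * (e u p * (e v p * d p)))) ≡ Tri p * d p
        col p = trans (∑-cong (λ u → trans (∑-cong (λ v → trans (cong₂ (λ x y → e u v * (x * (y * d p))) (e-sym u p) (e-sym v p)) (trans (solve 4 (λ x y z w → x :* (y :* (z :* w)) := (y :* (z :* x)) :* w) refl (e u v) (e p u) (e p v) (d p)) (cong (_* d p) (sym (trans (ind-∧ (a p u) _) (cong (e p u *_) (ind-∧ (a p v) (a u v))))))))) (∑-*ʳ (λ v → ind (a p u ∧ (a p v ∧ a u v))) (d p)))) (∑-*ʳ (λ u → ∑ (λ v → ind (a p u ∧ (a p v ∧ a u v)))) (d p))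

    K₁ : ℕ
    K₁ = Λ * (c₁ * C′) + 2 * ((c₁ + 1) * C′) + 2 * (δ * C′)

    three-walks : 2 * g * W₃ ≤ n * E₂ * (Λ * (g + 1) + 2 * C) + g * (n * n * K₁)
    three-walks = begin
      2 * g * W₃ ≤⟨ *-monoʳ-≤ (2 * g) W₃≤ ⟩
      2 * g * (Λ * X + C * Y + (c₁ + 1) * D² + n * (δ * (n * C′))) ≡⟨ solve 8 (λ g l x c y p q r → con 2 :* g :* (l :* x :+ c :* y :+ p :* q :+ r) := l :* (g :* (con 2 :* x)) :+ con 2 :* c :* (g :* y) :+ g :* (con 2 :* (p :* q)) :+ g :* (con 2 :* r)) refl g Λ X C Y (c₁ + 1) D² (n * (δ * (n * C′))) ⟩
      Λ * (g * (2 * X)) + 2 * C * (g * Y) + g * (2 * ((c₁ + 1) * D²)) + g * (2 * (n * (δ * (n * C′))))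
        ≤⟨ +-monoˡ-≤ _ (+-mono-≤ (+-mono-≤ (*-monoʳ-≤ Λ (*-monoʳ-≤ g 2X≤)) (*-monoʳ-≤ (2 * C) gY≤)) (*-monoʳ-≤ g (*-monoʳ-≤ 2 (*-monoʳ-≤ (c₁ + 1) D²≤)))) ⟩
      Λ * (g * (n * E₂ + V + c₁ * D²)) + 2 * C * (n * E₂) + g * (2 * ((c₁ + 1) * (n * (n * C′)))) + g * (2 * (n * (δ * (n * C′))))
        ≡⟨ cong (λ z → Λ * z + 2 * C * (n * E₂) + g * (2 * ((c₁ + 1) * (n * (n * C′)))) + g * (2 * (n * (δ * (n * C′))))) (solve 4 (λ g m v w → g :* (m :+ v :+ w) := g :* m :+ g :* v :+ g :* w) refl g (n * E₂) V (c₁ * D²)) ⟩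
      Λ * (g * (n * E₂) + g * V + g * (c₁ * D²)) + 2 * C * (n * E₂) + g * (2 * ((c₁ + 1) * (n * (n * C′)))) + g * (2 * (n * (δ * (n * C′))))
        ≤⟨ +-monoˡ-≤ _ (+-monoˡ-≤ _ (+-monoˡ-≤ _ (*-monoʳ-≤ Λ (+-mono-≤ (+-monoʳ-≤ (g * (n * E₂)) gV≤) (*-monoʳ-≤ g (*-monoʳ-≤ c₁ D²≤)))))) ⟩
      Λ * (g * (n * E₂) + n * E₂ + g * (c₁ * (n * (n * C′)))) + 2 * C * (n * E₂) + g * (2 * ((c₁ + 1) * (n * (n * C′)))) + g * (2 * (n * (δ * (n * C′))))
        ≡⟨ solve 8 (λ l g m c n p C δ → l :* (g :* m :+ m :+ g :* (p :* (n :* (n :* C)))) :+ con 2 :* c :* m :+ g :* (con 2 :* ((p :+ con 1) :* (n :* (n :* C)))) :+ g :* (con 2 :* (n :* (δ :* (n :* C))))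
             := m :* (l :* (g :+ con 1) :+ con 2 :* c) :+ g :* (n :* n :* (l :* (p :* C) :+ con 2 :* ((p :+ con 1) :* C) :+ con 2 :* (δ :* C)))) refl Λ g (n * E₂) C n c₁ C′ δ ⟩
      n * E₂ * (Λ * (g + 1) + 2 * C) + g * (n * n * K₁) ∎
      where
      open ≤-Reasoning
      open +-*-Solver

-- Hölder's inequality and the upper bound

module UpperBound where

  open FinSum
  open Graphs
  open Levels
  open Structure
  open CountingWalks
  open Tower using (∣!)
  open import Defs hiding (sym; irrefl)
  open import Data.Nat as ℕ using (ℕ; zero; suc; _+_; _*_; _∸_; _^_; _!; _≤_; z≤n; s≤s)
  open import Data.Nat.Properties
  open import Data.Nat.DivMod using (m/n*n≤m; m/n*n≡m)
  import Data.Nat.Divisibility as Div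
  open import Data.Nat.Solver using (module +-*-Solver)
  open import Data.Bool using (true; false)
  open import Data.Fin using (Fin)

  quo : ℕ → ℕ → ℕ
  quo a zero = 0
  quo a (suc b) = a ℕ./ suc b

  module _ where
    open +-*-Solver

    both-above : ∀ E s t → 3 * (E * E) * ((E + s) * (E + t)) ≤ (E + s) * (E + s) * ((E + t) * (E + t)) + E * E * E * ((E + s) + (E + t))
    both-above E s t = ≤-trans (m≤m+n _ (E * E * (s * s + s * t + t * t) + 2 * E * s * t * (s + t) + s * s * (t * t))) (≤-reflexive
      (solve 3 (λ E s t → con 3 :* (E :* E) :* ((E :+ s) :* (E :+ t)) :+ (E :* E :* (s :* s :+ s :* t :+ t :* t) :+ con 2 :* E :* s :* t :* (s :+ t) :+ s :* s :* (t :* t))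
         := (E :+ s) :* (E :+ s) :* ((E :+ t) :* (E :+ t)) :+ E :* E :* E :* ((E :+ s) :+ (E :+ t))) refl E s t))

    2pq : ∀ p q → 2 * (p * q) ≤ p * p + q * q
    2pq p q with ≤-total p q
    ... | inj₁ h with m≤n⇒∃[o]m+o≡n h
    ... | r , refl = ≤-trans (m≤m+n _ (r * r)) (≤-reflexive (solve 2 (λ p r → con 2 :* (p :* (p :+ r)) :+ r :* r := p :* p :+ (p :+ r) :* (p :+ r)) refl p r))
    2pq p q | inj₂ h with m≤n⇒∃[o]m+o≡n h
    ... | r , refl = ≤-trans (m≤m+n _ (r * r)) (≤-reflexive (solve 2 (λ q r → con 2 :* ((q :+ r) :* q) :+ r :* r := (q :+ r) :* (q :+ r) :+ q :* q) refl q r))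

    separated : ∀ y τ s → let E = y + τ ; x = E + s in 3 * (E * E) * (x * y) ≤ x * x * (y * y) + E * E * E * (x + y)
    separated y τ s = +-cancelʳ-≤ (p * p + q * q) _ _ (≤-trans (m≤m+n _ (E * E * (s * τ))) (≤-trans (≤-reflexive
      (solve 3 (λ y τ s → let E = y :+ τ ; x = E :+ s ; p = y :* s ; q = τ :* (y :+ τ) in
          con 3 :* (E :* E) :* (x :* y) :+ (p :* p :+ q :* q) :+ E :* E :* (s :* τ) := x :* x :* (y :* y) :+ E :* E :* E :* (x :+ y) :+ con 2 :* (p :* q)) refl y τ s))
      (+-monoʳ-≤ (x * x * (y * y) + E * E * E * (x + y)) (2pq p q))))
      where
      E x p q : ℕ
      E = y + τ
      x = E + s
      p = y * s
      q = τ * (y + τ)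

    both-below : ∀ x r τ → let y = x + r ; E = x + r + τ in 3 * (E * E) * (x * y) ≤ x * x * (y * y) + E * E * E * (x + y)
    both-below x r τ = ≤-trans (m≤m+n _ (x * x * (σ * σ + σ * τ + τ * τ) + 2 * x * (σ * σ * σ) + σ * σ * σ * r)) (≤-reflexive
      (solve 3 (λ x r τ → let y = x :+ r ; E = x :+ r :+ τ ; σ = r :+ τ in
        con 3 :* (E :* E) :* (x :* y) :+ (x :* x :* (σ :* σ :+ σ :* τ :+ τ :* τ) :+ con 2 :* x :* (σ :* σ :* σ) :+ σ :* σ :* σ :* r) := x :* x :* (y :* y) :+ E :* E :* E :* (x :+ y)) refl x r τ))
      where
      σ : ℕ
      σ = r + τ

    -- AM-GM for x² y², E³ x and E³ y, whose product is (E² x y)³. Roots are avoided by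
    -- distinguishing the order of x, y and E.
    amgm : ∀ E x y → 3 * (E * E) * (x * y) ≤ x * x * (y * y) + E * E * E * (x + y)
    amgm E x y = go (≤-total E x) (≤-total E y)
      where
      swapped : ∀ {x y} → 3 * (E * E) * (x * y) ≤ x * x * (y * y) + E * E * E * (x + y) → 3 * (E * E) * (y * x) ≤ y * y * (x * x) + E * E * E * (y + x)
      swapped {x} {y} h = ≤-trans (≤-reflexive (cong (3 * (E * E) *_) (*-comm y x))) (≤-trans h (≤-reflexive (cong₂ (λ p q → p + E * E * E * q) (*-comm (x * x) (y * y)) (+-comm x y))))
      apart : ∀ {x y} → E ≤ x → y ≤ E → 3 * (E * E) * (x * y) ≤ x * x * (y * y) + E * E * E * (x + y)
      apart {x} {y} Ex yE with m≤n⇒∃[o]m+o≡n yE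
      ... | τ , refl with m≤n⇒∃[o]m+o≡n Ex
      ... | s , refl = separated y τ s
      below : ∀ {x y} → x ≤ y → y ≤ E → 3 * (E * E) * (x * y) ≤ x * x * (y * y) + E * E * E * (x + y)
      below {x} xy yE with m≤n⇒∃[o]m+o≡n xy
      ... | r , refl with m≤n⇒∃[o]m+o≡n yE
      ... | τ , refl = both-below x r τ
      go : (E ≤ x) ⊎ (x ≤ E) → (E ≤ y) ⊎ (y ≤ E) → 3 * (E * E) * (x * y) ≤ x * x * (y * y) + E * E * E * (x + y)
      go (inj₁ p) (inj₁ q) with m≤n⇒∃[o]m+o≡n p | m≤n⇒∃[o]m+o≡n q
      ... | s , refl | t , refl = both-above E s t
      go (inj₁ p) (inj₂ q) = apart p q
      go (inj₂ p) (inj₁ q) = swapped {y} {x} (apart q p)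
      go (inj₂ p) (inj₂ q) with ≤-total x y
      ... | inj₁ h = below h q
      ... | inj₂ h = swapped {y} {x} (below h p)

  quo-≤ : ∀ a d → d * quo a d ≤ a
  quo-≤ a zero = z≤n
  quo-≤ a (suc d) = ≤-trans (≤-reflexive (*-comm (suc d) _)) (m/n*n≤m a (suc d))

  quo-∣ : ∀ a {d} → 1 ≤ d → d Div.∣ a → d * quo a d ≡ a
  quo-∣ a {suc d} _ h = trans (*-comm (suc d) _) (m/n*n≡m h)

  -- With i(u) = n!/d(u) the sum over all directed edges of i(u) is at most n · n!,
  -- so that summing AM-GM for n d(u), n d(v) and E over the edges gives the claim.
  module Walks {n : ℕ} (G : Graph n) where
    open PathsIn G using (a; a-sym)
    d : Fin n → ℕ
    d u = count (a u)
    E W : ℕ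
    E = ∑ d
    W = ∑ (λ u → d u * ∑ (λ x → ind (a u x) * d x))

    K : ℕ
    K = n !

    i : Fin n → ℕ
    i u = quo K (d u)

    -- `amgm` at n d(u) and n d(v), multiplied by i(u) i(v), where d(u) i(u) = d(v) i(v) = n!.
    edge : 1 ≤ n → ∀ u v b → a u v ≡ b → ind b * (3 * (E * E) * (n * K)) ≤ ind b * (n * n * n * K * (d u * d v) + E * E * E * (i u + i v))
    edge 1≤n u v false _ = z≤n
    edge 1≤n u v true uv = *-monoʳ-≤ 1 (*-cancelˡ-≤ (n * K) {{ℕ.>-nonZero (*-mono-≤ 1≤n (1≤n! n))}} (begin
      n * K * (3 * (E * E) * (n * K)) ≡⟨ cong₂ (λ p q → n * p * (3 * (E * E) * (n * q))) (sym K₁) (sym K₂) ⟩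
      n * (x * y) * (3 * (E * E) * (n * (z * w))) ≡⟨ solve 6 (λ n E x y z w → n :* (x :* y) :* (con 3 :* (E :* E) :* (n :* (z :* w))) := y :* w :* (con 3 :* (E :* E) :* (n :* x :* (n :* z)))) refl n E x y z w ⟩
      y * w * (3 * (E * E) * (n * x * (n * z))) ≤⟨ *-monoʳ-≤ (y * w) (amgm E (n * x) (n * z)) ⟩
      y * w * (n * x * (n * x) * (n * z * (n * z)) + E * E * E * (n * x + n * z)) ≡⟨ solve 6 (λ n E x y z w → y :* w :* (n :* x :* (n :* x) :* (n :* z :* (n :* z)) :+ E :* E :* E :* (n :* x :+ n :* z)) :=
         n :* (x :* y) :* (n :* n :* n :* (z :* w) :* (x :* z)) :+ n :* E :* E :* E :* ((x :* y) :* w :+ (z :* w) :* y)) refl n E x y z w ⟩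
      n * (x * y) * (n * n * n * (z * w) * (x * z)) + n * E * E * E * ((x * y) * w + (z * w) * y) ≡⟨ cong₂ (λ p q → n * p * (n * n * n * q * (x * z)) + n * E * E * E * (p * w + q * y)) K₁ K₂ ⟩
      n * K * (n * n * n * K * (x * z)) + n * E * E * E * (K * w + K * y) ≡⟨ solve 6 (λ n E K r y w → n :* K :* (n :* n :* n :* K :* r) :+ n :* E :* E :* E :* (K :* w :+ K :* y) := n :* K :* (n :* n :* n :* K :* r :+ E :* E :* E :* (y :+ w))) refl n E K (x * z) y w ⟩
      n * K * (n * n * n * K * (x * z) + E * E * E * (y + w)) ∎))
      where
      open ≤-Reasoning
      open +-*-Solver
      x y z w : ℕ
      x = d u
      y = i u
      z = d v
      w = i v
      1≤d : ∀ {u v} → a u v ≡ true → 1 ≤ d u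
      1≤d {u} {v} h = ≤-trans (≤-reflexive (sym (cong ind h))) (∑-member (λ x → ind (a u x)) v)
      K₁ : x * y ≡ K
      K₁ = quo-∣ K (1≤d {u} {v} uv) (∣! (1≤d {u} {v} uv) (count≤n (a u)))
      K₂ : z * w ≡ K
      K₂ = quo-∣ K (1≤d {v} {u} (trans (a-sym v u) uv)) (∣! (1≤d {v} {u} (trans (a-sym v u) uv)) (count≤n (a v)))

    three-walks≥ : E * E * E ≤ n * n * W
    three-walks≥ with n ℕ.≟ 0
    ... | yes refl = z≤n
    ... | no n≢0 = *-cancelˡ-≤ (n * K) {{ℕ.>-nonZero (*-mono-≤ 1≤n (1≤n! n))}} (+-cancelʳ-≤ (E * E * E * (n * K + n * K)) _ _ (begin
      n * K * (E * E * E) + E * E * E * (n * K + n * K) ≡⟨ solve 2 (λ E r → r :* (E :* E :* E) :+ E :* E :* E :* (r :+ r) := E :* (con 3 :* (E :* E) :* r)) refl E (n * K) ⟩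
      E * (3 * (E * E) * (n * K)) ≡⟨ sym (trans (∑-cong (λ u → ∑-*ʳ (e u) _)) (∑-*ʳ d _)) ⟩
      ∑ (λ u → ∑ (λ v → e u v * (3 * (E * E) * (n * K)))) ≤⟨ ∑-mono (λ u → ∑-mono (λ v → edge 1≤n u v (a u v) refl)) ⟩
      ∑ (λ u → ∑ (λ v → e u v * (n * n * n * K * (d u * d v) + E * E * E * (i u + i v)))) ≡⟨ ∑-cong (λ u → trans (∑-cong (λ v → terms u v)) (trans (∑-+ (λ v → n * n * n * K * (d u * (e u v * d v))) (λ v → E * E * E * (e u v * i u + e u v * i v))) (cong₂ _+_ (trans (∑-* (n * n * n * K) (λ v → d u * (e u v * d v))) (cong (n * n * n * K *_) (∑-* (d u) (λ v → e u v * d v)))) (trans (∑-* (E * E * E) (λ v → e u v * i u + e u v * i v)) (cong (E * E * E *_) (∑-+ (λ v → e u v * i u) (λ v → e u v * i v))))))) ⟩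
      ∑ (λ u → n * n * n * K * (d u * ∑ (λ v → e u v * d v)) + E * E * E * (∑ (λ v → e u v * i u) + ∑ (λ v → e u v * i v)))
        ≡⟨ trans (∑-+ (λ u → n * n * n * K * (d u * ∑ (λ v → e u v * d v))) (λ u → E * E * E * (∑ (λ v → e u v * i u) + ∑ (λ v → e u v * i v)))) (cong₂ _+_ (∑-* (n * n * n * K) (λ u → d u * ∑ (λ v → e u v * d v))) (trans (∑-* (E * E * E) (λ u → ∑ (λ v → e u v * i u) + ∑ (λ v → e u v * i v))) (cong (E * E * E *_) (∑-+ (λ u → ∑ (λ v → e u v * i u)) (λ u → ∑ (λ v → e u v * i v)))))) ⟩
      n * n * n * K * W + E * E * E * (∑ (λ u → ∑ (λ v → e u v * i u)) + ∑ (λ u → ∑ (λ v → e u v * i v))) ≤⟨ +-monoʳ-≤ (n * n * n * K * W) (*-monoʳ-≤ (E * E * E) (+-mono-≤ inverses (≤-trans (≤-reflexive (trans (∑-swap (λ u v → e u v * i v)) (∑-cong (λ v → ∑-cong (λ u → cong (λ b → ind b * i v) (a-sym u v)))))) inverses))) ⟩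
      n * n * n * K * W + E * E * E * (n * K + n * K) ≡⟨ cong (_+ E * E * E * (n * K + n * K)) (solve 3 (λ n K W → n :* n :* n :* K :* W := n :* K :* (n :* n :* W)) refl n K W) ⟩
      n * K * (n * n * W) + E * E * E * (n * K + n * K) ∎))
      where
      open ≤-Reasoning
      open +-*-Solver
      1≤n : 1 ≤ n
      1≤n = n≢0⇒n>0 n≢0
      e : Fin n → Fin n → ℕ
      e u v = ind (a u v)
      terms : ∀ u v → e u v * (n * n * n * K * (d u * d v) + E * E * E * (i u + i v)) ≡ n * n * n * K * (d u * (e u v * d v)) + E * E * E * (e u v * i u + e u v * i v)
      terms u v = solve 7 (λ e r x y s p q → e :* (r :* (x :* y) :+ s :* (p :+ q)) := r :* (x :* (e :* y)) :+ s :* (e :* p :+ e :* q)) refl (e u v) (n * n * n * K) (d u) (d v) (E * E * E) (i u) (i v)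
      inverses : ∑ (λ u → ∑ (λ v → e u v * i u)) ≤ n * K
      inverses = ≤-trans (∑-mono (λ u → ≤-trans (≤-reflexive (∑-*ʳ (e u) (i u))) (quo-≤ K (d u)))) (≤-reflexive (∑-const n K))

  -- If E ≤ g K n, the claim follows from n being large. Otherwise the term with K is absorbed by
  -- adding 1 to the coefficient Λ (g + 1) + 2C, and g = m (2C + 2) turns the excess over Λ g into a
  -- relative error of at most 1/m.
  solve-quadratic : ∀ {n E W Λ C K m} → 1 ≤ Λ → 1 ≤ m → let g = m * (2 * C + 2) in
    E * E * E ≤ n * n * W → 2 * g * W ≤ n * E * (Λ * (g + 1) + 2 * C) + g * (n * n * K) → 2 * (m * m) * (g * K * (g * K)) ≤ n →
    2 * (m * m) * (E * E) ≤ (m + 1) * (m + 1) * Λ * (n * n * n)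
  solve-quadratic {n} {zero} {m = m} _ _ _ _ _ = ≤-trans (≤-reflexive (*-zeroʳ (2 * (m * m)))) z≤n
  solve-quadratic {n} {E@(suc _)} {W} {Λ} {C} {K} {m} 1≤Λ 1≤m below above large with ≤-total (m * (2 * C + 2) * K * n) E
  ... | inj₂ small = begin
    2 * (m * m) * (E * E) ≤⟨ *-monoʳ-≤ (2 * (m * m)) (*-mono-≤ small small) ⟩
    2 * (m * m) * (g * K * n * (g * K * n)) ≡⟨ solve 3 (λ s t n → s :* (t :* n :* (t :* n)) := s :* (t :* t) :* (n :* n)) refl (2 * (m * m)) (g * K) n ⟩
    2 * (m * m) * (g * K * (g * K)) * (n * n) ≤⟨ *-monoˡ-≤ (n * n) large ⟩
    n * (n * n) ≡⟨ solve 1 (λ n → n :* (n :* n) := con 1 :* con 1 :* con 1 :* (n :* n :* n)) refl n ⟩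
    1 * 1 * 1 * (n * n * n) ≤⟨ *-monoˡ-≤ (n * n * n) (*-mono-≤ (*-mono-≤ (m≤n+m 1 m) (m≤n+m 1 m)) 1≤Λ) ⟩
    (m + 1) * (m + 1) * Λ * (n * n * n) ∎
    where
    open ≤-Reasoning
    open +-*-Solver
    g : ℕ
    g = m * (2 * C + 2)
  ... | inj₁ big = begin
    2 * (m * m) * (E * E) ≡⟨ solve 2 (λ m s → con 2 :* (m :* m) :* s := m :* (con 2 :* m :* s)) refl m (E * E) ⟩
    m * (2 * m * (E * E)) ≤⟨ *-mono-≤ (m≤m+n m 1) (*-cancelˡ-≤ (2 * C + 2) {{ℕ.>-nonZero (≤-trans (s≤s z≤n) (m≤n+m 2 (2 * C)))}} reduced) ⟩
    (m + 1) * (Λ * (m + 1) * (n * n * n)) ≡⟨ solve 3 (λ m l s → m :* (l :* m :* s) := m :* m :* l :* s) refl (m + 1) Λ (n * n * n) ⟩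
    (m + 1) * (m + 1) * Λ * (n * n * n) ∎
    where
    open ≤-Reasoning
    open +-*-Solver
    g : ℕ
    g = m * (2 * C + 2)
    coefficient : Λ * (g + 1) + 2 * C + 1 ≤ Λ * (m + 1) * (2 * C + 2)
    coefficient = ≤-trans (≤-reflexive (+-assoc (Λ * (g + 1)) (2 * C) 1)) (≤-trans (+-monoʳ-≤ (Λ * (g + 1)) (≤-trans (≤-reflexive (sym (*-identityˡ (2 * C + 1)))) (*-monoˡ-≤ (2 * C + 1) 1≤Λ)))
      (≤-reflexive (solve 3 (λ l m C → l :* (m :* (con 2 :* C :+ con 2) :+ con 1) :+ l :* (con 2 :* C :+ con 1) := l :* (m :+ con 1) :* (con 2 :* C :+ con 2)) refl Λ m C)))
    reduced : (2 * C + 2) * (2 * m * (E * E)) ≤ (2 * C + 2) * (Λ * (m + 1) * (n * n * n))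
    reduced = *-cancelˡ-≤ E (begin
      E * ((2 * C + 2) * (2 * m * (E * E))) ≡⟨ solve 3 (λ E c m → E :* (c :* (con 2 :* m :* (E :* E))) := con 2 :* (m :* c) :* (E :* E :* E)) refl E (2 * C + 2) m ⟩
      2 * g * (E * E * E) ≤⟨ *-monoʳ-≤ (2 * g) below ⟩
      2 * g * (n * n * W) ≡⟨ solve 3 (λ g n W → g :* (n :* n :* W) := n :* n :* (g :* W)) refl (2 * g) n W ⟩
      n * n * (2 * g * W) ≤⟨ *-monoʳ-≤ (n * n) above ⟩
      n * n * (n * E * (Λ * (g + 1) + 2 * C) + g * (n * n * K)) ≡⟨ solve 5 (λ n E s g K → n :* n :* (n :* E :* s :+ g :* (n :* n :* K)) := n :* n :* n :* (E :* s :+ g :* K :* n)) refl n E (Λ * (g + 1) + 2 * C) g K ⟩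
      n * n * n * (E * (Λ * (g + 1) + 2 * C) + g * K * n) ≤⟨ *-monoʳ-≤ (n * n * n) (+-monoʳ-≤ (E * (Λ * (g + 1) + 2 * C)) big) ⟩
      n * n * n * (E * (Λ * (g + 1) + 2 * C) + E) ≡⟨ solve 3 (λ s E t → s :* (E :* t :+ E) := s :* E :* (t :+ con 1)) refl (n * n * n) E (Λ * (g + 1) + 2 * C) ⟩
      n * n * n * E * (Λ * (g + 1) + 2 * C + 1) ≤⟨ *-monoʳ-≤ (n * n * n * E) coefficient ⟩
      n * n * n * E * (Λ * (m + 1) * (2 * C + 2)) ≡⟨ solve 4 (λ s E t c → s :* E :* (t :* c) := E :* (c :* (t :* s))) refl (n * n * n) E (Λ * (m + 1)) (2 * C + 2) ⟩
      E * ((2 * C + 2) * (Λ * (m + 1) * (n * n * n))) ∎)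

  module Constants (j Λ m : ℕ) where
    c C g δ c₁ C′ K N : ℕ
    c = 2 * suc (suc j) + 4
    C = 2 ^ (2 * suc (suc j) + suc Λ)
    g = m * (2 * C + 2)
    -- The sum of what `few-both` and `few-excess` ask for; in the last summand j ∸ 1 is the k″ of
    -- `LongCycles`.
    δ = C + C + (g * (suc (dbl j 0) * (c * 2)) + g * (suc (dbl (suc j) (dbl (j ∸ 1) 0)) * (c * 2)))
    c₁ = dbl (suc j) 2 * (c * 2)
    C′ = C + c₁ + 1
    K = Λ * (c₁ * C′) + 2 * ((c₁ + 1) * C′) + 2 * (δ * C′)
    N = 2 * (m * m) * (g * K * (g * K))

  upper-bound : ∀ j Λ m → 1 ≤ Λ → ¬ (j ≡ 0 × Λ ≡ 1) → 1 ≤ m → Σ ℕ λ N → ∀ n → N ≤ n → (G : Graph n) → Admissible (suc (suc j)) (suc Λ) G →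
    8 * m ^ 2 * edgeCount G ^ 2 ≤ (m + 1) ^ 2 * Λ * n ^ 3
  upper-bound j Λ m 1≤Λ ne 1≤m = N , bound
    where
    open Constants j Λ m
    bound : ∀ n → N ≤ n → (G : Graph n) → Admissible (suc (suc j)) (suc Λ) G → 8 * m ^ 2 * edgeCount G ^ 2 ≤ (m + 1) ^ 2 * Λ * n ^ 3
    bound n N≤n G (noC , noK) = begin
      8 * m ^ 2 * edgeCount G ^ 2 ≡⟨ solve 2 (λ m e → con 8 :* m :^ 2 :* e :^ 2 := con 2 :* (m :* m) :* (con 2 :* e :* (con 2 :* e))) refl m (edgeCount G) ⟩
      2 * (m * m) * (2 * edgeCount G * (2 * edgeCount G)) ≡⟨ cong (λ z → 2 * (m * m) * (z * z)) (sym (doubleSum≡ G)) ⟩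
      2 * (m * m) * (doubleSum G * doubleSum G) ≤⟨ solve-quadratic {n} {doubleSum G} {Λ = Λ} {C} {K} {m} 1≤Λ 1≤m three-walks≥ three-walks N≤n ⟩
      (m + 1) * (m + 1) * Λ * (n * n * n) ≡⟨ solve 3 (λ m l n → m :* m :* l :* (n :* n :* n) := m :^ 2 :* l :* n :^ 3) refl (m + 1) Λ n ⟩
      (m + 1) ^ 2 * Λ * n ^ 3 ∎
      where
      open ≤-Reasoning
      open +-*-Solver
      open Walks G using (three-walks≥)
      module S = StructureOf G (suc j) (suc Λ) (s≤s z≤n) noC noK
      few-Excess : ∀ j′ → j′ ≡ j → ∀ u → g * count (S.Excess δ u) ≤ n
      -- Here k = 2, and the exclusion of the pair (2, 2) provides t ≥ 3.
      few-Excess zero refl u = ≤-trans (≤-reflexive (trans (cong (g *_) (∑-zero (λ w → none w (S.Excess δ u w) refl))) (*-zeroʳ g))) z≤n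
        where
        none : ∀ w b → S.Excess δ u w ≡ b → ind b ≡ 0
        none w false _ = refl
        none w true h = ⊥-elim (S.no-excess-C₅ refl (s≤s (≤∧≢⇒< 1≤Λ (λ eq → ne (refl , sym eq)))) δ u w h)
      few-Excess (suc i) refl u = S.LongCycles.few-excess i refl u δ g (+-mono-≤ (m≤m+n C C) (m≤n+m _ (g * (suc (dbl j 0) * (c * 2)))))
      few-Both : ∀ u v → adj G u v ≡ true → g * count (S.Both δ u v) ≤ n
      few-Both u v uv = S.Edges.few-both j refl u v uv δ g (+-monoʳ-≤ (C + C) (m≤m+n (g * (suc (dbl j 0) * (c * 2))) _))
      open CountIn G (suc j) Λ (s≤s z≤n) noC noK δ g (few-Excess j refl) few-Both using (three-walks)

-- The asymptotic formula

open LowerBound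
open UpperBound
open import Defs
open import Data.Nat using (ℕ; suc; _+_; _*_; _∸_; _^_; _≤_; _≥_; z≤n; s≤s)
open import Data.Nat.Properties using (≤-trans; m≤m+n; m≤n+m)
open import Data.Product using (Σ; _×_; _,_)
open import Relation.Binary.PropositionalEquality using (_≡_; refl)
open import Relation.Nullary using (¬_)

-- The square of √(t-1) (n/2)^(3/2) is (t-1) n³/8, so squaring removes the roots; the factor 1 +
-- o(1) becomes the bounds 1 + 1/m and 1 - 1/m for every m and all large n, cleared of denominators.
theorem3 : (k t : ℕ) → k ≥ 2 → t ≥ 2 → ¬ (k ≡ 2 × t ≡ 2) →
    (m : ℕ) → m ≥ 1 → Σ ℕ λ N → (n : ℕ) → n ≥ N →
    ((G : Graph n) → Admissible k t G →
    8 * m ^ 2 * edgeCount G ^ 2 ≤ (m + 1) ^ 2 * (t ∸ 1) * n ^ 3)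
    × Σ (Graph n) λ G → Admissible k t G ×
    ((m ∸ 1) ^ 2 * (t ∸ 1) * n ^ 3 ≤ 8 * m ^ 2 * edgeCount G ^ 2)
theorem3 (suc (suc j)) (suc (suc λ′)) (s≤s (s≤s _)) (s≤s (s≤s _)) ¬22 m m≥1 =
  let N₁ , upper = upper-bound j (suc λ′) m (s≤s z≤n) (λ { (refl , refl) → ¬22 (refl , refl) }) m≥1
      N₂ , lower = lower-bound (suc (suc j)) λ′ m m≥1
  in N₁ + N₂ , λ n n≥ → upper n (≤-trans (m≤m+n N₁ N₂) n≥) , lower n (≤-trans (m≤n+m N₂ N₁) n≥)
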